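{- There exists a unique triple of series $\mathsf{P}(t,y)\in\mathbb{Q}[[y,t]]$, $\mathsf{C}(t,x,y)\in\mathbb{Q}[x][[y,t]]$ and $\mathsf{D}(t,x,y)\in\mathbb{Q}[[x,y,t]]$ satisfying \begin{align*} \mathsf{P}(t,y)&=\frac1y[x^1]\mathsf{C}(t,x,y),\\ \mathsf{D}(t,x,y)&=\frac{1}{1-\mathsf{C}\left(t,\frac{1}{1-x},y\right)},\\ \mathsf{C}(t,x,y)&=xy\,[x^{\ge0}]\left(\mathsf{P}(t,tx)\,\mathsf{D}\left(t,\frac1x,y\right)\right), \end{align*} together with the initial condition $\mathsf{P}(t,0)=1$. For this unique $\mathsf{P}$, the generating function $\mathsf{Q}^c(t)$ of colourful labelled quadrangulations counted by faces is $\mathsf{Q}^c(t)=[y^1]\mathsf{P}(t,y)-1$. Moreover $\mathsf{Q}^c(t)=2\mathsf{G}(t)$, where $\mathsf{G}(t)$ counts rooted planar Eulerian orientations by edges.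
   Context: A planar map is a connected planar graph embedded in the sphere up to orientation-preserving homeomorphism, rooted by choosing and orienting a root edge. A labelled map is a rooted planar map with integer vertex labels such that adjacent labels differ by $\pm1$ and the root edge goes from label $0$ to label $1$ (the atomic map is included). A labelled quadrangulation is a labelled map all of whose faces have degree $4$; it is colourful if every face (including the outer one) contains three distinct labels. An Eulerian orientation is a rooted planar map with every edge oriented so that each vertex has in-degree equal to out-degree, the root edge orientation agreeing with the rooting. Notation: $[x^i]F$, $[y^i]F$ denote the series coefficient of $x^i$, $y^i$. In the third equation, $\mathsf{P}(t,tx)\mathsf{D}(t,1/x,y)$ is a series in $t,y$ whose coefficients are Laurent series in $1/x$, and $[x^{\ge0}]$ keeps only terms with non-negative powers of $x$. The substitution $x\mapsto1/(1-x)$ is performed by expanding as a series in $x$. -}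

module Defs where

open import Data.Nat as ℕ using (ℕ; zero; suc; _∸_; _≤ᵇ_)
open import Data.Nat.Combinatorics using (_C_)
open import Data.Integer as ℤ using (ℤ; ∣_∣)
open import Data.Rational as ℚ using (ℚ; 0ℚ; 1ℚ)
open import Data.Fin as Fin using (Fin)
open import Data.Fin.Properties using (_≟_)
import Data.Bool
open Data.Bool using (Bool; true; false; not; _∧_; if_then_else_)
open import Data.List using (List; []; _∷_; upTo; allFin; filter; length)
open import Data.Bool.ListAction using (any)
open import Data.Product using (Σ; _×_; _,_; ∃; ∃-syntax)
open import Relation.Nullary using (¬_; ⌊_⌋)
open import Relation.Binary.PropositionalEquality using (_≡_; _≢_)

ℕtoℚ : ℕ → ℚ
ℕtoℚ n = ℤ.+ n ℚ./ 1

δ₀ : ℕ → ℚ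
δ₀ zero    = 1ℚ
δ₀ (suc _) = 0ℚ

sumTo : ℕ → (ℕ → ℚ) → ℚ
sumTo zero    f = f 0
sumTo (suc n) f = sumTo n f ℚ.+ f (suc n)

coeffL : List ℚ → ℕ → ℚ
coeffL []       _       = 0ℚ
coeffL (c ∷ cs) zero    = c
coeffL (c ∷ cs) (suc i) = coeffL cs i

sumPoly : List ℚ → (ℕ → ℚ) → ℚ
sumPoly []       g = 0ℚ
sumPoly (c ∷ cs) g = (c ℚ.* g 0) ℚ.+ sumPoly cs (λ i → g (suc i))

-- [x^m] (1-x)^{-i}  =  binom(i+m-1, m)   (= δ_{m,0} when i = 0)
invPow : ℕ → ℕ → ℚ
invPow i m = ℕtoℚ (((i ℕ.+ m) ∸ 1) C m)

-- Series representations (all coefficientwise):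
--   PSer : P(t,y)   ∈ ℚ[[y,t]]      P n k     = [t^n y^k] P
--   CSer : C(t,x,y) ∈ ℚ[x][[y,t]]   C n j     = [t^n y^j] C   (a polynomial in x)
--   DSer : D(t,x,y) ∈ ℚ[[x,y,t]]    D n j m   = [t^n y^j x^m] D
PSer : Set
PSer = ℕ → ℕ → ℚ

CSer : Set
CSer = ℕ → ℕ → List ℚ

DSer : Set
DSer = ℕ → ℕ → ℕ → ℚ

-- E(t,x,y) = C(t, 1/(1-x), y), expanded as a series in x
substC : CSer → DSer
substC C n j m = sumPoly (C n j) (λ i → invPow i m)

oneMinus : DSer → DSer
oneMinus E zero    zero    zero    = 1ℚ ℚ.- E 0 0 0
oneMinus E zero    zero    (suc m) = ℚ.- E 0 0 (suc m)
oneMinus E zero    (suc j) m       = ℚ.- E 0 (suc j) m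
oneMinus E (suc n) j       m       = ℚ.- E (suc n) j m

mul3 : DSer → DSer → DSer
mul3 A B n j m =
  sumTo n λ a → sumTo j λ b → sumTo m λ c →
    A a b c ℚ.* B (n ∸ a) (j ∸ b) (m ∸ c)

one3 : DSer
one3 zero    zero    zero    = 1ℚ
one3 zero    zero    (suc _) = 0ℚ
one3 zero    (suc _) _       = 0ℚ
one3 (suc _) _       _       = 0ℚ

-- H n j m = [t^n y^j x^m] ( P(t,tx) D(t,1/x,y) ),  for m ≥ 0.
-- P(t,tx) = Σ P a k t^(a+k) x^k ,  D(t,1/x,y) = Σ D b j i t^b y^j x^(-i);
-- the x^m coefficient collects k - i = m, i.e. i = k - m with k ≥ m.
Hcoeff : PSer → DSer → ℕ → ℕ → ℕ → ℚ
Hcoeff P D n j m =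
  sumTo n λ a → sumTo (n ∸ a) λ k →
    if m ≤ᵇ k then P a k ℚ.* D ((n ∸ a) ∸ k) j (k ∸ m) else 0ℚ

Crhs : PSer → DSer → ℕ → ℕ → ℕ → ℚ
Crhs P D n zero    i       = 0ℚ
Crhs P D n (suc j) zero    = 0ℚ
Crhs P D n (suc j) (suc i) = Hcoeff P D n j i

record System (P : PSer) (C : CSer) (D : DSer) : Set where
  field
    -- y P(t,y) = [x^1] C(t,x,y)
    eqP₀  : ∀ n → coeffL (C n 0) 1 ≡ 0ℚ
    eqP   : ∀ n k → P n k ≡ coeffL (C n (suc k)) 1
    eqD   : ∀ n j m → mul3 D (oneMinus (substC C)) n j m ≡ one3 n j m
    eqC   : ∀ n j i → coeffL (C n j) i ≡ Crhs P D n j i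
    init  : ∀ n → P n 0 ≡ δ₀ n

SameTriple : PSer → CSer → DSer → PSer → CSer → DSer → Set
SameTriple P C D P' C' D' =
  (∀ n k → P n k ≡ P' n k) ×
  (∀ n j i → coeffL (C n j) i ≡ coeffL (C' n j) i) ×
  (∀ n j m → D n j m ≡ D' n j m)

iter : {A : Set} → (A → A) → ℕ → A → A
iter f zero    x = x
iter f (suc k) x = f (iter f k x)

isCycleMin : {d : ℕ} → (Fin d → Fin d) → Fin d → Bool
isCycleMin {d} s x = not (any (λ k → Fin.toℕ (iter s k x) ℕ.<ᵇ Fin.toℕ x) (upTo d))

numCycles : {d : ℕ} → (Fin d → Fin d) → ℕ
numCycles {d} s = length (filter (λ x → Data.Bool._≟_ (isCycleMin s x) true) (allFin d))

data Reach {d : ℕ} (σ α : Fin d → Fin d) (r : Fin d) : Fin d → Set where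
  here  : Reach σ α r r
  stepσ : ∀ {x} → Reach σ α r x → Reach σ α r (σ x)
  stepα : ∀ {x} → Reach σ α r x → Reach σ α r (α x)

-- A rooted planar map with n edges: darts Fin (2n), σ = vertex rotation
-- (counterclockwise order of darts around each vertex), α = edge
-- involution (fixed-point free), faces = cycles of σ ∘ α, root dart
-- (the root edge oriented from the origin of root to the origin of α root).
-- Connected, and genus 0 by Euler's formula V - E + F = 2.
record Map (n : ℕ) : Set where
  field
    σ     : Fin (2 ℕ.* n) → Fin (2 ℕ.* n)
    σ⁻    : Fin (2 ℕ.* n) → Fin (2 ℕ.* n)
    σσ⁻   : ∀ x → σ (σ⁻ x) ≡ x
    σ⁻σ   : ∀ x → σ⁻ (σ x) ≡ x
    α     : Fin (2 ℕ.* n) → Fin (2 ℕ.* n)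
    αα    : ∀ x → α (α x) ≡ x
    αfpf  : ∀ x → α x ≢ x
    root  : Fin (2 ℕ.* n)
    conn  : ∀ x → Reach σ α root x
    euler : numCycles σ ℕ.+ numCycles (λ x → σ (α x)) ≡ n ℕ.+ 2

  φ : Fin (2 ℕ.* n) → Fin (2 ℕ.* n)
  φ x = σ (α x)

  sameVertex : Fin (2 ℕ.* n) → Fin (2 ℕ.* n) → Bool
  sameVertex x y = any (λ k → ⌊ iter σ k x ≟ y ⌋) (upTo (2 ℕ.* n))

record MapIso {n : ℕ} (M M' : Map n) : Set where
  private
    module M  = Map M
    module M' = Map M'
  field
    π     : Fin (2 ℕ.* n) → Fin (2 ℕ.* n)
    π⁻    : Fin (2 ℕ.* n) → Fin (2 ℕ.* n)
    ππ⁻   : ∀ x → π (π⁻ x) ≡ x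
    π⁻π   : ∀ x → π⁻ (π x) ≡ x
    πσ    : ∀ x → π (M.σ x) ≡ M'.σ (π x)
    πα    : ∀ x → π (M.α x) ≡ M'.α (π x)
    πroot : π M.root ≡ M'.root

NumClasses : (A : Set) → (A → A → Set) → ℕ → Set
NumClasses A R k =
  Σ (Fin k → A) λ f →
    (∀ a → ∃[ i ] R (f i) a) × (∀ i j → R (f i) (f j) → i ≡ j)

record Labelling {n : ℕ} (M : Map n) : Set where
  open Map M
  field
    ℓ      : Fin (2 ℕ.* n) → ℤ           -- label of the origin vertex of a dart
    ℓσ     : ∀ x → ℓ (σ x) ≡ ℓ x
    ℓadj   : ∀ x → ∣ ℓ (α x) ℤ.- ℓ x ∣ ≡ 1
    ℓroot₀ : ℓ root ≡ ℤ.+ 0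
    ℓroot₁ : ℓ (α root) ≡ ℤ.+ 1

LabelledMap : ℕ → Set
LabelledMap n = Σ (Map n) Labelling

LabIso : {n : ℕ} → LabelledMap n → LabelledMap n → Set
LabIso (M , L) (M' , L') =
  Σ (MapIso M M') λ I → ∀ x → Labelling.ℓ L' (MapIso.π I x) ≡ Labelling.ℓ L x

-- a labelled quadrangulation with n faces has 2n edges;
-- every face (cycle of φ) has degree exactly 4, and contains three
-- distinct labels
record ColourfulQuad (n : ℕ) : Set where
  field
    map    : Map (2 ℕ.* n)
    lab    : Labelling map
  open Map map
  open Labelling lab
  field
    quad      : ∀ x → (iter φ 4 x ≡ x) × (iter φ 2 x ≢ x)
    colourful : ∀ x → Σ (Fin 4) λ i → Σ (Fin 4) λ j → Σ (Fin 4) λ k →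
                  (ℓ (iter φ (Fin.toℕ i) x) ≢ ℓ (iter φ (Fin.toℕ j) x)) ×
                  (ℓ (iter φ (Fin.toℕ i) x) ≢ ℓ (iter φ (Fin.toℕ k) x)) ×
                  (ℓ (iter φ (Fin.toℕ j) x) ≢ ℓ (iter φ (Fin.toℕ k) x))

CQIso : {n : ℕ} → ColourfulQuad n → ColourfulQuad n → Set
CQIso Q Q' = LabIso (ColourfulQuad.map Q , ColourfulQuad.lab Q)
                    (ColourfulQuad.map Q' , ColourfulQuad.lab Q')

record EulerianOrientation (n : ℕ) : Set where
  field
    map : Map n
  open Map map
  field
    out    : Fin (2 ℕ.* n) → Bool       -- true: edge oriented away from the dart's origin
    outα   : ∀ x → out (α x) ≡ not (out x)
    outRoot : out root ≡ true
    balanced : ∀ x →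
      length (filter (λ y → Data.Bool._≟_ (sameVertex x y ∧ out y) true) (allFin (2 ℕ.* n)))
      ≡ length (filter (λ y → Data.Bool._≟_ (sameVertex x y ∧ not (out y)) true) (allFin (2 ℕ.* n)))

EOIso : {n : ℕ} → EulerianOrientation n → EulerianOrientation n → Set
EOIso O O' =
  Σ (MapIso (EulerianOrientation.map O) (EulerianOrientation.map O')) λ I →
    ∀ x → EulerianOrientation.out O' (MapIso.π I x) ≡ EulerianOrientation.out O x

module Submission where

-- Peeling.  Delete the root edge of a planar map over and over: the edge either
-- separates the region inside the current boundary word or uncovers a new face.
-- This encodes a map whose darts carry letters (up or down steps of the labels)
-- by a tree, and Euler's formula says exactly that the two sides of a peeled
-- edge never lie on different pending boundaries.  So the number F(w) of
-- colourful patches with boundary word w obeys Tutte's equation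
--   F(s v) = Σ F(a) F(b) over v = a s̄ b,  plus  t Σ F(p v) over the faces s̄ p,
-- and so does the number H(w) of labelled maps with arbitrary balanced faces,
-- the dual picture of Eulerian orientations.
--
-- The system.  P has coefficients F((UD)ᵏ), and C has coefficients
-- tⁱ F((DU)ʲ (UD)ⁱ).  Peeling (DU)ʲ (UD)ⁱ at its first letter only meets the
-- words D (DU)ᵏ U (DU)ʲ (UD)ⁱ, and the resulting recursion is that of
-- D = 1 / (1 - C(1/(1-x))) convolved with P.
--
-- Q = 2 G.  In a colourful quadrangle U U D D call the second step up kept.
-- Erasing the edges that are not kept turns colourful quadrangulations into
-- labelled maps with one edge per quadrangle: on words of kept steps F, refined
-- by these marks, satisfies the equation of H, because the paths that replace
-- D D U (with U not kept) are exactly all paths descending by one.  Opening the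
-- root edge gives G = t F(UDDU), and a root step up is the first or the second
-- step up of its quadrangle, whence Q = 2 t F(UDDU).

-- The statement counts isomorphism classes, so codes must be canonical forms: every planar map has
-- one, every code is realised, and equal codes mean isomorphic rooted maps. The first point needs
-- an exploration that also copes with handles, because planarity is only given as a cycle count;
-- Euler's formula then makes the number of handles vanish. The same bound, V + F at most E + 2,
-- settles the second: the map built from a code exhibits enough vertices and faces to attain it.
--
-- Tutte's equation always peels the first letter and hides that F(w) depends only on the cyclic
-- word. This rotation invariance, obtained by rerooting maps, is used again and again.
--
-- For Q = 2 G the faces of H are arbitrarily long while those of F have four sides, so single steps
-- of the two recursions do not match. Descents of every height are therefore compared at once:
-- reading a path letter by letter and peeling steps that are not kept obey one recursion.

-- Duplicate-free lists and Boolean search.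

module FiniteLists where

  open import Data.Nat using (suc; _≤_; z≤n; s≤s)
  open import Data.Nat.Properties using (≤-antisym)
  open import Data.Bool using (Bool; true; false)
  open import Data.Bool.ListAction using (any)
  open import Data.List using (List; []; _∷_; _++_; length)
  open import Data.List.Membership.Propositional using (_∈_; _∉_)
  open import Data.List.Membership.Propositional.Properties using (∈-++⁺ˡ; ∈-++⁺ʳ; ∈-∃++)
  open import Data.List.Relation.Unary.Any using (here; there)
  open import Data.List.Relation.Unary.All as All using (All; []; _∷_)
  open import Data.List.Relation.Unary.AllPairs using ([]; _∷_)
  open import Data.List.Relation.Unary.Unique.Propositional using (Unique)
  import Data.List.Relation.Binary.Permutation.Setoid.Properties as SetoidPerm
  open import Data.List.Relation.Binary.Permutation.Propositional using (_↭_; ↭⇒↭ₛ)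
  open import Data.List.Relation.Binary.Permutation.Propositional.Properties using (shift; ↭-length; ∈-resp-↭)
  open import Data.Product using (_×_; _,_; ∃-syntax)
  open import Data.Empty using (⊥-elim)
  open import Relation.Binary.PropositionalEquality

  Unique-resp-↭ : {A : Set} {xs ys : List A} → xs ↭ ys → Unique xs → Unique ys
  Unique-resp-↭ {A} p u = SetoidPerm.Unique-resp-↭ (setoid A) (↭⇒↭ₛ p) u

  Unique-head : {A : Set} {x : A} {xs : List A} → Unique (x ∷ xs) → x ∉ xs
  Unique-head (x≢ ∷ _) i = All.lookup x≢ i refl

  Unique-tail : {A : Set} {x : A} {xs : List A} → Unique (x ∷ xs) → Unique xs
  Unique-tail (_ ∷ u) = u

  Unique-cons : {A : Set} {x : A} {xs : List A} → x ∉ xs → Unique xs → Unique (x ∷ xs)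
  Unique-cons n u = All.tabulate (λ i e → n (subst (_∈ _) (sym e) i)) ∷ u

  Unique-++ˡ : {A : Set} (xs : List A) {ys : List A} → Unique (xs ++ ys) → Unique xs
  Unique-++ˡ []       u       = []
  Unique-++ˡ (x ∷ xs) (a ∷ u) = Unique-cons (λ i → All.lookup a (∈-++⁺ˡ i) refl) (Unique-++ˡ xs u)

  Unique-++ʳ : {A : Set} (xs : List A) {ys : List A} → Unique (xs ++ ys) → Unique ys
  Unique-++ʳ []       u       = u
  Unique-++ʳ (x ∷ xs) (_ ∷ u) = Unique-++ʳ xs u

  Unique-disjoint : {A : Set} (xs : List A) {ys : List A} {x : A} → Unique (xs ++ ys) → x ∈ xs → x ∉ ys
  Unique-disjoint (x ∷ xs) (a ∷ u) (here refl) j = All.lookup a (∈-++⁺ʳ xs j) refl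
  Unique-disjoint (x ∷ xs) (a ∷ u) (there i)   j = Unique-disjoint xs u i j

  ∈-split : {A : Set} {x : A} (xs : List A) → x ∈ xs → ∃[ as ] ∃[ bs ] xs ≡ as ++ x ∷ bs
  ∈-split xs i = ∈-∃++ i

  Unique-⊆-length : {A : Set} (xs : List A) {ys : List A} → Unique xs → (∀ {x} → x ∈ xs → x ∈ ys) → length xs ≤ length ys
  Unique-⊆-length []       u sub = z≤n
  Unique-⊆-length (x ∷ xs) {ys} u sub with ∈-split ys (sub (here refl))
  ... | as , bs , refl =
    subst (suc (length xs) ≤_) (sym (↭-length (shift x as bs)))
      (s≤s (Unique-⊆-length xs (Unique-tail u) sub′))
    where
    sub′ : ∀ {z} → z ∈ xs → z ∈ as ++ bs
    sub′ {z} i with ∈-resp-↭ (shift x as bs) (sub (there i))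
    ... | here refl = ⊥-elim (Unique-head u i)
    ... | there j   = j

  Unique-same-length : {A : Set} (xs ys : List A) → Unique xs → Unique ys →
    (∀ {x} → x ∈ xs → x ∈ ys) → (∀ {x} → x ∈ ys → x ∈ xs) → length xs ≡ length ys
  Unique-same-length xs ys u v f g = ≤-antisym (Unique-⊆-length xs u f) (Unique-⊆-length ys v g)

  any-false⁺ : {A : Set} (f : A → Bool) (xs : List A) → (∀ {x} → x ∈ xs → f x ≡ false) → any f xs ≡ false
  any-false⁺ f []       h = refl
  any-false⁺ f (x ∷ xs) h rewrite h (here refl) = any-false⁺ f xs (λ i → h (there i))

  any-false⁻ : {A : Set} (f : A → Bool) (xs : List A) → any f xs ≡ false → ∀ {x} → x ∈ xs → f x ≡ false
  any-false⁻ f (y ∷ xs) e (here refl) with f y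
  ... | false = refl
  any-false⁻ f (y ∷ xs) e (there i) with f y
  ... | false = any-false⁻ f xs e i

  any-true⁺ : {A : Set} (f : A → Bool) (xs : List A) {x : A} → x ∈ xs → f x ≡ true → any f xs ≡ true
  any-true⁺ f (y ∷ xs) (here refl) e rewrite e = refl
  any-true⁺ f (y ∷ xs) (there i) e with f y
  ... | true  = refl
  ... | false = any-true⁺ f xs i e

  any-true⁻ : {A : Set} (f : A → Bool) (xs : List A) → any f xs ≡ true → ∃[ x ] (x ∈ xs × f x ≡ true)
  any-true⁻ f (y ∷ xs) e with f y in eq
  ... | true  = y , here refl , eq
  ... | false with any-true⁻ f xs e
  ... | x , i , h = x , there i , h

-- Cycles of a permutation of a finite set.

module Orbits where

  open import Defs using (iter; isCycleMin; numCycles)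
  open FiniteLists
  open import Data.Nat as ℕ using (ℕ; zero; suc; _+_; _*_; _≤_; _<_; s≤s; _<ᵇ_)
  open import Data.Nat.Properties as ℕₚ
  open import Data.Nat.DivMod using (_/_; _%_; m≡m%n+[m/n]*n; m%n<n)
  open import Data.Fin using (Fin; toℕ)
  open import Data.Fin.Properties as Finₚ using (toℕ-injective; pigeonhole)
  open import Data.Bool as Bool using (Bool; true; false; not; T)
  open import Data.Bool.Properties using (not-injective; ¬-not)
  open import Data.Bool.ListAction using (any)
  open import Data.List using (List; []; _∷_; length; upTo; allFin; filter)
  open import Data.List.Membership.Propositional using (_∈_)
  open import Data.List.Membership.Propositional.Properties using (∈-upTo⁺; ∈-filter⁺; ∈-filter⁻; ∈-allFin)
  open import Data.List.Relation.Unary.Any using (here; there)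
  open import Data.List.Relation.Unary.AllPairs using ([]; _∷_)
  open import Data.List.Relation.Unary.Unique.Propositional using (Unique)
  open import Data.List.Relation.Unary.Unique.Propositional.Properties using (filter⁺; allFin⁺)
  open import Data.Product using (_×_; _,_; ∃-syntax; proj₁; proj₂)
  open import Data.Sum using (inj₁; inj₂)
  open import Data.Empty using (⊥)
  open import Relation.Nullary using (yes; no)
  open import Relation.Binary.PropositionalEquality

  iter-+ : {A : Set} (f : A → A) (m n : ℕ) (x : A) → iter f (m + n) x ≡ iter f m (iter f n x)
  iter-+ f zero    n x = refl
  iter-+ f (suc m) n x = cong f (iter-+ f m n x)

  iter-suc : {A : Set} (f : A → A) (k : ℕ) (x : A) → iter f k (f x) ≡ f (iter f k x)
  iter-suc f zero    x = refl
  iter-suc f (suc k) x = cong f (iter-suc f k x)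

  iter-inv : {A B : Set} (f : A → A) (g : A → B) → (∀ x → g (f x) ≡ g x) → ∀ k x → g (iter f k x) ≡ g x
  iter-inv f g h zero    x = refl
  iter-inv f g h (suc k) x = trans (h _) (iter-inv f g h k x)

  module Orbit {d : ℕ} (s : Fin d → Fin d) (s-inj : ∀ {x y} → s x ≡ s y → x ≡ y) where

    iter-inj : ∀ k {x y} → iter s k x ≡ iter s k y → x ≡ y
    iter-inj zero    e = e
    iter-inj (suc k) e = iter-inj k (s-inj e)

    period : ∀ x → ∃[ p ] (p < d × iter s (suc p) x ≡ x)
    period x with pigeonhole (ℕₚ.n<1+n d) (λ i → iter s (toℕ i) x)
    ... | i , j , i<j , e with ℕₚ.m≤n⇒∃[o]m+o≡n i<j
    ... | p , eq = p , ℕₚ.<-≤-trans p<j (ℕₚ.≤-pred (Finₚ.toℕ<n j)) , sym (iter-inj (toℕ i) h)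
      where
      eq′ : toℕ i + suc p ≡ toℕ j
      eq′ = trans (ℕₚ.+-suc (toℕ i) p) eq
      p<j : p < toℕ j
      p<j = subst (suc p ≤_) eq′ (ℕₚ.m≤n+m (suc p) (toℕ i))
      h : iter s (toℕ i) x ≡ iter s (toℕ i) (iter s (suc p) x)
      h = trans e (trans (cong (λ k → iter s k x) (sym eq′)) (iter-+ s (toℕ i) (suc p) x))

    iter-mult : ∀ q p x → iter s p x ≡ x → iter s (q * p) x ≡ x
    iter-mult zero    p x e = refl
    iter-mult (suc q) p x e = trans (iter-+ s p (q * p) x) (trans (cong (iter s p) (iter-mult q p x e)) e)

    -- `isCycleMin` and `sameVertex` inspect only the first d iterates; reducing the exponent modulo
    -- a period shows that these reach the whole orbit.
    bounded : ∀ x k → ∃[ k′ ] (k′ < d × iter s k x ≡ iter s k′ x)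
    bounded x k with period x
    ... | p , p<d , e = k % suc p , ℕₚ.<-≤-trans (m%n<n k (suc p)) p<d ,
      trans (cong (λ j → iter s j x) (m≡m%n+[m/n]*n k (suc p)))
        (trans (iter-+ s (k % suc p) (k / suc p * suc p) x)
          (cong (iter s (k % suc p)) (iter-mult (k / suc p) (suc p) x e)))

    best : ℕ → Fin d → Fin d
    best zero    x = x
    best (suc k) x with toℕ (iter s (suc k) x) ℕ.<? toℕ (best k x)
    ... | yes _ = iter s (suc k) x
    ... | no  _ = best k x

    best-iter : ∀ k x → ∃[ j ] best k x ≡ iter s j x
    best-iter zero    x = 0 , refl
    best-iter (suc k) x with toℕ (iter s (suc k) x) ℕ.<? toℕ (best k x)
    ... | yes _ = suc k , refl
    ... | no  _ = best-iter k x

    best-min : ∀ k x j → j ≤ k → toℕ (best k x) ≤ toℕ (iter s j x)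
    best-min zero    x zero    j≤k = ℕₚ.≤-refl
    best-min (suc k) x j       j≤k with toℕ (iter s (suc k) x) ℕ.<? toℕ (best k x) | ℕₚ.m≤n⇒m<n∨m≡n j≤k
    ... | yes lt | inj₁ (s≤s h) = ℕₚ.≤-trans (ℕₚ.<⇒≤ lt) (best-min k x j h)
    ... | yes lt | inj₂ refl    = ℕₚ.≤-refl
    ... | no  _  | inj₁ (s≤s h) = best-min k x j h
    ... | no  ge | inj₂ refl    = ℕₚ.≮⇒≥ ge

    -- The least element of the orbit. Its fixed points are exactly what `numCycles` counts, which
    -- turns questions about that count into questions about functions constant on orbits.
    rep : Fin d → Fin d
    rep = best d

    rep-iter : ∀ x → ∃[ j ] rep x ≡ iter s j x
    rep-iter = best-iter d

    rep-min : ∀ x k → toℕ (rep x) ≤ toℕ (iter s k x)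
    rep-min x k with bounded x k
    ... | k′ , k′<d , e = subst (λ y → toℕ (rep x) ≤ toℕ y) (sym e) (best-min d x k′ (ℕₚ.<⇒≤ k′<d))

    rep-step : ∀ x → rep (s x) ≡ rep x
    rep-step x = toℕ-injective (ℕₚ.≤-antisym le ge)
      where
      le : toℕ (rep (s x)) ≤ toℕ (rep x)
      le with rep-iter x
      ... | suc j , e = subst (λ y → toℕ (rep (s x)) ≤ toℕ y) (trans (iter-suc s j x) (sym e)) (rep-min (s x) j)
      ... | zero  , e with period x
      ... | p , _ , e′ = subst (λ y → toℕ (rep (s x)) ≤ toℕ y) (trans (iter-suc s p x) (trans e′ (sym e))) (rep-min (s x) p)
      ge : toℕ (rep x) ≤ toℕ (rep (s x))
      ge with rep-iter (s x)
      ... | j , e = subst (λ y → toℕ (rep x) ≤ toℕ y) (sym (trans e (iter-suc s j x))) (rep-min x (suc j))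

    rep-iter-≡ : ∀ k x → rep (iter s k x) ≡ rep x
    rep-iter-≡ = iter-inv s rep rep-step

    rep-idem : ∀ x → rep (rep x) ≡ rep x
    rep-idem x with rep-iter x
    ... | j , e = trans (cong rep e) (rep-iter-≡ j x)

    rep-inv : {Y : Set} (f : Fin d → Y) → (∀ x → f (s x) ≡ f x) → ∀ x → f (rep x) ≡ f x
    rep-inv f h x with rep-iter x
    ... | j , e = trans (cong f e) (iter-inv s f h j x)

    isCycleMin-rep : ∀ x → isCycleMin s (rep x) ≡ true
    isCycleMin-rep x = cong not (any-false⁺ _ (upTo d) (λ {k} _ → ¬-not (λ h → ℕₚ.<⇒≱ (ℕₚ.<ᵇ⇒< _ _ (subst T (sym h) _)) (le k))))
      where
      le : ∀ k → toℕ (rep x) ≤ toℕ (iter s k (rep x))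
      le k = subst (λ y → toℕ y ≤ toℕ (iter s k (rep x))) (rep-idem x) (rep-min (rep x) k)

    isCycleMin⇒rep : ∀ x → isCycleMin s x ≡ true → rep x ≡ x
    isCycleMin⇒rep x h = toℕ-injective (ℕₚ.≤-antisym (rep-min x 0) ge)
      where
      no< : any (λ k → toℕ (iter s k x) <ᵇ toℕ x) (upTo d) ≡ false
      no< = not-injective h
      ge : toℕ x ≤ toℕ (rep x)
      ge with rep-iter x
      ... | j , e with bounded x j
      ... | j′ , j′<d , e′ = ℕₚ.≮⇒≥ λ lt → absurd (subst (λ y → toℕ y < toℕ x) (trans e e′) lt)
        where
        absurd : toℕ (iter s j′ x) < toℕ x → ⊥
        absurd lt with trans (sym (any-false⁻ _ (upTo d) no< (∈-upTo⁺ j′<d))) (Bool-T (ℕₚ.<⇒<ᵇ lt))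
          where
          Bool-T : ∀ {b} → T b → b ≡ true
          Bool-T {true} _ = refl
        ... | ()

    minima : List (Fin d)
    minima = filter (λ x → isCycleMin s x Bool.≟ true) (allFin d)

    -- A cycle minimum is its own representative, so a list that catches all representatives
    -- contains all minima. Applied to the vertices and faces met by an exploration.
    numCycles-≤ : (rs : List (Fin d)) → (∀ x → rep x ∈ rs) → numCycles s ≤ length rs
    numCycles-≤ rs h = Unique-⊆-length minima (filter⁺ _ (allFin⁺ d)) λ {x} i →
      subst (_∈ rs) (isCycleMin⇒rep x (proj₂ (∈-filter⁻ (λ x → isCycleMin s x Bool.≟ true) {xs = allFin d} i))) (h x)

    -- Each value of the invariant is attained at some orbit minimum, and different values force
    -- different minima. Applied to maps built from codes, whose vertices and faces come with names.
    numCycles-≥ : {Y : Set} (f : Fin d → Y) → (∀ x → f (s x) ≡ f x) → (ys : List Y) → Unique ys →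
      (∀ {y} → y ∈ ys → ∃[ x ] f x ≡ y) → length ys ≤ numCycles s
    numCycles-≥ {Y} f f-inv ys u hit with go ys u hit
      where
      go : (ys : List Y) → Unique ys → (∀ {y} → y ∈ ys → ∃[ x ] f x ≡ y) →
        ∃[ xs ] (length xs ≡ length ys × Unique xs × (∀ {x} → x ∈ xs → x ∈ minima × f x ∈ ys))
      go []       u hit = [] , refl , [] , λ ()
      go (y ∷ ys) u hit with hit (here refl) | go ys (Unique-tail u) (λ i → hit (there i))
      ... | x , fx | xs , len , uxs , h =
        rep x ∷ xs , cong suc len , Unique-cons (λ i → Unique-head u (subst (_∈ ys) frep (proj₂ (h i)))) uxs ,
        λ { (here refl) → ∈-filter⁺ (λ x → isCycleMin s x Bool.≟ true) (∈-allFin (rep x)) (isCycleMin-rep x) , here frep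
          ; (there i) → proj₁ (h i) , there (proj₂ (h i)) }
        where
        frep : f (rep x) ≡ y
        frep = trans (rep-inv f f-inv x) fx
    ... | xs , len , uxs , h = subst (_≤ numCycles s) len (Unique-⊆-length xs uxs (λ i → proj₁ (h i)))

-- Codes of peeled maps.

module Peeling where

  open import Data.Nat using (ℕ; suc; _+_)
  open import Data.List using (List; []; _∷_; _++_; length)
  open import Data.List.Membership.Propositional using (_∉_)
  open import Data.List.Relation.Unary.Unique.Propositional using (Unique)
  open import Data.Product using (_×_)
  open import Relation.Binary.PropositionalEquality

  -- The trace of a peeling, each node carrying the letter of the peeled dart. In `bridge s c d` the
  -- codes c and d belong to the two boundary words that the edge separates. In `face s k c` only
  -- the number k of further darts of the uncovered face is stored, since their letters are the
  -- first k letters of the boundary encoded by c.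
  data Code (A : Set) : Set where
    atom   : Code A
    bridge : A → Code A → Code A → Code A
    face   : A → ℕ → Code A → Code A

  size : {A : Set} → Code A → ℕ
  size atom           = 0
  size (bridge _ c d) = suc (size c + size d)
  size (face _ _ c)   = suc (size c)

  -- The list holds the darts strictly between the two ends. Hence `IsFace φ x p` unrolls the cycle
  -- of x with x as starting point, in the form in which peeling pastes it into a boundary word.
  Seg : {X : Set} → (X → X) → X → List X → X → Set
  Seg φ x []      y = φ x ≡ y
  Seg φ x (z ∷ p) y = φ x ≡ z × Seg φ z p y

  IsFace : {X : Set} → (X → X) → X → List X → Set
  IsFace φ x p = Seg φ x p x × Unique (x ∷ p)

  -- Connectedness as an induction principle: it is only ever applied to an invariant set that
  -- contains the root.
  Generated : {X : Set} → (X → X) → (X → X) → X → Set₁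
  Generated {X} φ α r = (S : X → Set) → S r → (∀ {x} → S x → S (φ x)) → (∀ {x} → S x → S (α x)) → ∀ x → S x

  -- Run φ α lt I l c: peeling the first dart of the boundary word l over and over
  -- produces the code c.  The peeled edge either separates the region (bridge),
  -- or its other side lies on a face that has not been seen yet (face); I holds
  -- for the darts at which such faces are entered.
  module _ {X A : Set} (φ α : X → X) (lt : X → A) (I : X → Set) where

    data Run : List X → Code A → Set where
      atom   : Run [] atom
      bridge : ∀ {r v s a b c d} → lt r ≡ s → v ≡ a ++ α r ∷ b → α r ∉ a →
               Run a c → Run b d → Run (r ∷ v) (bridge s c d)
      face   : ∀ {r v s k p c} → lt r ≡ s → length p ≡ k → α r ∉ v → IsFace φ (α r) p → I (α r) →
               Run (p ++ v) c → Run (r ∷ v) (face s k c)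

-- A code determines its map.

module Decoding where

  open FiniteLists
  open Peeling
  open import Data.Nat using (ℕ; suc; _+_; _*_; _∸_; _≤_)
  import Data.Nat.Properties as ℕₚ
  open import Data.Nat.Tactic.RingSolver using (solve-∀)
  open import Data.Fin using (Fin)
  open import Data.Fin.Properties using (_≟_)
  open import Data.List using (List; []; _∷_; _++_; length; map; zip; allFin)
  open import Data.List.Properties using (length-++; length-map; length-tabulate; ∷-injective; map-++)
  open import Data.List.Membership.Propositional using (_∈_; _∉_)
  open import Data.List.Membership.Propositional.Properties using (∈-++⁺ˡ; ∈-++⁺ʳ; ∈-++⁻; ∈-map⁺; ∈-map⁻)
  open import Data.List.Membership.DecPropositional using (_∈?_)
  open import Data.List.Relation.Unary.Any using (here; there)
  open import Data.List.Relation.Unary.AllPairs using ([]; _∷_)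
  open import Data.List.Relation.Unary.Unique.Propositional using (Unique)
  import Data.List.Relation.Unary.Unique.Propositional.Properties as Uniqueₚ
  open import Data.List.Relation.Binary.Permutation.Propositional using (↭-sym)
  open import Data.List.Relation.Binary.Permutation.Propositional.Properties using (shift; ↭-length; ∈-resp-↭)
  open import Data.Product using (_×_; _,_; ∃-syntax; proj₁; proj₂)
  open import Data.Sum using (_⊎_; inj₁; inj₂; [_,_]′)
  open import Data.Empty using (⊥-elim)
  open import Relation.Nullary using (yes; no)
  open import Relation.Binary.PropositionalEquality

  split-unique : {X : Set} {x : X} (a a′ : List X) {b b′ : List X} → x ∉ a → x ∉ a′ → a ++ x ∷ b ≡ a′ ++ x ∷ b′ → a ≡ a′ × b ≡ b′
  split-unique []      []       n n′ refl = refl , refl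
  split-unique []      (y ∷ a′) n n′ refl = ⊥-elim (n′ (here refl))
  split-unique (y ∷ a) []       n n′ refl = ⊥-elim (n (here refl))
  split-unique (y ∷ a) (z ∷ a′) n n′ e with ∷-injective e
  ... | refl , e′ with split-unique a a′ (λ i → n (there i)) (λ i → n′ (there i)) e′
  ... | refl , q = refl , q

  seg-unique : {X : Set} {φ : X → X} {x : X} (y : X) (p p′ : List X) → Seg φ y p x → Seg φ y p′ x → x ∉ p → x ∉ p′ → p ≡ p′
  seg-unique y []      []        s       s′        n n′ = refl
  seg-unique y []      (z ∷ p′)  s       (e , _)   n n′ = ⊥-elim (n′ (here (trans (sym s) e)))
  seg-unique y (z ∷ p) []        (e , _) s′        n n′ = ⊥-elim (n (here (trans (sym s′) e)))
  seg-unique y (z ∷ p) (z′ ∷ p′) (e , s) (e′ , s′) n n′ with trans (sym e) e′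
  ... | refl = cong (z ∷_) (seg-unique z p p′ s s′ (λ i → n (there i)) (λ i → n′ (there i)))

  face-unique : {X : Set} {φ : X → X} {x : X} {p p′ : List X} → IsFace φ x p → IsFace φ x p′ → p ≡ p′
  face-unique (s , u) (s′ , u′) = seg-unique _ _ _ s s′ (Unique-head u) (Unique-head u′)

  module _ {X A : Set} {φ α : X → X} {lt : X → A} {I I′ : X → Set} where

    -- Peeling is deterministic: the first occurrence of `α r` fixes the split, and φ fixes the list
    -- of an uncovered face. The two predicates are independent because `Iso-code` compares a run
    -- over inner darts with a transported run without that restriction.
    Run-unique : ∀ {l c c′} → Run φ α lt I l c → Run φ α lt I′ l c′ → c ≡ c′
    Run-unique atom atom = refl
    Run-unique (bridge {a = a} refl refl n p q) (bridge {a = a′} refl e n′ p′ q′) with split-unique a a′ n n′ e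
    ... | refl , refl = cong₂ (bridge _) (Run-unique p p′) (Run-unique q q′)
    Run-unique (bridge {a = a} _ refl _ _ _) (face _ _ n _ _ _) = ⊥-elim (n (∈-++⁺ʳ a (here refl)))
    Run-unique (face _ _ n _ _ _) (bridge {a = a} _ refl _ _ _) = ⊥-elim (n (∈-++⁺ʳ a (here refl)))
    Run-unique (face refl refl _ f _ p) (face refl refl _ f′ _ p′) with face-unique f f′
    ... | refl = cong (face _ _) (Run-unique p p′)

  module Transport {X X′ A : Set} {φ α : X → X} {lt : X → A} {I : X → Set} {φ′ α′ : X′ → X′} {lt′ : X′ → A} {I′ : X′ → Set}
    (π : X → X′) (π-inj : ∀ {x y} → π x ≡ π y → x ≡ y)
    (πφ : ∀ x → π (φ x) ≡ φ′ (π x)) (πα : ∀ x → π (α x) ≡ α′ (π x)) (πlt : ∀ x → lt′ (π x) ≡ lt x) (πI : ∀ {x} → I x → I′ (π x)) where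

    seg⁺ : ∀ x p {y} → Seg φ x p y → Seg φ′ (π x) (map π p) (π y)
    seg⁺ x []      e       = trans (sym (πφ x)) (cong π e)
    seg⁺ x (z ∷ p) (e , s) = trans (sym (πφ x)) (cong π e) , seg⁺ z p s

    face⁺ : ∀ {x p} → IsFace φ x p → IsFace φ′ (π x) (map π p)
    face⁺ {x} {p} (s , u) = seg⁺ x p s , Uniqueₚ.map⁺ π-inj u

    ∉⁺ : ∀ {x l} → x ∉ l → π x ∉ map π l
    ∉⁺ n i with ∈-map⁻ π i
    ... | y , j , e = n (subst (_∈ _) (sym (π-inj e)) j)

    Run⁺ : ∀ {l c} → Run φ α lt I l c → Run φ′ α′ lt′ I′ (map π l) c
    Run⁺ atom = atom
    Run⁺ (bridge {r} {a = a} {b} e refl n p q) =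
      bridge (trans (πlt r) e) (trans (map-++ π a (α r ∷ b)) (cong (λ z → map π a ++ z ∷ map π b) (πα r)))
        (subst (_∉ map π a) (πα r) (∉⁺ n)) (Run⁺ p) (Run⁺ q)
    Run⁺ (face {r} {v} {p = p} e k n f i q) =
      face (trans (πlt r) e) (trans (length-map π p) k) (subst (_∉ map π v) (πα r) (∉⁺ n))
        (subst (λ z → IsFace φ′ z (map π p)) (πα r) (face⁺ f))
        (subst I′ (πα r) (πI i)) (subst (λ l → Run φ′ α′ lt′ I′ l _) (map-++ π p v) (Run⁺ q))

  zip-++ : {X Y : Set} (a : List X) (a′ : List Y) {b : List X} {b′ : List Y} → length a ≡ length a′ →
    zip (a ++ b) (a′ ++ b′) ≡ zip a a′ ++ zip b b′
  zip-++ []      []        e = refl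
  zip-++ (x ∷ a) (y ∷ a′)  e = cong ((x , y) ∷_) (zip-++ a a′ (ℕₚ.suc-injective e))

  -- The length of the boundary word is a function of the code alone; this aligns the words of two
  -- runs with the same code.
  boundary : {A : Set} → Code A → ℕ
  boundary atom           = 0
  boundary (bridge _ c d) = suc (boundary c + suc (boundary d))
  boundary (face _ k c)   = suc (boundary c ∸ k)

  Run-length : ∀ {X A : Set} {φ α : X → X} {lt : X → A} {I : X → Set} {l c} → Run φ α lt I l c → length l ≡ boundary c
  Run-length atom = refl
  Run-length (bridge {a = a} _ refl _ p q) =
    cong suc (trans (length-++ a) (cong₂ _+_ (Run-length p) (cong suc (Run-length q))))
  Run-length (face {v = v} {p = p} _ refl _ _ _ q) =
    cong suc (trans (sym (ℕₚ.m+n∸m≡n (length p) (length v))) (cong (_∸ length p) (trans (sym (length-++ p)) (Run-length q))))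

  seg-zip : ∀ {X X′ : Set} {φ : X → X} {φ′ : X′ → X′} x p {y} x′ p′ {y′} → Seg φ x p y → Seg φ′ x′ p′ y′ → length p ≡ length p′ →
    ∀ {u u′} → (u , u′) ∈ zip (x ∷ p) (x′ ∷ p′) → (φ u , φ′ u′) ∈ zip p p′ ⊎ (φ u ≡ y × φ′ u′ ≡ y′)
  seg-zip x []      x′ []        s s′ e (here refl) = inj₂ (s , s′)
  seg-zip x (z ∷ p) x′ (z′ ∷ p′) (q , s) (q′ , s′) e (here refl) = inj₁ (here (cong₂ _,_ q q′))
  seg-zip x (z ∷ p) x′ (z′ ∷ p′) (q , s) (q′ , s′) e (there i) =
    [ (λ j → inj₁ (there j)) , inj₂ ]′ (seg-zip z p z′ p′ s s′ (ℕₚ.suc-injective e) i)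

  -- A list that covers a duplicate-free list and is no longer than it has no room for repetitions.
  -- This makes a relation with N pairs that is total on both sides the graph of a bijection.
  covering⇒Unique : ∀ {N} (xs ys : List (Fin N)) → Unique ys → (∀ {x} → x ∈ ys → x ∈ xs) → length xs ≤ length ys → Unique xs
  covering⇒Unique []       ys u sub le = []
  covering⇒Unique (x ∷ xs) ys u sub le with _∈?_ _≟_ x ys
  ... | no n = ⊥-elim (ℕₚ.<⇒≱ le (Unique-⊆-length ys u (λ i → tail-∈ (λ { refl → n i }) (sub i))))
    where
    tail-∈ : ∀ {y} → y ≢ x → y ∈ x ∷ xs → y ∈ xs
    tail-∈ ne (here e)  = ⊥-elim (ne e)
    tail-∈ ne (there i) = i
  ... | yes i with ∈-split ys i
  ... | as , bs , refl = Unique-cons fresh (covering⇒Unique xs (as ++ bs) (Unique-tail u′) sub′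
          (ℕₚ.≤-pred (subst (suc (length xs) ≤_) (↭-length (shift x as bs)) le)))
    where
    u′ : Unique (x ∷ as ++ bs)
    u′ = Unique-resp-↭ (shift x as bs) u
    sub′ : ∀ {y} → y ∈ as ++ bs → y ∈ xs
    sub′ j with sub (∈-resp-↭ (↭-sym (shift x as bs)) (there j))
    ... | here refl = ⊥-elim (Unique-head u′ j)
    ... | there k   = k
    fresh : x ∉ xs
    fresh k = ℕₚ.<⇒≱ le (Unique-⊆-length ys u λ {y} j → absorb (sub j))
      where
      absorb : ∀ {y} → y ∈ x ∷ xs → y ∈ xs
      absorb (here refl) = k
      absorb (there k′)  = k′

  record Iso {X X′ A : Set} (φ α : X → X) (lt : X → A) (φ′ α′ : X′ → X′) (lt′ : X′ → A) (r : X) (r′ : X′) : Set where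
    field
      π   : X → X′
      π⁻  : X′ → X
      ππ⁻ : ∀ x → π (π⁻ x) ≡ x
      π⁻π : ∀ x → π⁻ (π x) ≡ x
      πφ  : ∀ x → π (φ x) ≡ φ′ (π x)
      πα  : ∀ x → π (α x) ≡ α′ (π x)
      πlt : ∀ x → lt′ (π x) ≡ lt x
      πr  : π r ≡ r′

    π-inj : ∀ {x y} → π x ≡ π y → x ≡ y
    π-inj {x} {y} e = trans (sym (π⁻π x)) (trans (cong π⁻ e) (π⁻π y))

  module SameCode {X X′ A : Set} (bar : A → A) (φ α : X → X) (lt : X → A) (φ′ α′ : X′ → X′) (lt′ : X′ → A)
    (I : X → Set) (I′ : X′ → Set)
    (αα : ∀ x → α (α x) ≡ x) (αα′ : ∀ x → α′ (α′ x) ≡ x)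
    (ltα : ∀ x → lt (α x) ≡ bar (lt x)) (ltα′ : ∀ x → lt′ (α′ x) ≡ bar (lt′ x)) where

    -- The darts of the two structures that are peeled simultaneously.
    pairs : ∀ {l l′ c} → Run φ α lt I l c → Run φ′ α′ lt′ I′ l′ c → List (X × X′)
    pairs atom atom = []
    pairs (bridge {r} _ _ _ p q) (bridge {r′} _ _ _ p′ q′) = (r , r′) ∷ (α r , α′ r′) ∷ pairs p p′ ++ pairs q q′
    pairs (face {r} _ _ _ _ _ p) (face {r′} _ _ _ _ _ p′) = (r , r′) ∷ (α r , α′ r′) ∷ pairs p p′

    pairs-length : ∀ {l l′ c} (p : Run φ α lt I l c) (p′ : Run φ′ α′ lt′ I′ l′ c) → length (pairs p p′) ≡ 2 * size c
    pairs-length atom atom = refl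
    pairs-length {c = bridge _ c d} (bridge _ _ _ p q) (bridge _ _ _ p′ q′) =
      trans (cong (2 +_) (trans (length-++ (pairs p p′)) (cong₂ _+_ (pairs-length p p′) (pairs-length q q′)))) (lem (size c) (size d))
      where
      lem : ∀ c d → 2 + (2 * c + 2 * d) ≡ 2 * suc (c + d)
      lem = solve-∀
    pairs-length {c = face _ _ c} (face _ _ _ _ _ p) (face _ _ _ _ _ p′) = trans (cong (2 +_) (pairs-length p p′)) (lem (size c))
      where
      lem : ∀ c → 2 + 2 * c ≡ 2 * suc c
      lem = solve-∀

    pairs-lt : ∀ {l l′ c} (p : Run φ α lt I l c) (p′ : Run φ′ α′ lt′ I′ l′ c) → ∀ {x x′} → (x , x′) ∈ pairs p p′ → lt′ x′ ≡ lt x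
    pairs-lt atom atom ()
    pairs-lt (bridge e _ _ p q) (bridge e′ _ _ p′ q′) (here refl) = trans e′ (sym e)
    pairs-lt (bridge {r} e _ _ p q) (bridge {r′} e′ _ _ p′ q′) (there (here refl)) =
      trans (ltα′ r′) (trans (cong bar (trans e′ (sym e))) (sym (ltα r)))
    pairs-lt (bridge e _ _ p q) (bridge e′ _ _ p′ q′) (there (there i)) =
      [ pairs-lt p p′ , pairs-lt q q′ ]′ (∈-++⁻ (pairs p p′) i)
    pairs-lt (face e _ _ _ _ p) (face e′ _ _ _ _ p′) (here refl) = trans e′ (sym e)
    pairs-lt (face {r} e _ _ _ _ p) (face {r′} e′ _ _ _ _ p′) (there (here refl)) =
      trans (ltα′ r′) (trans (cong bar (trans e′ (sym e))) (sym (ltα r)))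
    pairs-lt (face e _ _ _ _ p) (face e′ _ _ _ _ p′) (there (there i)) = pairs-lt p p′ i

    pairs-α : ∀ {l l′ c} (p : Run φ α lt I l c) (p′ : Run φ′ α′ lt′ I′ l′ c) → ∀ {x x′} → (x , x′) ∈ pairs p p′ → (α x , α′ x′) ∈ pairs p p′
    pairs-α atom atom ()
    pairs-α (bridge e _ _ p q) (bridge e′ _ _ p′ q′) (here refl) = there (here refl)
    pairs-α (bridge {r} e _ _ p q) (bridge {r′} e′ _ _ p′ q′) (there (here refl)) = here (cong₂ _,_ (αα r) (αα′ r′))
    pairs-α (bridge e _ _ p q) (bridge e′ _ _ p′ q′) (there (there i)) =
      there (there ([ (λ j → ∈-++⁺ˡ (pairs-α p p′ j)) , (λ j → ∈-++⁺ʳ (pairs p p′) (pairs-α q q′ j)) ]′ (∈-++⁻ (pairs p p′) i)))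
    pairs-α (face e _ _ _ _ p) (face e′ _ _ _ _ p′) (here refl) = there (here refl)
    pairs-α (face {r} e _ _ _ _ p) (face {r′} e′ _ _ _ _ p′) (there (here refl)) = here (cong₂ _,_ (αα r) (αα′ r′))
    pairs-α (face e _ _ _ _ p) (face e′ _ _ _ _ p′) (there (there i)) = there (there (pairs-α p p′ i))

    same-length : ∀ {l l′ c} → Run φ α lt I l c → Run φ′ α′ lt′ I′ l′ c → length l ≡ length l′
    same-length p p′ = trans (Run-length p) (sym (Run-length p′))

    zip⊆pairs : ∀ {l l′ c} (p : Run φ α lt I l c) (p′ : Run φ′ α′ lt′ I′ l′ c) → ∀ {x} → x ∈ zip l l′ → x ∈ pairs p p′
    zip⊆pairs (bridge _ _ _ _ _) (bridge _ _ _ _ _) (here e) = here e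
    zip⊆pairs (bridge {a = a} _ refl _ p q) (bridge {a = a′} _ refl _ p′ q′) {x} (there i)
      with ∈-++⁻ (zip a a′) (subst (x ∈_) (zip-++ a a′ (same-length p p′)) i)
    ... | inj₁ j         = there (there (∈-++⁺ˡ (zip⊆pairs p p′ j)))
    ... | inj₂ (here e)  = there (here e)
    ... | inj₂ (there j) = there (there (∈-++⁺ʳ (pairs p p′) (zip⊆pairs q q′ j)))
    zip⊆pairs (face _ _ _ _ _ _) (face _ _ _ _ _ _) (here e) = here e
    zip⊆pairs (face {p = f} _ k _ _ _ p) (face {p = f′} _ k′ _ _ _ p′) {x} (there i) =
      there (there (zip⊆pairs p p′ (subst (x ∈_) (sym (zip-++ f f′ (trans k (sym k′)))) (∈-++⁺ʳ (zip f f′) i))))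

    -- Closure under φ fails only on the boundary, where the successor depends on what lies outside.
    -- Inside an uncovered face the successors are read off the zipped face lists, and the last dart
    -- returns to the pair of opposite darts.
    pairs-φ : ∀ {l l′ c} (p : Run φ α lt I l c) (p′ : Run φ′ α′ lt′ I′ l′ c) → ∀ {x x′} → (x , x′) ∈ pairs p p′ →
      (x , x′) ∈ zip l l′ ⊎ (φ x , φ′ x′) ∈ pairs p p′
    pairs-φ atom atom ()
    pairs-φ (bridge _ _ _ _ _) (bridge _ _ _ _ _) (here e) = inj₁ (here e)
    pairs-φ (bridge {a = a} _ refl _ p q) (bridge {a = a′} _ refl _ p′ q′) (there (here e)) =
      inj₁ (there (subst (_ ∈_) (sym (zip-++ a a′ (same-length p p′))) (∈-++⁺ʳ (zip a a′) (here e))))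
    pairs-φ (bridge {a = a} _ refl _ p q) (bridge {a = a′} _ refl _ p′ q′) (there (there i)) with ∈-++⁻ (pairs p p′) i
    ... | inj₁ j = [ (λ k → inj₁ (there (subst (_ ∈_) (sym (zip-++ a a′ (same-length p p′))) (∈-++⁺ˡ k))))
                   , (λ k → inj₂ (there (there (∈-++⁺ˡ k)))) ]′ (pairs-φ p p′ j)
    ... | inj₂ j = [ (λ k → inj₁ (there (subst (_ ∈_) (sym (zip-++ a a′ (same-length p p′))) (∈-++⁺ʳ (zip a a′) (there k)))))
                   , (λ k → inj₂ (there (there (∈-++⁺ʳ (pairs p p′) k)))) ]′ (pairs-φ q q′ j)
    pairs-φ (face _ _ _ _ _ _) (face _ _ _ _ _ _) (here e) = inj₁ (here e)
    pairs-φ (face {r} {p = f} _ k _ (s , _) _ p) (face {r′} {p = f′} _ k′ _ (s′ , _) _ p′) (there (here refl))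
      with seg-zip (α r) f (α′ r′) f′ s s′ (trans k (sym k′)) (here refl)
    ... | inj₁ j         = inj₂ (there (there (zip⊆pairs p p′ (subst (_ ∈_) (sym (zip-++ f f′ (trans k (sym k′)))) (∈-++⁺ˡ j)))))
    ... | inj₂ (e , e′)  = inj₂ (there (here (cong₂ _,_ e e′)))
    pairs-φ (face {r} {p = f} _ k _ (s , _) _ p) (face {r′} {p = f′} _ k′ _ (s′ , _) _ p′) (there (there i)) with pairs-φ p p′ i
    ... | inj₂ j = inj₂ (there (there j))
    ... | inj₁ j with ∈-++⁻ (zip f f′) (subst (_ ∈_) (zip-++ f f′ (trans k (sym k′))) j)
    ...   | inj₂ m = inj₁ (there m)
    ...   | inj₁ m with seg-zip (α r) f (α′ r′) f′ s s′ (trans k (sym k′)) (there m)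
    ...     | inj₁ o        = inj₂ (there (there (zip⊆pairs p p′ (subst (_ ∈_) (sym (zip-++ f f′ (trans k (sym k′)))) (∈-++⁺ˡ o)))))
    ...     | inj₂ (e , e′) = inj₂ (there (here (cong₂ _,_ e e′)))

  unique-fst : {X Y : Set} (Z : List (X × Y)) → Unique (map proj₁ Z) → ∀ {x y y′} → (x , y) ∈ Z → (x , y′) ∈ Z → y ≡ y′
  unique-fst (_ ∷ Z) u (here refl) (here refl) = refl
  unique-fst (_ ∷ Z) u (here refl) (there j)   = ⊥-elim (Unique-head u (∈-map⁺ proj₁ j))
  unique-fst (_ ∷ Z) u (there i)   (here refl) = ⊥-elim (Unique-head u (∈-map⁺ proj₁ i))
  unique-fst (_ ∷ Z) u (there i)   (there j)   = unique-fst Z (Unique-tail u) i j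

  unique-snd : {X Y : Set} (Z : List (X × Y)) → Unique (map proj₂ Z) → ∀ {x x′ y} → (x , y) ∈ Z → (x′ , y) ∈ Z → x ≡ x′
  unique-snd (_ ∷ Z) u (here refl) (here refl) = refl
  unique-snd (_ ∷ Z) u (here refl) (there j)   = ⊥-elim (Unique-head u (∈-map⁺ proj₂ j))
  unique-snd (_ ∷ Z) u (there i)   (here refl) = ⊥-elim (Unique-head u (∈-map⁺ proj₂ i))
  unique-snd (_ ∷ Z) u (there i)   (there j)   = unique-snd Z (Unique-tail u) i j

  -- The darts peeled simultaneously form 2n pairs. Both projections are onto because each map is
  -- generated from its root, so counting yields a bijection. The root face supplies the successors
  -- on the outermost boundary, the only ones that the runs leave open.
  sameCode⇒Iso : ∀ {N n A} (bar : A → A) {φ α φ′ α′ : Fin N → Fin N} {lt lt′ : Fin N → A} {I I′ : Fin N → Set} →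
    N ≡ 2 * n →
    (∀ x → α (α x) ≡ x) → (∀ x → α′ (α′ x) ≡ x) → (∀ x → lt (α x) ≡ bar (lt x)) → (∀ x → lt′ (α′ x) ≡ bar (lt′ x)) →
    ∀ {r r′ v v′ c} → IsFace φ r v → IsFace φ′ r′ v′ → Generated φ α r → Generated φ′ α′ r′ →
    Run φ α lt I (r ∷ v) c → Run φ′ α′ lt′ I′ (r′ ∷ v′) c → size c ≡ n → Iso φ α lt φ′ α′ lt′ r r′
  sameCode⇒Iso {N} {n} {A} bar {φ} {α} {φ′} {α′} {lt} {lt′} {I} {I′} N≡ αα αα′ ltα ltα′ {r} {r′} {v} {v′} {c} fc fc′ gen gen′ p p′ sz = record
    { π = λ x → proj₁ (fwd x) ; π⁻ = λ x → proj₁ (bwd x)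
    ; ππ⁻ = λ x → func (proj₂ (fwd _)) (proj₂ (bwd x))
    ; π⁻π = λ x → cofunc (proj₂ (bwd _)) (proj₂ (fwd x))
    ; πφ = λ x → func (proj₂ (fwd _)) (clφ (proj₂ (fwd x)))
    ; πα = λ x → func (proj₂ (fwd _)) (clα (proj₂ (fwd x)))
    ; πlt = λ x → pairs-lt p p′ (proj₂ (fwd x))
    ; πr = func (proj₂ (fwd r)) root∈ }
    where
    open SameCode bar φ α lt φ′ α′ lt′ I I′ αα αα′ ltα ltα′
    Z : List (Fin N × Fin N)
    Z = pairs p p′
    len : length Z ≡ N
    len = trans (pairs-length p p′) (trans (cong (2 *_) sz) (sym N≡))
    root∈ : (r , r′) ∈ Z
    root∈ = zip⊆pairs p p′ (here refl)
    clα : ∀ {x x′} → (x , x′) ∈ Z → (α x , α′ x′) ∈ Z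
    clα = pairs-α p p′
    clφ : ∀ {x x′} → (x , x′) ∈ Z → (φ x , φ′ x′) ∈ Z
    clφ i with pairs-φ p p′ i
    ... | inj₂ j = j
    ... | inj₁ j with seg-zip r v r′ v′ (proj₁ fc) (proj₁ fc′) (ℕₚ.suc-injective (same-length p p′)) j
    ...   | inj₁ k        = zip⊆pairs p p′ (there k)
    ...   | inj₂ (e , e′) = subst (_∈ Z) (sym (cong₂ _,_ e e′)) root∈
    fwd : ∀ x → ∃[ x′ ] (x , x′) ∈ Z
    fwd = gen (λ x → ∃[ x′ ] (x , x′) ∈ Z) (r′ , root∈) (λ (_ , i) → _ , clφ i) (λ (_ , i) → _ , clα i)
    bwd : ∀ x′ → ∃[ x ] (x , x′) ∈ Z
    bwd = gen′ (λ x′ → ∃[ x ] (x , x′) ∈ Z) (r , root∈) (λ (_ , i) → _ , clφ i) (λ (_ , i) → _ , clα i)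
    bound : ∀ {f : Fin N × Fin N → Fin N} → length (map f Z) ≤ length (allFin N)
    bound {f} = ℕₚ.≤-reflexive (trans (length-map f Z) (trans len (sym (length-tabulate {n = N} (λ z → z)))))
    func : ∀ {x y y′} → (x , y) ∈ Z → (x , y′) ∈ Z → y ≡ y′
    func = unique-fst Z (covering⇒Unique _ (allFin N) (Uniqueₚ.allFin⁺ N) (λ {x} _ → ∈-map⁺ proj₁ (proj₂ (fwd x))) bound)
    cofunc : ∀ {x x′ y} → (x , y) ∈ Z → (x′ , y) ∈ Z → x ≡ x′
    cofunc = unique-snd Z (covering⇒Unique _ (allFin N) (Uniqueₚ.allFin⁺ N) (λ {x} _ → ∈-map⁺ proj₂ (proj₂ (bwd x))) bound)

-- Exploring a map of any genus, and Euler's formula.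

module Exploration where

  open import Defs using (numCycles)
  open FiniteLists
  open Orbits
  open Peeling
  open import Data.Nat using (ℕ; zero; suc; _+_; _*_; _≤_; s≤s)
  import Data.Nat.Properties as ℕₚ
  open import Data.Nat.Tactic.RingSolver using (solve-∀)
  open import Data.Fin using (Fin)
  open import Data.Fin.Properties using (_≟_)
  open import Data.List using (List; []; _∷_; [_]; _++_; length; map; allFin; concat)
  open import Data.List.Properties using (length-++; length-tabulate; ++-assoc; ++-identityʳ; map-++; concat-++)
  open import Data.List.Membership.Propositional using (_∈_; _∉_)
  open import Data.List.Membership.Propositional.Properties using (∈-++⁺ˡ; ∈-++⁺ʳ; ∈-++⁻; ∈-allFin)
  open import Data.List.Membership.DecPropositional using (_∈?_)
  open import Data.List.Relation.Unary.Any using (here; there)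
  open import Data.List.Relation.Unary.All as All using (All; []; _∷_)
  open import Data.List.Relation.Unary.All.Properties as Allₚ using (++⁺; ++⁻)
  open import Data.List.Relation.Unary.AllPairs using ([]; _∷_)
  open import Data.List.Relation.Unary.Unique.Propositional using (Unique)
  import Data.List.Relation.Unary.Unique.Propositional.Properties as Uniqueₚ
  open import Data.List.Relation.Binary.Permutation.Propositional using (_↭_; ↭-refl; ↭-sym)
  open import Data.List.Relation.Binary.Permutation.Propositional.Properties using (++-commutativeMonoid; ∈-resp-↭)
  open import Data.Product using (_×_; _,_; ∃-syntax; proj₁; proj₂)
  open import Data.Sum using (_⊎_; inj₁; inj₂; [_,_]′)
  open import Data.Empty using (⊥-elim)
  open import Relation.Nullary using (yes; no)
  open import Relation.Binary.PropositionalEquality hiding ([_])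

  module _ {A : Set} where
    import Algebra.Solver.CommutativeMonoid
    open Algebra.Solver.CommutativeMonoid (++-commutativeMonoid {A = A}) using (solve; _⊜_; _⊕_)

    split-↭ : (C a b D : List A) (r s : A) → C ++ (r ∷ (a ++ s ∷ b) ++ D) ↭ (r ∷ s ∷ C) ++ a ++ b ++ D
    split-↭ C a b D r s = solve 6 (λ C a b D r s →
      (C ⊕ (r ⊕ ((a ⊕ (s ⊕ b)) ⊕ D))) ⊜ (r ⊕ (s ⊕ (C ⊕ (a ⊕ (b ⊕ D)))))) ↭-refl C a b D [ r ] [ s ]

    absorb-↭ : (C p v D : List A) (r s : A) → (s ∷ p) ++ (C ++ (r ∷ v) ++ D) ↭ (r ∷ s ∷ C) ++ (p ++ v) ++ D
    absorb-↭ C p v D r s = solve 6 (λ C p v D r s →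
      ((s ⊕ p) ⊕ (C ⊕ ((r ⊕ v) ⊕ D))) ⊜ (r ⊕ (s ⊕ (C ⊕ ((p ⊕ v) ⊕ D))))) ↭-refl C p v D [ r ] [ s ]

    handle-↭ : (C v c d D₁ D₂ : List A) (r s : A) →
      C ++ (r ∷ v) ++ (D₁ ++ (c ++ s ∷ d) ++ D₂) ↭ (r ∷ s ∷ C) ++ (d ++ c ++ v) ++ (D₁ ++ D₂)
    handle-↭ C v c d D₁ D₂ r s = solve 8 (λ C v c d D₁ D₂ r s →
      (C ⊕ ((r ⊕ v) ⊕ (D₁ ⊕ ((c ⊕ (s ⊕ d)) ⊕ D₂)))) ⊜ (r ⊕ (s ⊕ (C ⊕ ((d ⊕ (c ⊕ v)) ⊕ (D₁ ⊕ D₂))))))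
      ↭-refl C v c d D₁ D₂ [ r ] [ s ]

    move-↭ : (C V : List A) (r s : A) → (r ∷ s ∷ C) ++ V ↭ C ++ (r ∷ s ∷ V)
    move-↭ C V r s = solve 4 (λ C V r s → (r ⊕ (s ⊕ (C ⊕ V))) ⊜ (C ⊕ (r ⊕ (s ⊕ V)))) ↭-refl C V [ r ] [ s ]

  module _ {N : ℕ} (φ φ⁻ : Fin N → Fin N) (φφ⁻ : ∀ x → φ (φ⁻ x) ≡ x) where
    private X = Fin N

    seg-next : ∀ h q {x y} → Seg φ h q x → y ∈ h ∷ q → φ y ∈ q ⊎ φ y ≡ x
    seg-next h []      e (here refl) = inj₂ e
    seg-next h (z ∷ q) (e , s) (here refl) = inj₁ (here e)
    seg-next h (z ∷ q) (e , s) (there i) = [ (λ j → inj₁ (there j)) , inj₂ ]′ (seg-next z q s i)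

    -- The list grows backwards, by prepending `φ⁻` of its head, so that the segment extends without
    -- appending. Distinctness of the darts bounds its length by N, which is the fuel.
    findFace : ∀ x → ∃[ p ] IsFace φ x p
    findFace x with φ⁻ x ≟ x
    ... | yes e = [] , trans (cong φ (sym e)) (φφ⁻ x) , [] ∷ []
    ... | no  n = extend N (φ⁻ x) [] (φφ⁻ x) (Unique-cons (λ { (here e) → n (sym e) }) ([] ∷ [])) (ℕₚ.m≤m+n N 1)
      where
      extend : (fuel : ℕ) (h : X) (q : List X) → Seg φ h q x → Unique (x ∷ h ∷ q) → N ≤ fuel + length (h ∷ q) → ∃[ p ] IsFace φ x p
      extend zero h q sg u le = ⊥-elim (ℕₚ.<⇒≱ (s≤s le) (subst (length (x ∷ h ∷ q) ≤_) (length-tabulate {n = N} (λ z → z)) (Unique-⊆-length (x ∷ h ∷ q) u (λ {z} _ → ∈-allFin z))))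
      extend (suc f) h q sg u le with φ⁻ h ≟ x
      ... | yes e = h ∷ q , (trans (cong φ (sym e)) (φφ⁻ h) , sg) , u
      ... | no  n = extend f (φ⁻ h) (h ∷ q) (φφ⁻ h , sg)
                      (Unique-cons (λ { (here e) → n (sym e) ; (there i) → Unique-head u i })
                        (Unique-cons fresh (Unique-tail u)))
                      (subst (N ≤_) (sym (ℕₚ.+-suc f _)) le)
        where
        fresh : φ⁻ h ∉ h ∷ q
        fresh i with seg-next h q sg i
        ... | inj₁ j = Unique-head (Unique-tail u) (subst (_∈ q) (φφ⁻ h) j)
        ... | inj₂ e = Unique-head u (here (trans (sym e) (φφ⁻ h)))

  seg-∈ : {X : Set} {φ : X → X} (S : X → Set) → (∀ {x} → S x → S (φ x)) →
    ∀ x p {y z} → Seg φ x p z → y ∈ x ∷ p → S y → S z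
  seg-∈ S cl x []      e       (here refl) h = subst S e (cl h)
  seg-∈ S cl x (w ∷ p) (e , s) (here refl) h = seg-∈ S cl w p s (here refl) (subst S e (cl h))
  seg-∈ S cl x (w ∷ p) (e , s) (there i)   h = seg-∈ S cl w p s i h

  seg-inv : {X Y : Set} {φ : X → X} (f : X → Y) → (∀ x → f (φ x) ≡ f x) →
    ∀ x p {y z} → Seg φ x p z → y ∈ p → f y ≡ f x
  seg-inv f h x (w ∷ p) (refl , s) (here refl) = h x
  seg-inv f h x (w ∷ p) (refl , s) (there i)   = trans (seg-inv f h w p s i) (h x)

  module Explore {N : ℕ} {A : Set} (σ φ φ⁻ α : Fin N → Fin N)
    (φφ⁻ : ∀ x → φ (φ⁻ x) ≡ x) (σ-inj : ∀ {x y} → σ x ≡ σ y → x ≡ y) (φ-inj : ∀ {x y} → φ x ≡ φ y → x ≡ y)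
    (αα : ∀ x → α (α x) ≡ x) (αfpf : ∀ x → α x ≢ x) (σα : ∀ x → σ (α x) ≡ φ x) (lt : Fin N → A) (ℓ₀ : List (Fin N)) where

    private
      X = Fin N
      module V = Orbit σ σ-inj
      module F = Orbit φ φ-inj

    vert fac : X → X
    vert = V.rep
    fac  = F.rep

    vert-φ : ∀ x → vert (φ x) ≡ vert (α x)
    vert-φ x = trans (cong vert (sym (σα x))) (V.rep-step (α x))

    -- Every pending boundary word carries a base vertex: this vertex is what remains when the word
    -- is used up.
    Stack : Set
    Stack = List (X × List X)

    lists : Stack → List (List X)
    lists = map proj₂

    darts : Stack → List X
    darts St = concat (lists St)

    Walk : X → List X → X → Set
    Walk b []      c = b ≡ c
    Walk b (x ∷ l) c = vert x ≡ b × Walk (vert (α x)) l c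

    Closed : X × List X → Set
    Closed (b , l) = Walk b l b

    walk-++⁺ : ∀ {b c d} l {m} → Walk b l c → Walk c m d → Walk b (l ++ m) d
    walk-++⁺ []      refl    w = w
    walk-++⁺ (x ∷ l) (e , u) w = e , walk-++⁺ l u w

    walk-++⁻ : ∀ {b d} l {m} → Walk b (l ++ m) d → ∃[ c ] (Walk b l c × Walk c m d)
    walk-++⁻ []      w       = _ , refl , w
    walk-++⁻ (x ∷ l) (e , w) with walk-++⁻ l w
    ... | c , u , v = c , (e , u) , v

    seg-walk : ∀ x p y → Seg φ x p y → Walk (vert (α x)) p (vert y)
    seg-walk x []      y e       = trans (sym (vert-φ x)) (cong vert e)
    seg-walk x (z ∷ p) y (e , s) = trans (cong vert (sym e)) (vert-φ x) , seg-walk z p y s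

    walk-start : ∀ {b c} l (At : List X) → Walk b l c → (∀ {x} → x ∈ l → vert x ∈ At) → c ∈ At → b ∈ At
    walk-start []      At refl    h i = i
    walk-start (x ∷ l) At (e , _) h i = subst (_∈ At) e (h (here refl))

    Inner : X → Set
    Inner x = x ∉ ℓ₀

    -- C holds the darts already peeled, closed under α, and the stack those still waiting. Their
    -- union is closed under φ, so a face that leaves it anywhere avoids it altogether. It contains
    -- the original boundary, so every face uncovered later is an inner one.
    record Inv (C : List X) (St : Stack) : Set where
      no-eta-equality
      field
        uq : Unique (C ++ darts St)
        αC : ∀ {x} → x ∈ C → α x ∈ C
        φS : ∀ {x} → x ∈ C ++ darts St → φ x ∈ C ++ darts St
        wk : All Closed St
        l₀ : ∀ {x} → x ∈ ℓ₀ → x ∈ C ++ darts St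

    data Runs : List (List X) → ℕ → Set where
      []  : Runs [] 0
      _∷_ : ∀ {l ls c m} → Run φ α lt Inner l c → Runs ls m → Runs (l ∷ ls) (size c + m)

    -- The outcome of exploring from a stack of boundary words: h counts the
    -- peeled edges that join two different boundary words, At lists the vertices
    -- at which a boundary word got exhausted, Fr the faces that were swallowed.
    record Res (C : List X) (St : Stack) : Set where
      no-eta-equality
      field
        h       : ℕ
        At Fr V : List X
        count   : 2 * (length At + length Fr + 2 * h) ≡ 2 * length St + length V
        uqV     : Unique (C ++ V)
        sub     : ∀ {x} → x ∈ darts St → x ∈ V
        clα     : ∀ {x} → x ∈ V → α x ∈ V
        clφ     : ∀ {x} → x ∈ C ++ V → φ x ∈ C ++ V
        vAt     : ∀ {x} → x ∈ V → vert x ∈ At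
        bAt     : All (λ bl → proj₁ bl ∈ At) St
        fFr     : ∀ {x} → x ∈ V → (∃[ y ] (y ∈ darts St × fac x ≡ fac y)) ⊎ fac x ∈ Fr
        runs    : h ≡ 0 → ∃[ m ] (Runs (lists St) m × 2 * m ≡ length V)

    locate : ∀ {x} St → x ∈ darts St → ∃[ S₁ ] ∃[ b ] ∃[ c ] ∃[ d ] ∃[ S₂ ] St ≡ S₁ ++ (b , c ++ x ∷ d) ∷ S₂
    locate ((b , l) ∷ St) i with ∈-++⁻ l i
    ... | inj₁ j with ∈-split l j
    ...   | c , d , refl = [] , b , c , d , St , refl
    locate ((b , l) ∷ St) i | inj₂ j with locate St j
    ...   | S₁ , b′ , c , d , S₂ , refl = (b , l) ∷ S₁ , b′ , c , d , S₂ , refl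

    darts-++ : ∀ S₁ S₂ → darts (S₁ ++ S₂) ≡ darts S₁ ++ darts S₂
    darts-++ S₁ S₂ = trans (cong concat (map-++ proj₂ S₁ S₂)) (sym (concat-++ (lists S₁) (lists S₂)))

    module _ {C : List X} {St : Stack} (r : X) (I : Inv C St) (r∈ : r ∈ darts St) where
      open Inv I

      αr∉C : α r ∉ C
      αr∉C i = Unique-disjoint C uq (subst (_∈ C) (αα r) (αC i)) r∈

      unseen : ∀ b v St′ → α r ∉ v → α r ∉ darts St′ → α r ∉ C ++ darts ((b , r ∷ v) ∷ St′)
      unseen b v St′ ∉v ∉St i with ∈-++⁻ C i
      ... | inj₁ j         = αr∉C j
      ... | inj₂ (here e)  = αfpf r e
      ... | inj₂ (there j) = [ ∉v , ∉St ]′ (∈-++⁻ v j)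

      αC′ : ∀ {x} → x ∈ r ∷ α r ∷ C → α x ∈ r ∷ α r ∷ C
      αC′ (here refl)         = there (here refl)
      αC′ (there (here refl)) = here (αα r)
      αC′ (there (there i))   = there (there (αC i))

      inv-↭ : ∀ {St′} → C ++ darts St ↭ (r ∷ α r ∷ C) ++ darts St′ → All Closed St′ → Inv (r ∷ α r ∷ C) St′
      inv-↭ p w = record
        { uq = Unique-resp-↭ p uq ; αC = αC′ ; φS = λ i → ∈-resp-↭ p (φS (∈-resp-↭ (↭-sym p) i)) ; wk = w
        ; l₀ = λ i → ∈-resp-↭ p (l₀ i) }

      module Next {St′ : Stack} (R : Res (r ∷ α r ∷ C) St′) where
        open Res R
        uqV′ : Unique (C ++ r ∷ α r ∷ V)
        uqV′ = Unique-resp-↭ (move-↭ C V r (α r)) uqV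
        clα′ : ∀ {x} → x ∈ r ∷ α r ∷ V → α x ∈ r ∷ α r ∷ V
        clα′ (here refl)         = there (here refl)
        clα′ (there (here refl)) = here (αα r)
        clα′ (there (there i))   = there (there (clα i))
        clφ′ : ∀ {x} → x ∈ C ++ r ∷ α r ∷ V → φ x ∈ C ++ r ∷ α r ∷ V
        clφ′ i = ∈-resp-↭ (move-↭ C V r (α r)) (clφ (∈-resp-↭ (↭-sym (move-↭ C V r (α r))) i))

    atom-step : ∀ {C b St} → Res C St → Res C ((b , []) ∷ St)
    atom-step {C} {b} {St} R = record
      { h = h ; At = b ∷ At ; Fr = Fr ; V = V
      ; count = trans (lem (length At) (length Fr) h) (trans (cong (2 +_) count) (lem′ (length St) (length V)))
      ; uqV = uqV ; sub = sub ; clα = clα ; clφ = clφ ; vAt = λ i → there (vAt i)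
      ; bAt = here refl ∷ All.map there bAt ; fFr = fFr
      ; runs = λ e → let m , rs , q = runs e in m , atom ∷ rs , q }
      where
      open Res R
      lem : ∀ a f h → 2 * (suc a + f + 2 * h) ≡ 2 + 2 * (a + f + 2 * h)
      lem = solve-∀
      lem′ : ∀ s v → 2 + (2 * s + v) ≡ 2 * suc s + v
      lem′ = solve-∀

    split-inv : ∀ {C b r a b′ St} → Inv C ((b , r ∷ a ++ α r ∷ b′) ∷ St) →
      Inv (r ∷ α r ∷ C) ((vert (α r) , a) ∷ (b , b′) ∷ St)
    split-inv {C} {b} {r} {a} {b′} {St} I = inv-↭ r I (here refl) (split-↭ C a b′ (darts St) r (α r)) (wk′ (Inv.wk I))
      where
      wk′ : All Closed ((b , r ∷ a ++ α r ∷ b′) ∷ St) → All Closed ((vert (α r) , a) ∷ (b , b′) ∷ St)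
      wk′ ((vr , w) ∷ ws) with walk-++⁻ a w
      ... | c , wa , (vαr , wb) = subst (Walk (vert (α r)) a) (sym vαr) wa
              ∷ subst (λ z → Walk z b′ b) (trans (cong vert (αα r)) vr) wb ∷ ws

    split-step : ∀ {C b r a b′ St} → Inv C ((b , r ∷ a ++ α r ∷ b′) ∷ St) → α r ∉ a →
      Res (r ∷ α r ∷ C) ((vert (α r) , a) ∷ (b , b′) ∷ St) → Res C ((b , r ∷ a ++ α r ∷ b′) ∷ St)
    split-step {C} {b} {r} {a} {b′} {St} I ∉a R = go (Inv.wk I)
      where
      go : All Closed ((b , r ∷ a ++ α r ∷ b′) ∷ St) → Res C ((b , r ∷ a ++ α r ∷ b′) ∷ St)
      go ((vr , w) ∷ ws) = record
        { h = h ; At = At ; Fr = Fr ; V = r ∷ α r ∷ V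
        ; count = trans count (lem (length St) (length V))
        ; uqV = N.uqV′
        ; sub = sub′
        ; clα = N.clα′ ; clφ = N.clφ′
        ; vAt = λ { (here refl) → subst (_∈ At) (sym vr) (All.head (All.tail bAt))
                  ; (there (here refl)) → All.head bAt ; (there (there i)) → vAt i }
        ; bAt = All.head (All.tail bAt) ∷ All.tail (All.tail bAt)
        ; fFr = λ { (here refl) → inj₁ (r , here refl , refl)
                  ; (there (here refl)) → inj₁ (α r , ∈-resp-↭ (↭-sym perm) (there (here refl)) , refl)
                  ; (there (there i)) → [ (λ (y , j , e) → inj₁ (y , ∈-resp-↭ (↭-sym perm) (there (there j)) , e)) , inj₂ ]′ (fFr i) }
        ; runs = runs′ }
        where
        open Res R
        module N = Next r I (here refl) R
        perm : (r ∷ (a ++ α r ∷ b′) ++ darts St) ↭ r ∷ α r ∷ (a ++ b′ ++ darts St)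
        perm = split-↭ [] a b′ (darts St) r (α r)
        sub′ : ∀ {x} → x ∈ r ∷ (a ++ α r ∷ b′) ++ darts St → x ∈ r ∷ α r ∷ V
        sub′ i with ∈-resp-↭ perm i
        ... | here e = here e
        ... | there (here e) = there (here e)
        ... | there (there j) = there (there (sub j))
        lem : ∀ s v → 2 * suc (suc s) + v ≡ 2 * suc s + suc (suc v)
        lem = solve-∀
        runs′ : h ≡ 0 → ∃[ m ] (Runs (lists ((b , r ∷ a ++ α r ∷ b′) ∷ St)) m × 2 * m ≡ suc (suc (length V)))
        runs′ e with runs e
        ... | _ , (_∷_ {c = c} p (_∷_ {c = d} {m = m} q rs)) , eq =
          _ , bridge refl refl ∉a p q ∷ rs , trans (lem″ (size c) (size d) m) (cong (2 +_) eq)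
          where
          lem″ : ∀ c d m → 2 * (suc (c + d) + m) ≡ 2 + 2 * (c + (d + m))
          lem″ = solve-∀

    -- If some dart of the new face had been seen, following φ inside the closed set of seen darts
    -- would lead back to `α r`, which is unseen. So the whole face is new.
    absorb-inv : ∀ {C b r v St p} → Inv C ((b , r ∷ v) ∷ St) → α r ∉ v → α r ∉ darts St → IsFace φ (α r) p →
      Inv (r ∷ α r ∷ C) ((b , p ++ v) ∷ St)
    absorb-inv {C} {b} {r} {v} {St} {p} I ∉v ∉St fc = record
      { uq = Unique-resp-↭ perm (Uniqueₚ.++⁺ (proj₂ fc) uq (λ (i , j) → fresh i j))
      ; αC = αC′ r I (here refl)
      ; φS = λ i → ∈-resp-↭ perm (φS′ (∈-resp-↭ (↭-sym perm) i)) ; wk = wk′ (Inv.wk I)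
      ; l₀ = λ i → ∈-resp-↭ perm (∈-++⁺ʳ (α r ∷ p) (Inv.l₀ I i)) }
      where
      open Inv I using (uq; φS)
      seen : List X
      seen = C ++ (r ∷ v) ++ darts St
      αr∉ : α r ∉ seen
      αr∉ = unseen r I (here refl) b v St ∉v ∉St
      fresh : ∀ {y} → y ∈ α r ∷ p → y ∉ seen
      fresh i j = αr∉ (seg-∈ (_∈ seen) φS (α r) p (proj₁ fc) i j)
      perm : (α r ∷ p) ++ seen ↭ (r ∷ α r ∷ C) ++ (p ++ v) ++ darts St
      perm = absorb-↭ C p v (darts St) r (α r)
      next-∈ : ∀ {y} → y ∈ α r ∷ p → φ y ∈ α r ∷ p
      next-∈ i with seg-next φ φ⁻ φφ⁻ (α r) p (proj₁ fc) i
      ... | inj₁ j = there j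
      ... | inj₂ e = here e
      φS′ : ∀ {x} → x ∈ (α r ∷ p) ++ seen → φ x ∈ (α r ∷ p) ++ seen
      φS′ i with ∈-++⁻ (α r ∷ p) i
      ... | inj₁ j = ∈-++⁺ˡ (next-∈ j)
      ... | inj₂ j = ∈-++⁺ʳ (α r ∷ p) (φS j)
      wk′ : All Closed ((b , r ∷ v) ∷ St) → All Closed ((b , p ++ v) ∷ St)
      wk′ ((vr , w) ∷ ws) =
        walk-++⁺ p (subst (λ z → Walk z p (vert (α r))) (trans (cong vert (αα r)) vr) (seg-walk (α r) p (α r) (proj₁ fc))) w ∷ ws

    absorb-step : ∀ {C b r v St p} → Inv C ((b , r ∷ v) ∷ St) → α r ∉ v → α r ∉ darts St → IsFace φ (α r) p →
      Res (r ∷ α r ∷ C) ((b , p ++ v) ∷ St) → Res C ((b , r ∷ v) ∷ St)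
    absorb-step {C} {b} {r} {v} {St} {p} I ∉v ∉St fc R = go (Inv.wk I)
      where
      go : All Closed ((b , r ∷ v) ∷ St) → Res C ((b , r ∷ v) ∷ St)
      go ((vr , w) ∷ ws) = record
        { h = h ; At = At ; Fr = fac (α r) ∷ Fr ; V = r ∷ α r ∷ V
        ; count = trans (lem (length At) (length Fr) h) (trans (cong (2 +_) count) (lem′ (length St) (length V)))
        ; uqV = N.uqV′
        ; sub = λ { (here e) → here e ; (there i) → there (there (sub (v⊆ i))) }
        ; clα = N.clα′ ; clφ = N.clφ′
        ; vAt = λ { (here refl) → subst (_∈ At) (sym vr) b∈ ; (there (here refl)) → walk-start v At w (λ i → vAt (sub (v⊆ (∈-++⁺ˡ i)))) b∈
                  ; (there (there i)) → vAt i }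
        ; bAt = bAt′ bAt
        ; fFr = λ { (here refl) → inj₁ (r , here refl , refl) ; (there (here refl)) → inj₂ (here refl)
                  ; (there (there i)) → fFr′ i }
        ; runs = runs′ }
        where
        open Res R
        module N = Next r I (here refl) R
        v⊆ : ∀ {x} → x ∈ v ++ darts St → x ∈ (p ++ v) ++ darts St
        v⊆ i = subst (_ ∈_) (sym (++-assoc p v (darts St))) (∈-++⁺ʳ p i)
        b∈ : b ∈ At
        b∈ = All.head bAt
        bAt′ : All (λ bl → proj₁ bl ∈ At) ((b , p ++ v) ∷ St) → All (λ bl → proj₁ bl ∈ At) ((b , r ∷ v) ∷ St)
        bAt′ (x ∷ xs) = x ∷ xs
        fFr′ : ∀ {x} → x ∈ V → (∃[ y ] (y ∈ (r ∷ v) ++ darts St × fac x ≡ fac y)) ⊎ fac x ∈ fac (α r) ∷ Fr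
        fFr′ i with fFr i
        ... | inj₂ j = inj₂ (there j)
        ... | inj₁ (y , j , e) with ∈-++⁻ p (subst (y ∈_) (++-assoc p v (darts St)) j)
        ...   | inj₁ k = inj₂ (here (trans e (seg-inv fac F.rep-step (α r) p (proj₁ fc) k)))
        ...   | inj₂ k = inj₁ (y , there k , e)
        lem : ∀ a f h → 2 * (a + suc f + 2 * h) ≡ 2 + 2 * (a + f + 2 * h)
        lem = solve-∀
        lem′ : ∀ s v → 2 + (2 * suc s + v) ≡ 2 * suc s + suc (suc v)
        lem′ = solve-∀
        runs′ : h ≡ 0 → ∃[ m ] (Runs (lists ((b , r ∷ v) ∷ St)) m × 2 * m ≡ suc (suc (length V)))
        runs′ e with runs e
        ... | _ , (_∷_ {c = c} {m = m} q rs) , eq =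
          _ , face refl refl ∉v fc (λ i → unseen r I (here refl) b v St ∉v ∉St (Inv.l₀ I i)) q ∷ rs , trans (lem″ (size c) m) (cong (2 +_) eq)
          where
          lem″ : ∀ c m → 2 * (suc c + m) ≡ 2 + 2 * (c + m)
          lem″ = solve-∀

    module _ {b : X} {r : X} {v : List X} (S₁ : Stack) {b₂ : X} {c d : List X} {S₂ : Stack} where
      private
        St St′ : Stack
        St = (b , r ∷ v) ∷ S₁ ++ (b₂ , c ++ α r ∷ d) ∷ S₂
        St′ = (b , d ++ c ++ v) ∷ S₁ ++ S₂

      handle-darts-↭ : ∀ C → C ++ darts St ↭ (r ∷ α r ∷ C) ++ darts St′
      handle-darts-↭ C = subst₂ _↭_
        (cong (λ z → C ++ (r ∷ v) ++ z) (sym (darts-++ S₁ ((b₂ , c ++ α r ∷ d) ∷ S₂))))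
        (cong (λ z → (r ∷ α r ∷ C) ++ (d ++ c ++ v) ++ z) (sym (darts-++ S₁ S₂)))
        (handle-↭ C v c d (darts S₁) (darts S₂) r (α r))

      handle-inv : ∀ {C} → Inv C St → Inv (r ∷ α r ∷ C) St′
      handle-inv {C} I = inv-↭ r I (here refl) (handle-darts-↭ C) (wk′ (Inv.wk I))
        where
        wk′ : All Closed St → All Closed St′
        wk′ ((vr , w) ∷ ws) with Allₚ.++⁻ S₁ ws
        ... | ws₁ , (w₂ ∷ ws₂) with walk-++⁻ c w₂
        ... | e , wc , (vαr , wd) =
          walk-++⁺ d (subst (λ z → Walk z d b₂) (trans (cong vert (αα r)) vr) wd)
            (walk-++⁺ c (subst (Walk b₂ c) (sym vαr) wc) w)
          ∷ Allₚ.++⁺ ws₁ ws₂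

    -- With E half the number of visited darts, `count` says that vertices + faces + 2h equals words
    -- + E. Splitting a word trades one edge for one word, but joining two words loses a word
    -- together with the edge, hence the weight 2 of h. The opposite dart cuts the second word into
    -- c and d, and the joined boundary reads d, c, v.
    handle-step : ∀ {C b r v S₁ b₂ c d S₂} → Inv C ((b , r ∷ v) ∷ S₁ ++ (b₂ , c ++ α r ∷ d) ∷ S₂) →
      Res (r ∷ α r ∷ C) ((b , d ++ c ++ v) ∷ S₁ ++ S₂) →
      Res C ((b , r ∷ v) ∷ S₁ ++ (b₂ , c ++ α r ∷ d) ∷ S₂)
    handle-step {C} {b} {r} {v} {S₁} {b₂} {c} {d} {S₂} I R = go (Inv.wk I)
      where
      St St′ : Stack
      St = (b , r ∷ v) ∷ S₁ ++ (b₂ , c ++ α r ∷ d) ∷ S₂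
      St′ = (b , d ++ c ++ v) ∷ S₁ ++ S₂
      perm : darts St ↭ r ∷ α r ∷ darts St′
      perm = handle-darts-↭ {b} S₁ {b₂} []
      go : All Closed St → Res C St
      go ((vr , w) ∷ ws) with Allₚ.++⁻ S₁ ws
      ... | ws₁ , (w₂ ∷ ws₂) with walk-++⁻ c w₂
      ... | e , wc , (vαr , wd) = record
        { h = suc h ; At = At ; Fr = Fr ; V = r ∷ α r ∷ V
        ; count = trans (lem (length At) (length Fr) h) (trans (cong (4 +_) count) (lem′ (length V)))
        ; uqV = N.uqV′
        ; sub = sub′
        ; clα = N.clα′ ; clφ = N.clφ′
        ; vAt = λ { (here refl) → subst (_∈ At) (sym vr) b∈ ; (there (here refl)) → αr∈ ; (there (there i)) → vAt i }
        ; bAt = b∈ ∷ Allₚ.++⁺ (proj₁ bAts) (walk-start c At wc (λ i → vAt (sub (c⊆ i))) (subst (_∈ At) vαr αr∈) ∷ proj₂ bAts)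
        ; fFr = λ { (here refl) → inj₁ (r , here refl , refl)
                  ; (there (here refl)) → inj₁ (α r , ∈-resp-↭ (↭-sym perm) (there (here refl)) , refl)
                  ; (there (there i)) → [ (λ (y , j , e) → inj₁ (y , ∈-resp-↭ (↭-sym perm) (there (there j)) , e)) , inj₂ ]′ (fFr i) }
        -- No code describes a join; the claim about runs is made for h = 0 only.
        ; runs = λ () }
        where
        open Res R
        module N = Next r I (here refl) R
        b∈ : b ∈ At
        b∈ = All.head bAt
        bAts = Allₚ.++⁻ S₁ (All.tail bAt)
        v⊆ : ∀ {x} → x ∈ v → x ∈ darts St′
        v⊆ i = ∈-++⁺ˡ (∈-++⁺ʳ d (∈-++⁺ʳ c i))
        c⊆ : ∀ {x} → x ∈ c → x ∈ darts St′
        c⊆ i = ∈-++⁺ˡ (∈-++⁺ʳ d (∈-++⁺ˡ i))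
        αr∈ : vert (α r) ∈ At
        αr∈ = walk-start v At w (λ i → vAt (sub (v⊆ i))) b∈
        sub′ : ∀ {x} → x ∈ darts St → x ∈ r ∷ α r ∷ V
        sub′ i with ∈-resp-↭ perm i
        ... | here e = here e
        ... | there (here e) = there (here e)
        ... | there (there j) = there (there (sub j))
        lem : ∀ a f h → 2 * (a + f + 2 * suc h) ≡ 4 + 2 * (a + f + 2 * h)
        lem = solve-∀
        lenS : length (S₁ ++ (b₂ , c ++ α r ∷ d) ∷ S₂) ≡ suc (length (S₁ ++ S₂))
        lenS = trans (length-++ S₁) (trans (ℕₚ.+-suc (length S₁) (length S₂)) (cong suc (sym (length-++ S₁))))
        lem″ : ∀ s v → 4 + (2 * suc s + v) ≡ 2 * suc (suc s) + suc (suc v)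
        lem″ = solve-∀
        lem′ : ∀ v → 4 + (2 * length St′ + v) ≡ 2 * length St + suc (suc v)
        lem′ v = trans (lem″ (length (S₁ ++ S₂)) v) (cong (λ z → 2 * suc z + suc (suc v)) (sym lenS))

    first-split : ∀ {x} {xs : List X} → x ∈ xs → ∃[ a ] ∃[ c ] (xs ≡ a ++ x ∷ c × x ∉ a)
    first-split {x} {y ∷ xs} j with x ≟ y
    ... | yes refl = [] , xs , refl , λ ()
    first-split {x} {y ∷ xs} (here e)  | no n = ⊥-elim (n e)
    first-split {x} {y ∷ xs} (there j) | no n with first-split j
    ... | a , c , refl , ∉a = y ∷ a , c , refl , λ { (here e) → n e ; (there k) → ∉a k }

    bound : ∀ f (C : List X) → N ≤ suc f + length C → N ≤ f + suc (suc (length C))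
    bound f C le = ℕₚ.≤-trans le (subst (suc f + length C ≤_) (sym (trans (ℕₚ.+-suc f _) (cong suc (ℕₚ.+-suc f _)))) (ℕₚ.n≤1+n _))

    -- The cases are whether `α r` lies further on in the same word, nowhere on the stack, or on
    -- another word: split, absorb, join. Each peeled edge uses one unit of fuel and adds two darts
    -- to C, whose darts are distinct, so N units suffice.
    explore : (fuel : ℕ) (C : List X) (St : Stack) → Inv C St → N ≤ fuel + length C → Res C St
    explore fuel C [] I le = record
      { h = 0 ; At = [] ; Fr = [] ; V = [] ; count = refl ; uqV = uq ; sub = λ () ; clα = λ ()
      ; clφ = φS ; vAt = λ () ; bAt = [] ; fFr = λ () ; runs = λ _ → 0 , [] , refl }
      where open Inv I
    explore fuel C ((b , []) ∷ St) I le =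
      atom-step (explore fuel C St (record { uq = uq ; αC = αC ; φS = φS ; wk = All.tail wk ; l₀ = l₀ }) le)
      where open Inv I
    explore zero C ((b , r ∷ v) ∷ St) I le = ⊥-elim (ℕₚ.<⇒≱ lt′ (subst (length (C ++ darts ((b , r ∷ v) ∷ St)) ≤_) (length-tabulate {n = N} (λ z → z))
        (Unique-⊆-length _ (Inv.uq I) (λ {z} _ → ∈-allFin z))))
      where
      lt′ : suc N ≤ length (C ++ (r ∷ v) ++ darts St)
      lt′ = subst (suc N ≤_) (sym (trans (length-++ C) (ℕₚ.+-suc (length C) _))) (s≤s (ℕₚ.≤-trans le (ℕₚ.m≤m+n (length C) _)))
    explore (suc f) C ((b , r ∷ v) ∷ St) I le with _∈?_ _≟_ (α r) v
    ... | yes i with first-split i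
    ...   | a , b′ , refl , ∉a = split-step I ∉a (explore f (r ∷ α r ∷ C) _ (split-inv I) (bound f C le))
    explore (suc f) C ((b , r ∷ v) ∷ St) I le | no ∉v with _∈?_ _≟_ (α r) (darts St)
    ... | no ∉St with findFace φ φ⁻ φφ⁻ (α r)
    ...   | p , fc = absorb-step I ∉v ∉St fc (explore f (r ∷ α r ∷ C) _ (absorb-inv I ∉v ∉St fc) (bound f C le))
    explore (suc f) C ((b , r ∷ v) ∷ St) I le | no ∉v | yes i with locate St i
    ...   | S₁ , b₂ , c , d , S₂ , refl = handle-step {S₁ = S₁} I (explore f (r ∷ α r ∷ C) _ (handle-inv S₁ I) (bound f C le))

    module Connected (root : X) (v : List X) (ℓ₀≡ : ℓ₀ ≡ root ∷ v) (fc : IsFace φ root v) (gen : Generated φ α root) where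

      start : Inv [] ((vert root , root ∷ v) ∷ [])
      start = record
        { uq = subst Unique (sym (++-identityʳ (root ∷ v))) (proj₂ fc) ; αC = λ ()
        ; φS = λ i → ∈-++⁺ˡ (step (∈-++⁻ (root ∷ v) i))
        ; wk = (refl , seg-walk root v root (proj₁ fc)) ∷ []
        ; l₀ = λ i → ∈-++⁺ˡ (subst (_ ∈_) ℓ₀≡ i) }
        where
        step : ∀ {x} → x ∈ root ∷ v ⊎ x ∈ [] → φ x ∈ root ∷ v
        step (inj₁ i) = [ there , (λ e → here e) ]′ (seg-next φ φ⁻ φφ⁻ root v (proj₁ fc) i)

      open Res (explore N [] _ start (ℕₚ.m≤m+n N 0))

      visited : ∀ x → x ∈ V
      visited = gen (_∈ V) (sub (here refl)) clφ clα

      V≤ : length V ≤ N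
      V≤ = subst (length V ≤_) (length-tabulate {n = N} (λ z → z)) (Unique-⊆-length V uqV (λ {z} _ → ∈-allFin z))

      V≥ : N ≤ length V
      V≥ = subst (_≤ length V) (length-tabulate {n = N} (λ z → z)) (Unique-⊆-length (allFin N) (Uniqueₚ.allFin⁺ N) (λ {z} _ → visited z))

      cycles : numCycles σ + numCycles φ ≤ length At + suc (length Fr)
      cycles = ℕₚ.+-mono-≤ (V.numCycles-≤ At (λ x → vAt (visited x))) (F.numCycles-≤ (fac root ∷ Fr) λ x → facs (fFr (visited x)))
        where
        facs : ∀ {x} → (∃[ y ] (y ∈ (root ∷ v) ++ [] × fac x ≡ fac y)) ⊎ fac x ∈ Fr → fac x ∈ fac root ∷ Fr
        facs (inj₂ i) = there i
        facs (inj₁ (y , i , e)) with ∈-++⁻ (root ∷ v) i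
        ... | inj₁ (here refl) = here e
        ... | inj₁ (there j)   = here (trans e (seg-inv fac F.rep-step root v (proj₁ fc) j))

      total : 2 * (length At + suc (length Fr)) + 4 * h ≡ length V + 4
      total = trans (lem (length At) (length Fr) h) (trans (cong (_+ 2) count) (lem′ (length V)))
        where
        lem : ∀ a f h → 2 * (a + suc f) + 4 * h ≡ 2 * (a + f + 2 * h) + 2
        lem = solve-∀
        lem′ : ∀ v → 2 + v + 2 ≡ v + 4
        lem′ = solve-∀

      -- The genus is not negative: all vertices and faces are among those listed by the
      -- exploration, and handles only make the lists shorter. For a map built from a code this
      -- gives the upper half of Euler's formula.
      euler-≤ : 2 * (numCycles σ + numCycles φ) ≤ N + 4
      euler-≤ = ℕₚ.≤-trans (ℕₚ.*-monoʳ-≤ 2 cycles) (ℕₚ.≤-trans (ℕₚ.m≤m+n _ (4 * h)) (subst (_≤ N + 4) (sym total) (ℕₚ.+-monoˡ-≤ 4 V≤)))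

      -- When Euler's formula is an equality there is no slack left for the term 4h, so no join took
      -- place and the exploration was a peeling.
      planar⇒Run : ∀ {n} → N ≡ 2 * n → numCycles σ + numCycles φ ≡ n + 2 → ∃[ c ] (Run φ α lt Inner (root ∷ v) c × size c ≡ n)
      planar⇒Run {n} N≡ e with runs (no-handles h refl)
        where
        le : N + 4 + 4 * h ≤ N + 4
        le = ℕₚ.≤-trans (ℕₚ.+-monoˡ-≤ (4 * h) (subst (_≤ 2 * (length At + suc (length Fr)))
               (trans (cong (2 *_) e) (trans (lem n) (cong (_+ 4) (sym N≡)))) (ℕₚ.*-monoʳ-≤ 2 cycles)))
               (subst (_≤ N + 4) (sym total) (ℕₚ.+-monoˡ-≤ 4 V≤))
          where
          lem : ∀ n → 2 * (n + 2) ≡ 2 * n + 4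
          lem = solve-∀
        no-handles : ∀ k → h ≡ k → h ≡ 0
        no-handles zero    p = p
        no-handles (suc k) p = ⊥-elim (ℕₚ.m+1+n≰m (N + 4) (subst (λ z → N + 4 + z ≤ N + 4) (cong (4 *_) p) le))
      ... | _ , (_∷_ {c = c} r []) , eq = c , r , ℕₚ.*-cancelˡ-≡ (size c) n 2
        (trans (cong (2 *_) (sym (ℕₚ.+-identityʳ (size c)))) (trans eq (trans (ℕₚ.≤-antisym V≤ V≥) N≡)))

-- Permutations given by lists of cycles.

module CyclicOrders where

  open FiniteLists
  open Decoding using (unique-fst; unique-snd)
  open Peeling
  open import Data.List using (List; []; _∷_; [_]; _++_; map; concatMap)
  open import Data.List.Properties using (map-++)
  open import Data.List.Membership.Propositional using (_∈_; _∉_)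
  open import Data.List.Membership.Propositional.Properties using (∈-++⁺ˡ; ∈-++⁺ʳ; ∈-++⁻; ∈-map⁻)
  open import Data.List.Relation.Unary.Any using (here; there)
  open import Data.List.Relation.Unary.Unique.Propositional using (Unique)
  open import Data.List.Relation.Binary.Permutation.Propositional using (_↭_; ↭-refl; ↭-sym)
  open import Data.List.Relation.Binary.Permutation.Propositional.Properties using (∈-resp-↭; ++⁺; ∷↭∷ʳ)
  open import Data.Product using (_×_; _,_; ∃-syntax; proj₁; proj₂)
  open import Data.Sum using (inj₁; inj₂)
  open import Data.Empty using (⊥-elim)
  open import Relation.Binary.PropositionalEquality hiding ([_])

  cycle : {X : Set} → X × List X → List X
  cycle (x , p) = x ∷ p

  -- The point `x₀`, to which the last arrow returns, stays fixed while x moves along the cycle.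
  steps : {X : Set} → X → X → List X → List (X × X)
  steps x₀ x []      = (x , x₀) ∷ []
  steps x₀ x (z ∷ p) = (x , z) ∷ steps x₀ z p

  steps-fst : {X : Set} (x₀ x : X) (p : List X) → map proj₁ (steps x₀ x p) ≡ x ∷ p
  steps-fst x₀ x []      = refl
  steps-fst x₀ x (z ∷ p) = cong (x ∷_) (steps-fst x₀ z p)

  steps-snd : {X : Set} (x₀ x : X) (p : List X) → map proj₂ (steps x₀ x p) ≡ p ++ [ x₀ ]
  steps-snd x₀ x []      = refl
  steps-snd x₀ x (z ∷ p) = cong (z ∷_) (steps-snd x₀ z p)

  arrows : {X : Set} → List (X × List X) → List (X × X)
  arrows = concatMap (λ (x , p) → steps x x p)

  arrows-fst : {X : Set} (fs : List (X × List X)) → map proj₁ (arrows fs) ≡ concatMap cycle fs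
  arrows-fst []             = refl
  arrows-fst ((x , p) ∷ fs) = trans (map-++ proj₁ (steps x x p) (arrows fs)) (cong₂ _++_ (steps-fst x x p) (arrows-fst fs))

  -- The targets are the points of each cycle rotated by one place. So they are distinct as well,
  -- and the arrows can be followed backwards.
  arrows-snd : {X : Set} (fs : List (X × List X)) → map proj₂ (arrows fs) ↭ concatMap cycle fs
  arrows-snd []             = ↭-refl
  arrows-snd ((x , p) ∷ fs) = subst (_↭ cycle (x , p) ++ concatMap cycle fs)
    (sym (trans (map-++ proj₂ (steps x x p) (arrows fs)) (cong (_++ map proj₂ (arrows fs)) (steps-snd x x p))))
    (++⁺ (↭-sym (∷↭∷ʳ x p)) (arrows-snd fs))

  arrows-∈ : {X : Set} (fs : List (X × List X)) {x : X} {p : List X} {u : X × X} → (x , p) ∈ fs → u ∈ steps x x p → u ∈ arrows fs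
  arrows-∈ ((x , p) ∷ fs) (here refl) j = ∈-++⁺ˡ j
  arrows-∈ ((x , p) ∷ fs) (there i)   j = ∈-++⁺ʳ (steps x x p) (arrows-∈ fs i j)

  arrows-∈⁻ : {X : Set} (fs : List (X × List X)) {u : X × X} → u ∈ arrows fs → ∃[ x ] ∃[ p ] ((x , p) ∈ fs × u ∈ steps x x p)
  arrows-∈⁻ ((x , p) ∷ fs) i with ∈-++⁻ (steps x x p) i
  ... | inj₁ j = x , p , here refl , j
  ... | inj₂ j with arrows-∈⁻ fs j
  ...   | y , q , k , l = y , q , there k , l

  concat-∈⁻ : {X : Set} (fs : List (X × List X)) {u : X} → u ∈ concatMap cycle fs → ∃[ f ] (f ∈ fs × u ∈ cycle f)
  concat-∈⁻ ((x , p) ∷ fs) i with ∈-++⁻ (x ∷ p) i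
  ... | inj₁ j = (x , p) , here refl , j
  ... | inj₂ j with concat-∈⁻ fs j
  ...   | f , k , l = f , there k , l

  concat-∈⁺ : {X : Set} (fs : List (X × List X)) {u : X} {f : X × List X} → f ∈ fs → u ∈ cycle f → u ∈ concatMap cycle fs
  concat-∈⁺ (f ∷ fs) (here refl) j = ∈-++⁺ˡ j
  concat-∈⁺ (f ∷ fs) (there i)   j = ∈-++⁺ʳ (cycle f) (concat-∈⁺ fs i j)

  same-cycle : {X : Set} (fs : List (X × List X)) → Unique (concatMap cycle fs) → ∀ {u f g} →
    f ∈ fs → u ∈ cycle f → g ∈ fs → u ∈ cycle g → f ≡ g
  same-cycle (f ∷ fs) uq (here refl) i (here refl) j = refl
  same-cycle (f ∷ fs) uq (here refl) i (there l)   j = ⊥-elim (Unique-disjoint (cycle f) uq i (concat-∈⁺ fs l j))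
  same-cycle (f ∷ fs) uq (there k)   i (here refl) j = ⊥-elim (Unique-disjoint (cycle f) uq j (concat-∈⁺ fs k i))
  same-cycle (f ∷ fs) uq (there k)   i (there l)   j = same-cycle fs (Unique-++ʳ (cycle f) uq) k i l j

  cycle-Unique : {X : Set} (fs : List (X × List X)) → Unique (concatMap cycle fs) → ∀ {f} → f ∈ fs → Unique (cycle f)
  cycle-Unique (f ∷ fs) uq (here refl) = Unique-++ˡ (cycle f) uq
  cycle-Unique (f ∷ fs) uq (there i)   = cycle-Unique fs (Unique-++ʳ (cycle f) uq) i

  heads-Unique : {X : Set} (fs : List (X × List X)) → Unique (concatMap cycle fs) → Unique (map proj₁ fs)
  heads-Unique []             uq = uq
  heads-Unique ((x , p) ∷ fs) uq = Unique-cons fresh (heads-Unique fs (Unique-++ʳ (x ∷ p) uq))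
    where
    fresh : x ∉ map proj₁ fs
    fresh i with ∈-map⁻ proj₁ i
    ... | f , j , refl = Unique-disjoint (x ∷ p) uq (here refl) (concat-∈⁺ fs j (here refl))

  steps-snd-∈ : {X : Set} (x₀ x : X) (p : List X) {u v : X} → (u , v) ∈ steps x₀ x p → v ∈ x₀ ∷ p
  steps-snd-∈ x₀ x []      (here refl) = here refl
  steps-snd-∈ x₀ x (z ∷ p) (here refl) = there (here refl)
  steps-snd-∈ x₀ x (z ∷ p) (there i) with steps-snd-∈ x₀ z p i
  ... | here e  = here e
  ... | there j = there (there j)

  steps-fst-∈ : {X : Set} (x₀ x : X) (p : List X) {u v : X} → (u , v) ∈ steps x₀ x p → u ∈ x ∷ p
  steps-fst-∈ x₀ x []      (here refl) = here refl
  steps-fst-∈ x₀ x (z ∷ p) (here refl) = here refl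
  steps-fst-∈ x₀ x (z ∷ p) (there i) = there (steps-fst-∈ x₀ z p i)

  module CyclicPerm {X : Set} (fs : List (X × List X)) (uq : Unique (concatMap cycle fs)) (total : ∀ x → x ∈ concatMap cycle fs) where

    private
      ufst : Unique (map proj₁ (arrows fs))
      ufst = subst Unique (sym (arrows-fst fs)) uq
      usnd : Unique (map proj₂ (arrows fs))
      usnd = Unique-resp-↭ (↭-sym (arrows-snd fs)) uq

    out : ∀ x → ∃[ y ] (x , y) ∈ arrows fs
    out x with ∈-map⁻ proj₁ (subst (x ∈_) (sym (arrows-fst fs)) (total x))
    ... | (_ , y) , i , refl = y , i

    into : ∀ y → ∃[ x ] (x , y) ∈ arrows fs
    into y with ∈-map⁻ proj₂ (∈-resp-↭ (↭-sym (arrows-snd fs)) (total y))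
    ... | (x , _) , i , refl = x , i

    next prev : X → X
    next x = proj₁ (out x)
    prev y = proj₁ (into y)

    next-prev : ∀ y → next (prev y) ≡ y
    next-prev y = unique-fst (arrows fs) ufst (proj₂ (out _)) (proj₂ (into y))

    prev-next : ∀ x → prev (next x) ≡ x
    prev-next x = unique-snd (arrows fs) usnd (proj₂ (into _)) (proj₂ (out x))

    arrow⇒next : ∀ {x y} → (x , y) ∈ arrows fs → next x ≡ y
    arrow⇒next i = unique-fst (arrows fs) ufst (proj₂ (out _)) i

    next-seg : ∀ x₀ x p → (∀ {u} → u ∈ steps x₀ x p → u ∈ arrows fs) → Seg next x p x₀
    next-seg x₀ x []      h = arrow⇒next (h (here refl))
    next-seg x₀ x (z ∷ p) h = arrow⇒next (h (here refl)) , next-seg x₀ z p (λ i → h (there i))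

    next-face : ∀ {x p} → (x , p) ∈ fs → IsFace next x p
    next-face {x} {p} i = next-seg x x p (arrows-∈ fs i) , cycle-Unique fs uq i

    -- An invariant of `next` with a different value on each cycle; it bounds the number of faces
    -- from below.
    head : X → X
    head x = proj₁ (proj₁ (concat-∈⁻ fs (total x)))

    head-of : ∀ {f x} → f ∈ fs → x ∈ cycle f → head x ≡ proj₁ f
    head-of {f} {x} i j with concat-∈⁻ fs (total x)
    ... | g , k , l = cong proj₁ (same-cycle fs uq k l i j)

    head-next : ∀ x → head (next x) ≡ head x
    head-next x with arrows-∈⁻ fs (proj₂ (out x))
    ... | y , p , i , j = trans (head-of i (steps-snd-∈ y y p j)) (sym (head-of i (steps-fst-∈ y y p j)))

-- The map described by a code.

module Building where

  open FiniteLists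
  open Peeling
  open CyclicOrders
  open import Data.Nat using (suc; _+_; _*_; _≤_)
  import Data.Nat.Properties as ℕₚ
  open import Data.Nat.Tactic.RingSolver using (solve-∀)
  open import Data.Integer using (ℤ; 0ℤ; -_) renaming (_+_ to _+ᶻ_)
  import Data.Integer.Properties as ℤₚ
  open import Data.Fin using (Fin)
  open import Data.Fin.Properties using (+↔⊎; 2↔Bool; 0↔⊥)
  open import Data.Bool using (Bool; true; false; not)
  open import Data.Unit using (⊤; tt)
  open import Data.Empty using (⊥)
  open import Data.List using (List; []; _∷_; [_]; _++_; length; map; concatMap; take; drop)
  open import Data.List.Properties using (map-++; map-∘; length-map; length-++; length-take; take++drop≡id; concatMap-++; take-map; drop-map)
  open import Data.List.Membership.Propositional using (_∈_; _∉_)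
  open import Data.List.Membership.Propositional.Properties using (∈-++⁺ˡ; ∈-++⁺ʳ; ∈-++⁻; ∈-map⁺; ∈-map⁻)
  open import Data.List.Relation.Unary.Any using (here; there)
  open import Data.List.Relation.Unary.AllPairs using ([]; _∷_)
  open import Data.List.Relation.Unary.All using ([]; _∷_)
  open import Data.List.Relation.Unary.Unique.Propositional using (Unique)
  import Data.List.Relation.Unary.Unique.Propositional.Properties as Uniqueₚ
  open import Data.List.Relation.Binary.Permutation.Propositional using (_↭_; ↭-refl; ↭-sym; ↭-trans; ↭-reflexive; prep)
  open import Data.List.Relation.Binary.Permutation.Propositional.Properties using (++⁺; map⁺; ++-commutativeMonoid)
  open import Data.Product using (_×_; _,_; ∃-syntax; proj₁; proj₂)
  open import Data.Sum using (_⊎_; inj₁; inj₂)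
  open import Data.Sum.Properties using (inj₁-injective; inj₂-injective)
  open import Data.Sum.Function.Propositional using (_⊎-↔_)
  open import Function using (_∘_; _↔_)
  import Function.Construct.Composition as Comp
  import Function.Construct.Symmetry as Sym
  open import Relation.Binary.PropositionalEquality hiding ([_])

  Face : Set → Set
  Face X = X × List X

  mapF : {X Y : Set} → (X → Y) → Face X → Face Y
  mapF f (x , p) = f x , map f p

  concatMap-mapF : {X Y : Set} (f : X → Y) (fs : List (Face X)) → concatMap cycle (map (mapF f) fs) ≡ map f (concatMap cycle fs)
  concatMap-mapF f []             = refl
  concatMap-mapF f ((x , p) ∷ fs) = trans (cong (map f (x ∷ p) ++_) (concatMap-mapF f fs)) (sym (map-++ f (x ∷ p) (concatMap cycle fs)))

  module _ {A : Set} (bar : A → A) where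

    -- In a `face` step the first k letters of the inner boundary belong to the uncovered face and
    -- disappear behind the peeled edge.
    word : Code A → List A
    word atom           = []
    word (bridge s c d) = s ∷ word c ++ bar s ∷ word d
    word (face s k c)   = s ∷ drop k (word c)

    -- S holds for the contours of all faces but the root face.
    Good : (List A → Set) → Code A → Set
    Good S atom           = ⊤
    Good S (bridge _ c d) = Good S c × Good S d
    Good S (face s k c)   = k ≤ length (word c) × S (bar s ∷ take k (word c)) × Good S c

  module _ {A : Set} where

    -- In the Boolean summand of an edge, `true` is the dart that is peeled and `false` its other
    -- side.
    Dart : Code A → Set
    Dart atom           = ⊥
    Dart (bridge _ c d) = Bool ⊎ (Dart c ⊎ Dart d)
    Dart (face _ _ c)   = Bool ⊎ Dart c

    Dart↔Fin : ∀ c → Dart c ↔ Fin (2 * size c)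
    Dart↔Fin atom           = Sym.inverse 0↔⊥
    Dart↔Fin (bridge s c d) = subst (λ n → Dart (bridge s c d) ↔ Fin n) (lem (size c) (size d))
      (Comp.inverse (Sym.inverse 2↔Bool ⊎-↔ Comp.inverse (Dart↔Fin c ⊎-↔ Dart↔Fin d) (Sym.inverse +↔⊎)) (Sym.inverse (+↔⊎ {m = 2})))
      where
      lem : ∀ a b → 2 + (2 * a + 2 * b) ≡ 2 * suc (a + b)
      lem = solve-∀
    Dart↔Fin (face s k c) = subst (λ n → Dart (face s k c) ↔ Fin n) (lem (size c))
      (Comp.inverse (Sym.inverse 2↔Bool ⊎-↔ Dart↔Fin c) (Sym.inverse (+↔⊎ {m = 2})))
      where
      lem : ∀ a → 2 + 2 * a ≡ 2 * suc a
      lem = solve-∀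

    opp : ∀ c → Dart c → Dart c
    opp (bridge _ c d) (inj₁ b)        = inj₁ (not b)
    opp (bridge _ c d) (inj₂ (inj₁ x)) = inj₂ (inj₁ (opp c x))
    opp (bridge _ c d) (inj₂ (inj₂ x)) = inj₂ (inj₂ (opp d x))
    opp (face _ _ c)   (inj₁ b)        = inj₁ (not b)
    opp (face _ _ c)   (inj₂ x)        = inj₂ (opp c x)

    opp-opp : ∀ c x → opp c (opp c x) ≡ x
    opp-opp (bridge _ c d) (inj₁ true)     = refl
    opp-opp (bridge _ c d) (inj₁ false)    = refl
    opp-opp (bridge _ c d) (inj₂ (inj₁ x)) = cong (inj₂ ∘ inj₁) (opp-opp c x)
    opp-opp (bridge _ c d) (inj₂ (inj₂ x)) = cong (inj₂ ∘ inj₂) (opp-opp d x)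
    opp-opp (face _ _ c)   (inj₁ true)     = refl
    opp-opp (face _ _ c)   (inj₁ false)    = refl
    opp-opp (face _ _ c)   (inj₂ x)        = cong inj₂ (opp-opp c x)

    opp≢ : ∀ c x → opp c x ≢ x
    opp≢ (bridge _ c d) (inj₁ true)     ()
    opp≢ (bridge _ c d) (inj₁ false)    ()
    opp≢ (bridge _ c d) (inj₂ (inj₁ x)) e = opp≢ c x (inj₁-injective (inj₂-injective e))
    opp≢ (bridge _ c d) (inj₂ (inj₂ x)) e = opp≢ d x (inj₂-injective (inj₂-injective e))
    opp≢ (face _ _ c)   (inj₁ true)     ()
    opp≢ (face _ _ c)   (inj₁ false)    ()
    opp≢ (face _ _ c)   (inj₂ x)        e = opp≢ c x (inj₂-injective e)

    -- One vertex for each `atom`: a used-up boundary word shrinks to a vertex, and a bridge never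
    -- identifies the two sides.
    Vert : Code A → Set
    Vert atom           = ⊤
    Vert (bridge _ c d) = Vert c ⊎ Vert d
    Vert (face _ _ c)   = Vert c

    rootV : ∀ c → Vert c
    rootV atom           = tt
    rootV (bridge _ c d) = inj₂ (rootV d)
    rootV (face _ _ c)   = rootV c

    verts : ∀ c → List (Vert c)
    verts atom           = tt ∷ []
    verts (bridge _ c d) = map inj₁ (verts c) ++ map inj₂ (verts d)
    verts (face _ _ c)   = verts c

    verts-Unique : ∀ c → Unique (verts c)
    verts-Unique atom           = [] ∷ []
    verts-Unique (bridge _ c d) = Uniqueₚ.++⁺ (Uniqueₚ.map⁺ (λ { refl → refl }) (verts-Unique c))
      (Uniqueₚ.map⁺ (λ { refl → refl }) (verts-Unique d)) disj
      where
      disj : ∀ {v} → v ∈ map inj₁ (verts c) × v ∈ map inj₂ (verts d) → ⊥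
      disj (i , j) with ∈-map⁻ inj₁ i | ∈-map⁻ inj₂ j
      ... | _ , _ , refl | _ , _ , ()
    verts-Unique (face _ _ c)   = verts-Unique c

    contour : ∀ c → List (Dart c)
    contour atom           = []
    contour (bridge _ c d) = inj₁ true ∷ map (inj₂ ∘ inj₁) (contour c) ++ inj₁ false ∷ map (inj₂ ∘ inj₂) (contour d)
    contour (face _ k c)   = inj₁ true ∷ map inj₂ (drop k (contour c))

    -- A bridge leads from the root vertex of d to that of c. In a face step the peeled edge leads
    -- from the root vertex of c to the corner where the first k boundary darts end, since `false`
    -- followed by these darts must close up.
    org : ∀ c → Dart c → Vert c
    startAt : ∀ c → List (Dart c) → Vert c
    org (bridge _ c d) (inj₁ true)     = inj₂ (rootV d)
    org (bridge _ c d) (inj₁ false)    = inj₁ (rootV c)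
    org (bridge _ c d) (inj₂ (inj₁ x)) = inj₁ (org c x)
    org (bridge _ c d) (inj₂ (inj₂ x)) = inj₂ (org d x)
    org (face _ k c)   (inj₁ true)     = rootV c
    org (face _ k c)   (inj₁ false)    = startAt c (drop k (contour c))
    org (face _ k c)   (inj₂ x)        = org c x
    -- A boundary followed to its end is back at the root vertex.
    startAt c []      = rootV c
    startAt c (x ∷ _) = org c x

    faces : ∀ c → List (Face (Dart c))
    faces atom           = []
    faces (bridge _ c d) = map (mapF (inj₂ ∘ inj₁)) (faces c) ++ map (mapF (inj₂ ∘ inj₂)) (faces d)
    faces (face _ k c)   = (inj₁ false , map inj₂ (take k (contour c))) ∷ map (mapF inj₂) (faces c)

    -- The right-hand side is E + 1 and not E + 2 because the root face is missing from `faces`.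
    euler : ∀ c → length (verts c) + length (faces c) ≡ suc (size c)
    euler atom = refl
    euler (bridge _ c d) = trans (cong₂ _+_
        (trans (length-++ (map inj₁ (verts c))) (cong₂ _+_ (length-map inj₁ (verts c)) (length-map inj₂ (verts d))))
        (trans (length-++ (map (mapF (inj₂ ∘ inj₁)) (faces c))) (cong₂ _+_ (length-map _ (faces c)) (length-map _ (faces d)))))
      (trans (lem (length (verts c)) (length (verts d)) _ _) (trans (cong₂ _+_ (euler c) (euler d)) (cong suc (ℕₚ.+-suc (size c) (size d)))))
      where
      lem : ∀ a b c d → (a + b) + (c + d) ≡ (a + c) + (b + d)
      lem = solve-∀
    euler (face _ _ c) = trans (cong (λ z → length (verts c) + suc z) (length-map _ (faces c)))
      (trans (ℕₚ.+-suc (length (verts c)) (length (faces c))) (cong suc (euler c)))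

    flat : ∀ c → List (Dart c)
    flat c = contour c ++ concatMap cycle (faces c)

    all : ∀ c → List (Dart c)
    all atom           = []
    all (bridge _ c d) = inj₁ true ∷ inj₁ false ∷ map (inj₂ ∘ inj₁) (all c) ++ map (inj₂ ∘ inj₂) (all d)
    all (face _ _ c)   = inj₁ true ∷ inj₁ false ∷ map inj₂ (all c)

    all-Unique : ∀ c → Unique (all c)
    all-Unique atom = []
    all-Unique (bridge _ c d) = Unique-cons fresh₁ (Unique-cons fresh₂ (Uniqueₚ.++⁺
        (Uniqueₚ.map⁺ (λ { refl → refl }) (all-Unique c)) (Uniqueₚ.map⁺ (λ { refl → refl }) (all-Unique d)) disj))
      where
      disj : ∀ {v : Bool ⊎ (Dart c ⊎ Dart d)} → v ∈ map (inj₂ ∘ inj₁) (all c) × v ∈ map (inj₂ ∘ inj₂) (all d) → ⊥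
      disj (i , j) with ∈-map⁻ (inj₂ ∘ inj₁) i | ∈-map⁻ (inj₂ ∘ inj₂) j
      ... | _ , _ , refl | _ , _ , ()
      fresh₂ : ∀ {b} → inj₁ b ∉ map (inj₂ ∘ inj₁) (all c) ++ map (inj₂ ∘ inj₂) (all d)
      fresh₂ i with ∈-++⁻ (map (inj₂ ∘ inj₁) (all c)) i
      ... | inj₁ j with ∈-map⁻ (inj₂ ∘ inj₁) j
      ...   | _ , _ , ()
      fresh₂ i | inj₂ j with ∈-map⁻ (inj₂ ∘ inj₂) j
      ...   | _ , _ , ()
      fresh₁ : inj₁ true ∉ inj₁ false ∷ map (inj₂ ∘ inj₁) (all c) ++ map (inj₂ ∘ inj₂) (all d)
      fresh₁ (there i) = fresh₂ i
    all-Unique (face _ _ c) = Unique-cons (λ { (there i) → fresh i }) (Unique-cons fresh (Uniqueₚ.map⁺ (λ { refl → refl }) (all-Unique c)))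
      where
      fresh : ∀ {b} → inj₁ b ∉ map inj₂ (all c)
      fresh i with ∈-map⁻ inj₂ i
      ... | _ , _ , ()

    all-complete : ∀ c x → x ∈ all c
    all-complete (bridge _ c d) (inj₁ true)     = here refl
    all-complete (bridge _ c d) (inj₁ false)    = there (here refl)
    all-complete (bridge _ c d) (inj₂ (inj₁ x)) = there (there (∈-++⁺ˡ (∈-map⁺ (inj₂ ∘ inj₁) (all-complete c x))))
    all-complete (bridge _ c d) (inj₂ (inj₂ x)) = there (there (∈-++⁺ʳ (map (inj₂ ∘ inj₁) (all c)) (∈-map⁺ (inj₂ ∘ inj₂) (all-complete d x))))
    all-complete (face _ _ c)   (inj₁ true)     = here refl
    all-complete (face _ _ c)   (inj₁ false)    = there (here refl)
    all-complete (face _ _ c)   (inj₂ x)        = there (there (∈-map⁺ inj₂ (all-complete c x)))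

  module _ {A : Set} where
    import Algebra.Solver.CommutativeMonoid
    open Algebra.Solver.CommutativeMonoid (++-commutativeMonoid {A = A}) using (solve; _⊜_; _⊕_)

    bridge-↭ : (a b c d : List A) (r s : A) → (r ∷ a ++ s ∷ b) ++ (c ++ d) ↭ r ∷ s ∷ (a ++ c) ++ (b ++ d)
    bridge-↭ a b c d r s = solve 6 (λ a b c d r s →
      ((r ⊕ (a ⊕ (s ⊕ b))) ⊕ (c ⊕ d)) ⊜ (r ⊕ (s ⊕ ((a ⊕ c) ⊕ (b ⊕ d))))) ↭-refl a b c d [ r ] [ s ]

    face-↭ : (a b c : List A) (r s : A) → (r ∷ b) ++ ((s ∷ a) ++ c) ↭ r ∷ s ∷ (a ++ b) ++ c
    face-↭ a b c r s = solve 5 (λ a b c r s → ((r ⊕ b) ⊕ ((s ⊕ a) ⊕ c)) ⊜ (r ⊕ (s ⊕ ((a ⊕ b) ⊕ c)))) ↭-refl a b c [ r ] [ s ]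

  module _ {A : Set} where

    -- The contour and the inner faces together contain every dart once, so they can serve as the
    -- cycles of the face permutation.
    flat-↭ : ∀ (c : Code A) → flat c ↭ all c
    flat-↭ atom = ↭-refl
    flat-↭ (bridge s c d) = ↭-trans
      (↭-reflexive (cong (contour (bridge s c d) ++_) (trans (concatMap-++ cycle (map (mapF iL) (faces c)) _)
        (cong₂ _++_ (concatMap-mapF iL (faces c)) (concatMap-mapF iR (faces d))))))
      (↭-trans (bridge-↭ (map iL (contour c)) (map iR (contour d)) (map iL (concatMap cycle (faces c))) (map iR (concatMap cycle (faces d))) (inj₁ true) (inj₁ false))
        (prep _ (prep _ (++⁺ (↭-trans (↭-reflexive (sym (map-++ iL (contour c) _))) (map⁺ iL (flat-↭ c)))
                             (↭-trans (↭-reflexive (sym (map-++ iR (contour d) _))) (map⁺ iR (flat-↭ d)))))))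
      where
      iL : Dart c → Dart (bridge s c d)
      iL = inj₂ ∘ inj₁
      iR : Dart d → Dart (bridge s c d)
      iR = inj₂ ∘ inj₂
    flat-↭ (face s k c) = ↭-trans
      (↭-reflexive (cong (λ z → (inj₁ true ∷ map i (drop k (contour c))) ++ ((inj₁ false ∷ map i (take k (contour c))) ++ z)) (concatMap-mapF i (faces c))))
      (↭-trans (face-↭ (map i (take k (contour c))) (map i (drop k (contour c))) (map i (concatMap cycle (faces c))) (inj₁ true) (inj₁ false))
        (prep _ (prep _ (↭-trans (↭-reflexive (trans
            (cong (_++ map i (concatMap cycle (faces c))) (trans (sym (map-++ i (take k (contour c)) _)) (cong (map i) (take++drop≡id k (contour c)))))
            (sym (map-++ i (contour c) _))))
          (map⁺ i (flat-↭ c))))))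
      where
      i : Dart c → Dart (face s k c)
      i = inj₂

    Walk : ∀ (c : Code A) → Vert c → List (Dart c) → Vert c → Set
    Walk c b []      b′ = b ≡ b′
    Walk c b (x ∷ l) b′ = org c x ≡ b × Walk c (org c (opp c x)) l b′

    walk-++⁺ : ∀ c l {m b b′ b″} → Walk c b l b′ → Walk c b′ m b″ → Walk c b (l ++ m) b″
    walk-++⁺ c []      refl    w = w
    walk-++⁺ c (x ∷ l) (e , u) w = e , walk-++⁺ c l u w

    walk-cut : ∀ c l m {b} → Walk c b (l ++ m) (rootV c) → Walk c b l (startAt c m) × Walk c (startAt c m) m (rootV c)
    walk-cut c []      []      w       = w , refl
    walk-cut c []      (x ∷ m) (e , w) = sym e , (refl , w)
    walk-cut c (x ∷ l) m       (e , w) with walk-cut c l m w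
    ... | u , v = (e , u) , v

    module _ (c d : Code A) (f : Dart c → Dart d) (g : Vert c → Vert d)
      (fo : ∀ x → org d (f x) ≡ g (org c x)) (fα : ∀ x → opp d (f x) ≡ f (opp c x)) where
      walk-map : ∀ l {b b′} → Walk c b l b′ → Walk d (g b) (map f l) (g b′)
      walk-map []      refl    = refl
      walk-map (x ∷ l) (refl , w) = fo x , subst (λ z → Walk d z (map f l) _) (sym (trans (cong (org d) (fα x)) (fo (opp c x)))) (walk-map l w)

    contour-walk : ∀ c → Walk c (rootV c) (contour c) (rootV c)
    contour-walk atom = refl
    contour-walk (bridge s c d) = refl , walk-++⁺ (bridge s c d) (map (inj₂ ∘ inj₁) (contour c))
      (walk-map c (bridge s c d) (inj₂ ∘ inj₁) inj₁ (λ _ → refl) (λ _ → refl) (contour c) (contour-walk c))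
      (refl , walk-map d (bridge s c d) (inj₂ ∘ inj₂) inj₂ (λ _ → refl) (λ _ → refl) (contour d) (contour-walk d))
    contour-walk (face s k c) = refl , walk-map c (face s k c) inj₂ (λ v → v) (λ _ → refl) (λ _ → refl) (drop k (contour c))
      (proj₂ (walk-cut c (take k (contour c)) (drop k (contour c)) (subst (λ l → Walk c (rootV c) l (rootV c)) (sym (take++drop≡id k (contour c))) (contour-walk c))))

    Closed : ∀ (c : Code A) → Face (Dart c) → Set
    Closed c (x , p) = Walk c (org c x) (x ∷ p) (org c x)

    faces-closed : ∀ c {f} → f ∈ faces c → Closed c f
    faces-closed (bridge s c d) i with ∈-++⁻ (map (mapF (inj₂ ∘ inj₁)) (faces c)) i
    ... | inj₁ j with ∈-map⁻ (mapF (inj₂ ∘ inj₁)) j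
    ...   | (x , p) , m , refl = walk-map c (bridge s c d) (inj₂ ∘ inj₁) inj₁ (λ _ → refl) (λ _ → refl) (x ∷ p) (faces-closed c m)
    faces-closed (bridge s c d) i | inj₂ j with ∈-map⁻ (mapF (inj₂ ∘ inj₂)) j
    ...   | (x , p) , m , refl = walk-map d (bridge s c d) (inj₂ ∘ inj₂) inj₂ (λ _ → refl) (λ _ → refl) (x ∷ p) (faces-closed d m)
    faces-closed (face s k c) (here refl) = refl , walk-map c (face s k c) inj₂ (λ v → v) (λ _ → refl) (λ _ → refl) (take k (contour c))
      (proj₁ (walk-cut c (take k (contour c)) (drop k (contour c)) (subst (λ l → Walk c (rootV c) l (rootV c)) (sym (take++drop≡id k (contour c))) (contour-walk c))))
    faces-closed (face s k c) (there i) with ∈-map⁻ (mapF inj₂) i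
    ...   | (x , p) , m , refl = walk-map c (face s k c) inj₂ (λ v → v) (λ _ → refl) (λ _ → refl) (x ∷ p) (faces-closed c m)

    org-steps : ∀ c x₀ x p {b} → Walk c b (x ∷ p) (org c x₀) → ∀ {u v} → (u , v) ∈ steps x₀ x p → org c v ≡ org c (opp c u)
    org-steps c x₀ x []      (_ , w)         (here refl) = sym w
    org-steps c x₀ x (z ∷ p) (_ , (e , w))   (here refl) = e
    org-steps c x₀ x (z ∷ p) (_ , w)         (there i)   = org-steps c x₀ z p w i

    -- The root vertex is set apart because an atom has a vertex but no dart.
    org-onto : (c : Code A) (v : Vert c) → v ≡ rootV c ⊎ ∃[ x ] org c x ≡ v
    org-onto atom tt = inj₁ refl
    org-onto (bridge s c d) (inj₁ v) with org-onto c v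
    ... | inj₁ refl       = inj₂ (inj₁ false , refl)
    ... | inj₂ (x , refl) = inj₂ (inj₂ (inj₁ x) , refl)
    org-onto (bridge s c d) (inj₂ v) with org-onto d v
    ... | inj₁ refl       = inj₁ refl
    ... | inj₂ (x , refl) = inj₂ (inj₂ (inj₂ x) , refl)
    org-onto (face s k c) v with org-onto c v
    ... | inj₁ e          = inj₁ e
    ... | inj₂ (x , refl) = inj₂ (inj₂ x , refl)

    module _ {X : Set} (φ α : X → X) (S : X → Set) where

      -- How a face step is penetrated: the contour gives the peeled dart, α its other side, and the
      -- face through that side the hidden part of the inner contour. The embedding i keeps α that
      -- of the whole map while c shrinks.
      spread : (c : Code A) (i : Dart c → X) → (∀ x → i (opp c x) ≡ α (i x)) → (∀ {x} → S x → S (α x)) →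
        (∀ {f x y} → f ∈ faces c → x ∈ cycle f → y ∈ cycle f → S (i x) → S (i y)) →
        (∀ {x} → x ∈ contour c → S (i x)) → ∀ x → S (i x)
      spread (bridge s c d) i iα Sα Sf SL = go
        where
        goL : ∀ x → S (i (inj₂ (inj₁ x)))
        goL = spread c (λ x → i (inj₂ (inj₁ x))) (λ x → iα (inj₂ (inj₁ x))) Sα
          (λ m u v → Sf (∈-++⁺ˡ (∈-map⁺ (mapF (inj₂ ∘ inj₁)) m)) (∈-map⁺ (inj₂ ∘ inj₁) u) (∈-map⁺ (inj₂ ∘ inj₁) v))
          (λ m → SL (there (∈-++⁺ˡ (∈-map⁺ (inj₂ ∘ inj₁) m))))
        goR : ∀ x → S (i (inj₂ (inj₂ x)))
        goR = spread d (λ x → i (inj₂ (inj₂ x))) (λ x → iα (inj₂ (inj₂ x))) Sα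
          (λ m u v → Sf (∈-++⁺ʳ (map (mapF (inj₂ ∘ inj₁)) (faces c)) (∈-map⁺ (mapF (inj₂ ∘ inj₂)) m)) (∈-map⁺ (inj₂ ∘ inj₂) u) (∈-map⁺ (inj₂ ∘ inj₂) v))
          (λ m → SL (there (∈-++⁺ʳ (map (inj₂ ∘ inj₁) (contour c)) (there (∈-map⁺ (inj₂ ∘ inj₂) m)))))
        go : ∀ x → S (i x)
        go (inj₁ true)     = SL (here refl)
        go (inj₁ false)    = SL (there (∈-++⁺ʳ (map (inj₂ ∘ inj₁) (contour c)) (here refl)))
        go (inj₂ (inj₁ x)) = goL x
        go (inj₂ (inj₂ x)) = goR x
      spread (face s k c) i iα Sα Sf SL = go
        where
        S-false : S (i (inj₁ false))
        S-false = subst S (sym (iα (inj₁ true))) (Sα (SL (here refl)))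
        SL′ : ∀ {x} → x ∈ contour c → S (i (inj₂ x))
        SL′ {x} m with ∈-++⁻ (take k (contour c)) (subst (x ∈_) (sym (take++drop≡id k (contour c))) m)
        ... | inj₁ j = Sf (here refl) (here refl) (there (∈-map⁺ inj₂ j)) S-false
        ... | inj₂ j = SL (there (∈-map⁺ inj₂ j))
        go : ∀ x → S (i x)
        go (inj₁ true)  = SL (here refl)
        go (inj₁ false) = S-false
        go (inj₂ x)     = spread c (λ x → i (inj₂ x)) (λ x → iα (inj₂ x)) Sα
          (λ m u v → Sf (there (∈-map⁺ (mapF inj₂) m)) (∈-map⁺ inj₂ u) (∈-map⁺ inj₂ v)) SL′ x

  module _ {A : Set} (bar : A → A) (bar-bar : ∀ s → bar (bar s) ≡ s) where

    letter : ∀ c → Dart c → A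
    letter (bridge s c d) (inj₁ true)     = s
    letter (bridge s c d) (inj₁ false)    = bar s
    letter (bridge s c d) (inj₂ (inj₁ x)) = letter c x
    letter (bridge s c d) (inj₂ (inj₂ x)) = letter d x
    letter (face s k c)   (inj₁ true)     = s
    letter (face s k c)   (inj₁ false)    = bar s
    letter (face s k c)   (inj₂ x)        = letter c x

    letter-opp : ∀ c x → letter c (opp c x) ≡ bar (letter c x)
    letter-opp (bridge s c d) (inj₁ true)     = refl
    letter-opp (bridge s c d) (inj₁ false)    = sym (bar-bar s)
    letter-opp (bridge s c d) (inj₂ (inj₁ x)) = letter-opp c x
    letter-opp (bridge s c d) (inj₂ (inj₂ x)) = letter-opp d x
    letter-opp (face s k c)   (inj₁ true)     = refl
    letter-opp (face s k c)   (inj₁ false)    = sym (bar-bar s)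
    letter-opp (face s k c)   (inj₂ x)        = letter-opp c x

    letter-contour : ∀ c → map (letter c) (contour c) ≡ word bar c
    letter-contour atom = refl
    letter-contour (bridge s c d) = cong (s ∷_) (trans (map-++ (letter (bridge s c d)) (map (inj₂ ∘ inj₁) (contour c)) _)
      (cong₂ _++_ (trans (sym (map-∘ (contour c))) (letter-contour c))
        (cong (bar s ∷_) (trans (sym (map-∘ (contour d))) (letter-contour d)))))
    letter-contour (face s k c) = cong (s ∷_) (trans (sym (map-∘ (drop k (contour c))))
      (trans (sym (drop-map {f = letter c} k (contour c))) (cong (drop k) (letter-contour c))))

    letter-faces : (S : List A → Set) → ∀ c → Good bar S c → ∀ {x p} → (x , p) ∈ faces c → S (map (letter c) (x ∷ p))
    letter-faces S (bridge s c d) (g , h) i with ∈-++⁻ (map (mapF (inj₂ ∘ inj₁)) (faces c)) i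
    ... | inj₁ j with ∈-map⁻ (mapF (inj₂ ∘ inj₁)) j
    ...   | (x , p) , m , refl = subst S (cong (letter c x ∷_) (map-∘ p)) (letter-faces S c g m)
    letter-faces S (bridge s c d) (g , h) i | inj₂ j with ∈-map⁻ (mapF (inj₂ ∘ inj₂)) j
    ...   | (x , p) , m , refl = subst S (cong (letter d x ∷_) (map-∘ p)) (letter-faces S d h m)
    letter-faces S (face s k c) (le , g , h) (here refl) = subst S (cong (bar s ∷_)
      (trans (cong (take k) (sym (letter-contour c))) (trans (take-map {f = letter c} k (contour c)) (map-∘ (take k (contour c)))))) g
    letter-faces S (face s k c) (le , g , h) (there i) with ∈-map⁻ (mapF inj₂) i
    ...   | (x , p) , m , refl = subst S (cong (letter c x ∷_) (map-∘ p)) (letter-faces S c h m)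

    contour-length : ∀ c → length (contour c) ≡ length (word bar c)
    contour-length c = trans (sym (length-map (letter c) (contour c))) (cong length (letter-contour c))

    module _ {X : Set} (φ α : X → X) (lt : X → A) (I : X → Set) (S : List A → Set) where

      -- Peeling the built map returns the code it was built from. The recursion runs over subcodes,
      -- embedded by i into one fixed set of darts, since peeling never changes φ and α.
      build-Run : (c : Code A) → Good bar S c → (i : Dart c → X) → (∀ {x y} → i x ≡ i y → x ≡ y) →
        (∀ x → i (opp c x) ≡ α (i x)) → (∀ x → lt (i x) ≡ letter c x) →
        (∀ {x p} → (x , p) ∈ faces c → IsFace φ (i x) (map i p) × I (i x)) → Unique (contour c) → Run φ α lt I (map i (contour c)) c
      build-Run atom g i inj iα il fc u = atom
      build-Run (bridge s c d) (g , h) i inj iα il fc u = bridge (il (inj₁ true))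
        (trans (map-++ i (map (inj₂ ∘ inj₁) (contour c)) _) (cong₂ _++_ (sym (map-∘ (contour c)))
          (cong₂ _∷_ (iα (inj₁ true)) (sym (map-∘ (contour d))))))
        fresh
        (build-Run c g (λ x → i (inj₂ (inj₁ x))) (λ e → inj₁-injective (inj₂-injective (inj e))) (λ x → iα _) (λ x → il _)
          (λ {x} {p} m → subst (λ q → IsFace φ _ q × I _) (sym (map-∘ p)) (fc (∈-++⁺ˡ (∈-map⁺ (mapF (inj₂ ∘ inj₁)) m))))
          (Uniqueₚ.map⁻ (Unique-++ˡ (map (inj₂ ∘ inj₁) (contour c)) (Unique-tail u))))
        (build-Run d h (λ x → i (inj₂ (inj₂ x))) (λ e → inj₂-injective (inj₂-injective (inj e))) (λ x → iα _) (λ x → il _)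
          (λ {x} {p} m → subst (λ q → IsFace φ _ q × I _) (sym (map-∘ p)) (fc (∈-++⁺ʳ (map (mapF (inj₂ ∘ inj₁)) (faces c)) (∈-map⁺ (mapF (inj₂ ∘ inj₂)) m))))
          (Uniqueₚ.map⁻ (Unique-tail (Unique-++ʳ (map (inj₂ ∘ inj₁) (contour c)) (Unique-tail u)))))
        where
        fresh : α (i (inj₁ true)) ∉ map (λ x → i (inj₂ (inj₁ x))) (contour c)
        fresh m with ∈-map⁻ (λ x → i (inj₂ (inj₁ x))) m
        ... | y , _ , e with inj (trans (iα (inj₁ true)) e)
        ... | ()
      build-Run (face s k c) (le , g , h) i inj iα il fc u = face (il (inj₁ true))
        (trans (length-map i (map inj₂ (take k (contour c)))) (trans (length-map inj₂ (take k (contour c))) (trans (length-take k (contour c))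
          (ℕₚ.m≤n⇒m⊓n≡m (subst (k ≤_) (sym (contour-length c)) le)))))
        fresh
        (subst (λ z → IsFace φ z _) (iα (inj₁ true)) (proj₁ (fc (here refl))))
        (subst I (iα (inj₁ true)) (proj₂ (fc (here refl))))
        (subst (λ l → Run φ α lt I l c) eq
          (build-Run c h (λ x → i (inj₂ x)) (λ e → inj₂-injective (inj e)) (λ x → iα _) (λ x → il _)
            (λ {x} {p} m → subst (λ q → IsFace φ _ q × I _) (sym (map-∘ p)) (fc (there (∈-map⁺ (mapF inj₂) m)))) u′))
        where
        fresh : α (i (inj₁ true)) ∉ map i (map inj₂ (drop k (contour c)))
        fresh m with ∈-map⁻ i m
        ... | y , n , e with inj (trans (iα (inj₁ true)) e)
        ... | refl with ∈-map⁻ inj₂ n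
        ... | _ , _ , ()
        eq : map (λ x → i (inj₂ x)) (contour c) ≡ map i (map inj₂ (take k (contour c))) ++ map i (map inj₂ (drop k (contour c)))
        eq = trans (cong (map (λ x → i (inj₂ x))) (sym (take++drop≡id k (contour c))))
          (trans (map-++ (λ x → i (inj₂ x)) (take k (contour c)) _) (cong₂ _++_ (map-∘ (take k (contour c))) (map-∘ (drop k (contour c)))))
        u′ : Unique (contour c)
        u′ = Unique-++ˡ (contour c) (Unique-resp-↭ (↭-sym (flat-↭ c)) (all-Unique c))

  module Potential {A : Set} (bar : A → A) (bar-bar : ∀ s → bar (bar s) ≡ s)
    (val : A → ℤ) (val-bar : ∀ s → val (bar s) ≡ - val s) where

    net : List A → ℤ
    net []      = 0ℤ
    net (s ∷ w) = val s +ᶻ net w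

    height : ∀ c → ℤ → Vert c → ℤ
    height atom           b _        = b
    height (bridge s c d) b (inj₁ v) = height c (b +ᶻ val s) v
    height (bridge s c d) b (inj₂ v) = height d b v
    height (face s k c)   b v        = height c b v

    height-root : ∀ c b → height c b (rootV c) ≡ b
    height-root atom           b = refl
    height-root (bridge s c d) b = height-root d b
    height-root (face s k c)   b = height-root c b

    back : ∀ b s → b ≡ (b +ᶻ val s) +ᶻ val (bar s)
    back b s = sym (trans (ℤₚ.+-assoc b (val s) (val (bar s))) (trans (cong (λ z → b +ᶻ (val s +ᶻ z)) (val-bar s))
      (trans (cong (b +ᶻ_) (ℤₚ.+-inverseʳ (val s))) (ℤₚ.+-identityʳ b))))

    module _ (S : List A → Set) (S-net : ∀ w → S w → net w ≡ 0ℤ) where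

      height-step : ∀ c b → Good bar S c → ∀ x → height c b (org c (opp c x)) ≡ height c b (org c x) +ᶻ val (letter bar bar-bar c x)

      height-walk : ∀ c b → Good bar S c → ∀ l {v v′} → Walk c v l v′ → height c b v′ ≡ height c b v +ᶻ net (map (letter bar bar-bar c) l)
      height-walk c b g []      refl = sym (ℤₚ.+-identityʳ _)
      height-walk c b g (x ∷ l) (refl , w) = trans (height-walk c b g l w)
        (trans (cong (_+ᶻ net (map (letter bar bar-bar c) l)) (height-step c b g x)) (ℤₚ.+-assoc (height c b (org c x)) _ _))

      -- Here net value zero of the faces is needed: the k hidden steps of the uncovered face make
      -- up for `bar s`, so their end lies `val s` above the root vertex, as the peeled edge
      -- demands.
      corner : ∀ s k c b → Good bar S (face s k c) → height c b (startAt c (drop k (contour c))) ≡ b +ᶻ val s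
      corner s k c b (le , sg , g) = trans (height-walk c b g (take k (contour c))
          (proj₁ (walk-cut c (take k (contour c)) (drop k (contour c)) (subst (λ l → Walk c (rootV c) l (rootV c)) (sym (take++drop≡id k (contour c))) (contour-walk c)))))
        (cong₂ _+ᶻ_ (height-root c b) (trans (cong net (trans (sym (take-map {f = letter bar bar-bar c} k (contour c))) (cong (take k) (letter-contour bar bar-bar c))))
          (cancel (net (take k (word bar c))) (S-net _ sg))))
        where
        cancel : ∀ z → val (bar s) +ᶻ z ≡ 0ℤ → z ≡ val s
        cancel z e = trans (sym (ℤₚ.+-identityˡ z)) (trans (cong (_+ᶻ z) (trans (sym (ℤₚ.+-inverseʳ (val s))) (cong (val s +ᶻ_) (sym (val-bar s)))))
          (trans (ℤₚ.+-assoc (val s) (val (bar s)) z) (trans (cong (val s +ᶻ_) e) (ℤₚ.+-identityʳ (val s)))))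

      height-step (bridge s c d) b (g , h) (inj₁ true) = trans (height-root c (b +ᶻ val s)) (cong (_+ᶻ val s) (sym (height-root d b)))
      height-step (bridge s c d) b (g , h) (inj₁ false) = trans (height-root d b) (trans (back b s) (cong (_+ᶻ val (bar s)) (sym (height-root c (b +ᶻ val s)))))
      height-step (bridge s c d) b (g , h) (inj₂ (inj₁ x)) = height-step c (b +ᶻ val s) g x
      height-step (bridge s c d) b (g , h) (inj₂ (inj₂ x)) = height-step d b h x
      height-step (face s k c) b gd (inj₁ true) = trans (corner s k c b gd) (cong (_+ᶻ val s) (sym (height-root c b)))
      height-step (face s k c) b gd (inj₁ false) = trans (height-root c b) (trans (back b s) (cong (_+ᶻ val (bar s)) (sym (corner s k c b gd))))
      height-step (face s k c) b (_ , _ , g) (inj₂ x) = height-step c b g x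

-- Rooted planar maps with letters on the darts.

module PlanarMaps where

  open import Defs using (iter; numCycles)
  open FiniteLists
  open Orbits
  open Peeling
  open Decoding
  open Exploration
  open CyclicOrders
  open Building
  open import Data.Nat as ℕ using (ℕ; zero; suc; _+_; _*_; _≤_)
  import Data.Nat.Properties as ℕₚ
  open import Data.Nat.Tactic.RingSolver using (solve-∀)
  open import Data.Fin as Fin using (Fin)
  open import Data.Bool as Bool using (Bool; true; false; not)
  open import Data.Unit using (⊤; tt)
  open import Data.List using (List; []; _∷_; [_]; _++_; length; map; take; drop; concatMap; filter; allFin; upTo)
  open import Data.List.Properties using (length-map; length-++; map-++; ++-assoc; ++-identityʳ)
  open import Data.Bool.ListAction using (any)
  open import Data.List.Membership.Propositional using (_∈_; _∉_)
  open import Data.List.Membership.Propositional.Properties using (∈-map⁺; ∈-map⁻)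
  open import Data.List.Relation.Unary.Any using (here; there)
  open import Data.List.Relation.Unary.Unique.Propositional using (Unique)
  open import Data.List.Relation.Binary.Permutation.Propositional using (↭-sym)
  open import Data.List.Relation.Binary.Permutation.Propositional.Properties using (∈-resp-↭; ∷↭∷ʳ)
  open import Data.Product using (_×_; _,_; ∃-syntax; proj₁; proj₂)
  open import Data.Sum using (inj₁; inj₂)
  open import Data.Empty using (⊥-elim)
  open import Function using (Inverse; _↔_)
  open import Data.Integer as ℤ using (ℤ; 0ℤ)
  open import Relation.Binary.PropositionalEquality hiding ([_])

  iter-cong : {X : Set} {f g : X → X} → (∀ x → f x ≡ g x) → ∀ k x → iter f k x ≡ iter g k x
  iter-cong h zero    x = refl
  iter-cong {g = g} h (suc k) x = trans (h _) (cong g (iter-cong h k x))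

  any-cong : {X : Set} {f g : X → Bool} → (∀ x → f x ≡ g x) → ∀ xs → any f xs ≡ any g xs
  any-cong h []       = refl
  any-cong h (x ∷ xs) = cong₂ Bool._∨_ (h x) (any-cong h xs)

  count-cong : {X : Set} {f g : X → Bool} → (∀ x → f x ≡ g x) → ∀ xs →
    length (filter (λ x → f x Bool.≟ true) xs) ≡ length (filter (λ x → g x Bool.≟ true) xs)
  count-cong h [] = refl
  count-cong {f = f} {g} h (x ∷ xs) with f x | g x | h x
  ... | true  | true  | refl = cong suc (count-cong h xs)
  ... | false | false | refl = count-cong h xs

  numCycles-cong : ∀ {d} {f g : Fin d → Fin d} → (∀ x → f x ≡ g x) → numCycles f ≡ numCycles g
  numCycles-cong {d} h = count-cong (λ x → cong not (any-cong (λ k → cong (λ y → Fin.toℕ y ℕ.<ᵇ Fin.toℕ x) (iter-cong h k x)) (upTo d))) (allFin d)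

  -- φ is the face permutation and σ the vertex permutation; both are kept as
  -- data so that passing to the dual map just swaps them.
  record Coloured (A : Set) (bar : A → A) (n : ℕ) : Set₁ where
    no-eta-equality
    field
      σ σ⁻ φ φ⁻ α : Fin (2 * n) → Fin (2 * n)
      σσ⁻  : ∀ x → σ (σ⁻ x) ≡ x
      σ⁻σ  : ∀ x → σ⁻ (σ x) ≡ x
      φφ⁻  : ∀ x → φ (φ⁻ x) ≡ x
      φ⁻φ  : ∀ x → φ⁻ (φ x) ≡ x
      αα   : ∀ x → α (α x) ≡ x
      αfpf : ∀ x → α x ≢ x
      σα   : ∀ x → σ (α x) ≡ φ x
      root : Fin (2 * n)
      rest : List (Fin (2 * n))
      rootFace : IsFace φ root rest
      gen  : Generated φ α root
      planar : numCycles σ + numCycles φ ≡ n + 2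
      lt   : Fin (2 * n) → A
      ltα  : ∀ x → lt (α x) ≡ bar (lt x)

    σ-inj : ∀ {x y} → σ x ≡ σ y → x ≡ y
    σ-inj {x} {y} e = trans (sym (σ⁻σ x)) (trans (cong σ⁻ e) (σ⁻σ y))
    φ-inj : ∀ {x y} → φ x ≡ φ y → x ≡ y
    φ-inj {x} {y} e = trans (sym (φ⁻φ x)) (trans (cong φ⁻ e) (φ⁻φ y))

    rootWord : List A
    rootWord = map lt (root ∷ rest)

    Inner : Fin (2 * n) → Set
    Inner x = x ∉ root ∷ rest

    InnerFaces : (List A → Set) → Set
    InnerFaces S = ∀ {x p} → Inner x → IsFace φ x p → S (map lt (x ∷ p))

    HasCode : Code A → Set
    HasCode c = Run φ α lt Inner (root ∷ rest) c

    encode : ∃[ c ] (HasCode c × size c ≡ n)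
    encode = planar⇒Run refl planar
      where
      open Explore σ φ φ⁻ α φφ⁻ σ-inj φ-inj αα αfpf σα lt (root ∷ rest)
      open Connected root rest refl (rootFace) gen

  open Coloured

  record Heights {A bar n} (P : Coloured A bar n) (val : A → ℤ) : Set where
    field
      h     : Fin (2 * n) → ℤ
      hσ    : ∀ x → h (σ P x) ≡ h x
      hα    : ∀ x → h (α P x) ≡ h x ℤ.+ val (lt P x)
      hroot : h (root P) ≡ 0ℤ

  ColouredIso : ∀ {A bar n} → Coloured A bar n → Coloured A bar n → Set
  ColouredIso P Q = Iso (φ P) (α P) (lt P) (φ Q) (α Q) (lt Q) (root P) (root Q)

  module _ {A : Set} {bar : A → A} where

    Run-word : ∀ {X : Set} {φ α : X → X} {lt : X → A} {I l c} → (∀ x → lt (α x) ≡ bar (lt x)) →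
      Run φ α lt I l c → map lt l ≡ word bar c
    Run-word ltα atom = refl
    Run-word {lt = lt} ltα (bridge {r} {a = a} {b} e refl _ p q) = cong₂ _∷_ e (trans (map-++ lt a _)
      (cong₂ _++_ (Run-word ltα p) (cong₂ _∷_ (trans (ltα r) (cong bar e)) (Run-word ltα q))))
    Run-word {lt = lt} ltα (face {v = v} {k = k} {p = p} e refl _ _ _ q) = cong₂ _∷_ e
      (trans (sym (drop-++ (map lt p) (map lt v))) (trans (cong (λ n → drop n (map lt p ++ map lt v)) (length-map lt p))
        (cong (drop (length p)) (trans (sym (map-++ lt p v)) (Run-word ltα q)))))
      where
      drop-++ : ∀ (xs ys : List A) → drop (length xs) (xs ++ ys) ≡ ys
      drop-++ []       ys = refl
      drop-++ (x ∷ xs) ys = drop-++ xs ys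

    Run-Good : ∀ {X : Set} {φ α : X → X} {lt : X → A} {I l c} (S : List A → Set) → (∀ x → lt (α x) ≡ bar (lt x)) →
      (∀ {x p} → I x → IsFace φ x p → S (map lt (x ∷ p))) → Run φ α lt I l c → Good bar S c
    Run-Good S ltα h atom = tt
    Run-Good S ltα h (bridge _ _ _ p q) = Run-Good S ltα h p , Run-Good S ltα h q
    Run-Good {lt = lt} S ltα h (face {r} {v} {p = p} {c = c} refl refl _ f i q) = len ,
      subst S (cong₂ _∷_ (ltα r) (trans (sym take-++) (cong (take (length p)) w))) (h i f) , Run-Good S ltα h q
      where
      w : map lt (p ++ v) ≡ word bar c
      w = Run-word ltα q
      len : length p ≤ length (word bar c)
      len = subst (λ z → length p ≤ z) (trans (sym (trans (length-map lt (p ++ v)) (length-++ p))) (cong length w)) (ℕₚ.m≤m+n (length p) (length v))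
      take-pre : ∀ (xs ys : List A) → take (length xs) (xs ++ ys) ≡ xs
      take-pre []       ys = refl
      take-pre (x ∷ xs) ys = cong (x ∷_) (take-pre xs ys)
      take-++ : take (length p) (map lt (p ++ v)) ≡ map lt p
      take-++ = trans (cong₂ take (sym (length-map lt p)) (map-++ lt p v)) (take-pre (map lt p) (map lt v))

    code-Iso : ∀ {n} (P Q : Coloured A bar n) {c} → HasCode P c → HasCode Q c → size c ≡ n → ColouredIso P Q
    code-Iso P Q p q sz = sameCode⇒Iso bar refl (αα P) (αα Q) (ltα P) (ltα Q)
      (rootFace P) (rootFace Q) (gen P) (gen Q) p q sz

    -- An isomorphism carries the peeling of one map to a peeling of the other from its own root
    -- face, and peeling is deterministic.
    Iso-code : ∀ {n} (P Q : Coloured A bar n) {c d} → ColouredIso P Q → HasCode P c → HasCode Q d → c ≡ d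
    Iso-code P Q {c} i p q = Run-unique (subst (λ l → Run (φ Q) (α Q) (lt Q) (λ _ → ⊤) l c) eq
        (Transport.Run⁺ {I′ = λ _ → ⊤} π (Iso.π-inj i) πφ πα πlt (λ _ → tt) p)) q
      where
      open Iso i
      f : IsFace (φ Q) (root Q) (map π (rest P))
      f = subst (λ z → IsFace (φ Q) z (map π (rest P))) πr
        (Transport.face⁺ {α = α P} {lt = lt P} {I = λ _ → ⊤} {α′ = α Q} {lt′ = lt Q} {I′ = λ _ → ⊤} π (Iso.π-inj i) πφ πα πlt (λ _ → tt) (rootFace P))
      eq : map π (root P ∷ rest P) ≡ root Q ∷ rest Q
      eq = cong₂ _∷_ πr (face-unique f (rootFace Q))

  module _ {X : Set} {φ : X → X} where

    seg-snoc : ∀ x p {y} → Seg φ x p y → Seg φ x (p ++ [ y ]) (φ y)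
    seg-snoc x []      e       = e , refl
    seg-snoc x (z ∷ p) (e , s) = e , seg-snoc z p s

    rotate-face : ∀ {x z p} → IsFace φ x (z ∷ p) → IsFace φ z (p ++ [ x ])
    rotate-face {x} {z} {p} ((e , s) , u) = subst (Seg φ z (p ++ [ x ])) e (seg-snoc z p s) , Unique-resp-↭ (∷↭∷ʳ x (z ∷ p)) u

    face-φ : ∀ {x p} → IsFace φ x p → ∃[ q ] (IsFace φ (φ x) q × (∀ {y} → y ∈ x ∷ p → y ∈ φ x ∷ q) × (∀ {y} → y ∈ φ x ∷ q → y ∈ x ∷ p))
    face-φ {x} {[]}    f = [] , subst (λ z → IsFace φ z []) (sym (proj₁ f)) f , (λ i → subst (λ z → _ ∈ z ∷ []) (sym (proj₁ f)) i) , (λ i → subst (λ z → _ ∈ z ∷ []) (proj₁ f) i)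
    face-φ {x} {z ∷ p} f@((e , s) , u) = p ++ [ x ] , subst (λ y → IsFace φ y (p ++ [ x ])) (sym e) (rotate-face f) ,
      (λ i → subst (λ y → _ ∈ y ∷ p ++ [ x ]) (sym e) (∈-resp-↭ (∷↭∷ʳ x (z ∷ p)) i)) ,
      (λ i → ∈-resp-↭ (↭-sym (∷↭∷ʳ x (z ∷ p))) (subst (λ y → _ ∈ y ∷ p ++ [ x ]) e i))

    -- The list is rotated one dart at a time until y heads it; then uniqueness of face lists
    -- identifies it with q.
    face-word : {A : Set} (lt : X → A) (S : List A → Set) → (∀ s w → S (s ∷ w) → S (w ++ [ s ])) →
      ∀ {x p y q} → IsFace φ x p → y ∈ x ∷ p → IsFace φ y q → S (map lt (x ∷ p)) → S (map lt (y ∷ q))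
    face-word lt S rot {x} {p} f (here refl) g h with face-unique f g
    ... | refl = h
    face-word lt S rot {x} {p} {y} {q} f (there i) g h =
      go x [] p (subst (IsFace φ x) (sym (++-identityʳ p)) f) i (subst (λ l → S (map lt (x ∷ l))) (sym (++-identityʳ p)) h)
      where
      go : ∀ x a b → IsFace φ x (b ++ a) → y ∈ b → S (map lt (x ∷ b ++ a)) → S (map lt (y ∷ q))
      go x a (z ∷ b) f i h with subst (IsFace φ z) (++-assoc b a [ x ]) (rotate-face f)
        | subst S (trans (cong (λ w → lt z ∷ w) (trans (sym (map-++ lt (b ++ a) [ x ])) (cong (map lt) (++-assoc b a [ x ])))) refl) (rot _ _ h)
      go x a (z ∷ b) f (here refl) h | f′ | h′ with face-unique f′ g
      ... | refl = h′
      go x a (z ∷ b) f (there i) h | f′ | h′ = go z (a ++ [ x ]) b f′ i h′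

  module Realise {A : Set} {bar : A → A} (bar-bar : ∀ s → bar (bar s) ≡ s)
    (S : List A → Set) (S-rot : ∀ s w → S (s ∷ w) → S (w ++ [ s ])) where

    module OnDarts (c : Code A) (r : Dart c) (tl : List (Dart c)) (c≡ : contour c ≡ r ∷ tl) where

      cycles : List (Dart c × List (Dart c))
      cycles = (r , tl) ∷ faces c

      cycles≡ : concatMap cycle cycles ≡ flat c
      cycles≡ = cong (_++ concatMap cycle (faces c)) (sym c≡)

      uq : Unique (concatMap cycle cycles)
      uq = subst Unique (sym cycles≡) (Unique-resp-↭ (↭-sym (flat-↭ c)) (all-Unique c))

      total : ∀ x → x ∈ concatMap cycle cycles
      total x = subst (x ∈_) (sym cycles≡) (∈-resp-↭ (↭-sym (flat-↭ c)) (all-complete c x))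

      open CyclicPerm cycles uq total public

      rot : Dart c → Dart c
      rot x = next (opp c x)

      rot-opp : ∀ x → rot (opp c x) ≡ next x
      rot-opp x = cong next (opp-opp c x)

      closed : ∀ {f} → f ∈ cycles → Closed c f
      closed (here refl) = subst (λ b → Walk c b (r ∷ tl) b) (sym (proj₁ w)) w
        where
        w : Walk c (rootV c) (r ∷ tl) (rootV c)
        w = subst (λ l → Walk c (rootV c) l (rootV c)) c≡ (contour-walk c)
      closed (there i) = faces-closed c i

      org-next : ∀ x → org c (next x) ≡ org c (opp c x)
      org-next x with arrows-∈⁻ cycles (proj₂ (out x))
      ... | y , p , i , j = org-steps c y y p (closed i) j

      org-rot : ∀ x → org c (rot x) ≡ org c x
      org-rot x = trans (org-next (opp c x)) (cong (org c) (opp-opp c x))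

      org-surj : ∀ v → ∃[ x ] org c x ≡ v
      org-surj v with org-onto c v
      ... | inj₂ h    = h
      ... | inj₁ refl = r , proj₁ (subst (λ l → Walk c (rootV c) l (rootV c)) c≡ (contour-walk c))

      generated : Generated next (opp c) r
      generated T Tr Tn To = spread next (opp c) T c (λ x → x) (λ _ → refl) To
        (λ {f} {x} {y} m i j → around f (there m) i j)
        (λ {x} i → along r tl r (proj₁ (next-face (here refl))) Tr (subst (x ∈_) c≡ i))
        where
        along : ∀ x p y → Seg next x p y → T x → ∀ {z} → z ∈ x ∷ p → T z
        along x p       y s       t (here refl) = t
        along x (w ∷ p) y (e , s) t (there i)   = along w p y s (subst T e (Tn t)) i
        around : ∀ f → f ∈ cycles → ∀ {x y} → x ∈ cycle f → y ∈ cycle f → T x → T y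
        around (h , p) m {x} i j t = along h p h (proj₁ (next-face m)) (seg-∈ T Tn h p (proj₁ (next-face m)) i t) j

    module OnFin {n : ℕ} (c : Code A) (sz : size c ≡ n) (good : Good bar S c)
      (r : Dart c) (tl : List (Dart c)) (c≡ : contour c ≡ r ∷ tl)
      (e : Dart c → Fin (2 * n)) (e⁻ : Fin (2 * n) → Dart c) (ee⁻ : ∀ y → e (e⁻ y) ≡ y) (e⁻e : ∀ x → e⁻ (e x) ≡ x) where

      private
        N = 2 * n

        module D = OnDarts c r tl c≡

        e-inj : ∀ {x y} → e x ≡ e y → x ≡ y
        e-inj {x} {y} q = trans (sym (e⁻e x)) (trans (cong e⁻ q) (e⁻e y))

        conj : (Dart c → Dart c) → Fin N → Fin N
        conj f y = e (f (e⁻ y))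

        conj-∘ : ∀ f g h → (∀ x → f (g x) ≡ h x) → ∀ y → conj f (conj g y) ≡ conj h y
        conj-∘ f g h q y = cong e (trans (cong f (e⁻e _)) (q _))

        conj-inv : ∀ f g → (∀ x → f (g x) ≡ x) → ∀ y → conj f (conj g y) ≡ y
        conj-inv f g q y = trans (conj-∘ f g (λ x → x) q y) (ee⁻ y)

        e-conj : ∀ f x → e (f x) ≡ conj f (e x)
        e-conj f x = cong (λ z → e (f z)) (sym (e⁻e x))

        rot⁻ : Dart c → Dart c
        rot⁻ x = opp c (D.prev x)

        rr⁻ : ∀ x → D.rot (rot⁻ x) ≡ x
        rr⁻ x = trans (D.rot-opp (D.prev x)) (D.next-prev x)
        r⁻r : ∀ x → rot⁻ (D.rot x) ≡ x
        r⁻r x = trans (cong (opp c) (D.prev-next (opp c x))) (opp-opp c x)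

        σ₀ φ₀ α₀ : Fin N → Fin N
        σ₀ = conj D.rot
        φ₀ = conj D.next
        α₀ = conj (opp c)

        inj : ∀ f g → (∀ x → g (f x) ≡ x) → ∀ {x y} → conj f x ≡ conj f y → x ≡ y
        inj f g q {x} {y} p = trans (sym (conj-inv g f q x)) (trans (cong (conj g) p) (conj-inv g f q y))

        gen₀ : Generated φ₀ α₀ (e r)
        gen₀ T Tr Tφ Tα y = subst T (ee⁻ y) (D.generated (λ x → T (e x)) Tr
          (λ t → subst T (sym (e-conj D.next _)) (Tφ t)) (λ t → subst T (sym (e-conj (opp c) _)) (Tα t)) (e⁻ y))

        α-fpf : ∀ y → α₀ y ≢ y
        α-fpf y q = opp≢ c (e⁻ y) (e-inj (trans q (sym (ee⁻ y))))

        σα₀ : ∀ y → σ₀ (α₀ y) ≡ φ₀ y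
        σα₀ = conj-∘ D.rot (opp c) D.next D.rot-opp

        ≥V : length (verts c) ≤ numCycles σ₀
        ≥V = Orbit.numCycles-≥ σ₀ (inj D.rot rot⁻ r⁻r) (λ y → org c (e⁻ y))
          (λ y → trans (cong (org c) (e⁻e _)) (D.org-rot (e⁻ y))) (verts c) (verts-Unique c)
          (λ {v} _ → e (proj₁ (D.org-surj v)) , trans (cong (org c) (e⁻e _)) (proj₂ (D.org-surj v)))

        ≥F : suc (length (faces c)) ≤ numCycles φ₀
        ≥F = subst (_≤ numCycles φ₀) (length-map proj₁ D.cycles) (Orbit.numCycles-≥ φ₀ (inj D.next D.prev D.prev-next) (λ y → D.head (e⁻ y))
          (λ y → trans (cong D.head (e⁻e _)) (D.head-next (e⁻ y))) (map proj₁ D.cycles) (heads-Unique D.cycles D.uq) hit)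
          where
          hit : ∀ {x} → x ∈ map proj₁ D.cycles → ∃[ y ] D.head (e⁻ y) ≡ x
          hit i with ∈-map⁻ proj₁ i
          ... | f , j , refl = e (proj₁ f) , trans (cong D.head (e⁻e _)) (D.head-of j (here refl))

        face₀ : ∀ {x p} → (x , p) ∈ D.cycles → IsFace φ₀ (e x) (map e p)
        face₀ m = Transport.face⁺ {α = opp c} {lt = λ _ → tt} {I = λ _ → ⊤} {α′ = α₀} {lt′ = λ _ → tt} {I′ = λ _ → ⊤}
          e e-inj (e-conj D.next) (e-conj (opp c)) (λ _ → refl) (λ _ → tt) (D.next-face m)

        lt₀ : Fin N → A
        lt₀ y = letter bar bar-bar c (e⁻ y)

        module E = Explore σ₀ φ₀ (conj D.prev) α₀ (conj-inv D.next D.prev D.next-prev) (inj D.rot rot⁻ r⁻r) (inj D.next D.prev D.prev-next)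
          (conj-inv (opp c) (opp c) (opp-opp c)) α-fpf σα₀ lt₀ (e r ∷ map e tl)

        -- Squeezed between two bounds: the exploration of this very permutation pair bounds V + F
        -- from above in any genus, and the names of vertices and faces provided by the code bound
        -- it from below.
        euler-eq : numCycles σ₀ + numCycles φ₀ ≡ n + 2
        euler-eq = ℕₚ.≤-antisym
          (ℕₚ.*-cancelˡ-≤ 2 (ℕₚ.≤-trans (E.Connected.euler-≤ (e r) (map e tl) refl (face₀ (here refl)) gen₀) (ℕₚ.≤-reflexive (lem n))))
          (ℕₚ.≤-trans (ℕₚ.≤-reflexive (trans (trans (ℕₚ.+-comm n 2) (cong (λ k → suc (suc k)) (sym sz)))
              (trans (cong suc (sym (euler c))) (sym (ℕₚ.+-suc (length (verts c)) (length (faces c))))))) (ℕₚ.+-mono-≤ ≥V ≥F))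
          where
          lem : ∀ n → 2 * n + 4 ≡ 2 * (n + 2)
          lem = solve-∀

      realise : Coloured A bar n
      realise = record
        { σ = σ₀ ; σ⁻ = conj rot⁻ ; φ = φ₀ ; φ⁻ = conj D.prev ; α = α₀
        ; σσ⁻ = conj-inv D.rot rot⁻ rr⁻ ; σ⁻σ = conj-inv rot⁻ D.rot r⁻r
        ; φφ⁻ = conj-inv D.next D.prev D.next-prev ; φ⁻φ = conj-inv D.prev D.next D.prev-next
        ; αα = conj-inv (opp c) (opp c) (opp-opp c) ; αfpf = α-fpf ; σα = σα₀
        ; root = e r ; rest = map e tl ; rootFace = face₀ (here refl) ; gen = gen₀ ; planar = euler-eq ; lt = lt₀
        ; ltα = λ y → trans (cong (letter bar bar-bar c) (e⁻e _)) (letter-opp bar bar-bar c (e⁻ y)) }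

      private
        e-contour : map e (contour c) ≡ e r ∷ map e tl
        e-contour = cong (map e) c≡

        org-start : org c r ≡ rootV c
        org-start = proj₁ (subst (λ l → Walk c (rootV c) l (rootV c)) c≡ (contour-walk c))

        lt-e : ∀ x → lt₀ (e x) ≡ letter bar bar-bar c x
        lt-e x = cong (letter bar bar-bar c) (e⁻e x)

        disj : ∀ {x p} → (x , p) ∈ faces c → Inner realise (e x)
        disj {x} {p} m i with ∈-map⁻ e (subst (e x ∈_) (sym e-contour) i)
        ... | y , j , q with e-inj q
        ... | refl = Unique-disjoint (r ∷ tl) D.uq (subst (x ∈_) c≡ j) (concat-∈⁺ (faces c) m (here refl))

      realise-code : HasCode realise c
      realise-code = subst (λ l → Run φ₀ α₀ lt₀ (Inner realise) l c) e-contour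
        (build-Run bar bar-bar φ₀ α₀ lt₀ (Inner realise) S c good e e-inj (e-conj (opp c)) lt-e
          (λ m → face₀ (there m) , disj m) (subst Unique (sym c≡) (Unique-++ˡ (r ∷ tl) D.uq)))

      realise-faces : InnerFaces realise S
      realise-faces {y} {p} ni f with concat-∈⁻ D.cycles (D.total (e⁻ y))
      ... | g , here refl , i = ⊥-elim (ni (subst (_∈ e r ∷ map e tl) (ee⁻ y) (∈-map⁺ e i)))
      ... | (x , q) , there m , i = face-word lt₀ S S-rot (face₀ (there m)) (subst (_∈ map e (x ∷ q)) (ee⁻ y) (∈-map⁺ e i)) f
            (subst S (eqm (x ∷ q)) (letter-faces bar bar-bar S c good m))
        where
        eqm : ∀ l → map (letter bar bar-bar c) l ≡ map lt₀ (map e l)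
        eqm []      = refl
        eqm (x ∷ l) = cong₂ _∷_ (sym (lt-e x)) (eqm l)

      module _ (val : A → ℤ) (val-bar : ∀ s → val (bar s) ≡ ℤ.- val s) (S-net : ∀ w → S w → Potential.net bar bar-bar val val-bar w ≡ 0ℤ) where
        open Potential bar bar-bar val val-bar

        realise-height : Heights realise val
        realise-height = record
          { h = λ y → height c 0ℤ (org c (e⁻ y))
          ; hσ = λ y → cong (height c 0ℤ) (trans (cong (org c) (e⁻e _)) (D.org-rot (e⁻ y)))
          ; hα = λ y → trans (cong (λ z → height c 0ℤ (org c z)) (e⁻e _)) (height-step S S-net c 0ℤ good (e⁻ y))
          ; hroot = trans (cong (λ z → height c 0ℤ (org c z)) (e⁻e r)) (trans (cong (height c 0ℤ) org-start) (height-root c 0ℤ)) }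

    module Realisation {n} (c : Code A) (sz : size c ≡ n) (good : Good bar S c) {s : A} {w : List A} (c-word : word bar c ≡ s ∷ w) where

      private
        start : ∃[ r ] ∃[ tl ] contour c ≡ r ∷ tl
        start = nonempty (contour c) (trans (letter-contour bar bar-bar c) c-word)
          where
          nonempty : ∀ l → map (letter bar bar-bar c) l ≡ s ∷ w → ∃[ r ] ∃[ tl ] l ≡ r ∷ tl
          nonempty (r ∷ tl) _ = r , tl , refl

        bij : ∃[ e ] ∃[ e⁻ ] ((∀ (y : Fin (2 * n)) → e (e⁻ y) ≡ y) × (∀ (x : Dart c) → e⁻ (e x) ≡ x))
        bij = Inverse.to b , Inverse.from b , (λ y → Inverse.inverseˡ b refl) , (λ x → Inverse.inverseʳ b refl)
          where
          b = subst (λ k → Dart c ↔ Fin (2 * k)) sz (Dart↔Fin c)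

      open OnFin c sz good (proj₁ start) (proj₁ (proj₂ start)) (proj₂ (proj₂ start))
        (proj₁ bij) (proj₁ (proj₂ bij)) (proj₁ (proj₂ (proj₂ bij))) (proj₂ (proj₂ (proj₂ bij))) public

-- Enumeration of codes and Tutte's equation.

module Counting where

  open FiniteLists
  open Peeling
  open Decoding
  open Building using (word; Good)
  open PlanarMaps
  open import Data.Nat using (ℕ; zero; suc; _+_; _*_; _∸_; _≤_; _<_; z≤n; s≤s)
  import Data.Nat.Properties as ℕₚ
  open import Data.Nat.Tactic.RingSolver using (solve-∀)
  open import Data.Fin using (Fin)
  open Exploration using (seg-∈)
  open import Data.Unit using (tt)
  open import Data.List using (List; []; _∷_; [_]; _++_; length; map; take; drop; concatMap; downFrom)
  open import Data.List.Properties using (length-map; length-++; map-++; ++-assoc; ++-identityʳ; ∷-injective; take++drop≡id; length-take)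
  open import Data.Nat.ListAction using (sum)
  open import Data.Nat.ListAction.Properties using (sum-++)
  open import Data.List.Membership.Propositional using (_∈_)
  open import Data.List.Membership.Propositional.Properties using (∈-++⁺ˡ; ∈-++⁺ʳ; ∈-++⁻; ∈-map⁺; ∈-map⁻; ∈-downFrom⁺; ∈-downFrom⁻)
  open import Data.List.Relation.Unary.Any using (here; there)
  open import Data.List.Relation.Unary.AllPairs using ([]; _∷_)
  open import Data.List.Relation.Unary.All using ([]; _∷_)
  open import Data.List.Relation.Unary.Unique.Propositional using (Unique)
  import Data.List.Relation.Unary.Unique.Propositional.Properties as Uniqueₚ
  open import Data.Product using (_×_; _,_; ∃-syntax; proj₁; proj₂)
  open import Data.Sum using (inj₁; inj₂)
  open import Data.Empty using (⊥; ⊥-elim)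
  open import Relation.Nullary using (yes; no; Dec)
  open import Relation.Binary.PropositionalEquality hiding ([_])

  sumOver : {X : Set} → List X → (X → ℕ) → ℕ
  sumOver []       f = 0
  sumOver (x ∷ xs) f = f x + sumOver xs f

  length-concatMap : {X Y : Set} (f : X → List Y) (xs : List X) → length (concatMap f xs) ≡ sumOver xs (λ x → length (f x))
  length-concatMap f []       = refl
  length-concatMap f (x ∷ xs) = trans (length-++ (f x)) (cong (length (f x) +_) (length-concatMap f xs))

  sumOver-cong : {X : Set} {f g : X → ℕ} (xs : List X) → (∀ {x} → x ∈ xs → f x ≡ g x) → sumOver xs f ≡ sumOver xs g
  sumOver-cong []       h = refl
  sumOver-cong (x ∷ xs) h = cong₂ _+_ (h (here refl)) (sumOver-cong xs (λ i → h (there i)))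

  sumOver-const : {X : Set} (xs : List X) (k : ℕ) → sumOver xs (λ _ → k) ≡ length xs * k
  sumOver-const []       k = refl
  sumOver-const (x ∷ xs) k = cong (k +_) (sumOver-const xs k)

  concatMap-∈⁺ : {X Y : Set} (f : X → List Y) {xs : List X} {x : X} {y : Y} → x ∈ xs → y ∈ f x → y ∈ concatMap f xs
  concatMap-∈⁺ f (here refl) j = ∈-++⁺ˡ j
  concatMap-∈⁺ f {x ∷ xs} (there i) j = ∈-++⁺ʳ (f x) (concatMap-∈⁺ f i j)

  concatMap-∈⁻ : {X Y : Set} (f : X → List Y) (xs : List X) {y : Y} → y ∈ concatMap f xs → ∃[ x ] (x ∈ xs × y ∈ f x)
  concatMap-∈⁻ f (x ∷ xs) i with ∈-++⁻ (f x) i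
  ... | inj₁ j = x , here refl , j
  ... | inj₂ j with concatMap-∈⁻ f xs j
  ...   | x′ , k , l = x′ , there k , l

  concatMap-Unique : {X Y : Set} (f : X → List Y) (xs : List X) → Unique xs → (∀ x → x ∈ xs → Unique (f x)) →
    (∀ {x x′ y} → x ∈ xs → x′ ∈ xs → y ∈ f x → y ∈ f x′ → x ≡ x′) → Unique (concatMap f xs)
  concatMap-Unique f []       u h d = []
  concatMap-Unique f (x ∷ xs) u h d = Uniqueₚ.++⁺ (h x (here refl))
    (concatMap-Unique f xs (Unique-tail u) (λ z i → h z (there i)) (λ i j → d (there i) (there j)))
    λ (i , j) → let x′ , k , l = concatMap-∈⁻ f xs j in
      Unique-head u (subst (_∈ xs) (sym (d (here refl) (there k) i l)) k)

  -- The injection is given as a relation with unique preimages. It takes values in `Set₁` because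
  -- the instance `Rotates` contains a whole map.
  Unique-inject : {X Y : Set} (R : X → Y → Set₁) (xs : List X) (ys : List Y) → Unique xs →
    (∀ {x} → x ∈ xs → ∃[ y ] (y ∈ ys × R x y)) → (∀ {x x′ y} → R x y → R x′ y → x ≡ x′) → length xs ≤ length ys
  Unique-inject {X} {Y} R xs ys u f inj with go xs u f
    where
    go : ∀ xs → Unique xs → (∀ {x} → x ∈ xs → ∃[ y ] (y ∈ ys × R x y)) →
      ∃[ zs ] (length zs ≡ length xs × Unique zs × (∀ {z} → z ∈ zs → z ∈ ys × ∃[ x ] (x ∈ xs × R x z)))
    go [] u f = [] , refl , [] , λ ()
    go (x ∷ xs) u f with f (here refl) | go xs (Unique-tail u) (λ i → f (there i))
    ... | y , y∈ , r | zs , len , uz , h = y ∷ zs , cong suc len ,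
      Unique-cons (λ i → let _ , x′ , k , r′ = h i in Unique-head u (subst (_∈ xs) (inj r′ r) k)) uz ,
      λ { (here refl) → y∈ , x , here refl , r ; (there i) → let a , x′ , k , r′ = h i in a , x′ , there k , r′ }
  ... | zs , len , uz , h = subst (_≤ length ys) len (Unique-⊆-length zs uz (λ i → proj₁ (h i)))

  module Splitting {A : Set} (_≟_ : (s t : A) → Dec (s ≡ t)) where

    splits : A → List A → List (List A × List A)
    splits-here : A → A → List A → List (List A × List A)
    splits-here x y v with x ≟ y
    ... | yes _ = ([] , v) ∷ []
    ... | no  _ = []
    consˡ : A → List A × List A → List A × List A
    consˡ y (a , b) = y ∷ a , b
    splits x []      = []
    splits x (y ∷ v) = splits-here x y v ++ map (consˡ y) (splits x v)

    splits-sound : ∀ x v {a b} → (a , b) ∈ splits x v → v ≡ a ++ x ∷ b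
    splits-sound x (y ∷ v) i with x ≟ y
    splits-sound x (y ∷ v) (here refl) | yes refl = refl
    splits-sound x (y ∷ v) (there i)   | yes refl with ∈-map⁻ (consˡ y) i
    ... | _ , j , refl = cong (y ∷_) (splits-sound x v j)
    splits-sound x (y ∷ v) i | no _ with ∈-map⁻ (consˡ y) i
    ... | _ , j , refl = cong (y ∷_) (splits-sound x v j)

    splits-complete : ∀ x a b → (a , b) ∈ splits x (a ++ x ∷ b)
    splits-complete x [] b with x ≟ x
    ... | yes _ = here refl
    ... | no n  = ⊥-elim (n refl)
    splits-complete x (y ∷ a) b = ∈-++⁺ʳ (splits-here x y (a ++ x ∷ b)) (∈-map⁺ (consˡ y) (splits-complete x a b))

    splits-Unique : ∀ x v → Unique (splits x v)
    splits-Unique x [] = []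
    splits-Unique x (y ∷ v) = Uniqueₚ.++⁺ u (Uniqueₚ.map⁺ (λ { refl → refl }) (splits-Unique x v)) d
      where
      u : Unique (splits-here x y v)
      u with x ≟ y
      ... | yes _ = [] ∷ []
      ... | no  _ = []
      d : ∀ {z} → z ∈ splits-here x y v × z ∈ map (consˡ y) (splits x v) → ⊥
      d (i , j) with x ≟ y
      d (here refl , j) | yes _ with ∈-map⁻ (consˡ y) j
      ... | _ , _ , ()

  -- A class of words that may occur as contours of inner faces.  cand s g lists
  -- the continuations p such that bar s ∷ p is a contour of weight 1 + g.
  record FaceClass (A : Set) : Set₁ where
    field
      _≟_   : (s t : A) → Dec (s ≡ t)
      bar   : A → A
      bar-bar : ∀ s → bar (bar s) ≡ s
      S     : List A → Set
      S-rot : ∀ s w → S (s ∷ w) → S (w ++ [ s ])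
      wt    : List A → ℕ
      cand  : A → ℕ → List (List A)
      cand-sound    : ∀ {s g p} → p ∈ cand s g → S (bar s ∷ p) × wt (bar s ∷ p) ≡ suc g
      cand-complete : ∀ {s p} → S (bar s ∷ p) → ∃[ g ] (wt (bar s ∷ p) ≡ suc g × p ∈ cand s g)
      cand-Unique   : ∀ s g → Unique (cand s g)
      cand-length   : ∀ {s g p} → p ∈ cand s g → length p < 4 * suc g
      up    : A → ℕ
      up-bar : ∀ s → up s + up (bar s) ≡ 1
      m     : ℕ
      S-up  : ∀ w → S w → sum (map up w) ≡ suc m * wt w

  module Count {A : Set} (K : FaceClass A) where
    open FaceClass K
    open Splitting _≟_ public

    ups : List A → ℕ
    ups w = sum (map up w)

    ups-++ : ∀ a b → ups (a ++ b) ≡ ups a + ups b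
    ups-++ a b = trans (cong sum (map-++ up a b)) (sum-++ (map up a) (map up b))

    weight : Code A → ℕ
    weight atom           = 0
    weight (bridge _ c d) = weight c + weight d
    weight (face s k c)   = wt (bar s ∷ take k (word bar c)) + weight c

    -- Each edge has exactly one dart that counts as up. It lies on the boundary word or on an inner
    -- face, and inner faces contribute `suc m` of them per unit of weight.
    size-weight : ∀ c → Good bar S c → size c ≡ ups (word bar c) + suc m * weight c
    size-weight atom g = sym (ℕₚ.*-zeroʳ m)
    size-weight (bridge s c d) (g , h) = trans (cong suc (cong₂ _+_ (size-weight c g) (size-weight d h)))
      (trans (cong (_+ (ups (word bar c) + suc m * weight c + (ups (word bar d) + suc m * weight d))) (sym (up-bar s))) (trans (lem (up s) (up (bar s)) (ups (word bar c)) (weight c) (ups (word bar d)) (weight d) m)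
        (cong (λ z → up s + z + suc m * (weight c + weight d)) (sym (ups-++ (word bar c) (bar s ∷ word bar d))))))
      where
      lem : ∀ s t a wa b wb m → s + t + (a + suc m * wa + (b + suc m * wb)) ≡ s + (a + (t + b)) + suc m * (wa + wb)
      lem = solve-∀
    size-weight (face s k c) (le , g , h) = trans (cong suc (size-weight c h)) (trans (cong₂ _+_ (sym (up-bar s)) (cong (_+ suc m * weight c)
        (trans (cong ups (sym (take++drop≡id k (word bar c)))) (ups-++ (take k (word bar c)) (drop k (word bar c))))))
      (trans (lem (up s) (up (bar s)) (ups (take k (word bar c))) (ups (drop k (word bar c))) (suc m * weight c))
        (trans (cong (λ z → up s + ups (drop k (word bar c)) + (z + suc m * weight c)) (S-up _ g))
          (lem′ (up s + ups (drop k (word bar c))) (wt (bar s ∷ take k (word bar c))) (weight c) m))))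
      where
      lem : ∀ s t a b w → s + t + ((a + b) + w) ≡ s + b + ((t + a) + w)
      lem = solve-∀
      lem′ : ∀ x f w m → x + (suc m * f + suc m * w) ≡ x + suc m * (f + w)
      lem′ = solve-∀

    codes : ℕ → ℕ → List A → List (Code A)
    bridgesAt : ℕ → ℕ → A → List A × List A → ℕ → List (Code A)
    bridges : ℕ → ℕ → A → List A × List A → List (Code A)
    facesAt : ℕ → ℕ → A → List A → ℕ → List (Code A)
    codes zero    n       w       = []
    codes (suc f) zero    []      = atom ∷ []
    codes (suc f) (suc n) []      = []
    codes (suc f) n       (s ∷ v) = concatMap (bridges f n s) (splits (bar s) v) ++ concatMap (facesAt f n s v) (downFrom n)
    bridgesAt f n s (a , b) k = concatMap (λ c → map (bridge s c) (codes f (n ∸ k) b)) (codes f k a)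
    bridges f n s ab = concatMap (bridgesAt f n s ab) (downFrom (suc n))
    facesAt f n s v g = concatMap (λ p → map (face s (length p)) (codes f (n ∸ suc g) (p ++ v))) (cand s g)

    record Ok (n : ℕ) (w : List A) (c : Code A) : Set where
      constructor ok
      field
        good : Good bar S c
        word≡ : word bar c ≡ w
        weight≡ : weight c ≡ n

    take-pre : ∀ (xs ys : List A) → take (length xs) (xs ++ ys) ≡ xs
    take-pre []       ys = refl
    take-pre (x ∷ xs) ys = cong (x ∷_) (take-pre xs ys)

    drop-pre : ∀ (xs ys : List A) → drop (length xs) (xs ++ ys) ≡ ys
    drop-pre []       ys = refl
    drop-pre (x ∷ xs) ys = drop-pre xs ys

    face-ok : ∀ {n s v g p c} → g < n → p ∈ cand s g → Ok (n ∸ suc g) (p ++ v) c → Ok n (s ∷ v) (face s (length p) c)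
    face-ok {n} {s} {v} {g} {p} {c} g<n i (ok gd w≡ wt≡) = ok
      (subst (length p ≤_) (trans (sym (length-++ p)) (cong length (sym w≡))) (ℕₚ.m≤m+n (length p) (length v))
        , subst (λ z → S (bar s ∷ z)) (sym t≡) (proj₁ (cand-sound i)) , gd)
      (cong (s ∷_) (trans (cong (drop (length p)) w≡) (drop-pre p v)))
      (trans (cong₂ _+_ (trans (cong (λ z → wt (bar s ∷ z)) t≡) (proj₂ (cand-sound i))) wt≡) (ℕₚ.m+[n∸m]≡n g<n))
      where
      t≡ : take (length p) (word bar c) ≡ p
      t≡ = trans (cong (take (length p)) w≡) (take-pre p v)

    codes-sound : ∀ f n w {c} → c ∈ codes f n w → Ok n w c
    codes-sound (suc f) zero [] (here refl) = ok tt refl refl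
    codes-sound (suc f) n (s ∷ v) i with ∈-++⁻ (concatMap (bridges f n s) (splits (bar s) v)) (i′ n i)
      where
      i′ : ∀ n {c} → c ∈ codes (suc f) n (s ∷ v) → c ∈ concatMap (bridges f n s) (splits (bar s) v) ++ concatMap (facesAt f n s v) (downFrom n)
      i′ zero    i = i
      i′ (suc n) i = i
    ... | inj₁ j with concatMap-∈⁻ (bridges f n s) (splits (bar s) v) j
    ...   | (a , b) , j₁ , j₂ with concatMap-∈⁻ (bridgesAt f n s (a , b)) (downFrom (suc n)) j₂
    ...     | k , j₃ , j₄ with concatMap-∈⁻ (λ c → map (bridge s c) (codes f (n ∸ k) b)) (codes f k a) j₄
    ...       | c , j₅ , j₆ with ∈-map⁻ (bridge s c) j₆
    ...         | d , j₇ , refl with codes-sound f k a j₅ | codes-sound f (n ∸ k) b j₇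
    ...           | ok g₁ w₁ t₁ | ok g₂ w₂ t₂ = ok (g₁ , g₂)
      (cong (s ∷_) (trans (cong₂ (λ x y → x ++ bar s ∷ y) w₁ w₂) (sym (splits-sound (bar s) v j₁))))
      (trans (cong₂ _+_ t₁ t₂) (ℕₚ.m+[n∸m]≡n (ℕₚ.≤-pred (∈-downFrom⁻ j₃))))
    codes-sound (suc f) n (s ∷ v) i | inj₂ j with concatMap-∈⁻ (facesAt f n s v) (downFrom n) j
    ... | g , j₁ , j₂ with concatMap-∈⁻ (λ p → map (face s (length p)) (codes f (n ∸ suc g) (p ++ v))) (cand s g) j₂
    ...   | p , j₃ , j₄ with ∈-map⁻ (face s (length p)) j₄
    ...     | c , j₅ , refl = face-ok (∈-downFrom⁻ j₁) j₃ (codes-sound f (n ∸ suc g) (p ++ v) j₅)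

    -- Uncovering a face of weight 1 + g costs 4 (1 + g) and adds fewer letters than that, by
    -- `cand-length`. The factor 4 is the degree of a quadrangle.
    measure : ℕ → List A → ℕ
    measure n w = 4 * n + length w

    codes-∷ : ∀ f n s v → codes (suc f) n (s ∷ v) ≡ concatMap (bridges f n s) (splits (bar s) v) ++ concatMap (facesAt f n s v) (downFrom n)
    codes-∷ f zero    s v = refl
    codes-∷ f (suc n) s v = refl

    measureˡ : ∀ f n s v k {a b} → measure n (s ∷ v) < suc f → (a , b) ∈ splits (bar s) v → k ≤ n → measure k a < f
    measureˡ f n s v k {a} {b} lt i k≤n = ℕₚ.≤-trans (s≤s (ℕₚ.+-mono-≤ (ℕₚ.*-monoʳ-≤ 4 k≤n) la)) (ℕₚ.≤-trans (ℕₚ.≤-reflexive (sym (ℕₚ.+-suc (4 * n) (length v)))) (ℕₚ.≤-pred lt))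
      where
      la : length a ≤ length v
      la = subst (length a ≤_) (sym (trans (cong length (splits-sound (bar s) v i)) (length-++ a))) (ℕₚ.m≤m+n (length a) _)

    measureʳ : ∀ f n s v k {a b} → measure n (s ∷ v) < suc f → (a , b) ∈ splits (bar s) v → k ≤ n → measure k b < f
    measureʳ f n s v k {a} {b} lt i k≤n = ℕₚ.≤-trans (s≤s (ℕₚ.+-mono-≤ (ℕₚ.*-monoʳ-≤ 4 k≤n) lb)) (ℕₚ.≤-trans (ℕₚ.≤-reflexive (sym (ℕₚ.+-suc (4 * n) (length v)))) (ℕₚ.≤-pred lt))
      where
      lb : length b ≤ length v
      lb = subst (length b ≤_) (sym (trans (cong length (splits-sound (bar s) v i)) (length-++ a))) (ℕₚ.≤-trans (ℕₚ.n≤1+n _) (ℕₚ.m≤n+m (suc (length b)) (length a)))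

    measureᶠ : ∀ f n s v g p → measure n (s ∷ v) < suc f → p ∈ cand s g → g < n → measure (n ∸ suc g) (p ++ v) < f
    measureᶠ f n s v g p lt i g<n = ℕₚ.≤-trans (ℕₚ.≤-trans (s≤s (ℕₚ.≤-reflexive (cong (4 * (n ∸ suc g) +_) (length-++ p))))
        (ℕₚ.≤-trans (ℕₚ.≤-reflexive (lem (4 * (n ∸ suc g)) (length p) (length v))) (ℕₚ.≤-trans (ℕₚ.+-monoˡ-≤ (length v) (ℕₚ.+-monoʳ-≤ (4 * (n ∸ suc g)) (cand-length i)))
          (ℕₚ.≤-reflexive (cong (_+ length v) (trans (sym (ℕₚ.*-distribˡ-+ 4 (n ∸ suc g) (suc g))) (cong (4 *_) (ℕₚ.m∸n+n≡m g<n))))))))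
      (ℕₚ.≤-trans (ℕₚ.≤-trans (ℕₚ.n≤1+n _) (ℕₚ.≤-reflexive (sym (ℕₚ.+-suc (4 * n) (length v))))) (ℕₚ.≤-pred lt))
      where
      lem : ∀ a p v → suc (a + (p + v)) ≡ a + suc p + v
      lem = solve-∀

    codes-complete : ∀ f c n w → measure n w < f → Ok n w c → c ∈ codes f n w
    codes-complete (suc f) atom .0 .[] lt (ok g refl refl) = here refl
    codes-complete (suc f) (bridge s c d) n .(s ∷ word bar c ++ bar s ∷ word bar d) lt (ok (g , h) refl refl) =
      subst (bridge s c d ∈_) (sym (codes-∷ f n s _)) (∈-++⁺ˡ (concatMap-∈⁺ (bridges f n s) sp (concatMap-∈⁺ (bridgesAt f n s (word bar c , word bar d)) (∈-downFrom⁺ (s≤s le))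
        (concatMap-∈⁺ (λ c → map (bridge s c) (codes f (n ∸ weight c₀) (word bar d)))
          (codes-complete f c (weight c) (word bar c) (measureˡ f n s (word bar c ++ bar s ∷ word bar d) (weight c) lt sp le) (ok g refl refl))
          (∈-map⁺ (bridge s c) (codes-complete f d (n ∸ weight c) (word bar d) (measureʳ f n s (word bar c ++ bar s ∷ word bar d) (n ∸ weight c) lt sp (ℕₚ.m∸n≤m n (weight c)))
            (ok h refl (sym (ℕₚ.m+n∸m≡n (weight c) (weight d))))))))))
      where
      c₀ = c
      le : weight c ≤ weight c + weight d
      le = ℕₚ.m≤m+n (weight c) (weight d)
      sp : (word bar c , word bar d) ∈ splits (bar s) (word bar c ++ bar s ∷ word bar d)
      sp = splits-complete (bar s) (word bar c) (word bar d)
    codes-complete (suc f) (face s k c) n .(s ∷ drop k (word bar c)) lt (ok (le , sg , h) refl refl) with cand-complete sg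
    ... | g , e , i = subst (face s k c ∈_) (sym (codes-∷ f n s _)) (∈-++⁺ʳ (concatMap (bridges f n s) (splits (bar s) v)) (concatMap-∈⁺ (facesAt f n s v) (∈-downFrom⁺ g<n)
        (concatMap-∈⁺ (λ p → map (face s (length p)) (codes f (n ∸ suc g) (p ++ v))) i
          (subst (λ z → face s z c ∈ map (face s (length p)) (codes f (n ∸ suc g) (p ++ v))) len
            (∈-map⁺ (face s (length p)) (codes-complete f c (n ∸ suc g) (p ++ v) (measureᶠ f n s v g p lt i g<n)
              (ok h (sym (take++drop≡id k (word bar c))) (trans (sym (ℕₚ.m+n∸m≡n (suc g) (weight c))) (cong (λ z → z + weight c ∸ suc g) (sym e))))))))))
      where
      p = take k (word bar c)
      v = drop k (word bar c)
      len : length p ≡ k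
      len = trans (length-take k (word bar c)) (ℕₚ.m≤n⇒m⊓n≡m le)
      g<n : g < n
      g<n = subst (_≤ n) e (ℕₚ.m≤m+n _ (weight c))

    -- Every choice can be recovered from the resulting code: a, b and k as the words and the weight
    -- of the two parts, p as the prefix of known length of the inner word, and g from the weight of
    -- p.
    codes-Unique : ∀ f n w → Unique (codes f n w)
    codes-Unique zero    n       w  = []
    codes-Unique (suc f) zero    [] = [] ∷ []
    codes-Unique (suc f) (suc n) [] = []
    codes-Unique (suc f) n (s ∷ v) = subst Unique (sym (codes-∷ f n s v)) (Uniqueₚ.++⁺
      (concatMap-Unique (bridges f n s) (splits (bar s) v) (splits-Unique (bar s) v)
        (λ (a , b) _ → concatMap-Unique (bridgesAt f n s (a , b)) (downFrom (suc n)) (Uniqueₚ.downFrom⁺ (suc n))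
          (λ k _ → concatMap-Unique (λ c → map (bridge s c) (codes f (n ∸ k) b)) (codes f k a) (codes-Unique f k a)
            (λ c _ → Uniqueₚ.map⁺ (λ { refl → refl }) (codes-Unique f (n ∸ k) b))
            (λ {c} {c′} _ _ i j → same-c {c} {c′} (∈-map⁻ (bridge s c) i) (∈-map⁻ (bridge s c′) j)))
          (λ {k} {k′} _ _ i j → same-k {k} {k′} i j))
        (λ {ab} {ab′} _ _ i j → same-ab {ab} {ab′} i j))
      (concatMap-Unique (facesAt f n s v) (downFrom n) (Uniqueₚ.downFrom⁺ n)
        (λ g g∈ → concatMap-Unique (λ p → map (face s (length p)) (codes f (n ∸ suc g) (p ++ v))) (cand s g) (cand-Unique s g)
          (λ p _ → Uniqueₚ.map⁺ (λ { refl → refl }) (codes-Unique f (n ∸ suc g) (p ++ v)))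
          (λ {p} {p′} _ _ i j → same-p {g} {p} {p′} i j))
        (λ {g} {g′} _ _ i j → same-g {g} {g′} i j))
      different)
      where
      same-c : ∀ {c c′ y} {D D′ : List (Code A)} → ∃[ d ] (d ∈ D × y ≡ bridge s c d) → ∃[ d ] (d ∈ D′ × y ≡ bridge s c′ d) → c ≡ c′
      same-c (_ , _ , refl) (_ , _ , refl) = refl
      bridge⁻ : ∀ {a b k y} → y ∈ bridgesAt f n s (a , b) k → ∃[ c ] ∃[ d ] (y ≡ bridge s c d × Ok k a c × word bar d ≡ b)
      bridge⁻ {a} {b} {k} i with concatMap-∈⁻ (λ c → map (bridge s c) (codes f (n ∸ k) b)) (codes f k a) i
      ... | c , i₁ , i₂ with ∈-map⁻ (bridge s c) i₂
      ...   | d , i₃ , e = c , d , e , codes-sound f k a i₁ , Ok.word≡ (codes-sound f (n ∸ k) b i₃)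
      same-k : ∀ {k k′ a b y} → y ∈ bridgesAt f n s (a , b) k → y ∈ bridgesAt f n s (a , b) k′ → k ≡ k′
      same-k i j with bridge⁻ i | bridge⁻ j
      ... | _ , _ , refl , ok _ _ refl , _ | _ , _ , refl , ok _ _ refl , _ = refl
      same-ab : ∀ {ab ab′ y} → y ∈ bridges f n s ab → y ∈ bridges f n s ab′ → ab ≡ ab′
      same-ab {ab} {ab′} i j with concatMap-∈⁻ (bridgesAt f n s ab) (downFrom (suc n)) i | concatMap-∈⁻ (bridgesAt f n s ab′) (downFrom (suc n)) j
      ... | k , _ , i′ | k′ , _ , j′ with bridge⁻ i′ | bridge⁻ j′
      ...   | _ , _ , refl , ok _ refl _ , refl | _ , _ , refl , ok _ refl _ , refl = refl
      face⁻ : ∀ {g y} → y ∈ facesAt f n s v g → ∃[ p ] ∃[ c ] (y ≡ face s (length p) c × p ∈ cand s g × word bar c ≡ p ++ v)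
      face⁻ {g} i with concatMap-∈⁻ (λ p → map (face s (length p)) (codes f (n ∸ suc g) (p ++ v))) (cand s g) i
      ... | p , i₁ , i₂ with ∈-map⁻ (face s (length p)) i₂
      ...   | c , i₃ , e = p , c , e , i₁ , Ok.word≡ (codes-sound f (n ∸ suc g) (p ++ v) i₃)
      prefix-unique : ∀ (p p′ : List A) {x y} → length p ≡ length p′ → p ++ x ≡ p′ ++ y → p ≡ p′
      prefix-unique []      []       l e = refl
      prefix-unique (_ ∷ p) (_ ∷ p′) l e with ∷-injective e
      ... | refl , e′ = cong (_ ∷_) (prefix-unique p p′ (ℕₚ.suc-injective l) e′)
      face-inj : ∀ {k k′} {c c′ : Code A} → face s k c ≡ face s k′ c′ → k ≡ k′ × c ≡ c′
      face-inj refl = refl , refl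
      same-p : ∀ {g p p′ y} → y ∈ map (face s (length p)) (codes f (n ∸ suc g) (p ++ v)) → y ∈ map (face s (length p′)) (codes f (n ∸ suc g) (p′ ++ v)) → p ≡ p′
      same-p {g} {p} {p′} i j with ∈-map⁻ (face s (length p)) i | ∈-map⁻ (face s (length p′)) j
      ... | c , i₁ , refl | c′ , j₁ , e with face-inj {c = c} {c′} e
      ...   | l , refl = prefix-unique p p′ l (trans (sym (Ok.word≡ (codes-sound f _ _ i₁))) (Ok.word≡ (codes-sound f _ _ j₁)))
      same-g : ∀ {g g′ y} → y ∈ facesAt f n s v g → y ∈ facesAt f n s v g′ → g ≡ g′
      same-g i j with face⁻ i | face⁻ j
      ... | p , c , refl , i₁ , w₁ | p′ , c′ , e , j₁ , w₂ with face-inj {c = c} {c′} e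
      ...   | l , refl with prefix-unique p p′ l (trans (sym w₁) w₂)
      ...     | refl = ℕₚ.suc-injective (trans (sym (proj₂ (cand-sound i₁))) (proj₂ (cand-sound j₁)))
      different : ∀ {y} → y ∈ concatMap (bridges f n s) (splits (bar s) v) × y ∈ concatMap (facesAt f n s v) (downFrom n) → ⊥
      different (i , j) with concatMap-∈⁻ (bridges f n s) (splits (bar s) v) i | concatMap-∈⁻ (facesAt f n s v) (downFrom n) j
      ... | ab , _ , i₁ | g , _ , j₁ with concatMap-∈⁻ (bridgesAt f n s ab) (downFrom (suc n)) i₁ | face⁻ j₁
      ...   | k , _ , i₂ | _ , _ , refl , _ with bridge⁻ i₂
      ...     | _ , _ , () , _

    -- Sealed, so that counts remain symbolic; what is known about the list is that it is sound,
    -- complete and without repetitions.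
    abstract
      codesOf : ℕ → List A → List (Code A)
      codesOf n w = codes (suc (measure n w)) n w

      codesOf-sound : ∀ n w {c} → c ∈ codesOf n w → Ok n w c
      codesOf-sound n w = codes-sound (suc (measure n w)) n w

      codesOf-complete : ∀ n w {c} → Ok n w c → c ∈ codesOf n w
      codesOf-complete n w = codes-complete (suc (measure n w)) _ n w ℕₚ.≤-refl

      codesOf-Unique : ∀ n w → Unique (codesOf n w)
      codesOf-Unique n w = codes-Unique (suc (measure n w)) n w

    cnt : ℕ → List A → ℕ
    cnt n w = length (codesOf n w)

    cnt-fuel : ∀ f n w → measure n w < f → length (codes f n w) ≡ cnt n w
    cnt-fuel f n w lt = Unique-same-length (codes f n w) (codesOf n w) (codes-Unique f n w) (codesOf-Unique n w)
      (λ i → codesOf-complete n w (codes-sound f n w i))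
      (λ i → codes-complete f _ n w lt (codesOf-sound n w i))

    bridgeSum : ℕ → List A × List A → ℕ
    bridgeSum n (a , b) = sumOver (downFrom (suc n)) λ k → cnt k a * cnt (n ∸ k) b

    cnt-[] : cnt 0 [] ≡ 1
    cnt-[] = sym (cnt-fuel 1 0 [] (s≤s z≤n))

    cnt-suc-[] : ∀ n → cnt (suc n) [] ≡ 0
    cnt-suc-[] n = sym (cnt-fuel (suc (measure (suc n) [])) (suc n) [] ℕₚ.≤-refl)

    cnt-∷ : ∀ n s v → cnt n (s ∷ v) ≡ sumOver (splits (bar s) v) (bridgeSum n)
      + sumOver (downFrom n) (λ g → sumOver (cand s g) (λ p → cnt (n ∸ suc g) (p ++ v)))
    cnt-∷ n s v = trans (sym (cnt-fuel (suc f) n (s ∷ v) ℕₚ.≤-refl)) (trans (cong length (codes-∷ f n s v)) (trans (length-++ (concatMap (bridges f n s) (splits (bar s) v)))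
      (cong₂ _+_ (trans (length-concatMap (bridges f n s) (splits (bar s) v)) (sumOver-cong (splits (bar s) v) λ {ab} → at-split ab))
                 (trans (length-concatMap (facesAt f n s v) (downFrom n)) (sumOver-cong (downFrom n) λ {g} → at-face g)))))
      where
      f = measure n (s ∷ v)
      at-split : ∀ ab → ab ∈ splits (bar s) v → length (bridges f n s ab) ≡ bridgeSum n ab
      at-split (a , b) i = trans (length-concatMap (bridgesAt f n s (a , b)) (downFrom (suc n))) (sumOver-cong (downFrom (suc n)) λ {k} j →
        trans (length-concatMap (λ c → map (bridge s c) (codes f (n ∸ k) b)) (codes f k a))
          (trans (sumOver-cong (codes f k a) λ {c} _ → trans (length-map (bridge s c) (codes f (n ∸ k) b))
                    (cnt-fuel f (n ∸ k) b (measureʳ f n s v (n ∸ k) ℕₚ.≤-refl i (ℕₚ.m∸n≤m n k))))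
            (trans (sumOver-const (codes f k a) (cnt (n ∸ k) b))
              (cong (_* cnt (n ∸ k) b) (cnt-fuel f k a (measureˡ f n s v k ℕₚ.≤-refl i (ℕₚ.≤-pred (∈-downFrom⁻ j))))))))
      at-face : ∀ g → g ∈ downFrom n → length (facesAt f n s v g) ≡ sumOver (cand s g) (λ p → cnt (n ∸ suc g) (p ++ v))
      at-face g j = trans (length-concatMap (λ p → map (face s (length p)) (codes f (n ∸ suc g) (p ++ v))) (cand s g))
        (sumOver-cong (cand s g) λ {p} i → trans (length-map (face s (length p)) (codes f (n ∸ suc g) (p ++ v)))
          (cnt-fuel f (n ∸ suc g) (p ++ v) (measureᶠ f n s v g p ℕₚ.≤-refl i (∈-downFrom⁻ j))))

    -- The root moves to the next dart of the same root face, so the inner faces stay what they are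
    -- and the boundary word is rotated.
    reroot : ∀ {k} → Coloured A bar k → Coloured A bar k
    reroot P = record
      { σ = σ ; σ⁻ = σ⁻ ; φ = φ ; φ⁻ = φ⁻ ; α = α ; σσ⁻ = σσ⁻ ; σ⁻σ = σ⁻σ ; φφ⁻ = φφ⁻ ; φ⁻φ = φ⁻φ ; αα = αα ; αfpf = αfpf ; σα = σα
      ; root = φ root ; rest = proj₁ f′ ; rootFace = proj₁ (proj₂ f′)
      ; gen = λ T t Tφ Tα → gen T (back T Tφ t rest rootFace) Tφ Tα
      ; planar = planar ; lt = lt ; ltα = ltα }
      where
      open Coloured P
      f′ = face-φ rootFace
      back : (T : Fin _ → Set) → (∀ {x} → T x → T (φ x)) → T (φ root) → ∀ p → IsFace φ root p → T root
      back T Tφ t []      (e , _)       = subst T e t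
      back T Tφ t (z ∷ p) ((e , s) , _) = seg-∈ T Tφ z p s (here refl) (subst T e t)

    reroot-inner : ∀ {k} (P : Coloured A bar k) → Coloured.InnerFaces P S → Coloured.InnerFaces (reroot P) S
    reroot-inner P h ni = h (λ i → ni (proj₁ (proj₂ (proj₂ (face-φ (Coloured.rootFace P)))) i))

    reroot-word : ∀ {k} (P : Coloured A bar k) {s v} → Coloured.rootWord P ≡ s ∷ v → Coloured.rootWord (reroot P) ≡ v ++ [ s ]
    reroot-word P e = go (Coloured.rest P) (Coloured.rootFace P) e
      where
      open Coloured P
      go : ∀ p (f : IsFace φ root p) {s v} → map lt (root ∷ p) ≡ s ∷ v → map lt (φ root ∷ proj₁ (face-φ f)) ≡ v ++ [ s ]
      go []      (e , _)       refl = cong (λ z → lt z ∷ []) e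
      go (z ∷ p) ((e , _) , _) refl = cong₂ _∷_ (cong lt e) (map-++ lt p [ root ])

    reroot-Iso : ∀ {k} (P Q : Coloured A bar k) → ColouredIso (reroot P) (reroot Q) → ColouredIso P Q
    reroot-Iso P Q i = record { π = π ; π⁻ = π⁻ ; ππ⁻ = ππ⁻ ; π⁻π = π⁻π ; πφ = πφ ; πα = πα ; πlt = πlt
                              ; πr = Coloured.φ-inj Q (trans (sym (πφ (Coloured.root P))) πr) }
      where open Iso i

    -- The number of edges of a patch with boundary w and weight n, by `size-weight`.
    rank : ℕ → List A → ℕ
    rank n w = ups w + suc m * n

    Ok-size : ∀ {n w c} → Ok n w c → size c ≡ rank n w
    Ok-size (ok g refl refl) = size-weight _ g

    Ok-encode : ∀ {n w} (P : Coloured A bar (rank n w)) → Coloured.InnerFaces P S → Coloured.rootWord P ≡ w →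
      ∃[ c ] (Ok n w c × Coloured.HasCode P c)
    Ok-encode {n} {w} P h e with Coloured.encode P
    ... | c , r , sz = c , ok g w≡ (ℕₚ.*-cancelˡ-≡ (weight c) n (suc m) (ℕₚ.+-cancelˡ-≡ (ups w) _ _ (trans (cong (λ z → ups z + suc m * weight c) (sym w≡)) (trans (sym (size-weight c g)) sz)))) , r
      where
      g : Good bar S c
      g = Run-Good S (Coloured.ltα P) h r
      w≡ : word bar c ≡ w
      w≡ = trans (sym (Run-word (Coloured.ltα P) r)) e

    record Rotates (k : ℕ) (c d : Code A) : Set₁ where
      constructor rotates
      field
        map′ : Coloured A bar k
        size≡ : size d ≡ k
        before : Coloured.HasCode map′ c
        after  : Coloured.HasCode (reroot map′) d

    Rotates-inj : ∀ {k c c′ d} → Rotates k c d → Rotates k c′ d → c ≡ c′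
    Rotates-inj (rotates P sz b a) (rotates Q _ b′ a′) = Iso-code P Q (reroot-Iso P Q (code-Iso (reroot P) (reroot Q) a a′ sz)) b b′

    rank-rotate : ∀ n s v → rank n (s ∷ v) ≡ rank n (v ++ [ s ])
    rank-rotate n s v = cong (_+ suc m * n) (trans (ℕₚ.+-comm (up s) (ups v)) (trans (cong (ups v +_) (sym (ℕₚ.+-identityʳ (up s)))) (sym (ups-++ v [ s ]))))

    Ok-rotate : ∀ {n s v c} → Ok n (s ∷ v) c → ∃[ d ] (Ok n (v ++ [ s ]) d × Rotates (rank n (v ++ [ s ])) c d)
    Ok-rotate {n} {s} {v} {c} o@(ok g w≡ _) = let d , od , r = Ok-encode (reroot P) (reroot-inner P faces) (reroot-word P wP) in
        d , od , rotates P (Ok-size od) code r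
      where
      open Realise {bar = bar} bar-bar S S-rot
      k = rank n (v ++ [ s ])
      module R = Realisation c (trans (Ok-size o) (rank-rotate n s v)) g w≡
      P : Coloured A bar k
      P = R.realise
      code : Coloured.HasCode P c
      code = R.realise-code
      faces : Coloured.InnerFaces P S
      faces = R.realise-faces
      wP : Coloured.rootWord P ≡ s ∷ v
      wP = trans (Run-word (Coloured.ltα P) code) w≡

    -- The recursion gives no access to this, as it only peels the first letter. Instead a code is
    -- realised as a map, the map is rerooted, and the result is encoded; isomorphism of the
    -- rerooted maps undoes the move. Equality comes later, by rotating the rest of the way round.
    cnt-rotate-≤ : ∀ n s v → cnt n (s ∷ v) ≤ cnt n (v ++ [ s ])
    cnt-rotate-≤ n s v = Unique-inject (Rotates (rank n (v ++ [ s ]))) (codesOf n (s ∷ v)) (codesOf n (v ++ [ s ]))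
      (codesOf-Unique n (s ∷ v))
      (λ i → let d , od , r = Ok-rotate (codesOf-sound n (s ∷ v) i) in d , codesOf-complete n (v ++ [ s ]) od , r)
      Rotates-inj

    cnt-swap-≤ : ∀ n a b → cnt n (a ++ b) ≤ cnt n (b ++ a)
    cnt-swap-≤ n []      b = ℕₚ.≤-reflexive (cong (cnt n) (sym (++-identityʳ b)))
    cnt-swap-≤ n (s ∷ a) b = ℕₚ.≤-trans (cnt-rotate-≤ n s (a ++ b))
      (ℕₚ.≤-trans (ℕₚ.≤-reflexive (cong (cnt n) (++-assoc a b [ s ])))
        (ℕₚ.≤-trans (cnt-swap-≤ n a (b ++ [ s ])) (ℕₚ.≤-reflexive (cong (cnt n) (++-assoc b [ s ] a)))))

    cnt-swap : ∀ n a b → cnt n (a ++ b) ≡ cnt n (b ++ a)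
    cnt-swap n a b = ℕₚ.≤-antisym (cnt-swap-≤ n a b) (cnt-swap-≤ n b a)

  module Unbalanced {A : Set} (Kl : FaceClass A)
    (S-ups : ∀ w → FaceClass.S Kl w → sum (map (FaceClass.up Kl) w) ≡ sum (map (λ s → FaceClass.up Kl (FaceClass.bar Kl s)) w)) where
    open FaceClass Kl
    open Count Kl

    dns : List A → ℕ
    dns w = sum (map (λ s → up (bar s)) w)

    dns-++ : ∀ a b → dns (a ++ b) ≡ dns a + dns b
    dns-++ a b = trans (cong sum (map-++ (λ s → up (bar s)) a b)) (sum-++ (map (λ s → up (bar s)) a) _)

    code-balanced : ∀ c → Good bar S c → ups (word bar c) ≡ dns (word bar c)
    code-balanced atom g = refl
    code-balanced (bridge s c e) (g , h) = trans (cong (up s +_) (ups-++ (word bar c) _)) (trans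
      (cong₂ (λ x y → up s + (x + (up (bar s) + y))) (code-balanced c g) (code-balanced e h)) (trans (lem (up s) (up (bar s)) (dns (word bar c)) (dns (word bar e)))
        (trans (cong (λ z → up (bar s) + (dns (word bar c) + (up z + dns (word bar e)))) (sym (bar-bar s))) (cong (up (bar s) +_) (sym (dns-++ (word bar c) _))))))
      where
      lem : ∀ a b x y → a + (x + (b + y)) ≡ b + (x + (a + y))
      lem = solve-∀
    code-balanced (face s k c) (le , sg , g) = ℕₚ.+-cancelˡ-≡ (up (bar s) + ups t) _ _
        (trans (lem (up (bar s)) (ups t) (up s) (ups v)) (trans (cong (λ z → up s + (up (bar s) + z)) (trans (sym (ups-++ t v)) (trans (cong ups (take++drop≡id k (word bar c)))
          (trans (code-balanced c g) (trans (cong dns (sym (take++drop≡id k (word bar c)))) (dns-++ t v))))))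
          (trans (lem′ (up s) (up (bar s)) (dns t) (dns v)) (cong (_+ (up (bar s) + dns v)) (trans (cong (λ z → up z + dns t) (sym (bar-bar s))) (sym (S-ups _ sg)))))))
      where
      t = take k (word bar c)
      v = drop k (word bar c)
      lem : ∀ b t a v → (b + t) + (a + v) ≡ a + (b + (t + v))
      lem = solve-∀
      lem′ : ∀ a b t v → a + (b + (t + v)) ≡ (a + t) + (b + v)
      lem′ = solve-∀

    cnt-unbalanced : ∀ n w → ups w ≢ dns w → cnt n w ≡ 0
    cnt-unbalanced n w ne = empty (codesOf n w) (λ i → let o = codesOf-sound n w i in
        ne (subst (λ z → ups z ≡ dns z) (Ok.word≡ o) (code-balanced _ (Ok.good o))))
      where
      empty : (l : List (Code A)) → (∀ {c} → c ∈ l → ⊥) → length l ≡ 0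
      empty []      h = refl
      empty (c ∷ l) h = ⊥-elim (h (here refl))

-- From codes to numbers of isomorphism classes.

module Rooted where

  open import Defs using (NumClasses)
  open FiniteLists
  open Peeling
  open Building using (word; Good)
  open PlanarMaps
  open Counting
  open import Data.Nat using (_≤_; ℕ; zero; suc; _+_; _*_; _∸_; _<_)
  import Data.Nat.Properties as ℕₚ
  open import Data.Fin as Fin using (Fin)
  import Data.Fin.Properties as Finₚ
  open import Data.Integer as ℤ using (ℤ; 0ℤ)
  open import Data.List using (List; []; _∷_; length; map; concatMap; downFrom; lookup)
  open import Data.List.Properties using (∷-injective)
  open import Data.List.Membership.Propositional using (_∈_)
  open import Data.List.Membership.Propositional.Properties using (∈-lookup; ∈-downFrom⁺; ∈-downFrom⁻)
  open import Data.List.Membership.DecPropositional using (_∈?_)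
  open import Data.List.Relation.Unary.Any using (index)
  open import Data.List.Relation.Unary.Any.Properties using (lookup-index)
  open import Data.List.Relation.Unary.Unique.Propositional using (Unique)
  import Data.List.Relation.Unary.Unique.Propositional.Properties as Uniqueₚ
  open import Data.Product using (_×_; _,_; ∃-syntax; proj₁; proj₂)
  open import Data.Empty using (⊥-elim)
  open import Relation.Nullary using (yes; no)
  open import Relation.Binary.PropositionalEquality

  lookup-injective : {X : Set} (xs : List X) → Unique xs → ∀ i j → lookup xs i ≡ lookup xs j → i ≡ j
  lookup-injective (x ∷ xs) u Fin.zero    Fin.zero    e = refl
  lookup-injective (x ∷ xs) u Fin.zero    (Fin.suc j) e = ⊥-elim (Unique-head u (subst (_∈ xs) (sym e) (∈-lookup j)))
  lookup-injective (x ∷ xs) u (Fin.suc i) Fin.zero    e = ⊥-elim (Unique-head u (subst (_∈ xs) e (∈-lookup i)))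
  lookup-injective (x ∷ xs) u (Fin.suc i) (Fin.suc j) e = cong Fin.suc (lookup-injective xs (Unique-tail u) i j e)

  -- `HC x c` reads: x has code c. The realised codes are a system of representatives, since sharing
  -- a code and being isomorphic amount to the same.
  numClasses : {X C : Set} (R : X → X → Set) (HC : X → C → Set) (cs : List C) → Unique cs →
    (∀ {c} → c ∈ cs → ∃[ x ] HC x c) → (∀ x → ∃[ c ] (c ∈ cs × HC x c)) →
    (∀ {x y c} → c ∈ cs → HC x c → HC y c → R x y) → (∀ {x y c d} → R x y → HC x c → HC y d → c ≡ d) →
    NumClasses X R (length cs)
  numClasses R HC cs u real enc iso inv = (λ i → proj₁ (real (∈-lookup {xs = cs} i))) , onto ,
    λ i j r → lookup-injective cs u i j (inv r (proj₂ (real (∈-lookup i))) (proj₂ (real (∈-lookup j))))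
    where
    onto : ∀ x → ∃[ i ] R (proj₁ (real (∈-lookup {xs = cs} i))) x
    onto x with enc x
    ... | c , c∈ , h = index c∈ , iso (∈-lookup (index c∈)) (proj₂ (real (∈-lookup (index c∈)))) (subst (HC x) (lookup-index c∈) h)

  module Root {A : Set} (K : FaceClass A) (s : A) where
    open FaceClass K
    open Count K

    AllFaces : ∀ {N} → Coloured A bar N → Set
    AllFaces P = ∀ {x p} → IsFace (Coloured.φ P) x p → S (map (Coloured.lt P) (x ∷ p))

    rootWords : ℕ → ℕ → List (Code A)
    rootWords n g = concatMap (λ p → codesOf (n ∸ suc g) (bar s ∷ p)) (cand s g)

    -- The codes of the maps without exceptional face whose root has letter bar s.
    rootCodes : ℕ → List (Code A)
    rootCodes n = concatMap (rootWords n) (downFrom n)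

    rootCodes-length : ∀ n → length (rootCodes n) ≡ sumOver (downFrom n) (λ g → sumOver (cand s g) (λ p → cnt (n ∸ suc g) (bar s ∷ p)))
    rootCodes-length n = trans (length-concatMap (rootWords n) (downFrom n))
      (sumOver-cong (downFrom n) λ {g} _ → length-concatMap (λ p → codesOf (n ∸ suc g) (bar s ∷ p)) (cand s g))

    rootCodes-∈ : ∀ n {c} → c ∈ rootCodes n → ∃[ g ] ∃[ p ] (g < n × p ∈ cand s g × Ok (n ∸ suc g) (bar s ∷ p) c)
    rootCodes-∈ n i with concatMap-∈⁻ (rootWords n) (downFrom n) i
    ... | g , g∈ , j with concatMap-∈⁻ (λ p → codesOf (n ∸ suc g) (bar s ∷ p)) (cand s g) j
    ...   | p , p∈ , k = g , p , ∈-downFrom⁻ g∈ , p∈ , codesOf-sound (n ∸ suc g) (bar s ∷ p) k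

    rootCodes-Unique : ∀ n → Unique (rootCodes n)
    rootCodes-Unique n = concatMap-Unique (rootWords n) (downFrom n) (Uniqueₚ.downFrom⁺ n)
      (λ g _ → concatMap-Unique (λ p → codesOf (n ∸ suc g) (bar s ∷ p)) (cand s g) (cand-Unique s g)
        (λ p _ → codesOf-Unique (n ∸ suc g) (bar s ∷ p))
        (λ {p} {p′} _ _ i j → proj₂ (∷-injective (trans (sym (Ok.word≡ (codesOf-sound _ (bar s ∷ p) i))) (Ok.word≡ (codesOf-sound _ (bar s ∷ p′) j))))))
      (λ {g} {g′} _ _ i j → same g g′ i j)
      where
      same : ∀ g g′ {c} → c ∈ rootWords n g → c ∈ rootWords n g′ → g ≡ g′
      same g g′ i j with concatMap-∈⁻ (λ p → codesOf (n ∸ suc g) (bar s ∷ p)) (cand s g) i | concatMap-∈⁻ (λ p → codesOf (n ∸ suc g′) (bar s ∷ p)) (cand s g′) j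
      ... | p , p∈ , k | p′ , p′∈ , k′ with trans (sym (Ok.word≡ (codesOf-sound _ (bar s ∷ p) k))) (Ok.word≡ (codesOf-sound _ (bar s ∷ p′) k′))
      ...   | refl = ℕₚ.suc-injective (trans (sym (proj₂ (cand-sound p∈))) (proj₂ (cand-sound p′∈)))

    root-rank : ∀ n {g p} → g < n → p ∈ cand s g → rank (n ∸ suc g) (bar s ∷ p) ≡ suc m * n
    root-rank n {g} {p} g<n p∈ = trans (cong (_+ suc m * (n ∸ suc g)) (trans (S-up _ (proj₁ (cand-sound p∈))) (cong (suc m *_) (proj₂ (cand-sound p∈)))))
      (trans (sym (ℕₚ.*-distribˡ-+ (suc m) (suc g) (n ∸ suc g))) (cong (suc m *_) (ℕₚ.m+[n∸m]≡n g<n)))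

    rootCodes-size : ∀ n {c} → c ∈ rootCodes n → size c ≡ suc m * n
    rootCodes-size n i with rootCodes-∈ n i
    ... | g , p , g<n , p∈ , o = trans (Ok-size o) (root-rank n g<n p∈)

    -- An ordinary face is turned into the boundary by removing its weight 1 + g from the total.
    -- That g is less than n follows by comparing the number of edges computed in two ways.
    encodeRoot : ∀ {N} n (P : Coloured A bar N) → N ≡ suc m * n → AllFaces P → Coloured.lt P (Coloured.root P) ≡ bar s →
      ∃[ c ] (c ∈ rootCodes n × Coloured.HasCode P c)
    encodeRoot {N} n P N≡ all lr with Coloured.encode P
    ... | c , r , sz with cand-complete (subst (λ z → S (z ∷ _)) lr (all (Coloured.rootFace P)))
    ...   | g , wg , p∈ = c , concatMap-∈⁺ (rootWords n) (∈-downFrom⁺ g<n) (concatMap-∈⁺ (λ p → codesOf (n ∸ suc g) (bar s ∷ p)) p∈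
              (codesOf-complete (n ∸ suc g) (bar s ∷ p) (ok good word≡ weight≡))) , r
      where
      p : List A
      p = map (Coloured.lt P) (Coloured.rest P)
      good : Good bar S c
      good = Run-Good S (Coloured.ltα P) (λ _ → all) r
      word≡ : word bar c ≡ bar s ∷ p
      word≡ = trans (sym (Run-word (Coloured.ltα P) r)) (cong (_∷ p) lr)
      sum≡ : suc g + weight c ≡ n
      sum≡ = ℕₚ.*-cancelˡ-≡ (suc g + weight c) n (suc m) (trans (ℕₚ.*-distribˡ-+ (suc m) (suc g) (weight c))
        (trans (cong (_+ suc m * weight c) (sym (trans (cong ups word≡) (trans (S-up _ (proj₁ (cand-sound p∈))) (cong (suc m *_) wg)))))
          (trans (sym (size-weight c good)) (trans sz N≡))))
      g<n : g < n
      g<n = subst (suc g ≤_) sum≡ (ℕₚ.m≤m+n (suc g) (weight c))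
      weight≡ : weight c ≡ n ∸ suc g
      weight≡ = trans (sym (ℕₚ.m+n∸m≡n (suc g) (weight c))) (cong (_∸ suc g) sum≡)

    all-faces : ∀ {N} (P : Coloured A bar N) → Coloured.InnerFaces P S → S (Coloured.rootWord P) → AllFaces P
    all-faces P inner Sr {x} f with _∈?_ Finₚ._≟_ x (Coloured.root P ∷ Coloured.rest P)
    ... | no ni = inner ni f
    ... | yes j = face-word (Coloured.lt P) S S-rot (Coloured.rootFace P) j f Sr

    NetZero : (val : A → ℤ) → (∀ s → val (bar s) ≡ ℤ.- val s) → Set
    NetZero val val-bar = ∀ w → S w → Building.Potential.net bar bar-bar val val-bar w ≡ 0ℤ

    record RootRealisation (N : ℕ) (c : Code A) : Set₁ where
      field
        map′    : Coloured A bar N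
        hasCode : Coloured.HasCode map′ c
        allFaces : AllFaces map′
        lt-root : Coloured.lt map′ (Coloured.root map′) ≡ bar s
        heights : (val : A → ℤ) (val-bar : ∀ s → val (bar s) ≡ ℤ.- val s) → NetZero val val-bar → Heights map′ val

    realiseRoot : ∀ {N} n → N ≡ suc m * n → ∀ {c} → c ∈ rootCodes n → RootRealisation N c
    realiseRoot {N} n N≡ {c} i with rootCodes-∈ n i
    ... | g , p , g<n , p∈ , ok good word≡ _ = record
      { map′ = R.realise ; hasCode = R.realise-code
      ; allFaces = all-faces R.realise R.realise-faces (subst S (sym w≡) (proj₁ (cand-sound p∈)))
      ; lt-root = proj₁ (∷-injective w≡) ; heights = R.realise-height }
      where
      module R = Realise.Realisation {bar = bar} bar-bar S S-rot c (trans (rootCodes-size n i) (sym N≡)) good word≡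
      w≡ : Coloured.rootWord R.realise ≡ bar s ∷ p
      w≡ = trans (Run-word (Coloured.ltα R.realise) R.realise-code) word≡

-- Colourful quadrangles and balanced faces.

module FaceClasses where

  open FiniteLists
  open Counting
  open import Data.Nat using (ℕ; zero; suc; _+_; _*_; _≤_; _<_)
  import Data.Nat.Properties as ℕₚ
  open import Data.Nat.Tactic.RingSolver using (solve-∀)
  open import Data.Nat.ListAction using (sum)
  open import Data.Nat.ListAction.Properties using (sum-++)
  open import Data.Bool as Bool using (Bool; true; false; not)
  import Data.Bool.Properties as Boolₚ
  open import Data.List using (List; []; _∷_; [_]; _++_; length; map)
  open import Data.List.Properties using (map-++; ∷-injective)
  open import Data.List.Membership.Propositional using (_∈_)
  open import Data.List.Membership.Propositional.Properties using (∈-++⁺ˡ; ∈-++⁺ʳ; ∈-++⁻; ∈-map⁺; ∈-map⁻)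
  open import Data.List.Relation.Unary.Any using (here; there)
  open import Data.List.Relation.Unary.AllPairs using ([]; _∷_)
  open import Data.List.Relation.Unary.All using ([]; _∷_)
  open import Data.List.Relation.Unary.Unique.Propositional using (Unique)
  import Data.List.Relation.Unary.Unique.Propositional.Properties as Uniqueₚ
  open import Data.Product using (_×_; _,_; ∃-syntax; proj₂)
  open import Data.Sum using (inj₁; inj₂)
  open import Data.Empty using (⊥)
  open import Relation.Binary.PropositionalEquality hiding ([_])

  -- true is a step up, false a step down.
  Word : Set
  Word = List Bool

  pattern U = true
  pattern D = false

  up down : Bool → ℕ
  up b   = Bool.if b then 1 else 0
  down b = Bool.if b then 0 else 1

  ups downs : Word → ℕ
  ups w   = sum (map up w)
  downs w = sum (map down w)

  up-not : ∀ s → up s + up (not s) ≡ 1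
  up-not true  = refl
  up-not false = refl

  downs-++ : ∀ a b → downs (a ++ b) ≡ downs a + downs b
  downs-++ a b = trans (cong sum (map-++ down a b)) (sum-++ (map down a) (map down b))

  ups-++ : ∀ a b → ups (a ++ b) ≡ ups a + ups b
  ups-++ a b = trans (cong sum (map-++ up a b)) (sum-++ (map up a) (map up b))

  ups+downs : ∀ w → ups w + downs w ≡ length w
  ups+downs []          = refl
  ups+downs (true ∷ w)  = cong suc (ups+downs w)
  ups+downs (false ∷ w) = trans (ℕₚ.+-suc (ups w) (downs w)) (cong suc (ups+downs w))

  data Quad : Word → Set where
    uudd : Quad (U ∷ U ∷ D ∷ D ∷ [])
    uddu : Quad (U ∷ D ∷ D ∷ U ∷ [])
    dduu : Quad (D ∷ D ∷ U ∷ U ∷ [])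
    duud : Quad (D ∷ U ∷ U ∷ D ∷ [])

  quadCand : Bool → ℕ → List Word
  quadCand U zero = (D ∷ U ∷ U ∷ []) ∷ (U ∷ U ∷ D ∷ []) ∷ []
  quadCand D zero = (U ∷ D ∷ D ∷ []) ∷ (D ∷ D ∷ U ∷ []) ∷ []
  quadCand s (suc g) = []

  quadClass : FaceClass Bool
  quadClass = record
    { _≟_ = Bool._≟_ ; bar = not ; bar-bar = Boolₚ.not-involutive
    ; S = Quad ; S-rot = λ { _ _ uudd → uddu ; _ _ uddu → dduu ; _ _ dduu → duud ; _ _ duud → uudd }
    ; wt = λ _ → 1 ; cand = quadCand
    ; cand-sound = λ {s} {g} → sound s g
    ; cand-complete = λ {s} → complete s
    ; cand-Unique = unique
    ; cand-length = λ {s} {g} → len s g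
    -- A quadrangle has two steps up, so n quadrangles account for 2n edges.
    ; up = up ; up-bar = up-not ; m = 1
    ; S-up = λ { _ uudd → refl ; _ uddu → refl ; _ dduu → refl ; _ duud → refl } }
    where
    sound : ∀ s g {p} → p ∈ quadCand s g → Quad (not s ∷ p) × 1 ≡ suc g
    sound U zero (here refl)         = dduu , refl
    sound U zero (there (here refl)) = duud , refl
    sound D zero (here refl)         = uudd , refl
    sound D zero (there (here refl)) = uddu , refl
    complete : ∀ s {p} → Quad (not s ∷ p) → ∃[ g ] (1 ≡ suc g × p ∈ quadCand s g)
    complete U dduu = 0 , refl , here refl
    complete U duud = 0 , refl , there (here refl)
    complete D uudd = 0 , refl , here refl
    complete D uddu = 0 , refl , there (here refl)
    unique : ∀ s g → Unique (quadCand s g)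
    unique U zero = ((λ ()) ∷ []) ∷ [] ∷ []
    unique D zero = ((λ ()) ∷ []) ∷ [] ∷ []
    unique U (suc g) = []
    unique D (suc g) = []
    len : ∀ s g {p} → p ∈ quadCand s g → length p < 4 * suc g
    len U zero (here refl)         = ℕₚ.≤-refl
    len U zero (there (here refl)) = ℕₚ.≤-refl
    len D zero (here refl)         = ℕₚ.≤-refl
    len D zero (there (here refl)) = ℕₚ.≤-refl

  paths : ℕ → ℕ → List Word
  paths zero    zero    = [] ∷ []
  paths (suc u) zero    = map (U ∷_) (paths u zero)
  paths zero    (suc d) = map (D ∷_) (paths zero d)
  paths (suc u) (suc d) = map (U ∷_) (paths u (suc d)) ++ map (D ∷_) (paths (suc u) d)

  paths-sound : ∀ u d {p} → p ∈ paths u d → ups p ≡ u × downs p ≡ d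
  paths-sound zero zero (here refl) = refl , refl
  paths-sound (suc u) zero i with ∈-map⁻ (U ∷_) i
  ... | p , j , refl with paths-sound u zero j
  ... | refl , e = refl , e
  paths-sound zero (suc d) i with ∈-map⁻ (D ∷_) i
  ... | p , j , refl with paths-sound zero d j
  ... | e , refl = e , refl
  paths-sound (suc u) (suc d) i with ∈-++⁻ (map (U ∷_) (paths u (suc d))) i
  ... | inj₁ i′ with ∈-map⁻ (U ∷_) i′
  ...   | p , j , refl with paths-sound u (suc d) j
  ...     | refl , e = refl , e
  paths-sound (suc u) (suc d) i | inj₂ i′ with ∈-map⁻ (D ∷_) i′
  ...   | p , j , refl with paths-sound (suc u) d j
  ...     | e , refl = e , refl

  paths-U : ∀ u d {p} → p ∈ paths u d → U ∷ p ∈ paths (suc u) d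
  paths-U u zero    i = ∈-map⁺ (U ∷_) i
  paths-U u (suc d) i = ∈-++⁺ˡ (∈-map⁺ (U ∷_) i)

  paths-D : ∀ u d {p} → p ∈ paths u d → D ∷ p ∈ paths u (suc d)
  paths-D zero    d i = ∈-map⁺ (D ∷_) i
  paths-D (suc u) d i = ∈-++⁺ʳ (map (U ∷_) (paths u (suc d))) (∈-map⁺ (D ∷_) i)

  paths-complete : ∀ p → p ∈ paths (ups p) (downs p)
  paths-complete []          = here refl
  paths-complete (true ∷ p)  = paths-U (ups p) (downs p) (paths-complete p)
  paths-complete (false ∷ p) = paths-D (ups p) (downs p) (paths-complete p)

  paths-Unique : ∀ u d → Unique (paths u d)
  paths-Unique zero    zero    = [] ∷ []
  paths-Unique (suc u) zero    = Uniqueₚ.map⁺ (λ e → proj₂ (∷-injective e)) (paths-Unique u zero)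
  paths-Unique zero    (suc d) = Uniqueₚ.map⁺ (λ e → proj₂ (∷-injective e)) (paths-Unique zero d)
  paths-Unique (suc u) (suc d) = Uniqueₚ.++⁺ (Uniqueₚ.map⁺ (λ e → proj₂ (∷-injective e)) (paths-Unique u (suc d)))
    (Uniqueₚ.map⁺ (λ e → proj₂ (∷-injective e)) (paths-Unique (suc u) d)) disj
    where
    disj : ∀ {p} → p ∈ map (U ∷_) (paths u (suc d)) × p ∈ map (D ∷_) (paths (suc u) d) → ⊥
    disj (i , j) with ∈-map⁻ (U ∷_) i | ∈-map⁻ (D ∷_) j
    ... | _ , _ , refl | _ , _ , ()

  balancedCand : Bool → ℕ → List Word
  balancedCand U g = paths (suc g) g
  balancedCand D g = paths g (suc g)

  Balanced : Word → Set
  Balanced w = ups w ≡ downs w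

  balancedClass : FaceClass Bool
  balancedClass = record
    { _≟_ = Bool._≟_ ; bar = not ; bar-bar = Boolₚ.not-involutive
    ; S = Balanced
    ; S-rot = λ s w e → trans (rot up s w) (trans e (sym (rot down s w)))
    ; wt = ups ; cand = balancedCand
    ; cand-sound = λ {s} {g} → sound s g
    ; cand-complete = λ {s} → complete s
    ; cand-Unique = unique
    ; cand-length = λ {s} {g} {p} → len s g p
    -- The weight of a face is its number of steps up, so the total weight is the number of edges.
    ; up = up ; up-bar = up-not ; m = 0
    ; S-up = λ w _ → sym (ℕₚ.*-identityˡ (ups w)) }
    where
    rot : (f : Bool → ℕ) → ∀ s w → sum (map f (w ++ [ s ])) ≡ sum (map f (s ∷ w))
    rot f s w = trans (cong sum (map-++ f w [ s ])) (trans (sum-++ (map f w) [ f s ])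
      (trans (cong (sum (map f w) +_) (ℕₚ.+-identityʳ (f s))) (ℕₚ.+-comm (sum (map f w)) (f s))))
    sound : ∀ s g {p} → p ∈ balancedCand s g → Balanced (not s ∷ p) × ups (not s ∷ p) ≡ suc g
    sound U g i with paths-sound (suc g) g i
    ... | e , e′ = trans e (cong suc (sym e′)) , e
    sound D g i with paths-sound g (suc g) i
    ... | e , e′ = trans (cong suc e) (sym e′) , cong suc e
    complete : ∀ s {p} → Balanced (not s ∷ p) → ∃[ g ] (ups (not s ∷ p) ≡ suc g × p ∈ balancedCand s g)
    complete U {p} e = downs p , e , subst (λ u → p ∈ paths u (downs p)) e (paths-complete p)
    complete D {p} e = ups p , refl , subst (λ d → p ∈ paths (ups p) d) (sym e) (paths-complete p)
    unique : ∀ s g → Unique (balancedCand s g)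
    unique U g = paths-Unique (suc g) g
    unique D g = paths-Unique g (suc g)
    lem : ∀ g → suc (suc g + g) ≤ 4 * suc g
    lem g = subst (suc (suc g + g) ≤_) (sym (eq g)) (ℕₚ.m≤m+n (suc (suc g + g)) (2 * g + 2))
      where
      eq : ∀ g → 4 * suc g ≡ suc (suc g + g) + (2 * g + 2)
      eq = solve-∀
    len : ∀ s g p → p ∈ balancedCand s g → length p < 4 * suc g
    len U g p i with paths-sound (suc g) g i
    ... | e , e′ = subst (_< 4 * suc g) (trans (sym (cong₂ _+_ e e′)) (ups+downs p)) (lem g)
    len D g p i with paths-sound g (suc g) i
    ... | e , e′ = subst (_< 4 * suc g) (trans (sym (cong₂ _+_ e e′)) (ups+downs p)) (subst (_< 4 * suc g) (sym (ℕₚ.+-suc g g)) (lem g))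

-- Colourful quadrangulations as maps with letters.

module MapTransfer where

  open import Defs
  open FiniteLists
  open Peeling
  open Decoding
  open Exploration using (findFace)
  open PlanarMaps
  open Counting
  open Rooted
  open FaceClasses
  open import Data.Nat using (ℕ; zero; suc; _+_; _*_)
  import Data.Nat.Properties as ℕₚ
  open import Data.Fin as Fin using (Fin)
  open import Data.Integer as ℤ using (ℤ; 0ℤ; ∣_∣)
  import Data.Integer.Properties as ℤₚ
  open import Data.Bool using (Bool; true; false; not)
  open import Data.List using ([]; _∷_; length; map)
  open import Data.List.Relation.Unary.Any using (here)
  open import Data.List.Relation.Unary.All using ([]; _∷_)
  open import Data.List.Relation.Unary.AllPairs using ([]; _∷_)
  open import Data.Product using (_×_; _,_; Σ; ∃-syntax; proj₁; proj₂)
  open import Data.Empty using (⊥; ⊥-elim)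
  open import Relation.Binary.PropositionalEquality hiding ([_])

  val : Bool → ℤ
  val true  = ℤ.+ 1
  val false = ℤ.-[1+ 0 ]

  val-not : ∀ s → val (not s) ≡ ℤ.- val s
  val-not true  = refl
  val-not false = refl

  val-injective : ∀ {s t} → val s ≡ val t → s ≡ t
  val-injective {true}  {true}  e = refl
  val-injective {false} {false} e = refl

  unit : ∀ d → ∣ d ∣ ≡ 1 → ∃[ s ] d ≡ val s
  unit (ℤ.+ .1)       refl = true , refl
  unit (ℤ.-[1+ .0 ])  refl = false , refl

  add-diff : ∀ a b → a ≡ b ℤ.+ (a ℤ.- b)
  add-diff a b = sym (trans (ℤₚ.+-comm b (a ℤ.- b)) (trans (ℤₚ.+-assoc a (ℤ.- b) b)
    (trans (cong (λ z → a ℤ.+ z) (ℤₚ.+-inverseˡ b)) (ℤₚ.+-identityʳ a))))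

  diff-add : ∀ b v → (b ℤ.+ v) ℤ.- b ≡ v
  diff-add b v = trans (cong (ℤ._- b) (ℤₚ.+-comm b v)) (trans (ℤₚ.+-assoc v b (ℤ.- b))
    (trans (cong (λ z → v ℤ.+ z) (ℤₚ.+-inverseʳ b)) (ℤₚ.+-identityʳ v)))

  shift≢ : ∀ z {v} → v ≢ 0ℤ → z ≢ z ℤ.+ v
  shift≢ z {v} n e = n (trans (sym (diff-add z v)) (trans (cong (ℤ._- z) (sym e)) (ℤₚ.+-inverseʳ z)))

  module MapLemmas {N : ℕ} (M : Map N) where
    open Map M

    σ-injective : ∀ {x y} → σ x ≡ σ y → x ≡ y
    σ-injective {x} {y} e = trans (sym (σ⁻σ x)) (trans (cong σ⁻ e) (σ⁻σ y))

    φ⁻ : Fin (2 * N) → Fin (2 * N)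
    φ⁻ x = α (σ⁻ x)

    φφ⁻ : ∀ x → φ (φ⁻ x) ≡ x
    φφ⁻ x = trans (cong σ (αα (σ⁻ x))) (σσ⁻ x)

    φ⁻φ : ∀ x → φ⁻ (φ x) ≡ x
    φ⁻φ x = trans (cong α (σ⁻σ (α x))) (αα x)

    φα : ∀ x → φ (α x) ≡ σ x
    φα x = cong σ (αα x)

    generated-φ : Generated φ α root
    generated-φ T t Tφ Tα x = go (conn x)
      where
      go : ∀ {x} → Reach σ α root x → T x
      go here = t
      go (stepσ {x} r) = subst T (φα x) (Tφ (Tα (go r)))
      go (stepα r) = Tα (go r)

    generated-σ : Generated σ α root
    generated-σ T t Tσ Tα x = go (conn x)
      where
      go : ∀ {x} → Reach σ α root x → T x
      go here = t
      go (stepσ r) = Tσ (go r)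
      go (stepα r) = Tα (go r)

  module FromMap {N : ℕ} (M : Map N) (lt : Fin (2 * N) → Bool) (ltα : ∀ x → lt (Map.α M x) ≡ not (lt x)) where
    open Map M
    open MapLemmas M

    primal : Coloured Bool not N
    primal = record
      { σ = σ ; σ⁻ = σ⁻ ; φ = φ ; φ⁻ = φ⁻ ; α = α ; σσ⁻ = σσ⁻ ; σ⁻σ = σ⁻σ ; φφ⁻ = φφ⁻ ; φ⁻φ = φ⁻φ
      ; αα = αα ; αfpf = αfpf ; σα = λ _ → refl ; root = root
      ; rest = proj₁ (findFace φ φ⁻ φφ⁻ root) ; rootFace = proj₂ (findFace φ φ⁻ φφ⁻ root)
      ; gen = generated-φ ; planar = euler ; lt = lt ; ltα = ltα }

    -- Exchanging σ and φ makes the vertices of an orientation into faces, so that in-degree equal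
    -- to out-degree becomes a condition on contours.
    dual : Coloured Bool not N
    dual = record
      { σ = φ ; σ⁻ = φ⁻ ; φ = σ ; φ⁻ = σ⁻ ; α = α ; σσ⁻ = φφ⁻ ; σ⁻σ = φ⁻φ ; φφ⁻ = σσ⁻ ; φ⁻φ = σ⁻σ
      ; αα = αα ; αfpf = αfpf ; σα = φα ; root = root
      ; rest = proj₁ (findFace σ σ⁻ σσ⁻ root) ; rootFace = proj₂ (findFace σ σ⁻ σσ⁻ root)
      ; gen = generated-σ ; planar = trans (ℕₚ.+-comm (numCycles φ) (numCycles σ)) euler ; lt = lt ; ltα = ltα }

  module ToMap {N : ℕ} (P : Coloured Bool not N) where
    open Coloured P

    φα′ : ∀ x → φ (α x) ≡ σ x
    φα′ x = trans (sym (σα (α x))) (cong σ (αα x))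

    primalMap : Map N
    primalMap = record
      { σ = σ ; σ⁻ = σ⁻ ; σσ⁻ = σσ⁻ ; σ⁻σ = σ⁻σ ; α = α ; αα = αα ; αfpf = αfpf ; root = root
      ; conn = gen (Reach σ α root) here (λ {x} r → subst (Reach σ α root) (σα x) (stepσ (stepα r))) stepα
      ; euler = trans (cong (numCycles σ +_) (numCycles-cong σα)) planar }

    dualMap : Map N
    dualMap = record
      { σ = φ ; σ⁻ = φ⁻ ; σσ⁻ = φφ⁻ ; σ⁻σ = φ⁻φ ; α = α ; αα = αα ; αfpf = αfpf ; root = root
      ; conn = gen (Reach φ α root) here stepσ stepα
      ; euler = trans (cong (numCycles φ +_) (numCycles-cong φα′)) (trans (ℕₚ.+-comm (numCycles φ) (numCycles σ)) planar) }

  Iso-HasCode : ∀ {N} (P Q : Coloured Bool not N) {c} → ColouredIso P Q → Coloured.HasCode P c → Coloured.HasCode Q c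
  Iso-HasCode P Q i h with Coloured.encode Q
  ... | d , h′ , _ with Iso-code P Q i h h′
  ... | refl = h′

  module QuadTransfer (n : ℕ) where

    module Q = Root quadClass false

    letters : (q : ColourfulQuad n) → Fin (2 * (2 * n)) → Bool
    letters q x = proj₁ (unit (ℓ (α x) ℤ.- ℓ x) (ℓadj x))
      where
      open Map (ColourfulQuad.map q)
      open Labelling (ColourfulQuad.lab q)

    module Letters (q : ColourfulQuad n) where
      open ColourfulQuad q renaming (map to M)
      open Map M
      open Labelling lab

      lt : Fin (2 * (2 * n)) → Bool
      lt = letters q

      ℓ-α : ∀ x → ℓ (α x) ≡ ℓ x ℤ.+ val (lt x)
      ℓ-α x = trans (add-diff (ℓ (α x)) (ℓ x)) (cong (λ z → ℓ x ℤ.+ z) (proj₂ (unit (ℓ (α x) ℤ.- ℓ x) (ℓadj x))))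

      ℓ-φ : ∀ x → ℓ (φ x) ≡ ℓ x ℤ.+ val (lt x)
      ℓ-φ x = trans (ℓσ (α x)) (ℓ-α x)

      lt-unique : ∀ x s → ℓ (α x) ≡ ℓ x ℤ.+ val s → lt x ≡ s
      lt-unique x s e = val-injective (trans (sym (diff-add (ℓ x) (val (lt x)))) (trans (cong (ℤ._- ℓ x) (trans (sym (ℓ-α x)) e)) (diff-add (ℓ x) (val s))))

      ltα : ∀ x → lt (α x) ≡ not (lt x)
      ltα x = lt-unique (α x) (not (lt x)) (trans (cong ℓ (αα x)) (sym (trans (cong₂ ℤ._+_ (ℓ-α x) (val-not (lt x)))
        (trans (ℤₚ.+-assoc (ℓ x) (val (lt x)) (ℤ.- val (lt x))) (trans (cong (λ z → ℓ x ℤ.+ z) (ℤₚ.+-inverseʳ (val (lt x)))) (ℤₚ.+-identityʳ (ℓ x)))))))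

      coloured : Coloured Bool not (2 * n)
      coloured = FromMap.primal M lt ltα

      lt-root : lt root ≡ true
      lt-root = lt-unique root true (trans ℓroot₁ (cong (λ z → z ℤ.+ ℤ.+ 1) (sym ℓroot₀)))

      φ-inj : ∀ {x y} → φ x ≡ φ y → x ≡ y
      φ-inj = Coloured.φ-inj coloured

      square : ∀ x → IsFace φ x (φ x ∷ φ (φ x) ∷ φ (φ (φ x)) ∷ [])
      square x = (refl , refl , refl , proj₁ (quad x)) ,
        (≢1 x ∷ ≢2 x ∷ ≢3 x ∷ []) ∷ (≢1 (φ x) ∷ ≢2 (φ x) ∷ []) ∷ (≢1 (φ (φ x)) ∷ []) ∷ [] ∷ []
        where
        ≢2 : ∀ x → x ≢ φ (φ x)
        ≢2 x e = proj₂ (quad x) (sym e)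
        ≢1 : ∀ x → x ≢ φ x
        ≢1 x e = ≢2 x (trans e (cong φ e))
        ≢3 : ∀ x → x ≢ φ (φ (φ x))
        ≢3 x e = ≢1 x (trans (sym (proj₁ (quad x))) (sym (cong φ e)))

      -- Six words of four unit steps close up; the two alternating ones, which visit two labels
      -- only, are excluded by the last hypothesis.
      classify : ∀ a b c d z → z ℤ.+ val a ℤ.+ val b ℤ.+ val c ℤ.+ val d ≡ z →
        (a ≡ not b → b ≡ not c → ⊥) → Quad (a ∷ b ∷ c ∷ d ∷ [])
      classify a b c d z sm = go a b c d (trans (sym (diff-add z _)) (trans (cong (ℤ._- z) (trans assoc sm)) (ℤₚ.+-inverseʳ z)))
        where
        assoc : z ℤ.+ (val a ℤ.+ (val b ℤ.+ (val c ℤ.+ val d))) ≡ z ℤ.+ val a ℤ.+ val b ℤ.+ val c ℤ.+ val d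
        assoc = sym (trans (ℤₚ.+-assoc (z ℤ.+ val a ℤ.+ val b) (val c) (val d)) (trans (ℤₚ.+-assoc (z ℤ.+ val a) (val b) _) (ℤₚ.+-assoc z (val a) _)))
        go : ∀ a b c d → val a ℤ.+ (val b ℤ.+ (val c ℤ.+ val d)) ≡ 0ℤ → (a ≡ not b → b ≡ not c → ⊥) → Quad (a ∷ b ∷ c ∷ d ∷ [])
        go true  true  false false e h = uudd
        go true  false false true  e h = uddu
        go false false true  true  e h = dduu
        go false true  true  false e h = duud
        go true  false true  false e h = ⊥-elim (h refl refl)
        go false true  false true  e h = ⊥-elim (h refl refl)
        go true  true  true  true  () h
        go true  true  true  false () h
        go true  true  false true  () h
        go true  false true  true  () h
        go false true  true  true  () h
        go false false false true  () h
        go false false true  false () h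
        go false true  false false () h
        go true  false false false () h
        go false false false false () h

      word-quad : ∀ x → Quad (lt x ∷ lt (φ x) ∷ lt (φ (φ x)) ∷ lt (φ (φ (φ x))) ∷ [])
      word-quad x = classify (lt x) (lt (φ x)) (lt (φ (φ x))) (lt (φ (φ (φ x)))) (ℓ x) sm alternating
        where
        l : Fin 4 → ℤ
        l i = ℓ (iter φ (Fin.toℕ i) x)
        sm : ℓ x ℤ.+ val (lt x) ℤ.+ val (lt (φ x)) ℤ.+ val (lt (φ (φ x))) ℤ.+ val (lt (φ (φ (φ x)))) ≡ ℓ x
        sm = trans (cong (λ z → z ℤ.+ val (lt (φ (φ (φ x))))) (trans (cong (λ z → z ℤ.+ val (lt (φ (φ x)))) (trans (cong (λ z → z ℤ.+ val (lt (φ x))) (sym (ℓ-φ x))) (sym (ℓ-φ (φ x))))) (sym (ℓ-φ (φ (φ x))))))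
          (trans (sym (ℓ-φ (φ (φ (φ x))))) (cong ℓ (proj₁ (quad x))))
        two-back : ∀ y → lt y ≡ not (lt (φ y)) → ℓ (φ (φ y)) ≡ ℓ y
        two-back y e = trans (ℓ-φ (φ y)) (trans (cong₂ ℤ._+_ (ℓ-φ y) refl) (trans (ℤₚ.+-assoc (ℓ y) _ _)
          (trans (cong (λ z → ℓ y ℤ.+ z) (trans (cong (λ s → val s ℤ.+ val (lt (φ y))) e) (trans (cong (ℤ._+ val (lt (φ y))) (val-not (lt (φ y)))) (ℤₚ.+-inverseˡ (val (lt (φ y))))))) (ℤₚ.+-identityʳ (ℓ y)))))
        -- Along alternating steps the label depends only on the parity of the position, and two of
        -- any three positions have the same parity.
        alternating : lt x ≡ not (lt (φ x)) → lt (φ x) ≡ not (lt (φ (φ x))) → ⊥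
        alternating r r′ with colourful x
        ... | i , j , k , i≢j , i≢k , j≢k = pigeon (par i) (par j) (par k) refl refl refl
          where
          par : Fin 4 → Bool
          par Fin.zero = true
          par (Fin.suc Fin.zero) = false
          par (Fin.suc (Fin.suc Fin.zero)) = true
          par (Fin.suc (Fin.suc (Fin.suc Fin.zero))) = false
          pick : Bool → ℤ
          pick true  = ℓ x
          pick false = ℓ (φ x)
          by-par : ∀ i → l i ≡ pick (par i)
          by-par Fin.zero = refl
          by-par (Fin.suc Fin.zero) = refl
          by-par (Fin.suc (Fin.suc Fin.zero)) = two-back x r
          by-par (Fin.suc (Fin.suc (Fin.suc Fin.zero))) = two-back (φ x) r′
          same : ∀ a b → par a ≡ par b → l a ≡ l b
          same a b e = trans (by-par a) (trans (cong pick e) (sym (by-par b)))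
          pigeon : ∀ a b c → par i ≡ a → par j ≡ b → par k ≡ c → ⊥
          pigeon true  true  c     p q r = i≢j (same i j (trans p (sym q)))
          pigeon false false c     p q r = i≢j (same i j (trans p (sym q)))
          pigeon true  false true  p q r = i≢k (same i k (trans p (sym r)))
          pigeon false true  false p q r = i≢k (same i k (trans p (sym r)))
          pigeon true  false false p q r = j≢k (same j k (trans q (sym r)))
          pigeon false true  true  p q r = j≢k (same j k (trans q (sym r)))

      allFaces : Q.AllFaces coloured
      allFaces {x} f with face-unique f (square x)
      ... | refl = word-quad x

    HasCode : ColourfulQuad n → Code Bool → Set
    HasCode q c = Coloured.HasCode (Letters.coloured q) c

    toIso : ∀ q q′ → CQIso q q′ → ColouredIso (Letters.coloured q) (Letters.coloured q′)
    toIso q q′ (I , Iℓ) = record { π = π ; π⁻ = π⁻ ; ππ⁻ = ππ⁻ ; π⁻π = π⁻π ; πα = πα ; πr = πroot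
      ; πφ = λ x → trans (πσ (Map.α M x)) (cong (Map.σ M′) (πα x))
      ; πlt = λ x → L′.lt-unique (π x) (L.lt x) (trans (cong ℓ′ (sym (πα x))) (trans (Iℓ (Map.α M x)) (trans (L.ℓ-α x) (cong (ℤ._+ val (L.lt x)) (sym (Iℓ x)))))) }
      where
      open MapIso I
      M  = ColourfulQuad.map q
      M′ = ColourfulQuad.map q′
      ℓ′ = Labelling.ℓ (ColourfulQuad.lab q′)
      module L  = Letters q
      module L′ = Letters q′

    fromIso : ∀ q q′ → ColouredIso (Letters.coloured q) (Letters.coloured q′) → CQIso q q′
    fromIso q q′ i = record { π = π ; π⁻ = π⁻ ; ππ⁻ = ππ⁻ ; π⁻π = π⁻π ; πα = πα ; πroot = πr
        ; πσ = λ x → trans (cong π (sym (MapLemmas.φα M x))) (trans (πφ (Map.α M x)) (trans (cong (Map.φ M′) (πα x)) (MapLemmas.φα M′ (π x)))) } ,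
      -- The letters determine the labels: both labellings are 0 at the root and change by the same
      -- amounts along φ and α.
      MapLemmas.generated-φ M (λ x → ℓ′ (π x) ≡ ℓ x)
        (trans (cong ℓ′ πr) (trans (Labelling.ℓroot₀ (ColourfulQuad.lab q′)) (sym (Labelling.ℓroot₀ (ColourfulQuad.lab q)))))
        (λ {x} e → trans (cong ℓ′ (πφ x)) (trans (L′.ℓ-φ (π x)) (trans (cong₂ ℤ._+_ e (cong val (πlt x))) (sym (L.ℓ-φ x)))))
        (λ {x} e → trans (cong ℓ′ (πα x)) (trans (L′.ℓ-α (π x)) (trans (cong₂ ℤ._+_ e (cong val (πlt x))) (sym (L.ℓ-α x)))))
      where
      open Iso i
      M  = ColourfulQuad.map q
      M′ = ColourfulQuad.map q′
      ℓ  = Labelling.ℓ (ColourfulQuad.lab q)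
      ℓ′ = Labelling.ℓ (ColourfulQuad.lab q′)
      module L  = Letters q
      module L′ = Letters q′

    module Build (P : Coloured Bool not (2 * n)) (all : Q.AllFaces P) (lr : Coloured.lt P (Coloured.root P) ≡ true) (H : Heights P val) where
      open Coloured P
      open Heights H

      private
        M : Map (2 * n)
        M = ToMap.primalMap P
        ψ : Fin (2 * (2 * n)) → Fin (2 * (2 * n))
        ψ = Map.φ M

      h-ψ : ∀ x → h (ψ x) ≡ h x ℤ.+ val (lt x)
      h-ψ x = trans (hσ (α x)) (hα x)

      labelling : Labelling M
      labelling = record
        { ℓ = h ; ℓσ = hσ ; ℓroot₀ = hroot
        ; ℓadj = λ x → trans (cong ∣_∣ (trans (cong (ℤ._- h x) (hα x)) (diff-add (h x) (val (lt x))))) (abs (lt x))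
        ; ℓroot₁ = trans (hα root) (cong₂ ℤ._+_ hroot (cong val lr)) }
        where
        abs : ∀ s → ∣ val s ∣ ≡ 1
        abs true  = refl
        abs false = refl

      word-at : ∀ x → ∃[ a ] ∃[ b ] ∃[ c ] (IsFace φ x (a ∷ b ∷ c ∷ []) × Quad (lt x ∷ lt a ∷ lt b ∷ lt c ∷ []))
      word-at x with findFace φ φ⁻ φφ⁻ x
      ... | p , f = four p f (all f)
        where
        four : ∀ p → IsFace φ x p → Quad (map lt (x ∷ p)) → ∃[ a ] ∃[ b ] ∃[ c ] (IsFace φ x (a ∷ b ∷ c ∷ []) × Quad (lt x ∷ lt a ∷ lt b ∷ lt c ∷ []))
        four (a ∷ b ∷ c ∷ []) f q = a , b , c , f , q

      nonzero₁ : ∀ s → val s ≢ 0ℤ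
      nonzero₁ true  ()
      nonzero₁ false ()
      nonzero₂ : ∀ s → val s ℤ.+ val s ≢ 0ℤ
      nonzero₂ true  ()
      nonzero₂ false ()

      -- Two equal steps in a row visit three labels, and every word of `Quad` has such a pair among
      -- its first three letters.
      two-steps : ∀ y → lt y ≡ lt (ψ y) → h y ≢ h (ψ y) × h y ≢ h (ψ (ψ y)) × h (ψ y) ≢ h (ψ (ψ y))
      two-steps y e = (λ p → shift≢ (h y) (nonzero₁ (lt y)) (trans p (h-ψ y))) ,
        (λ p → shift≢ (h y) (nonzero₂ (lt y)) (trans p (trans (h-ψ (ψ y)) (trans (cong₂ ℤ._+_ (h-ψ y) (cong val (sym e))) (ℤₚ.+-assoc (h y) _ _))))) ,
        (λ p → shift≢ (h (ψ y)) (nonzero₁ (lt (ψ y))) (trans p (h-ψ (ψ y))))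

      quadrangulation : ColourfulQuad n
      quadrangulation = record { map = M ; lab = labelling ; quad = quad ; colourful = colourful }
        where
        quad : ∀ x → (iter ψ 4 x ≡ x) × (iter ψ 2 x ≢ x)
        quad x with word-at x
        ... | a , b , c , ((ea , eb , ec , ed) , (x≢a ∷ x≢b ∷ _) ∷ _) , _ =
          trans (σα _) (trans (cong φ (trans (σα _) (trans (cong φ (trans (cong ψ (trans (σα x) ea)) (trans (σα a) eb))) ec))) ed) ,
          λ e → x≢b (sym (trans (sym (trans (cong ψ (trans (σα x) ea)) (trans (σα a) eb))) e))
        colourful : ∀ x → Σ (Fin 4) λ i → Σ (Fin 4) λ j → Σ (Fin 4) λ k →
          (h (iter ψ (Fin.toℕ i) x) ≢ h (iter ψ (Fin.toℕ j) x)) × (h (iter ψ (Fin.toℕ i) x) ≢ h (iter ψ (Fin.toℕ k) x)) × (h (iter ψ (Fin.toℕ j) x) ≢ h (iter ψ (Fin.toℕ k) x))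
        colourful x with word-at x
        ... | a , b , c , ((refl , refl , refl , _) , _) , q = go (lt x) (lt (φ x)) (lt (φ (φ x))) _ q refl refl refl
          where
          i₀ i₁ i₂ i₃ : Fin 4
          i₀ = Fin.zero
          i₁ = Fin.suc Fin.zero
          i₂ = Fin.suc (Fin.suc Fin.zero)
          i₃ = Fin.suc (Fin.suc (Fin.suc Fin.zero))
          ψx : ψ x ≡ φ x
          ψx = σα x
          ψψx : ψ (ψ x) ≡ φ (φ x)
          ψψx = trans (cong ψ ψx) (σα (φ x))
          first : lt x ≡ lt (φ x) → Σ (Fin 4) λ i → Σ (Fin 4) λ j → Σ (Fin 4) λ k →
            (h (iter ψ (Fin.toℕ i) x) ≢ h (iter ψ (Fin.toℕ j) x)) × (h (iter ψ (Fin.toℕ i) x) ≢ h (iter ψ (Fin.toℕ k) x)) × (h (iter ψ (Fin.toℕ j) x) ≢ h (iter ψ (Fin.toℕ k) x))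
          first e = i₀ , i₁ , i₂ , two-steps x (trans e (cong lt (sym ψx)))
          second : lt (φ x) ≡ lt (φ (φ x)) → Σ (Fin 4) λ i → Σ (Fin 4) λ j → Σ (Fin 4) λ k →
            (h (iter ψ (Fin.toℕ i) x) ≢ h (iter ψ (Fin.toℕ j) x)) × (h (iter ψ (Fin.toℕ i) x) ≢ h (iter ψ (Fin.toℕ k) x)) × (h (iter ψ (Fin.toℕ j) x) ≢ h (iter ψ (Fin.toℕ k) x))
          second e = i₁ , i₂ , i₃ , two-steps (ψ x) (trans (cong lt ψx) (trans e (cong lt (sym ψψx))))
          go : ∀ s t u v → Quad (s ∷ t ∷ u ∷ v ∷ []) → lt x ≡ s → lt (φ x) ≡ t → lt (φ (φ x)) ≡ u → Σ (Fin 4) λ i → Σ (Fin 4) λ j → Σ (Fin 4) λ k →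
            (h (iter ψ (Fin.toℕ i) x) ≢ h (iter ψ (Fin.toℕ j) x)) × (h (iter ψ (Fin.toℕ i) x) ≢ h (iter ψ (Fin.toℕ k) x)) × (h (iter ψ (Fin.toℕ j) x) ≢ h (iter ψ (Fin.toℕ k) x))
          go _ _ _ _ uudd p q r = first (trans p (sym q))
          go _ _ _ _ dduu p q r = first (trans p (sym q))
          go _ _ _ _ uddu p q r = second (trans q (sym r))
          go _ _ _ _ duud p q r = second (trans q (sym r))

      back : ColouredIso P (Letters.coloured quadrangulation)
      back = record { π = λ x → x ; π⁻ = λ x → x ; ππ⁻ = λ _ → refl ; π⁻π = λ _ → refl ; πφ = λ x → sym (σα x) ; πα = λ _ → refl
        ; πlt = λ x → Letters.lt-unique quadrangulation x (lt x) (hα x) ; πr = refl }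

    net-zero : Q.NetZero val val-not
    net-zero _ uudd = refl
    net-zero _ uddu = refl
    net-zero _ dduu = refl
    net-zero _ duud = refl

    classes : NumClasses (ColourfulQuad n) CQIso (length (Q.rootCodes n))
    classes = numClasses CQIso HasCode (Q.rootCodes n) (Q.rootCodes-Unique n)
      (λ {c} i → realised c (Q.realiseRoot n refl i))
      (λ q → Q.encodeRoot n (Letters.coloured q) refl (Letters.allFaces q) (Letters.lt-root q))
      (λ {q} {q′} i h h′ → fromIso q q′ (code-Iso (Letters.coloured q) (Letters.coloured q′) h h′ (Q.rootCodes-size n i)))
      (λ {q} {q′} r h h′ → Iso-code (Letters.coloured q) (Letters.coloured q′) (toIso q q′ r) h h′)
      where
      realised : ∀ c → Q.RootRealisation (2 * n) c → ∃[ q ] HasCode q c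
      realised c R = quadrangulation , Iso-HasCode map′ (Letters.coloured quadrangulation) back hasCode
        where
        open Root.RootRealisation R
        open Build map′ allFaces lt-root (heights val val-not net-zero)

-- Eulerian orientations as maps with balanced faces.

module EulerianTransfer where

  open import Defs
  open FiniteLists
  open Orbits
  open Peeling
  open Decoding
  open Exploration using (findFace; seg-next)
  open PlanarMaps
  open Counting
  open Rooted
  open FaceClasses
  open MapTransfer using (module FromMap; module ToMap; module MapLemmas; Iso-HasCode)
  open import Data.Nat using (ℕ; zero; suc; _+_; _*_)
  import Data.Nat.Properties as ℕₚ
  open import Data.Nat.ListAction using (sum)
  open import Data.Fin using (Fin)
  import Data.Fin.Properties as Finₚ
  open import Data.Bool as Bool using (Bool; true; false; not; _∧_)
  open import Data.List using (List; []; _∷_; length; map; filter; allFin; upTo)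
  open import Data.List.Membership.Propositional using (_∈_)
  open import Data.List.Membership.Propositional.Properties using (∈-filter⁺; ∈-filter⁻; ∈-allFin; ∈-upTo⁺)
  open import Data.List.Relation.Unary.Any using (here; there)
  import Data.List.Relation.Unary.Unique.Propositional.Properties as Uniqueₚ
  open import Data.Product using (_×_; _,_; ∃-syntax; proj₁; proj₂)
  open import Data.Sum using (inj₁; inj₂)
  open import Relation.Nullary using (yes; no; ⌊_⌋)
  open import Relation.Binary.PropositionalEquality

  count-true : {X : Set} (g : X → Bool) (l : List X) → length (filter (λ y → g y Bool.≟ true) l) ≡ sum (map (λ y → up (g y)) l)
  count-true g [] = refl
  count-true g (x ∷ l) with g x
  ... | true  = cong suc (count-true g l)
  ... | false = count-true g l

  ∧-true⁻ : ∀ a b → a ∧ b ≡ true → a ≡ true × b ≡ true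
  ∧-true⁻ true true e = refl , refl

  sum-map-∘ : {X Y : Set} (f : Y → ℕ) (g : X → Y) (l : List X) → sum (map f (map g l)) ≡ sum (map (λ x → f (g x)) l)
  sum-map-∘ f g []      = refl
  sum-map-∘ f g (x ∷ l) = cong (f (g x) +_) (sum-map-∘ f g l)

  down≡up-not : ∀ s → down s ≡ up (not s)
  down≡up-not true  = refl
  down≡up-not false = refl

  sum-map-cong : {X : Set} {f g : X → ℕ} → (∀ x → f x ≡ g x) → (l : List X) → sum (map f l) ≡ sum (map g l)
  sum-map-cong h []      = refl
  sum-map-cong h (x ∷ l) = cong₂ _+_ (h x) (sum-map-cong h l)

  module VertexCount {n : ℕ} (M : Map n) where
    open Map M
    open MapLemmas M

    seg-iter : ∀ x p {z y} → Seg σ x p z → y ∈ x ∷ p → ∃[ k ] iter σ k x ≡ y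
    seg-iter x p       s          (here refl) = 0 , refl
    seg-iter x (w ∷ p) (refl , s) (there i) with seg-iter w p s i
    ... | k , e = suc k , trans (sym (iter-suc σ k x)) e

    sameVertex⁻ : ∀ {x p y} → IsFace σ x p → sameVertex x y ≡ true → y ∈ x ∷ p
    sameVertex⁻ {x} {p} {y} f e with any-true⁻ (λ k → ⌊ iter σ k x Finₚ.≟ y ⌋) (upTo (2 * n)) e
    ... | k , _ , h with iter σ k x Finₚ.≟ y
    ...   | yes refl = closed k
      where
      closed : ∀ k → iter σ k x ∈ x ∷ p
      closed zero = here refl
      closed (suc k) with seg-next σ σ⁻ σσ⁻ x p (proj₁ f) (closed k)
      ... | inj₁ i = there i
      ... | inj₂ q = here q

    sameVertex⁺ : ∀ {x p y} → IsFace σ x p → y ∈ x ∷ p → sameVertex x y ≡ true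
    sameVertex⁺ {x} {p} {y} f i with seg-iter x p (proj₁ f) i
    ... | k , e with Orbit.bounded σ σ-injective x k
    ...   | k′ , k′<d , e′ = any-true⁺ (λ k → ⌊ iter σ k x Finₚ.≟ y ⌋) (upTo (2 * n)) (∈-upTo⁺ k′<d) (dec-true′ (trans (sym e′) e))
      where
      dec-true′ : iter σ k′ x ≡ y → ⌊ iter σ k′ x Finₚ.≟ y ⌋ ≡ true
      dec-true′ q with iter σ k′ x Finₚ.≟ y
      ... | yes _ = refl
      ... | no n  with n q
      ... | ()

    -- The degree condition filters all darts by membership in a vertex. The darts kept are those of
    -- the σ-cycle, and neither list repeats a dart, so the lengths agree.
    vertex-count : ∀ {x p} (g : Fin (2 * n) → Bool) → IsFace σ x p →
      length (filter (λ y → (sameVertex x y ∧ g y) Bool.≟ true) (allFin (2 * n))) ≡ sum (map (λ y → up (g y)) (x ∷ p))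
    vertex-count {x} {p} g f = trans (Unique-same-length (filter (λ y → (sameVertex x y ∧ g y) Bool.≟ true) (allFin (2 * n))) (filter (λ y → g y Bool.≟ true) (x ∷ p))
        (Uniqueₚ.filter⁺ (λ y → (sameVertex x y ∧ g y) Bool.≟ true) (Uniqueₚ.allFin⁺ (2 * n))) (Uniqueₚ.filter⁺ (λ y → g y Bool.≟ true) (proj₂ f))
        (λ {y} i → let e = ∧-true⁻ (sameVertex x y) (g y) (proj₂ (∈-filter⁻ (λ y → (sameVertex x y ∧ g y) Bool.≟ true) {xs = allFin (2 * n)} i)) in
          ∈-filter⁺ (λ y → g y Bool.≟ true) (sameVertex⁻ f (proj₁ e)) (proj₂ e))
        (λ {y} i → let j , e = ∈-filter⁻ (λ y → g y Bool.≟ true) {xs = x ∷ p} i in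
          ∈-filter⁺ (λ y → (sameVertex x y ∧ g y) Bool.≟ true) (∈-allFin y) (cong₂ _∧_ (sameVertex⁺ f j) e)))
      (count-true g (x ∷ p))

    module _ (out : Fin (2 * n) → Bool) where

      Even : Fin (2 * n) → Set
      Even x = length (filter (λ y → (sameVertex x y ∧ out y) Bool.≟ true) (allFin (2 * n)))
             ≡ length (filter (λ y → (sameVertex x y ∧ not (out y)) Bool.≟ true) (allFin (2 * n)))

      ups≡ : ∀ {x p} → IsFace σ x p → length (filter (λ y → (sameVertex x y ∧ out y) Bool.≟ true) (allFin (2 * n))) ≡ ups (map out (x ∷ p))
      ups≡ {x} {p} f = trans (vertex-count out f) (sym (sum-map-∘ up out (x ∷ p)))

      downs≡ : ∀ {x p} → IsFace σ x p → length (filter (λ y → (sameVertex x y ∧ not (out y)) Bool.≟ true) (allFin (2 * n))) ≡ downs (map out (x ∷ p))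
      downs≡ {x} {p} f = trans (vertex-count (λ y → not (out y)) f)
        (trans (sum-map-cong (λ y → sym (down≡up-not (out y))) (x ∷ p)) (sym (sum-map-∘ down out (x ∷ p))))

      Even⇒Balanced : ∀ {x p} → IsFace σ x p → Even x → Balanced (map out (x ∷ p))
      Even⇒Balanced f e = trans (sym (ups≡ f)) (trans e (downs≡ f))

      Balanced⇒Even : ∀ {x p} → IsFace σ x p → Balanced (map out (x ∷ p)) → Even x
      Balanced⇒Even f e = trans (ups≡ f) (trans e (sym (downs≡ f)))

  module OrientationTransfer (n : ℕ) where

    module B = Root balancedClass false

    coloured : EulerianOrientation n → Coloured Bool not n
    coloured o = FromMap.dual M out outα
      where open EulerianOrientation o renaming (map to M)

    HasCode : EulerianOrientation n → Code Bool → Set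
    HasCode o c = Coloured.HasCode (coloured o) c

    faces-balanced : ∀ o → B.AllFaces (coloured o)
    faces-balanced o {x} f = VertexCount.Even⇒Balanced M out f (balanced x)
      where open EulerianOrientation o renaming (map to M)

    toIso : ∀ o o′ → EOIso o o′ → ColouredIso (coloured o) (coloured o′)
    toIso o o′ (I , e) = record { π = π ; π⁻ = π⁻ ; ππ⁻ = ππ⁻ ; π⁻π = π⁻π ; πφ = πσ ; πα = πα ; πr = πroot ; πlt = e }
      where open MapIso I

    fromIso : ∀ o o′ → ColouredIso (coloured o) (coloured o′) → EOIso o o′
    fromIso o o′ i = record { π = π ; π⁻ = π⁻ ; ππ⁻ = ππ⁻ ; π⁻π = π⁻π ; πσ = πφ ; πα = πα ; πroot = πr } , πlt
      where open Iso i

    orientation : ∀ P → B.AllFaces P → Coloured.lt P (Coloured.root P) ≡ true → EulerianOrientation n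
    orientation P all lr = record { map = ToMap.dualMap P ; out = lt ; outα = ltα ; outRoot = lr
      ; balanced = λ x → let p , f = findFace φ φ⁻ φφ⁻ x in VertexCount.Balanced⇒Even (ToMap.dualMap P) lt f (all f) }
      where open Coloured P

    back : (P : Coloured Bool not n) (all : B.AllFaces P) (lr : Coloured.lt P (Coloured.root P) ≡ true) → ColouredIso P (coloured (orientation P all lr))
    back P all lr = record { π = λ x → x ; π⁻ = λ x → x ; ππ⁻ = λ _ → refl ; π⁻π = λ _ → refl ; πφ = λ _ → refl ; πα = λ _ → refl ; πlt = λ _ → refl ; πr = refl }

    classes : NumClasses (EulerianOrientation n) EOIso (length (B.rootCodes n))
    classes = numClasses EOIso HasCode (B.rootCodes n) (B.rootCodes-Unique n)
      (λ {c} i → realised c (B.realiseRoot n n≡ i))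
      (λ o → B.encodeRoot n (coloured o) n≡ (faces-balanced o) (EulerianOrientation.outRoot o))
      (λ {o} {o′} i h h′ → fromIso o o′ (code-Iso (coloured o) (coloured o′) h h′ (trans (B.rootCodes-size n i) (sym n≡))))
      (λ {o} {o′} r h h′ → Iso-code (coloured o) (coloured o′) (toIso o o′ r) h h′)
      where
      n≡ : n ≡ 1 * n
      n≡ = sym (ℕₚ.*-identityˡ n)
      realised : ∀ c → B.RootRealisation n c → ∃[ o ] HasCode o c
      realised c R = orientation map′ allFaces lt-root , Iso-HasCode map′ (coloured (orientation map′ allFaces lt-root)) (back map′ allFaces lt-root) hasCode
        where open Root.RootRealisation R

-- Marks on the edges, and sums over marks.

module Starred where

  open FiniteLists
  open Peeling
  open Building using (word)
  open Counting
  open FaceClasses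
  open import Data.Nat using (ℕ; zero; suc; _+_; _*_; _∸_; _≤_; _<_)
  import Data.Nat.Properties as ℕₚ
  open import Data.Nat.Tactic.RingSolver using (solve-∀)
  open import Data.Bool as Bool using (Bool; true; false)
  open import Data.Maybe using (Maybe; just; nothing)
  import Data.Maybe.Properties as Maybeₚ
  open import Data.List using (List; []; _∷_; _++_; length; map; downFrom)
  open import Data.List.Membership.Propositional using (_∈_)
  open import Data.List.Relation.Unary.Any using (here; there)
  open import Data.List.Relation.Unary.AllPairs using ([]; _∷_)
  open import Data.List.Relation.Unary.All using ([]; _∷_)
  open import Data.List.Relation.Unary.Unique.Propositional using (Unique)
  open import Data.Product using (_×_; _,_)
  open import Relation.Nullary using (yes; no; Dec)
  open import Relation.Binary.PropositionalEquality hiding ([_])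

  sumOver-++ : {X : Set} (xs ys : List X) (f : X → ℕ) → sumOver (xs ++ ys) f ≡ sumOver xs f + sumOver ys f
  sumOver-++ []       ys f = refl
  sumOver-++ (x ∷ xs) ys f = trans (cong (f x +_) (sumOver-++ xs ys f)) (sym (ℕₚ.+-assoc (f x) _ _))

  sumOver-map : {X Y : Set} (g : X → Y) (xs : List X) (f : Y → ℕ) → sumOver (map g xs) f ≡ sumOver xs (λ x → f (g x))
  sumOver-map g []       f = refl
  sumOver-map g (x ∷ xs) f = cong (f (g x) +_) (sumOver-map g xs f)

  interchange : ∀ a b c d → (a + b) + (c + d) ≡ (a + c) + (b + d)
  interchange = solve-∀

  sumOver-+ : {X : Set} (xs : List X) (f g : X → ℕ) → sumOver xs (λ x → f x + g x) ≡ sumOver xs f + sumOver xs g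
  sumOver-+ []       f g = refl
  sumOver-+ (x ∷ xs) f g = trans (cong (f x + g x +_) (sumOver-+ xs f g)) (interchange (f x) (g x) _ _)

  sumOver-0 : {X : Set} (xs : List X) → sumOver xs (λ _ → 0) ≡ 0
  sumOver-0 []       = refl
  sumOver-0 (x ∷ xs) = sumOver-0 xs

  sumOver-ext : {X : Set} (xs : List X) {f g : X → ℕ} → (∀ x → f x ≡ g x) → sumOver xs f ≡ sumOver xs g
  sumOver-ext xs h = sumOver-cong xs (λ {x} _ → h x)

  sumOver-swap : {X Y : Set} (xs : List X) (ys : List Y) (f : X → Y → ℕ) →
    sumOver xs (λ x → sumOver ys (f x)) ≡ sumOver ys (λ y → sumOver xs (λ x → f x y))
  sumOver-swap []       ys f = sym (sumOver-0 ys)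
  sumOver-swap (x ∷ xs) ys f = trans (cong (sumOver ys (f x) +_) (sumOver-swap xs ys f)) (sym (sumOver-+ ys (f x) _))

  sumOver-*ˡ : {X : Set} (xs : List X) (c : ℕ) (f : X → ℕ) → sumOver xs (λ x → c * f x) ≡ c * sumOver xs f
  sumOver-*ˡ []       c f = sym (ℕₚ.*-zeroʳ c)
  sumOver-*ˡ (x ∷ xs) c f = trans (cong (c * f x +_) (sumOver-*ˡ xs c f)) (sym (ℕₚ.*-distribˡ-+ c (f x) _))

  conv : (ℕ → ℕ) → (ℕ → ℕ) → ℕ → ℕ
  conv f g n = sumOver (downFrom (suc n)) (λ k → f k * g (n ∸ k))

  conv-cong : ∀ {f f′ g g′ : ℕ → ℕ} n → (∀ k → k ≤ n → f k ≡ f′ k) → (∀ k → k ≤ n → g k ≡ g′ k) → conv f g n ≡ conv f′ g′ n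
  conv-cong n hf hg = sumOver-cong (downFrom (suc n)) λ {k} i → cong₂ _*_ (hf k (ℕₚ.≤-pred (∈-downFrom⁻ i))) (hg (n ∸ k) (ℕₚ.m∸n≤m n k))
    where open import Data.List.Membership.Propositional.Properties using (∈-downFrom⁻)

  -- When all faces have weight 1, only g = 0 contributes to the face terms.
  weight-one : {X : Set} (n : ℕ) (C : ℕ → List X) (h : ℕ → X → ℕ) → (∀ g → C (suc g) ≡ []) →
    sumOver (downFrom (suc n)) (λ g → sumOver (C g) (h g)) ≡ sumOver (C 0) (h 0)
  weight-one zero    C h e = ℕₚ.+-identityʳ _
  weight-one (suc n) C h e = trans (cong (λ l → sumOver l (h (suc n)) + sumOver (downFrom (suc n)) (λ g → sumOver (C g) (h g))) (e n)) (weight-one n C h e)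

  -- The second step up of a face is marked K, the first one N.
  data Arc : Set where
    u d : Bool → Arc

  pattern K = true
  pattern N = false

  -- A mark belongs to the edge. It is decided on the side where the edge goes up and merely
  -- repeated on the other side.
  flip : Arc → Arc
  flip (u c) = d c
  flip (d c) = u c

  _≟ᵃ_ : (s t : Arc) → Dec (s ≡ t)
  u b ≟ᵃ u c with b Bool.≟ c
  ... | yes refl = yes refl
  ... | no n     = no λ { refl → n refl }
  d b ≟ᵃ d c with b Bool.≟ c
  ... | yes refl = yes refl
  ... | no n     = no λ { refl → n refl }
  u b ≟ᵃ d c = no λ ()
  d b ≟ᵃ u c = no λ ()

  -- The marks x and y of the steps down are free here, because the faces beyond these edges decide
  -- them.
  data Star : List Arc → Set where
    s₁ : ∀ x y → Star (u N ∷ u K ∷ d x ∷ d y ∷ [])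
    s₂ : ∀ x y → Star (u K ∷ d x ∷ d y ∷ u N ∷ [])
    s₃ : ∀ x y → Star (d x ∷ d y ∷ u N ∷ u K ∷ [])
    s₄ : ∀ x y → Star (d y ∷ u N ∷ u K ∷ d x ∷ [])

  starCand : Arc → ℕ → List (List Arc)
  starCand (u c) zero = (d K ∷ u N ∷ u K ∷ []) ∷ (d N ∷ u N ∷ u K ∷ []) ∷ (u N ∷ u K ∷ d K ∷ []) ∷ (u N ∷ u K ∷ d N ∷ []) ∷ []
  starCand (d K) zero = (d K ∷ d K ∷ u N ∷ []) ∷ (d K ∷ d N ∷ u N ∷ []) ∷ (d N ∷ d K ∷ u N ∷ []) ∷ (d N ∷ d N ∷ u N ∷ []) ∷ []
  starCand (d N) zero = (u K ∷ d K ∷ d K ∷ []) ∷ (u K ∷ d K ∷ d N ∷ []) ∷ (u K ∷ d N ∷ d K ∷ []) ∷ (u K ∷ d N ∷ d N ∷ []) ∷ []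
  starCand s (suc g) = []

  starCand-suc : ∀ s g → starCand s (suc g) ≡ []
  starCand-suc (u c)     g = refl
  starCand-suc (d true)  g = refl
  starCand-suc (d false) g = refl

  upᵃ : Arc → ℕ
  upᵃ (u _) = 1
  upᵃ (d _) = 0

  starClass : FaceClass Arc
  starClass = record
    { _≟_ = _≟ᵃ_ ; bar = flip ; bar-bar = λ { (u c) → refl ; (d c) → refl }
    ; S = Star ; S-rot = λ { _ _ (s₁ x y) → s₂ x y ; _ _ (s₂ x y) → s₃ x y ; _ _ (s₃ x y) → s₄ x y ; _ _ (s₄ x y) → s₁ x y }
    ; wt = λ _ → 1 ; cand = starCand
    ; cand-sound = λ {s} {g} → sound s g
    ; cand-complete = λ {s} i → 0 , refl , complete s i
    ; cand-Unique = unique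
    ; cand-length = λ {s} {g} → len s g
    ; up = upᵃ ; up-bar = λ { (u c) → refl ; (d c) → refl } ; m = 1
    ; S-up = λ { _ (s₁ x y) → refl ; _ (s₂ x y) → refl ; _ (s₃ x y) → refl ; _ (s₄ x y) → refl } }
    where
    sound : ∀ s g {p} → p ∈ starCand s g → Star (flip s ∷ p) × 1 ≡ suc g
    sound (u c) zero (here refl) = s₃ c K , refl
    sound (u c) zero (there (here refl)) = s₃ c N , refl
    sound (u c) zero (there (there (here refl))) = s₄ K c , refl
    sound (u c) zero (there (there (there (here refl)))) = s₄ N c , refl
    sound (d K) zero (here refl) = s₂ K K , refl
    sound (d K) zero (there (here refl)) = s₂ K N , refl
    sound (d K) zero (there (there (here refl))) = s₂ N K , refl
    sound (d K) zero (there (there (there (here refl)))) = s₂ N N , refl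
    sound (d N) zero (here refl) = s₁ K K , refl
    sound (d N) zero (there (here refl)) = s₁ K N , refl
    sound (d N) zero (there (there (here refl))) = s₁ N K , refl
    sound (d N) zero (there (there (there (here refl)))) = s₁ N N , refl
    sound s (suc g) i with subst (_ ∈_) (starCand-suc s g) i
    ... | ()
    complete : ∀ s {p} → Star (flip s ∷ p) → p ∈ starCand s 0
    complete (u c) (s₃ .c true)  = here refl
    complete (u c) (s₃ .c false) = there (here refl)
    complete (u c) (s₄ true .c)  = there (there (here refl))
    complete (u c) (s₄ false .c) = there (there (there (here refl)))
    complete (d true) (s₂ true true)   = here refl
    complete (d true) (s₂ true false)  = there (here refl)
    complete (d true) (s₂ false true)  = there (there (here refl))
    complete (d true) (s₂ false false) = there (there (there (here refl)))
    complete (d false) (s₁ true true)   = here refl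
    complete (d false) (s₁ true false)  = there (here refl)
    complete (d false) (s₁ false true)  = there (there (here refl))
    complete (d false) (s₁ false false) = there (there (there (here refl)))
    unique : ∀ s g → Unique (starCand s g)
    unique (u c) zero = ((λ ()) ∷ (λ ()) ∷ (λ ()) ∷ []) ∷ ((λ ()) ∷ (λ ()) ∷ []) ∷ ((λ ()) ∷ []) ∷ [] ∷ []
    unique (d true) zero = ((λ ()) ∷ (λ ()) ∷ (λ ()) ∷ []) ∷ ((λ ()) ∷ (λ ()) ∷ []) ∷ ((λ ()) ∷ []) ∷ [] ∷ []
    unique (d false) zero = ((λ ()) ∷ (λ ()) ∷ (λ ()) ∷ []) ∷ ((λ ()) ∷ (λ ()) ∷ []) ∷ ((λ ()) ∷ []) ∷ [] ∷ []
    unique s (suc g) = subst Unique (sym (starCand-suc s g)) []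
    len : ∀ s g {p} → p ∈ starCand s g → length p < 4 * suc g
    len (u c) zero (here refl) = ℕₚ.≤-refl
    len (u c) zero (there (here refl)) = ℕₚ.≤-refl
    len (u c) zero (there (there (here refl))) = ℕₚ.≤-refl
    len (u c) zero (there (there (there (here refl)))) = ℕₚ.≤-refl
    len (d K) zero (here refl) = ℕₚ.≤-refl
    len (d K) zero (there (here refl)) = ℕₚ.≤-refl
    len (d K) zero (there (there (here refl))) = ℕₚ.≤-refl
    len (d K) zero (there (there (there (here refl)))) = ℕₚ.≤-refl
    len (d N) zero (here refl) = ℕₚ.≤-refl
    len (d N) zero (there (here refl)) = ℕₚ.≤-refl
    len (d N) zero (there (there (here refl))) = ℕₚ.≤-refl
    len (d N) zero (there (there (there (here refl)))) = ℕₚ.≤-refl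
    len s (suc g) i with subst (_ ∈_) (starCand-suc s g) i
    ... | ()

  module F = Count quadClass
  module H = Count balancedClass
  module C = Count starClass

  cnt-∷₁ : ∀ {A : Set} (Kl : FaceClass A) → (∀ s g → FaceClass.cand Kl s (suc g) ≡ []) → let open Count Kl in
    ∀ n s v → cnt (suc n) (s ∷ v) ≡ sumOver (splits (FaceClass.bar Kl s) v) (bridgeSum (suc n)) + sumOver (FaceClass.cand Kl s 0) (λ p → cnt n (p ++ v))
  cnt-∷₁ Kl e n s v = trans (Count.cnt-∷ Kl (suc n) s v) (cong (sumOver (splits (FaceClass.bar Kl s) v) (bridgeSum (suc n)) +_)
    (weight-one n (FaceClass.cand Kl s) (λ g p → cnt (n ∸ g) (p ++ v)) (e s)))
    where open Count Kl

  quadCand-suc : ∀ s g → quadCand s (suc g) ≡ []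
  quadCand-suc true  g = refl
  quadCand-suc false g = refl

  -- An open word lists steps up with their marks (just) and steps down whose
  -- mark is left open (nothing); ⟦ w ⟧ f sums f over all ways to mark the latter.
  Open : Set
  Open = List (Maybe Bool)

  ⟦_⟧ : Open → (List Arc → ℕ) → ℕ
  ⟦ [] ⟧          f = f []
  ⟦ just c ∷ w ⟧  f = ⟦ w ⟧ (λ v → f (u c ∷ v))
  ⟦ nothing ∷ w ⟧ f = ⟦ w ⟧ (λ v → f (d K ∷ v)) + ⟦ w ⟧ (λ v → f (d N ∷ v))

  ⟦⟧-cong : ∀ w {f g : List Arc → ℕ} → (∀ v → f v ≡ g v) → ⟦ w ⟧ f ≡ ⟦ w ⟧ g
  ⟦⟧-cong []            h = h []
  ⟦⟧-cong (just c ∷ w)  h = ⟦⟧-cong w (λ v → h _)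
  ⟦⟧-cong (nothing ∷ w) h = cong₂ _+_ (⟦⟧-cong w (λ v → h _)) (⟦⟧-cong w (λ v → h _))

  ⟦⟧-+ : ∀ w (f g : List Arc → ℕ) → ⟦ w ⟧ (λ v → f v + g v) ≡ ⟦ w ⟧ f + ⟦ w ⟧ g
  ⟦⟧-+ []            f g = refl
  ⟦⟧-+ (just c ∷ w)  f g = ⟦⟧-+ w _ _
  ⟦⟧-+ (nothing ∷ w) f g = trans (cong₂ _+_ (⟦⟧-+ w _ _) (⟦⟧-+ w _ _)) (interchange (⟦ w ⟧ (λ v → f (d K ∷ v))) _ _ _)

  ⟦⟧-0 : ∀ w → ⟦ w ⟧ (λ _ → 0) ≡ 0
  ⟦⟧-0 []            = refl
  ⟦⟧-0 (just c ∷ w)  = ⟦⟧-0 w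
  ⟦⟧-0 (nothing ∷ w) = cong₂ _+_ (⟦⟧-0 w) (⟦⟧-0 w)

  ⟦⟧-*ʳ : ∀ w (f : List Arc → ℕ) c → ⟦ w ⟧ (λ v → f v * c) ≡ ⟦ w ⟧ f * c
  ⟦⟧-*ʳ []            f c = refl
  ⟦⟧-*ʳ (just _ ∷ w)  f c = ⟦⟧-*ʳ w _ c
  ⟦⟧-*ʳ (nothing ∷ w) f c = trans (cong₂ _+_ (⟦⟧-*ʳ w _ c) (⟦⟧-*ʳ w _ c)) (sym (ℕₚ.*-distribʳ-+ c (⟦ w ⟧ (λ v → f (d K ∷ v))) _))

  ⟦⟧-*ˡ : ∀ w (f : List Arc → ℕ) c → ⟦ w ⟧ (λ v → c * f v) ≡ c * ⟦ w ⟧ f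
  ⟦⟧-*ˡ w f c = trans (⟦⟧-cong w (λ v → ℕₚ.*-comm c (f v))) (trans (⟦⟧-*ʳ w f c) (ℕₚ.*-comm _ c))

  ⟦⟧-sumOver : ∀ w {X : Set} (xs : List X) (f : X → List Arc → ℕ) → ⟦ w ⟧ (λ v → sumOver xs (λ x → f x v)) ≡ sumOver xs (λ x → ⟦ w ⟧ (f x))
  ⟦⟧-sumOver w []       f = ⟦⟧-0 w
  ⟦⟧-sumOver w (x ∷ xs) f = trans (⟦⟧-+ w (f x) _) (cong (⟦ w ⟧ (f x) +_) (⟦⟧-sumOver w xs f))

  ⟦⟧-bridge : ∀ n a b → ⟦ a ⟧ (λ a′ → ⟦ b ⟧ (λ b′ → C.bridgeSum n (a′ , b′))) ≡ conv (λ k → ⟦ a ⟧ (C.cnt k)) (λ k → ⟦ b ⟧ (C.cnt k)) n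
  ⟦⟧-bridge n a b = trans (⟦⟧-cong a (λ a′ → trans (⟦⟧-sumOver b (downFrom (suc n)) _) (sumOver-ext (downFrom (suc n)) (λ k → ⟦⟧-*ˡ b (C.cnt (n ∸ k)) (C.cnt k a′)))))
    (trans (⟦⟧-sumOver a (downFrom (suc n)) _) (sumOver-ext (downFrom (suc n)) (λ k → ⟦⟧-*ʳ a (C.cnt k) _)))

  _≟ᵒ_ : (s t : Maybe Bool) → Dec (s ≡ t)
  _≟ᵒ_ = Maybeₚ.≡-dec Bool._≟_

  module So = Splitting _≟ᵒ_

  -- Peeling `u c` looks for the letter `d c`. In the sum over all markings each open step down is
  -- hit for exactly one of its two marks, so every split at an open step appears once, with both
  -- remaining parts still summed over their marks.
  lift-down : ∀ c w (f : List Arc × List Arc → ℕ) → ⟦ w ⟧ (λ v → sumOver (C.splits (d c) v) f) ≡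
    sumOver (So.splits nothing w) (λ (a , b) → ⟦ a ⟧ (λ a′ → ⟦ b ⟧ (λ b′ → f (a′ , b′))))
  lift-down c [] f = refl
  lift-down c (just e ∷ w) f = trans (⟦⟧-cong w (λ v → sumOver-map (C.consˡ (u e)) (C.splits (d c) v) f))
    (trans (lift-down c w _) (sym (sumOver-map (So.consˡ (just e)) (So.splits nothing w) _)))
  lift-down c (nothing ∷ w) f = trans (both c)
    (cong (⟦ w ⟧ (λ v → f ([] , v)) +_) (trans (cong₂ _+_ (lift-down c w _) (lift-down c w _)) (trans (sym (sumOver-+ (So.splits nothing w) _ _))
      (sym (sumOver-map (So.consˡ nothing) (So.splits nothing w) _)))))
    where
    rest : Bool → ℕ
    rest e = ⟦ w ⟧ (λ v → sumOver (C.splits (d c) v) (λ ab → f (C.consˡ (d e) ab)))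
    shifted : ∀ e → ⟦ w ⟧ (λ v → sumOver (map (C.consˡ (d e)) (C.splits (d c) v)) f) ≡ rest e
    shifted e = ⟦⟧-cong w (λ v → sumOver-map (C.consˡ (d e)) (C.splits (d c) v) f)
    both : ∀ c′ → ⟦ w ⟧ (λ v → sumOver (C.splits-here (d c′) (d K) v ++ map (C.consˡ (d K)) (C.splits (d c) v)) f)
                + ⟦ w ⟧ (λ v → sumOver (C.splits-here (d c′) (d N) v ++ map (C.consˡ (d N)) (C.splits (d c) v)) f)
                ≡ ⟦ w ⟧ (λ v → f ([] , v)) + (rest K + rest N)
    both true  = trans (cong₂ _+_ (trans (⟦⟧-+ w (λ v → f ([] , v)) _) (cong (⟦ w ⟧ (λ v → f ([] , v)) +_) (shifted K))) (shifted N)) (ℕₚ.+-assoc _ (rest K) (rest N))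
    both false = trans (cong₂ _+_ (shifted K) (trans (⟦⟧-+ w (λ v → f ([] , v)) _) (cong (⟦ w ⟧ (λ v → f ([] , v)) +_) (shifted N)))) (lem (rest K) _ (rest N))
      where
      lem : ∀ a b c → a + (b + c) ≡ b + (a + c)
      lem = solve-∀

  lift-up : ∀ c w (f : List Arc × List Arc → ℕ) → ⟦ w ⟧ (λ v → sumOver (C.splits (u c) v) f) ≡
    sumOver (So.splits (just c) w) (λ (a , b) → ⟦ a ⟧ (λ a′ → ⟦ b ⟧ (λ b′ → f (a′ , b′))))
  lift-up c [] f = refl
  lift-up c (nothing ∷ w) f = trans (cong₂ _+_ (step K) (step N)) (trans (sym (sumOver-+ (So.splits (just c) w) _ _)) (sym (sumOver-map (So.consˡ nothing) (So.splits (just c) w) _)))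
    where
    step : ∀ e → ⟦ w ⟧ (λ v → sumOver (map (C.consˡ (d e)) (C.splits (u c) v)) f) ≡ sumOver (So.splits (just c) w) (λ (a , b) → ⟦ a ⟧ (λ a′ → ⟦ b ⟧ (λ b′ → f (d e ∷ a′ , b′))))
    step e = trans (⟦⟧-cong w (λ v → sumOver-map (C.consˡ (d e)) (C.splits (u c) v) f)) (lift-up c w _)
  lift-up c (just e ∷ w) f = go c e
    where
    tailed : ⟦ w ⟧ (λ v → sumOver (map (C.consˡ (u e)) (C.splits (u c) v)) f) ≡ sumOver (map (So.consˡ (just e)) (So.splits (just c) w)) (λ (a , b) → ⟦ a ⟧ (λ a′ → ⟦ b ⟧ (λ b′ → f (a′ , b′))))
    tailed = trans (⟦⟧-cong w (λ v → sumOver-map (C.consˡ (u e)) (C.splits (u c) v) f)) (trans (lift-up c w _) (sym (sumOver-map (So.consˡ (just e)) (So.splits (just c) w) _)))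
    go : ∀ c′ e′ → ⟦ w ⟧ (λ v → sumOver (C.splits-here (u c′) (u e′) v ++ map (C.consˡ (u e)) (C.splits (u c) v)) f)
       ≡ sumOver (So.splits-here (just c′) (just e′) w ++ map (So.consˡ (just e)) (So.splits (just c) w)) (λ (a , b) → ⟦ a ⟧ (λ a′ → ⟦ b ⟧ (λ b′ → f (a′ , b′))))
    go true  true  = trans (⟦⟧-+ w (λ v → f ([] , v)) _) (cong (⟦ w ⟧ (λ v → f ([] , v)) +_) tailed)
    go false false = trans (⟦⟧-+ w (λ v → f ([] , v)) _) (cong (⟦ w ⟧ (λ v → f ([] , v)) +_) tailed)
    go true  false = tailed
    go false true  = tailed

  direction : Maybe Bool → Bool
  direction (just _) = U
  direction nothing  = D

  forget : Open → Word
  forget = map direction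

  pair-forget : Open × Open → Word × Word
  pair-forget (a , b) = forget a , forget b

  forget-down : ∀ w (f : Word × Word → ℕ) → sumOver (F.splits D (forget w)) f ≡ sumOver (So.splits nothing w) (λ ab → f (pair-forget ab))
  forget-down [] f = refl
  forget-down (just c ∷ w) f = trans (sumOver-map (F.consˡ U) (F.splits D (forget w)) f) (trans (forget-down w _) (sym (sumOver-map (So.consˡ (just c)) (So.splits nothing w) _)))
  forget-down (nothing ∷ w) f = cong (f ([] , forget w) +_)
    (trans (sumOver-map (F.consˡ D) (F.splits D (forget w)) f) (trans (forget-down w _) (sym (sumOver-map (So.consˡ nothing) (So.splits nothing w) _))))

  -- A step up carries one of the two marks, so the splits at U are those at K together with those
  -- at N.
  forget-up : ∀ w (f : Word × Word → ℕ) → sumOver (F.splits U (forget w)) f ≡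
    sumOver (So.splits (just K) w) (λ ab → f (pair-forget ab)) + sumOver (So.splits (just N) w) (λ ab → f (pair-forget ab))
  forget-up [] f = refl
  forget-up (nothing ∷ w) f = trans (sumOver-map (F.consˡ D) (F.splits U (forget w)) f) (trans (forget-up w _)
    (sym (cong₂ _+_ (sumOver-map (So.consˡ nothing) (So.splits (just K) w) _) (sumOver-map (So.consˡ nothing) (So.splits (just N) w) _))))
  forget-up (just c ∷ w) f = trans (cong (f ([] , forget w) +_) (trans (sumOver-map (F.consˡ U) (F.splits U (forget w)) f) (forget-up w _))) (go c)
    where
    k n : ℕ
    k = sumOver (So.splits (just K) w) (λ ab → f (pair-forget (So.consˡ (just c) ab)))
    n = sumOver (So.splits (just N) w) (λ ab → f (pair-forget (So.consˡ (just c) ab)))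
    mk : sumOver (map (So.consˡ (just c)) (So.splits (just K) w)) (λ ab → f (pair-forget ab)) ≡ k
    mk = sumOver-map (So.consˡ (just c)) (So.splits (just K) w) _
    mn : sumOver (map (So.consˡ (just c)) (So.splits (just N) w)) (λ ab → f (pair-forget ab)) ≡ n
    mn = sumOver-map (So.consˡ (just c)) (So.splits (just N) w) _
    lem : ∀ a k n → a + (k + n) ≡ k + (a + n)
    lem = solve-∀
    go : ∀ e → f ([] , forget w) + (k + n) ≡ sumOver (So.splits-here (just K) (just e) w ++ map (So.consˡ (just c)) (So.splits (just K) w)) (λ ab → f (pair-forget ab))
      + sumOver (So.splits-here (just N) (just e) w ++ map (So.consˡ (just c)) (So.splits (just N) w)) (λ ab → f (pair-forget ab))
    go true  = trans (sym (ℕₚ.+-assoc _ k n)) (sym (cong₂ _+_ (cong (f ([] , forget w) +_) mk) mn))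
    go false = trans (lem _ k n) (sym (cong₂ _+_ mk (cong (f ([] , forget w) +_) mn)))

-- Forgetting the marks.

module OpenWords where

  open Counting
  open FaceClasses
  open Starred
  open import Data.Nat using (ℕ; zero; suc; _+_; _≤_; _<_; s≤s)
  import Data.Nat.Properties as ℕₚ
  open import Data.Nat.Tactic.RingSolver using (solve-∀)
  open import Data.Bool using (Bool; true; false; not)
  open import Data.Maybe using (just; nothing)
  open import Data.List using ([]; _∷_; _++_; length)
  open import Data.List.Properties using (length-++)
  open import Data.List.Membership.Propositional using (_∈_)
  open import Data.Product using (_×_; _,_; proj₁; proj₂)
  open import Data.Sum using (inj₁; inj₂)
  open import Relation.Binary.PropositionalEquality hiding ([_])

  X : ℕ → Open → ℕ
  X n w = ⟦ w ⟧ (C.cnt n)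

  downSplits : ℕ → Open → ℕ
  downSplits n w = sumOver (So.splits nothing w) (λ (a , b) → conv (λ k → X k a) (λ k → X k b) n)

  upSplits : Bool → ℕ → Open → ℕ
  upSplits c n w = sumOver (So.splits (just c) w) (λ (a , b) → conv (λ k → X k a) (λ k → X k b) n)

  splits-length : ∀ x w {ab} → ab ∈ So.splits x w → length (proj₁ ab) < suc (length w) × length (proj₂ ab) < suc (length w)
  splits-length x w {a , b} i with So.splits-sound x w i
  ... | refl = s≤s (subst (length a ≤_) (sym (length-++ a)) (ℕₚ.m≤m+n (length a) _)) ,
               s≤s (subst (length b ≤_) (sym (length-++ a)) (ℕₚ.≤-trans (ℕₚ.n≤1+n _) (ℕₚ.m≤n+m (suc (length b)) (length a))))

  X-zero-up : ∀ c w → X 0 (just c ∷ w) ≡ downSplits 0 w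
  X-zero-up c w = trans (⟦⟧-cong w (λ v → trans (C.cnt-∷ 0 (u c) v) (ℕₚ.+-identityʳ _)))
    (trans (lift-down c w _) (sumOver-ext (So.splits nothing w) (λ (a , b) → ⟦⟧-bridge 0 a b)))

  X-suc-up : ∀ n c w → X (suc n) (just c ∷ w) ≡ downSplits (suc n) w + (X n (nothing ∷ just N ∷ just K ∷ w) + X n (just N ∷ just K ∷ nothing ∷ w))
  X-suc-up n c w = trans (⟦⟧-cong w (λ v → cnt-∷₁ starClass starCand-suc n (u c) v)) (trans (⟦⟧-+ w _ _) (cong₂ _+_
      (trans (lift-down c w _) (sumOver-ext (So.splits nothing w) (λ (a , b) → ⟦⟧-bridge (suc n) a b)))
      (trans (⟦⟧-cong w (λ v → lem (C.cnt n (d K ∷ u N ∷ u K ∷ v)) (C.cnt n (d N ∷ u N ∷ u K ∷ v)) (C.cnt n (u N ∷ u K ∷ d K ∷ v)) (C.cnt n (u N ∷ u K ∷ d N ∷ v))))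
        (trans (⟦⟧-+ w _ _) (cong₂ _+_ (⟦⟧-+ w _ _) (⟦⟧-+ w _ _))))))
    where
    lem : ∀ a b c d → a + (b + (c + (d + 0))) ≡ (a + b) + (c + d)
    lem = solve-∀

  X-down : Bool → ℕ → Open → ℕ
  X-down c n w = ⟦ w ⟧ (λ v → C.cnt n (d c ∷ v))

  X-down-zero : ∀ c w → X-down c 0 w ≡ upSplits c 0 w
  X-down-zero c w = trans (⟦⟧-cong w (λ v → trans (C.cnt-∷ 0 (d c) v) (ℕₚ.+-identityʳ _)))
    (trans (lift-up c w _) (sumOver-ext (So.splits (just c) w) (λ (a , b) → ⟦⟧-bridge 0 a b)))

  -- The rest of the quadrangle beyond a step down: D D U if the other side is the second step up, U
  -- D D if it is the first.
  afterDown : Bool → Open → Open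
  afterDown true  w = nothing ∷ nothing ∷ just N ∷ w
  afterDown false w = just K ∷ nothing ∷ nothing ∷ w

  X-down-suc : ∀ c n w → X-down c (suc n) w ≡ upSplits c (suc n) w + X n (afterDown c w)
  X-down-suc c n w = trans (⟦⟧-cong w (λ v → cnt-∷₁ starClass starCand-suc n (d c) v)) (trans (⟦⟧-+ w _ _) (cong₂ _+_
      (trans (lift-up c w _) (sumOver-ext (So.splits (just c) w) (λ (a , b) → ⟦⟧-bridge (suc n) a b)))
      (face c)))
    where
    lem : ∀ a b c d → a + (b + (c + (d + 0))) ≡ (a + b) + (c + d)
    lem = solve-∀
    face : ∀ c → ⟦ w ⟧ (λ v → sumOver (starCand (d c) 0) (λ p → C.cnt n (p ++ v))) ≡ X n (afterDown c w)
    face true  = trans (⟦⟧-cong w (λ v → lem (C.cnt n (d K ∷ d K ∷ u N ∷ v)) (C.cnt n (d K ∷ d N ∷ u N ∷ v)) (C.cnt n (d N ∷ d K ∷ u N ∷ v)) (C.cnt n (d N ∷ d N ∷ u N ∷ v))))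
      (trans (⟦⟧-+ w _ _) (cong₂ _+_ (⟦⟧-+ w _ _) (⟦⟧-+ w _ _)))
    face false = trans (⟦⟧-cong w (λ v → lem (C.cnt n (u K ∷ d K ∷ d K ∷ v)) (C.cnt n (u K ∷ d K ∷ d N ∷ v)) (C.cnt n (u K ∷ d N ∷ d K ∷ v)) (C.cnt n (u K ∷ d N ∷ d N ∷ v))))
      (trans (⟦⟧-+ w _ _) (cong₂ _+_ (⟦⟧-+ w _ _) (⟦⟧-+ w _ _)))

  F-zero : ∀ s v → F.cnt 0 (s ∷ v) ≡ sumOver (F.splits (not s) v) (F.bridgeSum 0)
  F-zero s v = trans (F.cnt-∷ 0 s v) (ℕₚ.+-identityʳ _)

  F-suc : ∀ n s v → F.cnt (suc n) (s ∷ v) ≡ sumOver (F.splits (not s) v) (F.bridgeSum (suc n)) + sumOver (quadCand s 0) (λ p → F.cnt n (p ++ v))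
  F-suc n s v = cnt-∷₁ quadClass quadCand-suc n s v

  -- Nothing is lost by forgetting the marks: each quadrangle determines those of its steps up.
  F≡X : ∀ n w → F.cnt n (forget w) ≡ X n w
  F≡X n w = go n (suc (length w)) w ℕₚ.≤-refl
    where
    Hyp : ℕ → Set
    Hyp n = ∀ w → F.cnt n (forget w) ≡ X n w

    module Level (n : ℕ) (lower : ∀ k → k < n → Hyp k) where
      bridge≡ : ∀ f a b → (∀ w → length w < f → F.cnt n (forget w) ≡ X n w) → length a < f → length b < f →
        F.bridgeSum n (forget a , forget b) ≡ conv (λ k → X k a) (λ k → X k b) n
      bridge≡ f a b ih la lb = conv-cong n (λ k k≤n → here′ k k≤n a la) (λ k k≤n → here′ k k≤n b lb)
        where
        here′ : ∀ k → k ≤ n → ∀ w → length w < f → F.cnt k (forget w) ≡ X k w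
        here′ k k≤n w lw with ℕₚ.m≤n⇒m<n∨m≡n k≤n
        ... | inj₁ k<n = lower k k<n w
        ... | inj₂ refl = ih w lw

      splits≡ : ∀ f x w → (∀ w → length w < f → F.cnt n (forget w) ≡ X n w) → length w < f →
        sumOver (So.splits x w) (λ ab → F.bridgeSum n (pair-forget ab)) ≡ sumOver (So.splits x w) (λ (a , b) → conv (λ k → X k a) (λ k → X k b) n)
      splits≡ f x w ih lw = sumOver-cong (So.splits x w) λ {(a , b)} i →
        let la , lb = splits-length x w i in bridge≡ f a b ih (ℕₚ.≤-trans la lw) (ℕₚ.≤-trans lb lw)

    go : ∀ n f w → length w < f → F.cnt n (forget w) ≡ X n w
    all : ∀ n k → k < n → Hyp k
    go zero    (suc f) [] (s≤s lt) = trans F.cnt-[] (sym C.cnt-[])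
    go (suc n) (suc f) [] (s≤s lt) = trans (F.cnt-suc-[] n) (sym (C.cnt-suc-[] n))
    go zero    (suc f) (just c ∷ w) (s≤s lt) = trans (F-zero U (forget w)) (trans (forget-down w _)
      (trans (Level.splits≡ 0 (all 0) f nothing w (go zero f) lt) (sym (X-zero-up c w))))
    go (suc n) (suc f) (just c ∷ w) (s≤s lt) = trans (F-suc n U (forget w)) (trans (cong₂ _+_
      (trans (forget-down w _) (Level.splits≡ (suc n) (all (suc n)) f nothing w (go (suc n) f) lt))
      (cong₂ _+_ (all (suc n) n ℕₚ.≤-refl (nothing ∷ just N ∷ just K ∷ w)) (trans (ℕₚ.+-identityʳ _) (all (suc n) n ℕₚ.≤-refl (just N ∷ just K ∷ nothing ∷ w)))))
      (sym (X-suc-up n c w)))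
    go zero    (suc f) (nothing ∷ w) (s≤s lt) = trans (F-zero D (forget w)) (trans (forget-up w _)
      (trans (cong₂ _+_ (Level.splits≡ 0 (all 0) f (just K) w (go zero f) lt) (Level.splits≡ 0 (all 0) f (just N) w (go zero f) lt))
        (sym (cong₂ _+_ (X-down-zero K w) (X-down-zero N w)))))
    -- The two quadrangles beyond an unmarked step down, U D D and D D U, correspond to its marks N
    -- and K, one each.
    go (suc n) (suc f) (nothing ∷ w) (s≤s lt) = trans (F-suc n D (forget w)) (trans (cong₂ _+_
      (trans (forget-up w _) (cong₂ _+_ (Level.splits≡ (suc n) (all (suc n)) f (just K) w (go (suc n) f) lt) (Level.splits≡ (suc n) (all (suc n)) f (just N) w (go (suc n) f) lt)))
      (cong₂ _+_ (all (suc n) n ℕₚ.≤-refl (just K ∷ nothing ∷ nothing ∷ w)) (trans (ℕₚ.+-identityʳ _) (all (suc n) n ℕₚ.≤-refl (nothing ∷ nothing ∷ just N ∷ w)))))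
      (trans (lem (upSplits K (suc n) w) (upSplits N (suc n) w) (X n (just K ∷ nothing ∷ nothing ∷ w)) (X n (nothing ∷ nothing ∷ just N ∷ w))) (sym (cong₂ _+_ (X-down-suc K n w) (X-down-suc N n w)))))
      where
      lem : ∀ a b c d → (a + b) + (c + d) ≡ (a + d) + (b + c)
      lem = solve-∀
    all (suc n) k (s≤s k≤n) w with ℕₚ.m≤n⇒m<n∨m≡n k≤n
    ... | inj₁ k<n  = all n k k<n w
    ... | inj₂ refl = go k (suc (length w)) w ℕₚ.≤-refl

-- Comparing quadrangles with balanced faces on kept words.

module KeptWords where

  open Counting
  open FaceClasses
  open Starred
  open OpenWords
  open import Data.Nat as ℕ using (ℕ; zero; suc; _+_; _*_; _∸_; _≤_; _<_; s≤s)
  import Data.Nat.Properties as ℕₚ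
  open import Data.Nat.Tactic.RingSolver using (solve-∀)
  open import Data.Nat.ListAction using (sum)
  open import Data.Bool using (Bool; true; false; not)
  open import Data.Maybe using (just; nothing)
  open import Data.List using (List; []; _∷_; [_]; _++_; length; map; downFrom; replicate)
  open import Data.List.Properties using (length-++; map-++; ++-assoc; ++-identityʳ)
  open import Data.List.Membership.Propositional using (_∈_)
  open import Data.Product using (_×_; _,_; ∃-syntax; proj₁; proj₂)
  open import Data.Sum using (_⊎_; inj₁; inj₂)
  open import Relation.Nullary using (yes; no)
  open import Relation.Binary.PropositionalEquality hiding ([_])

  keep : Bool → Arc
  keep true  = u K
  keep false = d K

  κ : Word → List Arc
  κ = map keep

  Z : ℕ → Word → ℕ
  Z n v = C.cnt n (κ v)

  star-ups : ∀ w → Star w → sum (map upᵃ w) ≡ sum (map (λ s → upᵃ (flip s)) w)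
  star-ups _ (s₁ x y) = refl
  star-ups _ (s₂ x y) = refl
  star-ups _ (s₃ x y) = refl
  star-ups _ (s₄ x y) = refl

  balanced-ups : ∀ w → Balanced w → sum (map up w) ≡ sum (map (λ s → up (not s)) w)
  balanced-ups w e = trans e (lem w)
    where
    lem : ∀ w → downs w ≡ sum (map (λ s → up (not s)) w)
    lem []          = refl
    lem (true ∷ w)  = lem w
    lem (false ∷ w) = cong suc (lem w)

  downs-not : ∀ w → sum (map (λ s → up (not s)) w) ≡ downs w
  downs-not []          = refl
  downs-not (true ∷ w)  = downs-not w
  downs-not (false ∷ w) = cong suc (downs-not w)

  module UC = Unbalanced starClass star-ups
  module UH = Unbalanced balancedClass balanced-ups

  κ-ups : ∀ v → C.ups (κ v) ≡ ups v
  κ-ups []          = refl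
  κ-ups (true ∷ v)  = cong suc (κ-ups v)
  κ-ups (false ∷ v) = κ-ups v

  κ-downs : ∀ v → UC.dns (κ v) ≡ downs v
  κ-downs []          = refl
  κ-downs (true ∷ v)  = κ-downs v
  κ-downs (false ∷ v) = cong suc (κ-downs v)

  H-unbalanced : ∀ n v → ups v ≢ downs v → H.cnt n v ≡ 0
  H-unbalanced n v ne = UH.cnt-unbalanced n v (λ e → ne (trans e (downs-not v)))

  Z-unbalanced : ∀ n v → ups v ≢ downs v → Z n v ≡ 0
  Z-unbalanced n v ne = UC.cnt-unbalanced n (κ v) (λ e → ne (trans (sym (κ-ups v)) (trans e (κ-downs v))))

  κ-splits : ∀ s v (f : List Arc × List Arc → ℕ) → sumOver (C.splits (keep s) (κ v)) f ≡ sumOver (H.splits s v) (λ (a , b) → f (κ a , κ b))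
  κ-splits s [] f = refl
  κ-splits s (t ∷ v) f = go s t
    where
    tailed : sumOver (map (C.consˡ (keep t)) (C.splits (keep s) (κ v))) f ≡ sumOver (map (H.consˡ t) (H.splits s v)) (λ (a , b) → f (κ a , κ b))
    tailed = trans (sumOver-map (C.consˡ (keep t)) (C.splits (keep s) (κ v)) f) (trans (κ-splits s v _) (sym (sumOver-map (H.consˡ t) (H.splits s v) _)))
    go : ∀ s′ t′ → sumOver (C.splits-here (keep s′) (keep t′) (κ v) ++ map (C.consˡ (keep t)) (C.splits (keep s) (κ v))) f
       ≡ sumOver (H.splits-here s′ t′ v ++ map (H.consˡ t) (H.splits s v)) (λ (a , b) → f (κ a , κ b))
    go true  true  = cong (f ([] , κ v) +_) tailed
    go false false = cong (f ([] , κ v) +_) tailed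
    go true  false = tailed
    go false true  = tailed

  κ-splits-uN : ∀ v (f : List Arc × List Arc → ℕ) → sumOver (C.splits (u N) (κ v)) f ≡ 0
  κ-splits-uN []          f = refl
  κ-splits-uN (true ∷ v)  f = trans (sumOver-map (C.consˡ (u K)) (C.splits (u N) (κ v)) f) (κ-splits-uN v _)
  κ-splits-uN (false ∷ v) f = trans (sumOver-map (C.consˡ (d K)) (C.splits (u N) (κ v)) f) (κ-splits-uN v _)

  κ-splits-dN : ∀ v (f : List Arc × List Arc → ℕ) → sumOver (C.splits (d N) (κ v)) f ≡ 0
  κ-splits-dN []          f = refl
  κ-splits-dN (true ∷ v)  f = trans (sumOver-map (C.consˡ (u K)) (C.splits (d N) (κ v)) f) (κ-splits-dN v _)
  κ-splits-dN (false ∷ v) f = trans (sumOver-map (C.consˡ (d K)) (C.splits (d N) (κ v)) f) (κ-splits-dN v _)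

  descent : ℕ → Open
  descent zero    = just N ∷ []
  descent (suc j) = nothing ∷ descent j

  -- The quadrangle side of the comparison: kept letters v followed by j open steps down and one
  -- step up that is not kept. Its partner `a` appends to v all paths of the same net descent j - 1
  -- and charges one unit of weight for every step up of the path.
  b : ℕ → ℕ → Word → ℕ
  b j n v = ⟦ descent j ⟧ (λ ds → C.cnt n (κ v ++ ds))

  -- The only `u N` in the word is the last letter of the descent, so there is a single place to
  -- split.
  splits-descent : ∀ j v (f : List Arc × List Arc → ℕ) →
    ⟦ descent j ⟧ (λ ds → sumOver (C.splits (u N) (ds ++ κ v)) f) ≡ ⟦ replicate j nothing ⟧ (λ ds → f (ds , κ v))
  splits-descent zero    v f = trans (cong (f ([] , κ v) +_) (trans (sumOver-map (C.consˡ (u N)) (C.splits (u N) (κ v)) f) (κ-splits-uN v _))) (ℕₚ.+-identityʳ _)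
  splits-descent (suc j) v f = cong₂ _+_ (step K) (step N)
    where
    step : ∀ c → ⟦ descent j ⟧ (λ ds → sumOver (map (C.consˡ (d c)) (C.splits (u N) (ds ++ κ v))) f) ≡ ⟦ replicate j nothing ⟧ (λ ds → f (d c ∷ ds , κ v))
    step c = trans (⟦⟧-cong (descent j) (λ ds → sumOver-map (C.consˡ (d c)) (C.splits (u N) (ds ++ κ v)) f)) (splits-descent j v _)

  all-down-0 : ∀ j (f : List Arc → ℕ) → (∀ ds → C.ups ds ≡ 0 → UC.dns ds ≡ j → f ds ≡ 0) → ⟦ replicate j nothing ⟧ f ≡ 0
  all-down-0 zero    f h = h [] refl refl
  all-down-0 (suc j) f h = cong₂ _+_ (all-down-0 j _ (λ ds e e′ → h _ e (cong suc e′))) (all-down-0 j _ (λ ds e e′ → h _ e (cong suc e′)))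

  bridge-zero : ∀ n ds w → C.ups ds ≢ UC.dns ds → C.bridgeSum n (ds , w) ≡ 0
  bridge-zero n ds w ne = trans (sumOver-ext (downFrom (suc n)) (λ k → cong (_* C.cnt (n ∸ k) w) (UC.cnt-unbalanced k ds ne))) (sumOver-0 (downFrom (suc n)))

  sum-shift : ∀ n (f : ℕ → ℕ) → sumOver (downFrom (suc n)) f ≡ f 0 + sumOver (downFrom n) (λ g → f (suc g))
  sum-shift zero    f = refl
  sum-shift (suc n) f = trans (cong (f (suc n) +_) (sum-shift n f)) (lem (f (suc n)) (f 0) _)
    where
    lem : ∀ a b c → a + (b + c) ≡ b + (a + c)
    lem = solve-∀

  bridge-empty : ∀ n w → C.bridgeSum n ([] , w) ≡ C.cnt n w
  bridge-empty n w = trans (sum-shift n (λ k → C.cnt k [] * C.cnt (n ∸ k) w)) (trans (cong₂ _+_ (trans (cong (_* C.cnt n w) C.cnt-[]) (ℕₚ.*-identityˡ _))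
    (trans (sumOver-ext (downFrom n) (λ g → cong (_* C.cnt (n ∸ suc g) w) (C.cnt-suc-[] g))) (sumOver-0 (downFrom n)))) (ℕₚ.+-identityʳ _))

  δb : ℕ → ℕ → Word → ℕ
  δb zero    n v = Z n v
  δb (suc j) n v = 0

  nextb : ℕ → ℕ → Word → ℕ
  nextb j zero    v = 0
  nextb j (suc m) v = b (suc (suc j)) m (v ++ [ U ])

  -- By the mark of the first open step down. If kept, it joins v. If not, it is rotated to the
  -- front and peeled. Matching it with the only `u N` encloses j steps down, which is possible for
  -- j = 0 only. Otherwise it uncovers `u K` and two open steps down; the kept step up joins v and
  -- the descent has become longer.
  b-suc : ∀ j n v → b (suc j) n v ≡ b j n (v ++ [ D ]) + (δb j n v + nextb j n v)
  b-suc j n v = cong₂ _+_ first (trans (⟦⟧-cong (descent j) (λ ds → C.cnt-swap n (κ v) (d N ∷ ds))) (second n))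
    where
    first : ⟦ descent j ⟧ (λ ds → C.cnt n (κ v ++ d K ∷ ds)) ≡ b j n (v ++ [ D ])
    first = ⟦⟧-cong (descent j) (λ ds → cong (C.cnt n) (trans (sym (++-assoc (κ v) [ d K ] ds)) (cong (_++ ds) (sym (map-++ keep v [ D ])))))
    δ : ∀ j n → ⟦ replicate j nothing ⟧ (λ ds → C.bridgeSum n (ds , κ v)) ≡ δb j n v
    δ zero    n = bridge-empty n (κ v)
    δ (suc j) n = all-down-0 (suc j) _ (λ ds e e′ → bridge-zero n ds (κ v) (λ q → zero≢ (trans (sym e) (trans q e′))))
      where
      zero≢ : ∀ {j} → 0 ≢ suc j
      zero≢ ()
    spl : ∀ n → ⟦ descent j ⟧ (λ ds → sumOver (C.splits (u N) (ds ++ κ v)) (C.bridgeSum n)) ≡ δb j n v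
    spl n = trans (splits-descent j v (C.bridgeSum n)) (δ j n)
    second : ∀ n → ⟦ descent j ⟧ (λ ds → C.cnt n (d N ∷ ds ++ κ v)) ≡ δb j n v + nextb j n v
    second zero = trans (⟦⟧-cong (descent j) (λ ds → C.cnt-∷ 0 (d N) (ds ++ κ v))) (trans (⟦⟧-+ (descent j) _ _) (cong₂ _+_ (spl 0) (⟦⟧-0 (descent j))))
    second (suc m) = trans (⟦⟧-cong (descent j) (λ ds → cnt-∷₁ starClass starCand-suc m (d N) (ds ++ κ v))) (trans (⟦⟧-+ (descent j) _ _) (cong₂ _+_ (spl (suc m))
      (trans (⟦⟧-cong (descent j) (λ ds → trans (cong₂ _+_ (rot K K ds) (cong₂ _+_ (rot K N ds) (cong₂ _+_ (rot N K ds) (cong (_+ 0) (rot N N ds))))) (lem (c K K ds) (c K N ds) (c N K ds) (c N N ds))))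
        (trans (⟦⟧-+ (descent j) _ _) (cong₂ _+_ (⟦⟧-+ (descent j) _ _) (⟦⟧-+ (descent j) _ _))))))
      where
      c : Bool → Bool → List Arc → ℕ
      c x y ds = C.cnt m (κ (v ++ [ U ]) ++ d x ∷ d y ∷ ds)
      rot : ∀ x y ds → C.cnt m (u K ∷ d x ∷ d y ∷ ds ++ κ v) ≡ c x y ds
      rot x y ds = trans (C.cnt-swap m (u K ∷ d x ∷ d y ∷ ds) (κ v)) (cong (C.cnt m) (trans (sym (++-assoc (κ v) [ u K ] (d x ∷ d y ∷ ds))) (cong (_++ (d x ∷ d y ∷ ds)) (sym (map-++ keep v [ U ])))))
      lem : ∀ a b c d → a + (b + (c + (d + 0))) ≡ (a + b) + (c + d)
      lem = solve-∀

  -- Index j stands for net descent j - 1.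
  a : ℕ → ℕ → Word → ℕ
  a zero    n v = sumOver (downFrom n) (λ g → sumOver (paths (suc g) g) (λ p → H.cnt (n ∸ suc g) (v ++ p)))
  a (suc h) n v = sumOver (downFrom (suc n)) (λ g → sumOver (paths g (g + h)) (λ p → H.cnt (n ∸ g) (v ++ p)))

  paths-∷ : ∀ g e (f : Word → ℕ) → sumOver (paths (suc g) (suc e)) f ≡ sumOver (paths g (suc e)) (λ p → f (U ∷ p)) + sumOver (paths (suc g) e) (λ p → f (D ∷ p))
  paths-∷ g e f = trans (sumOver-++ (map (U ∷_) (paths g (suc e))) _ f) (cong₂ _+_ (sumOver-map (U ∷_) (paths g (suc e)) f) (sumOver-map (D ∷_) (paths (suc g) e) f))

  δa : ℕ → ℕ → Word → ℕ
  δa zero    n v = H.cnt n v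
  δa (suc j) n v = 0

  nexta : ℕ → ℕ → Word → ℕ
  nexta j zero    v = 0
  nexta j (suc m) v = a (suc (suc j)) m (v ++ [ U ])

  up-part : ∀ h n v → sumOver (downFrom n) (λ g → sumOver (paths g (suc (g + h))) (λ p → H.cnt (n ∸ suc g) (v ++ U ∷ p))) ≡ nexta h n v
  up-part h zero    v = refl
  up-part h (suc m) v = sumOver-ext (downFrom (suc m)) (λ g → trans (cong (λ e → sumOver (paths g e) (λ p → H.cnt (m ∸ g) (v ++ U ∷ p))) (sym (ℕₚ.+-suc g h)))
    (sumOver-ext (paths g (g + suc h)) (λ p → cong (H.cnt (m ∸ g)) (sym (++-assoc v [ U ] p)))))

  -- By the first letter of the path: D joins v, U joins v at the price of one unit of weight and
  -- raises the remaining descent, and the empty path occurs for net descent 0 only. This is the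
  -- recursion of `b`.
  a-suc : ∀ j n v → a (suc j) n v ≡ a j n (v ++ [ D ]) + (δa j n v + nexta j n v)
  a-suc zero n v = trans (sum-shift n _) (trans (cong₂ _+_ (trans (ℕₚ.+-identityʳ _) (cong (H.cnt n) (++-identityʳ v)))
      (trans (sumOver-ext (downFrom n) (λ g → paths-∷ g (g + 0) (λ p → H.cnt (n ∸ suc g) (v ++ p)))) (trans (sumOver-+ (downFrom n) _ _)
        (cong₂ _+_ (up-part 0 n v) (sumOver-ext (downFrom n) (λ g → trans (cong (λ e → sumOver (paths (suc g) e) (λ p → H.cnt (n ∸ suc g) (v ++ D ∷ p))) (ℕₚ.+-identityʳ g))
          (sumOver-ext (paths (suc g) g) (λ p → cong (H.cnt (n ∸ suc g)) (sym (++-assoc v [ D ] p))))))))))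
    (lem (H.cnt n v) (nexta 0 n v) (a 0 n (v ++ [ D ]))))
    where
    lem : ∀ x y z → x + (y + z) ≡ z + (x + y)
    lem = solve-∀
  a-suc (suc h) n v = trans (sum-shift n _) (trans (cong₂ _+_ (trans (sumOver-map (D ∷_) (paths 0 h) _) (assoc (paths 0 h) n))
      (trans (sumOver-ext (downFrom n) (λ g → paths-∷ g (g + suc h) (λ p → H.cnt (n ∸ suc g) (v ++ p)))) (trans (sumOver-+ (downFrom n) _ _)
        (cong₂ _+_ (up-part (suc h) n v) (sumOver-ext (downFrom n) (λ g → trans (cong (λ e → sumOver (paths (suc g) e) (λ p → H.cnt (n ∸ suc g) (v ++ D ∷ p))) (ℕₚ.+-suc g h))
          (assoc (paths (suc g) (suc (g + h))) (n ∸ suc g))))))))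
    (trans (lem (sumOver (paths 0 h) (λ p → H.cnt n ((v ++ [ D ]) ++ p))) (nexta (suc h) n v) _) (cong (_+ nexta (suc h) n v) (sym (sum-shift n _)))))
    where
    assoc : ∀ l k → sumOver l (λ p → H.cnt k (v ++ D ∷ p)) ≡ sumOver l (λ p → H.cnt k ((v ++ [ D ]) ++ p))
    assoc l k = sumOver-ext l (λ p → cong (H.cnt k) (sym (++-assoc v [ D ] p)))
    lem : ∀ x y z → x + (y + z) ≡ (x + z) + y
    lem = solve-∀

  Agree : ℕ → Set
  Agree n = ∀ v → H.cnt n v ≡ Z n v

  starFaces : ℕ → Word → ℕ
  starFaces n v = sumOver (downFrom n) (λ g → sumOver (starCand (u K) g) (λ p → C.cnt (n ∸ suc g) (p ++ κ v)))

  starCand-u : ∀ c g → starCand (u c) g ≡ starCand (u K) g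
  starCand-u c zero    = refl
  starCand-u c (suc g) = refl

  -- A kept letter is matched by a kept letter, so on kept words both recursions split at the same
  -- places.
  splits-agree : ∀ n s v → (∀ k → k ≤ n → ∀ w → length w < suc (length v) → H.cnt k w ≡ Z k w) →
    sumOver (H.splits s v) (H.bridgeSum n) ≡ sumOver (C.splits (keep s) (κ v)) (C.bridgeSum n)
  splits-agree n s v h = trans (sumOver-cong (H.splits s v) λ {(x , y)} i →
      conv-cong n (λ k k≤n → h k k≤n x (proj₁ (len x y i))) (λ k k≤n → h k k≤n y (proj₂ (len x y i))))
    (sym (κ-splits s v (C.bridgeSum n)))
    where
    len : ∀ x y → (x , y) ∈ H.splits s v → length x < suc (length v) × length y < suc (length v)
    len x y i with H.splits-sound s v i
    ... | refl = s≤s (subst (length x ≤_) (sym (length-++ x)) (ℕₚ.m≤m+n (length x) _)) ,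
                 s≤s (subst (length y ≤_) (sym (length-++ x)) (ℕₚ.≤-trans (ℕₚ.n≤1+n _) (ℕₚ.m≤n+m (suc (length y)) (length x))))

  -- The steps u K and u N open the same faces, so b 0 can be read off from
  -- the known value on v ++ [ U ].
  b0≡a0 : ∀ n v → (∀ k → k ≤ n → Agree k) → b 0 n v ≡ a 0 n v
  b0≡a0 n v agree = trans b≡ (trans (ℕₚ.+-cancelˡ-≡ spl _ _ (trans (sym z≡) (trans (sym (agree n ℕₚ.≤-refl (U ∷ v))) h≡))) (sumOver-ext (downFrom n) (λ g →
      sumOver-ext (paths (suc g) g) (λ p → H.cnt-swap (n ∸ suc g) p v))))
    where
    spl : ℕ
    spl = sumOver (H.splits D v) (H.bridgeSum n)
    b≡ : b 0 n v ≡ starFaces n v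
    b≡ = trans (C.cnt-swap n (κ v) [ u N ]) (trans (C.cnt-∷ n (u N) (κ v)) (cong₂ _+_ (κ-splits-dN v (C.bridgeSum n))
      (sumOver-ext (downFrom n) (λ g → cong (λ l → sumOver l (λ p → C.cnt (n ∸ suc g) (p ++ κ v))) (starCand-u N g)))))
    z≡ : Z n (U ∷ v) ≡ spl + starFaces n v
    z≡ = trans (C.cnt-∷ n (u K) (κ v)) (cong (_+ starFaces n v) (sym (splits-agree n D v (λ k k≤n w _ → agree k k≤n w))))
    h≡ : H.cnt n (U ∷ v) ≡ spl + sumOver (downFrom n) (λ g → sumOver (paths (suc g) g) (λ p → H.cnt (n ∸ suc g) (p ++ v)))
    h≡ = H.cnt-∷ n U v

  -- Induction on n and then on j: the recursion asks for a longer descent only where the weight has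
  -- dropped.
  b≡a : ∀ n j v → (∀ k → k ≤ n → Agree k) → b j n v ≡ a j n v
  b≡a n       zero    v agree = b0≡a0 n v agree
  b≡a n       (suc j) v agree = trans (b-suc j n v) (trans (cong₂ _+_ (b≡a n j (v ++ [ D ]) agree) (cong₂ _+_ (δ j) (next n agree))) (sym (a-suc j n v)))
    where
    δ : ∀ j → δb j n v ≡ δa j n v
    δ zero    = sym (agree n ℕₚ.≤-refl v)
    δ (suc j) = refl
    next : ∀ n → (∀ k → k ≤ n → Agree k) → nextb j n v ≡ nexta j n v
    next zero    agree = refl
    next (suc m) agree = b≡a m (suc (suc j)) (v ++ [ U ]) (λ k k≤m → agree k (ℕₚ.m≤n⇒m≤1+n k≤m))

  find-D : ∀ v → (∃[ x ] ∃[ y ] v ≡ x ++ D ∷ y) ⊎ downs v ≡ 0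
  find-D []          = inj₂ refl
  find-D (false ∷ v) = inj₁ ([] , v , refl)
  find-D (true ∷ v) with find-D v
  ... | inj₁ (x , y , refl) = inj₁ (U ∷ x , y , refl)
  ... | inj₂ e              = inj₂ e

  -- A word that is not balanced counts zero on both sides, and a nonempty balanced one can be
  -- rotated so that it begins with D.
  agree-below : ∀ n → (∀ k → k < n → Agree k) → ∀ f v → length v < f → H.cnt n v ≡ Z n v
  -- Behind D the faces of H are all paths of net descent 1, summing to `a 2`. Behind `d K` the
  -- quadrangles read d d `u N` with open marks, summing to `b 2`. Both come with weight reduced by
  -- one, so the two agree by induction, and words starting with U need no separate peeling.
  agree-D : ∀ n → (∀ k → k < n → Agree k) → ∀ f v → length v < f → H.cnt n (D ∷ v) ≡ Z n (D ∷ v)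
  agree-below n lower (suc f) v (s≤s lt) with ups v ℕ.≟ downs v
  ... | no ne = trans (H-unbalanced n v ne) (sym (Z-unbalanced n v ne))
  ... | yes e with find-D v
  ...   | inj₁ (x , y , refl) = trans (H.cnt-swap n x (D ∷ y)) (trans (agree-D n lower f (y ++ x) (ℕₚ.≤-trans (ℕₚ.≤-reflexive
            (trans (cong suc (trans (length-++ y) (ℕₚ.+-comm (length y) (length x)))) (trans (sym (ℕₚ.+-suc (length x) (length y))) (sym (length-++ x))))) lt))
          (trans (cong (C.cnt n) (map-++ keep (D ∷ y) x)) (trans (C.cnt-swap n (κ (D ∷ y)) (κ x)) (cong (C.cnt n) (sym (map-++ keep x (D ∷ y)))))))
  agree-below n lower (suc f) v (s≤s lt) | yes e | inj₂ z with v | trans (sym (ups+downs v)) (cong₂ _+_ (trans e z) z)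
  ... | [] | _ = empty n
    where
    empty : ∀ n → H.cnt n [] ≡ Z n []
    empty zero    = trans H.cnt-[] (sym C.cnt-[])
    empty (suc n) = trans (H.cnt-suc-[] n) (sym (C.cnt-suc-[] n))
  agree-D n lower f v lt = trans (H.cnt-∷ n D v) (trans (cong₂ _+_ spl (faces n lower)) (sym (C.cnt-∷ n (d K) (κ v))))
    where
    spl : sumOver (H.splits U v) (H.bridgeSum n) ≡ sumOver (C.splits (u K) (κ v)) (C.bridgeSum n)
    spl = splits-agree n U v λ k k≤n w lw → here′ k k≤n w lw
      where
      here′ : ∀ k → k ≤ n → ∀ w → length w < suc (length v) → H.cnt k w ≡ Z k w
      here′ k k≤n w lw with ℕₚ.m≤n⇒m<n∨m≡n k≤n
      ... | inj₁ k<n  = lower k k<n w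
      ... | inj₂ refl = agree-below n lower f w (ℕₚ.≤-trans lw lt)
    faces : ∀ n → (∀ k → k < n → Agree k) → sumOver (downFrom n) (λ g → sumOver (paths g (suc g)) (λ p → H.cnt (n ∸ suc g) (p ++ v)))
      ≡ sumOver (downFrom n) (λ g → sumOver (starCand (d K) g) (λ p → C.cnt (n ∸ suc g) (p ++ κ v)))
    faces zero    lower = refl
    faces (suc m) lower = trans (sumOver-ext (downFrom (suc m)) (λ g → trans (cong (λ e → sumOver (paths g e) (λ p → H.cnt (m ∸ g) (p ++ v))) (ℕₚ.+-comm 1 g))
        (sumOver-ext (paths g (g + 1)) (λ p → H.cnt-swap (m ∸ g) p v))))
      (trans (sym (b≡a m 2 v (λ k k≤m → lower k (s≤s k≤m))))
        (trans (trans (cong₂ _+_ (cong₂ _+_ (rot K K) (rot K N)) (cong₂ _+_ (rot N K) (rot N N))) (lem (c K K) (c K N) (c N K) (c N N)))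
          (sym (weight-one m (starCand (d K)) (λ g p → C.cnt (m ∸ g) (p ++ κ v)) (starCand-suc (d K))))))
      where
      c : Bool → Bool → ℕ
      c x y = C.cnt m (d x ∷ d y ∷ u N ∷ κ v)
      rot : ∀ x y → C.cnt m (κ v ++ d x ∷ d y ∷ u N ∷ []) ≡ c x y
      rot x y = C.cnt-swap m (κ v) (d x ∷ d y ∷ u N ∷ [])
      lem : ∀ a b c d → (a + b) + (c + d) ≡ a + (b + (c + (d + 0)))
      lem = solve-∀

  agree : ∀ n → Agree n
  agree-< : ∀ n k → k < n → Agree k
  agree n v = agree-below n (agree-< n) (suc (length v)) v ℕₚ.≤-refl
  agree-< (suc n) k (s≤s k≤n) with ℕₚ.m≤n⇒m<n∨m≡n k≤n
  ... | inj₁ k<n  = agree-< n k k<n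
  ... | inj₂ refl = agree k

  -- The left-hand side counts planar Eulerian orientations with n + 1 edges by their root vertex.
  eulerian-count : ∀ n → sumOver (downFrom (suc n)) (λ g → sumOver (paths g (suc g)) (λ p → H.cnt (n ∸ g) (U ∷ p))) ≡ F.cnt n (U ∷ D ∷ D ∷ U ∷ [])
  eulerian-count n = trans (sumOver-ext (downFrom (suc n)) (λ g → cong (λ e → sumOver (paths g e) (λ p → H.cnt (n ∸ g) (U ∷ p))) (ℕₚ.+-comm 1 g)))
    -- On the left, U followed by all paths of net descent 1 is `a 2 n [ U ]`. On the right, the
    -- kept U and a descent of height two spell U D D U, with K and N as the marks of its steps up,
    -- and the marks can be forgotten.
    (trans (sym (b≡a n 2 [ U ] (λ k _ → agree k))) (sym (F≡X n (just K ∷ nothing ∷ nothing ∷ just N ∷ []))))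

-- Patches with alternating boundaries and the series D.

module Patches where

  open Counting
  open FaceClasses
  open Starred
  open OpenWords using (F-zero; F-suc)
  open KeptWords using (sum-shift; downs-not)
  open import Data.Nat using (ℕ; zero; suc; _+_; _*_; _∸_; _≤_; _<_; s≤s)
  import Data.Nat.Properties as ℕₚ
  open import Data.Nat.Combinatorics using (_C_; nCk+nC[k+1]≡[n+1]C[k+1]; nCn≡1)
  open import Data.Nat.Tactic.RingSolver using (solve-∀)
  open import Data.Nat.ListAction using (sum)
  open import Data.Bool using (not)
  open import Data.List using (List; []; _∷_; [_]; _++_; map; downFrom)
  open import Data.List.Properties using (++-assoc)
  open import Data.List.Membership.Propositional.Properties using (∈-downFrom⁻)
  open import Data.Product using (_×_; _,_)
  open import Data.Sum using (inj₁; inj₂)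
  open import Relation.Binary.PropositionalEquality hiding ([_])

  quad-ups : ∀ w → Quad w → sum (map up w) ≡ sum (map (λ s → up (not s)) w)
  quad-ups _ uudd = refl
  quad-ups _ uddu = refl
  quad-ups _ dduu = refl
  quad-ups _ duud = refl

  module UF = Unbalanced quadClass quad-ups

  bridge-unbalanced : ∀ n x y → ups x ≢ downs x → F.bridgeSum n (x , y) ≡ 0
  bridge-unbalanced n x y ne = trans (sumOver-ext (downFrom (suc n)) (λ k → cong (_* F.cnt (n ∸ k) y) (UF.cnt-unbalanced k x (λ e → ne (trans e (downs-not x)))))) (sumOver-0 (downFrom (suc n)))

  Σ≤ : ℕ → (ℕ → ℕ) → ℕ
  Σ≤ n = sumOver (downFrom (suc n))

  Σ≤-cong : ∀ n {f g : ℕ → ℕ} → (∀ k → k ≤ n → f k ≡ g k) → Σ≤ n f ≡ Σ≤ n g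
  Σ≤-cong n h = sumOver-cong (downFrom (suc n)) (λ {k} i → h k (ℕₚ.≤-pred (∈-downFrom⁻ i)))

  Σ≤-ext : ∀ n {f g : ℕ → ℕ} → (∀ k → f k ≡ g k) → Σ≤ n f ≡ Σ≤ n g
  Σ≤-ext n = sumOver-ext (downFrom (suc n))

  -- Both sides run over the pairs with m + a at most n.
  triangle : ∀ n (f : ℕ → ℕ → ℕ) → Σ≤ n (λ m → Σ≤ (n ∸ m) (f m)) ≡ Σ≤ n (λ a → Σ≤ (n ∸ a) (λ m → f m a))
  triangle zero    f = refl
  triangle (suc n) f = trans (sum-shift (suc n) (λ m → Σ≤ (suc n ∸ m) (f m))) (trans (cong (Σ≤ (suc n) (f 0) +_) (triangle n (λ m → f (suc m)))) (sym (trans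
    (trans (sumOver-ext (downFrom (suc (suc n))) (λ a → sum-shift (suc n ∸ a) (λ m → f m a))) (sumOver-+ (downFrom (suc (suc n))) (f 0) (λ a → sumOver (downFrom (suc n ∸ a)) (λ m → f (suc m) a))))
    (cong (Σ≤ (suc n) (f 0) +_) (trans (cong₂ _+_ (cong (λ k → sumOver (downFrom k) (λ m → f (suc m) (suc n))) (ℕₚ.n∸n≡0 n))
      (Σ≤-cong n λ a a≤n → cong (λ k → sumOver (downFrom k) (λ m → f (suc m) a)) (ℕₚ.+-∸-assoc 1 a≤n))) refl)))))

  conv-swap : ∀ n (f g h : ℕ → ℕ) → conv f (conv g h) n ≡ conv g (conv f h) n
  conv-swap n f g h = trans (Σ≤-ext n (λ a → sym (sumOver-*ˡ (downFrom (suc (n ∸ a))) (f a) _)))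
    (trans (triangle n (λ a b → f a * (g b * h (n ∸ a ∸ b))))
      (Σ≤-ext n (λ b → trans (sumOver-ext (downFrom (suc (n ∸ b))) (λ a → trans (lem (f a) (g b) _)
          (cong (λ k → g b * (f a * h k)) (trans (ℕₚ.∸-+-assoc n a b) (trans (cong (n ∸_) (ℕₚ.+-comm a b)) (sym (ℕₚ.∸-+-assoc n b a)))))))
        (sumOver-*ˡ (downFrom (suc (n ∸ b))) (g b) _))))
    where
    lem : ∀ a b c → a * (b * c) ≡ b * (a * c)
    lem = solve-∀

  conv-0ʳ : ∀ n f → conv f (λ _ → 0) n ≡ 0
  conv-0ʳ n f = trans (Σ≤-ext n (λ k → ℕₚ.*-zeroʳ (f k))) (sumOver-0 (downFrom (suc n)))

  conv-+ʳ : ∀ n f g h → conv f (λ k → g k + h k) n ≡ conv f g n + conv f h n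
  conv-+ʳ n f g h = trans (Σ≤-ext n (λ k → ℕₚ.*-distribˡ-+ (f k) (g (n ∸ k)) (h (n ∸ k))))
    (sumOver-+ (downFrom (suc n)) (λ k → f k * g (n ∸ k)) (λ k → f k * h (n ∸ k)))

  conv-sumʳ : ∀ n f {X : Set} (xs : List X) (g : X → ℕ → ℕ) → conv f (λ k → sumOver xs (λ x → g x k)) n ≡ sumOver xs (λ x → conv f (g x) n)
  conv-sumʳ n f []       g = conv-0ʳ n f
  conv-sumʳ n f (x ∷ xs) g = trans (conv-+ʳ n f (g x) (λ k → sumOver xs (λ x → g x k))) (cong (conv f (g x) n +_) (conv-sumʳ n f xs g))

  shift : (ℕ → ℕ) → ℕ → ℕ
  shift f zero    = 0
  shift f (suc n) = f n

  conv-shiftʳ : ∀ n f g → conv f (shift g) n ≡ shift (conv f g) n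
  conv-shiftʳ zero    f g = trans (ℕₚ.+-identityʳ _) (ℕₚ.*-zeroʳ (f 0))
  conv-shiftʳ (suc n) f g = cong₂ _+_ (trans (cong (λ k → f (suc n) * shift g k) (ℕₚ.n∸n≡0 n)) (ℕₚ.*-zeroʳ (f (suc n))))
    (Σ≤-cong n (λ k k≤n → cong (λ z → f k * shift g z) (ℕₚ.+-∸-assoc 1 k≤n)))

  -- Indices: n for t, m for x.

  Series : Set
  Series = ℕ → ℕ → ℕ

  δ : Series
  δ zero    zero    = 1
  δ zero    (suc m) = 0
  δ (suc n) m       = 0

  shiftᵗ shiftˣ : Series → Series
  shiftᵗ f n m = shift (λ k → f k m) n
  shiftˣ f n m = shift (f n) m

  conv₂ : Series → Series → Series
  conv₂ f g n m = Σ≤ n (λ a → Σ≤ m (λ c → f a c * g (n ∸ a) (m ∸ c)))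

  conv₂-cong : ∀ {f f′ g g′} n m → (∀ a c → f a c ≡ f′ a c) → (∀ a c → g a c ≡ g′ a c) → conv₂ f g n m ≡ conv₂ f′ g′ n m
  conv₂-cong n m hf hg = Σ≤-ext n (λ a → Σ≤-ext m (λ c → cong₂ _*_ (hf a c) (hg _ _)))

  conv₂-+ˡ : ∀ f f′ g n m → conv₂ (λ a c → f a c + f′ a c) g n m ≡ conv₂ f g n m + conv₂ f′ g n m
  conv₂-+ˡ f f′ g n m = trans (Σ≤-ext n (λ a → trans (Σ≤-ext m (λ c → ℕₚ.*-distribʳ-+ (g (n ∸ a) (m ∸ c)) (f a c) (f′ a c)))
        (sumOver-+ (downFrom (suc m)) (λ c → f a c * g (n ∸ a) (m ∸ c)) (λ c → f′ a c * g (n ∸ a) (m ∸ c)))))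
    (sumOver-+ (downFrom (suc n)) (λ a → Σ≤ m (λ c → f a c * g (n ∸ a) (m ∸ c))) (λ a → Σ≤ m (λ c → f′ a c * g (n ∸ a) (m ∸ c))))

  conv₂-shiftᵗ : ∀ f g n m → conv₂ (shiftᵗ f) g n m ≡ shiftᵗ (conv₂ f g) n m
  conv₂-shiftᵗ f g zero    m = trans (ℕₚ.+-identityʳ _) (sumOver-0 (downFrom (suc m)))
  conv₂-shiftᵗ f g (suc n) m = trans (sum-shift (suc n) (λ a → Σ≤ m (λ c → shiftᵗ f a c * g (suc n ∸ a) (m ∸ c)))) (cong (_+ conv₂ f g n m) (sumOver-0 (downFrom (suc m))))

  conv₂-shiftˣ : ∀ f g n m → conv₂ (shiftˣ f) g n m ≡ shiftˣ (conv₂ f g) n m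
  conv₂-shiftˣ f g n zero    = trans (Σ≤-ext n (λ _ → refl)) (sumOver-0 (downFrom (suc n)))
  conv₂-shiftˣ f g n (suc m) = Σ≤-ext n (λ a → sum-shift (suc m) (λ c → shiftˣ f a c * g (n ∸ a) (suc m ∸ c)))

  const-x : (ℕ → ℕ) → Series
  const-x f n zero    = f n
  const-x f n (suc m) = 0

  conv₂-const : ∀ f g n m → conv₂ (const-x f) g n m ≡ conv f (λ k → g k m) n
  conv₂-const f g n m = Σ≤-ext n (λ a → trans (sum-shift m (λ c → const-x f a c * g (n ∸ a) (m ∸ c))) (trans (cong (f a * g (n ∸ a) m +_) (sumOver-0 (downFrom m))) (ℕₚ.+-identityʳ _)))

  du ud : ℕ → Word
  du zero    = []
  du (suc k) = D ∷ U ∷ du k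
  ud zero    = []
  ud (suc k) = U ∷ D ∷ ud k

  ud-snoc : ∀ s → ud s ++ U ∷ D ∷ [] ≡ ud (suc s)
  ud-snoc zero    = refl
  ud-snoc (suc s) = cong (λ z → U ∷ D ∷ z) (ud-snoc s)

  u-du-d : ∀ s → U ∷ du s ++ [ D ] ≡ ud (suc s)
  u-du-d zero    = refl
  u-du-d (suc s) = cong (λ z → U ∷ D ∷ z) (u-du-d s)

  du-balanced : ∀ k → ups (du k) ≡ downs (du k)
  du-balanced zero    = refl
  du-balanced (suc k) = cong suc (du-balanced k)

  patch : ℕ → ℕ → ℕ → ℕ
  patch k s n = F.cnt n (du k ++ ud s)

  P : ℕ → ℕ → ℕ
  P k n = F.cnt n (ud k)

  -- D (DU)ᵏ U (DU)ʲ (UD)ⁱ: the words reached from (DU)ʲ⁺¹ (UD)ⁱ by peeling the first letter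
  V : ℕ → ℕ → ℕ → Word
  V k j i = D ∷ du k ++ U ∷ du j ++ ud i

  splits-ud : ∀ i (f : Word × Word → ℕ) → (∀ x y → ups x ≡ downs x → f (x , y) ≡ 0) → sumOver (F.splits U (ud i)) f ≡ 0
  splits-ud zero    f h = refl
  splits-ud (suc i) f h = cong₂ _+_ (h [] _ refl) (trans (sumOver-map (F.consˡ U) (map (F.consˡ D) (F.splits U (ud i))) f)
    (trans (sumOver-map (F.consˡ D) (F.splits U (ud i)) _) (splits-ud i _ (λ x y e → h (U ∷ D ∷ x) y (cong suc e)))))

  splits-du-ud : ∀ j i (f : Word × Word → ℕ) → (∀ x y → ups x ≡ downs x → f (x , y) ≡ 0) →
    sumOver (F.splits U (du j ++ ud i)) f ≡ sumOver (downFrom j) (λ s → f (du s ++ [ D ] , du (j ∸ suc s) ++ ud i))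
  splits-du-ud zero    i f h = splits-ud i f h
  splits-du-ud (suc j) i f h = trans (sumOver-map (F.consˡ D) (([] , du j ++ ud i) ∷ map (F.consˡ U) (F.splits U (du j ++ ud i))) f)
    (trans (cong (f (D ∷ [] , du j ++ ud i) +_) (trans (sumOver-map (F.consˡ U) (F.splits U (du j ++ ud i)) _)
      (splits-du-ud j i _ (λ x y e → h (D ∷ U ∷ x) y (cong suc e))))) (sym (sum-shift j _)))

  splits-du : ∀ k z (f : Word × Word → ℕ) → (∀ x y → downs x ≡ suc (ups x) → f (x , y) ≡ 0) →
    sumOver (F.splits U (du k ++ z)) f ≡ sumOver (F.splits U z) (λ (x , y) → f (du k ++ x , y))
  splits-du zero    z f h = refl
  splits-du (suc k) z f h = trans (sumOver-map (F.consˡ D) (([] , du k ++ z) ∷ map (F.consˡ U) (F.splits U (du k ++ z))) f)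
    (cong₂ _+_ (h (D ∷ []) _ refl) (trans (sumOver-map (F.consˡ U) (F.splits U (du k ++ z)) _) (splits-du k z _ (λ x y e → h (D ∷ U ∷ x) y (cong suc e)))))

  ups-suc≢ : ∀ w → downs w ≡ suc (ups w) → ups w ≢ downs w
  ups-suc≢ w e e′ = ℕₚ.1+n≢n (sym (trans e′ e))

  -- A split contributes only if the enclosed part is balanced. This excludes the steps U of `du k`
  -- and of `ud i`. What remains is the U in the middle, giving s = 0, and those of `du j`, where
  -- the enclosed part is `du k ++ ud s`.
  splits-V : ∀ n k j i → sumOver (F.splits U (du k ++ U ∷ du j ++ ud i)) (F.bridgeSum n) ≡ Σ≤ j (λ s → conv (patch k s) (patch (j ∸ s) i) n)
  splits-V n k j i = trans (splits-du k (U ∷ du j ++ ud i) (F.bridgeSum n) (λ x y e → bridge-unbalanced n x y (ups-suc≢ x e)))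
    (trans (cong (F.bridgeSum n (du k ++ [] , du j ++ ud i) +_) (trans (sumOver-map (F.consˡ U) (F.splits U (du j ++ ud i)) _)
        (trans (splits-du-ud j i (λ (x , y) → F.bridgeSum n (du k ++ U ∷ x , y)) (λ x y e → bridge-unbalanced n (du k ++ U ∷ x) y (unb x e)))
          (sumOver-ext (downFrom j) (λ s → cong (λ z → F.bridgeSum n (du k ++ z , du (j ∸ suc s) ++ ud i)) (u-du-d s))))))
      (sym (sum-shift j (λ s → conv (patch k s) (patch (j ∸ s) i) n))))
    where
    unb : ∀ x → ups x ≡ downs x → ups (du k ++ U ∷ x) ≢ downs (du k ++ U ∷ x)
    unb x e q = ℕₚ.1+n≢n (ℕₚ.+-cancelˡ-≡ (ups (du k)) _ _ (trans (sym (ups-++ (du k) (U ∷ x))) (trans q (trans (downs-++ (du k) (U ∷ x)) (cong₂ _+_ (sym (du-balanced k)) (sym e))))))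

  V-rotate : ∀ n k j i → F.cnt n (U ∷ D ∷ V k j i) ≡ F.cnt n (V k j (suc i))
  V-rotate n k j i = trans (F.cnt-swap n (U ∷ D ∷ []) (V k j i)) (cong (λ z → F.cnt n (D ∷ z))
    (trans (++-assoc (du k) (U ∷ du j ++ ud i) (U ∷ D ∷ [])) (cong (λ z → du k ++ U ∷ z) (trans (++-assoc (du j) (ud i) _) (cong (du j ++_) (ud-snoc i))))))

  -- The words V are closed under peeling: the quadrangle D D U lengthens `du k`, and U D D
  -- lengthens `ud i` after its first two letters have been rotated to the end.
  V-peel : ∀ n k j i → F.cnt n (V k j i) ≡ Σ≤ j (λ s → conv (patch k s) (patch (j ∸ s) i) n)
    + (shift (λ m → F.cnt m (V (suc k) j i)) n + shift (λ m → F.cnt m (V k j (suc i))) n)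
  V-peel zero    k j i = trans (F-zero D _) (trans (splits-V 0 k j i) (sym (ℕₚ.+-identityʳ _)))
  V-peel (suc n) k j i = trans (F-suc n D _) (cong₂ _+_ (splits-V (suc n) k j i)
    (trans (cong₂ _+_ (V-rotate n k j i) (ℕₚ.+-identityʳ _)) (ℕₚ.+-comm (F.cnt n (V k j (suc i))) _)))

  -- e k s = Σₗ zˡ⁺¹ tˡ patch (k + l) s with z = 1 / (1 - x), given here by its
  -- recursion (1 - x) e k s = patch k s + t e (k + 1) s.
  e : ℕ → ℕ → Series
  e k s zero    zero    = patch k s 0
  e k s zero    (suc m) = e k s zero m
  e k s (suc n) zero    = patch k s (suc n) + e (suc k) s n zero
  e k s (suc n) (suc m) = e (suc k) s n (suc m) + e k s (suc n) m

  e-rec : ∀ k s n m → e k s n m ≡ const-x (patch k s) n m + (shiftᵗ (e (suc k) s) n m + shiftˣ (e k s) n m)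
  e-rec k s zero    zero    = sym (ℕₚ.+-identityʳ _)
  e-rec k s zero    (suc m) = refl
  e-rec k s (suc n) zero    = cong (patch k s (suc n) +_) (sym (ℕₚ.+-identityʳ _))
  e-rec k s (suc n) (suc m) = refl

  -- The binomial is the coefficient of xᵐ in the (l + 1)-st power of 1 / (1 - x), and the recursion
  -- of `e` is Pascal's rule.
  e-closed : ∀ n m k s → e k s n m ≡ Σ≤ n (λ l → ((l + m) C m) * patch (k + l) s (n ∸ l))
  e-closed n m k s = go n m k
    where
    c : ℕ → ℕ → ℕ
    c l m = (l + m) C m
    c-first : ∀ m → c 0 m ≡ 1
    c-first m = nCn≡1 m
    pascal : ∀ l m → c (suc l) (suc m) ≡ c (suc l) m + c l (suc m)
    pascal l m = trans (sym (nCk+nC[k+1]≡[n+1]C[k+1] (l + suc m) m)) (cong (λ z → z C m + c l (suc m)) (ℕₚ.+-suc l m))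
    term0 : ∀ k n → patch (k + 0) s n ≡ patch k s n
    term0 k n = cong (λ z → patch z s n) (ℕₚ.+-identityʳ k)
    go : ∀ n m k → e k s n m ≡ Σ≤ n (λ l → c l m * patch (k + l) s (n ∸ l))
    go zero zero k = sym (trans (ℕₚ.+-identityʳ _) (trans (ℕₚ.*-identityˡ _) (term0 k 0)))
    go zero (suc m) k = trans (go zero m k) (cong (λ z → z * patch (k + 0) s 0 + 0) (trans (c-first m) (sym (c-first (suc m)))))
    go (suc n) zero k = sym (trans (sum-shift (suc n) (λ l → c l 0 * patch (k + l) s (suc n ∸ l))) (cong₂ _+_ (trans (ℕₚ.*-identityˡ _) (term0 k (suc n)))
      (trans (Σ≤-ext n (λ l → cong (λ z → 1 * patch z s (n ∸ l)) (ℕₚ.+-suc k l))) (sym (go n zero (suc k))))))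
    go (suc n) (suc m) k = sym (trans (sum-shift (suc n) (λ l → c l (suc m) * patch (k + l) s (suc n ∸ l))) (trans (cong₂ _+_ (cong (_* patch (k + 0) s (suc n)) (trans (c-first (suc m)) (sym (c-first m))))
        (trans (Σ≤-ext n (λ l → trans (cong (_* patch (k + suc l) s (n ∸ l)) (pascal l m)) (ℕₚ.*-distribʳ-+ (patch (k + suc l) s (n ∸ l)) (c (suc l) m) (c l (suc m)))))
          (sumOver-+ (downFrom (suc n)) (λ l → c (suc l) m * patch (k + suc l) s (n ∸ l)) (λ l → c l (suc m) * patch (k + suc l) s (n ∸ l)))))
      (trans (lem (c 0 m * patch (k + 0) s (suc n)) (Σ≤ n (λ l → c (suc l) m * patch (k + suc l) s (n ∸ l))) (Σ≤ n (λ l → c l (suc m) * patch (k + suc l) s (n ∸ l)))) (cong₂ _+_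
        (trans (Σ≤-ext n (λ l → cong (λ z → c l (suc m) * patch z s (n ∸ l)) (ℕₚ.+-suc k l))) (sym (go n (suc m) (suc k))))
        (trans (sym (sum-shift (suc n) (λ l → c l m * patch (k + l) s (suc n ∸ l)))) (sym (go (suc n) m k)))))))
      where
      lem : ∀ x y z → x + (y + z) ≡ z + (x + y)
      lem = solve-∀

  -- The coefficients in y of D = 1 / (1 - C(1/(1-x))); the first argument only serves termination.
  Dᶠ : ℕ → ℕ → Series
  Dᶠ f       zero    = δ
  Dᶠ zero    (suc j) = λ _ _ → 0
  Dᶠ (suc f) (suc j) n m = Σ≤ j (λ s → conv₂ (e 0 s) (Dᶠ f (j ∸ s)) n m)

  Dᶠ-fuel : ∀ f f′ j → j ≤ f → j ≤ f′ → ∀ n m → Dᶠ f j n m ≡ Dᶠ f′ j n m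
  Dᶠ-fuel f       f′       zero    p       p′       n m = refl
  Dᶠ-fuel (suc f) (suc f′) (suc j) (s≤s p) (s≤s p′) n m = Σ≤-ext j (λ s → conv₂-cong {f = e 0 s} n m (λ _ _ → refl)
    (Dᶠ-fuel f f′ (j ∸ s) (ℕₚ.≤-trans (ℕₚ.m∸n≤m j s) p) (ℕₚ.≤-trans (ℕₚ.m∸n≤m j s) p′)))

  Dₛ : ℕ → Series
  Dₛ j = Dᶠ j j

  -- For k = 0 this is the coefficient of yʲ⁺¹ in D, by D = 1 + C(1/(1-x)) D. Larger k replaces
  -- `e 0` by `e k` in the first factor; these are the series that belong to the words `V k j i`.
  Δ : ℕ → ℕ → Series
  Δ k j n m = Σ≤ j (λ s → conv₂ (e k s) (Dₛ (j ∸ s)) n m)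

  Dₛ-suc : ∀ j n m → Dₛ (suc j) n m ≡ Δ 0 j n m
  Dₛ-suc j n m = Σ≤-ext j (λ s → conv₂-cong {f = e 0 s} n m (λ _ _ → refl) (Dᶠ-fuel j (j ∸ s) (j ∸ s) (ℕₚ.m∸n≤m j s) ℕₚ.≤-refl))

  shift-sum : ∀ {X : Set} (xs : List X) (f : X → ℕ → ℕ) n → sumOver xs (λ x → shift (f x) n) ≡ shift (λ k → sumOver xs (λ x → f x k)) n
  shift-sum xs f zero    = sumOver-0 xs
  shift-sum xs f (suc n) = refl

  Δ-rec : ∀ k j n m → Δ k j n m ≡ Σ≤ j (λ s → conv (patch k s) (λ b → Dₛ (j ∸ s) b m) n) + (shiftᵗ (Δ (suc k) j) n m + shiftˣ (Δ k j) n m)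
  Δ-rec k j n m = trans (Σ≤-ext j term) (trans (sumOver-+ (downFrom (suc j)) (λ s → conv (patch k s) (λ b → Dₛ (j ∸ s) b m) n)
        (λ s → shiftᵗ (conv₂ (e (suc k) s) (Dₛ (j ∸ s))) n m + shiftˣ (conv₂ (e k s) (Dₛ (j ∸ s))) n m))
      (cong (Σ≤ j (λ s → conv (patch k s) (λ b → Dₛ (j ∸ s) b m) n) +_)
        (trans (sumOver-+ (downFrom (suc j)) (λ s → shiftᵗ (conv₂ (e (suc k) s) (Dₛ (j ∸ s))) n m) (λ s → shiftˣ (conv₂ (e k s) (Dₛ (j ∸ s))) n m))
          (cong₂ _+_ (shift-sum (downFrom (suc j)) (λ s b → conv₂ (e (suc k) s) (Dₛ (j ∸ s)) b m) n)
            (shift-sum (downFrom (suc j)) (λ s → conv₂ (e k s) (Dₛ (j ∸ s)) n) m)))))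
    where
    term : ∀ s → conv₂ (e k s) (Dₛ (j ∸ s)) n m ≡ conv (patch k s) (λ b → Dₛ (j ∸ s) b m) n
      + (shiftᵗ (conv₂ (e (suc k) s) (Dₛ (j ∸ s))) n m + shiftˣ (conv₂ (e k s) (Dₛ (j ∸ s))) n m)
    term s = trans (conv₂-cong {g = Dₛ (j ∸ s)} n m (e-rec k s) (λ _ _ → refl))
      (trans (conv₂-+ˡ (const-x (patch k s)) (λ a c → shiftᵗ (e (suc k) s) a c + shiftˣ (e k s) a c) (Dₛ (j ∸ s)) n m)
        (cong₂ _+_ (conv₂-const (patch k s) (Dₛ (j ∸ s)) n m)
          (trans (conv₂-+ˡ (shiftᵗ (e (suc k) s)) (shiftˣ (e k s)) (Dₛ (j ∸ s)) n m)
            (cong₂ _+_ (conv₂-shiftᵗ (e (suc k) s) (Dₛ (j ∸ s)) n m) (conv₂-shiftˣ (e k s) (Dₛ (j ∸ s)) n m)))))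

  -- G i X is the coefficient of xⁱ in P(t, tx) X(t, 1/x), divided by tⁱ
  G : ℕ → Series → ℕ → ℕ
  G i X n = Σ≤ n (λ m → conv (P (i + m)) (λ b → X b m) (n ∸ m))

  G-cong : ∀ i {X Y} n → (∀ b m → X b m ≡ Y b m) → G i X n ≡ G i Y n
  G-cong i n h = Σ≤-ext n (λ m → Σ≤-ext (n ∸ m) (λ a → cong (P (i + m) a *_) (h _ m)))

  G-+ : ∀ i X Y n → G i (λ b m → X b m + Y b m) n ≡ G i X n + G i Y n
  G-+ i X Y n = trans (Σ≤-ext n (λ m → conv-+ʳ (n ∸ m) (P (i + m)) (λ b → X b m) (λ b → Y b m)))
    (sumOver-+ (downFrom (suc n)) (λ m → conv (P (i + m)) (λ b → X b m) (n ∸ m)) (λ m → conv (P (i + m)) (λ b → Y b m) (n ∸ m)))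

  G-sum : ∀ i {A : Set} (xs : List A) (X : A → Series) n → G i (λ b m → sumOver xs (λ x → X x b m)) n ≡ sumOver xs (λ x → G i (X x) n)
  G-sum i xs X n = trans (Σ≤-ext n (λ m → conv-sumʳ (n ∸ m) (P (i + m)) xs (λ x b → X x b m))) (sumOver-swap (downFrom (suc n)) xs _)

  G-conv : ∀ i c X n → G i (λ b m → conv c (λ k → X k m) b) n ≡ conv c (G i X) n
  G-conv i c X n = trans (Σ≤-ext n (λ m → conv-swap (n ∸ m) (P (i + m)) c (λ k → X k m)))
    (trans (triangle n (λ m a → c a * conv (P (i + m)) (λ k → X k m) (n ∸ m ∸ a)))
      (Σ≤-ext n (λ a → trans (Σ≤-ext (n ∸ a) (λ m → cong (λ z → c a * conv (P (i + m)) (λ k → X k m) z)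
          (trans (ℕₚ.∸-+-assoc n m a) (trans (cong (n ∸_) (ℕₚ.+-comm m a)) (sym (ℕₚ.∸-+-assoc n a m))))))
        (sumOver-*ˡ (downFrom (suc (n ∸ a))) (c a) _))))

  G-shiftᵗ : ∀ i X n → G i (shiftᵗ X) n ≡ shift (G i X) n
  G-shiftᵗ i X zero    = trans (ℕₚ.+-identityʳ _) (conv-shiftʳ 0 (P (i + 0)) (λ b → X b 0))
  G-shiftᵗ i X (suc n) = cong₂ _+_ (trans (conv-shiftʳ (n ∸ n) (P (i + suc n)) (λ b → X b (suc n))) (cong (shift (conv (P (i + suc n)) (λ b → X b (suc n)))) (ℕₚ.n∸n≡0 n)))
    (Σ≤-cong n (λ m m≤n → trans (conv-shiftʳ (suc n ∸ m) (P (i + m)) (λ b → X b m)) (cong (shift (conv (P (i + m)) (λ b → X b m))) (ℕₚ.+-∸-assoc 1 m≤n))))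

  -- Since X is taken at 1/x, a factor x moves the extraction from xⁱ to xⁱ⁺¹, and the normalisation
  -- by tⁱ turns this into a factor t.
  G-shiftˣ : ∀ i X n → G i (shiftˣ X) n ≡ shift (G (suc i) X) n
  G-shiftˣ i X zero    = trans (ℕₚ.+-identityʳ _) (conv-0ʳ 0 (P (i + 0)))
  G-shiftˣ i X (suc n) = trans (sum-shift (suc n) (λ m → conv (P (i + m)) (λ b → shiftˣ X b m) (suc n ∸ m))) (cong₂ _+_ (conv-0ʳ (suc n) (P (i + 0)))
    (Σ≤-ext n (λ m → cong (λ z → conv (P z) (λ b → X b m) (n ∸ m)) (ℕₚ.+-suc i m))))

  G-δ : ∀ i n → G i δ n ≡ P i n
  G-δ i n = trans (sum-shift n _) (trans (cong₂ _+_ head (trans (sumOver-ext (downFrom n) (λ m → trans (Σ≤-ext (n ∸ suc m) (λ a → cong (P (i + suc m) a *_) (zero-x (n ∸ suc m ∸ a) m)))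
      (conv-0ʳ (n ∸ suc m) (P (i + suc m))))) (sumOver-0 (downFrom n)))) (trans (ℕₚ.+-identityʳ _) (cong (λ z → P z n) (ℕₚ.+-identityʳ i))))
    where
    zero-x : ∀ n m → δ n (suc m) ≡ 0
    zero-x zero    m = refl
    zero-x (suc n) m = refl
    pos : ∀ n a → a < n → δ (n ∸ a) 0 ≡ 0
    pos (suc n) zero    (s≤s h) = refl
    pos (suc n) (suc a) (s≤s h) = pos n a h
    below : ∀ n (f : ℕ → ℕ) → sumOver (downFrom n) (λ a → f a * δ (n ∸ a) 0) ≡ 0
    below n f = trans (sumOver-cong (downFrom n) (λ {a} i → trans (cong (f a *_) (pos n a (∈-downFrom⁻ i))) (ℕₚ.*-zeroʳ (f a)))) (sumOver-0 (downFrom n))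
    head : conv (P (i + 0)) (λ b → δ b 0) n ≡ P (i + 0) n
    head = trans (cong₂ _+_ (trans (cong (λ z → P (i + 0) n * δ z 0) (ℕₚ.n∸n≡0 n)) (ℕₚ.*-identityʳ _)) (below n (P (i + 0)))) (ℕₚ.+-identityʳ _)

  module _ (j : ℕ) (lower : ∀ s → s ≤ j → ∀ n i → patch s i n ≡ G i (Dₛ s) n) where

    -- Both sides obey one recursion in n. The split terms agree by induction on j; the term of
    -- `Δ-rec` with a factor t raises k, as the quadrangle D D U does, and the one with a factor x
    -- raises i, as U D D does.
    V≡G : ∀ n k i → F.cnt n (V k j i) ≡ G i (Δ k j) n
    V≡G n k i = trans (V-peel n k j i) (trans (cong₂ _+_ (Σ≤-ext j (λ s → conv-cong {f = patch k s} n (λ _ _ → refl) (λ b _ → lower (j ∸ s) (ℕₚ.m∸n≤m j s) b i)))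
        (cong₂ _+_ (st n) (sx n)))
      (sym (trans (G-cong i n (Δ-rec k j)) (trans (G-+ i A B n) (cong₂ _+_
        (trans (G-sum i (downFrom (suc j)) (λ s b m → conv (patch k s) (λ b → Dₛ (j ∸ s) b m) b) n) (Σ≤-ext j (λ s → G-conv i (patch k s) (Dₛ (j ∸ s)) n)))
        (trans (G-+ i (shiftᵗ (Δ (suc k) j)) (shiftˣ (Δ k j)) n) (cong₂ _+_ (G-shiftᵗ i (Δ (suc k) j) n) (G-shiftˣ i (Δ k j) n))))))))
      where
      A B : Series
      A b m = Σ≤ j (λ s → conv (patch k s) (λ b → Dₛ (j ∸ s) b m) b)
      B b m = shiftᵗ (Δ (suc k) j) b m + shiftˣ (Δ k j) b m
      st : ∀ n → shift (λ m → F.cnt m (V (suc k) j i)) n ≡ shift (G i (Δ (suc k) j)) n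
      st zero    = refl
      st (suc n) = V≡G n (suc k) i
      sx : ∀ n → shift (λ m → F.cnt m (V k j (suc i))) n ≡ shift (G (suc i) (Δ k j)) n
      sx zero    = refl
      sx (suc n) = V≡G n k (suc i)

  patch≡G : ∀ j n i → patch j i n ≡ G i (Dₛ j) n
  patch≡G-≤ : ∀ j s → s ≤ j → ∀ n i → patch s i n ≡ G i (Dₛ s) n
  patch≡G zero    n i = sym (G-δ i n)
  -- By definition `du (suc j) ++ ud i` is the word `V 0 j i`.
  patch≡G (suc j) n i = trans (V≡G j (patch≡G-≤ j) n 0 i) (sym (G-cong i n (Dₛ-suc j)))
  patch≡G-≤ j s s≤j with ℕₚ.m≤n⇒m<n∨m≡n s≤j
  patch≡G-≤ (suc j) s s≤j | inj₁ (s≤s h) = patch≡G-≤ j s h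
  patch≡G-≤ j       s s≤j | inj₂ refl    = patch≡G j

-- Uniqueness of the solution.

module SystemUnique where

  open import Defs
  open import Data.Nat using (ℕ; zero; suc; _∸_; _≤_; _<_; _≤ᵇ_; z≤n; s≤s)
  import Data.Nat.Properties as ℕₚ
  open import Data.Rational using (ℚ; 0ℚ; _+_; _*_; _-_; -_)
  import Data.Rational.Properties as ℚₚ
  open import Data.Bool using (if_then_else_)
  open import Data.List using ([]; _∷_)
  open import Data.Product using (_×_; _,_; proj₁; proj₂)
  open import Data.Sum using (inj₁; inj₂)
  open import Relation.Binary.PropositionalEquality

  sumTo-cong : ∀ n {f g : ℕ → ℚ} → (∀ k → k ≤ n → f k ≡ g k) → sumTo n f ≡ sumTo n g
  sumTo-cong zero    h = h 0 z≤n
  sumTo-cong (suc n) h = cong₂ _+_ (sumTo-cong n (λ k k≤n → h k (ℕₚ.m≤n⇒m≤1+n k≤n))) (h (suc n) ℕₚ.≤-refl)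

  sumTo-0 : ∀ n → sumTo n (λ _ → 0ℚ) ≡ 0ℚ
  sumTo-0 zero    = refl
  sumTo-0 (suc n) = trans (ℚₚ.+-identityʳ _) (sumTo-0 n)

  interchangeℚ : ∀ a b c d → (a + b) + (c + d) ≡ (a + c) + (b + d)
  interchangeℚ a b c d = trans (ℚₚ.+-assoc a b (c + d)) (trans (cong (a +_) (trans (sym (ℚₚ.+-assoc b c d)) (trans (cong (_+ d) (ℚₚ.+-comm b c)) (ℚₚ.+-assoc c b d))))
    (sym (ℚₚ.+-assoc a c (b + d))))

  sumTo-sub : ∀ n (f g : ℕ → ℚ) → sumTo n (λ k → f k - g k) ≡ sumTo n f - sumTo n g
  sumTo-sub zero    f g = refl
  sumTo-sub (suc n) f g = trans (cong (_+ (f (suc n) - g (suc n))) (sumTo-sub n f g)) (trans (interchangeℚ (sumTo n f) (- sumTo n g) (f (suc n)) (- g (suc n)))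
    (cong ((sumTo n f + f (suc n)) +_) (sym (ℚₚ.neg-distrib-+ (sumTo n g) (g (suc n))))))

  sumTo-last : ∀ n (f : ℕ → ℚ) → (∀ k → k < n → f k ≡ 0ℚ) → sumTo n f ≡ f n
  sumTo-last zero    f h = refl
  sumTo-last (suc n) f h = trans (cong (_+ f (suc n)) (trans (sumTo-cong n (λ k k≤n → h k (s≤s k≤n))) (sumTo-0 n))) (ℚₚ.+-identityˡ _)

  one3-n : ∀ {k} j m → 0 < k → one3 k j m ≡ 0ℚ
  one3-n {suc k} j m lt = refl
  one3-j : ∀ {k} m → 0 < k → one3 0 k m ≡ 0ℚ
  one3-j {suc k} m lt = refl
  one3-m : ∀ {k} → 0 < k → one3 0 0 k ≡ 0ℚ
  one3-m {suc k} lt = refl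

  mul3-one : ∀ (A : DSer) n j m → mul3 A one3 n j m ≡ A n j m
  mul3-one A n j m =
    trans (sumTo-last n _ (λ a a<n → trans (sumTo-cong j (λ b _ → trans (sumTo-cong m (λ c _ → zero-* (A a b c) (one3-n (j ∸ b) (m ∸ c) (ℕₚ.m<n⇒0<n∸m a<n)))) (sumTo-0 m))) (sumTo-0 j)))
    (trans (sumTo-last j _ (λ b b<j → trans (sumTo-cong m (λ c _ → zero-* (A n b c) (trans (cong (λ k → one3 k (j ∸ b) (m ∸ c)) (ℕₚ.n∸n≡0 n)) (one3-j (m ∸ c) (ℕₚ.m<n⇒0<n∸m b<j))))) (sumTo-0 m)))
    (trans (sumTo-last m _ (λ c c<m → zero-* (A n j c) (trans (cong₂ (λ k l → one3 k l (m ∸ c)) (ℕₚ.n∸n≡0 n) (ℕₚ.n∸n≡0 j)) (one3-m (ℕₚ.m<n⇒0<n∸m c<m)))))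
    (trans (cong (A n j m *_) (trans (cong₂ (λ k l → one3 k l (m ∸ m)) (ℕₚ.n∸n≡0 n) (ℕₚ.n∸n≡0 j)) (cong (one3 0 0) (ℕₚ.n∸n≡0 m)))) (ℚₚ.*-identityʳ _))))
    where
    zero-* : ∀ x {y} → y ≡ 0ℚ → x * y ≡ 0ℚ
    zero-* x refl = ℚₚ.*-zeroʳ x

  oneMinus-one3 : ∀ E n j m → oneMinus E n j m ≡ one3 n j m - E n j m
  oneMinus-one3 E zero    zero    zero    = refl
  oneMinus-one3 E zero    zero    (suc m) = sym (ℚₚ.+-identityˡ _)
  oneMinus-one3 E zero    (suc j) m       = sym (ℚₚ.+-identityˡ _)
  oneMinus-one3 E (suc n) j       m       = sym (ℚₚ.+-identityˡ _)

  *-distribˡ-sub : ∀ x y z → x * (y - z) ≡ x * y - x * z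
  *-distribˡ-sub x y z = trans (ℚₚ.*-distribˡ-+ x y (- z)) (cong (x * y +_) (sym (ℚₚ.neg-distribʳ-* x z)))

  mul3-oneMinus : ∀ A E n j m → mul3 A (oneMinus E) n j m ≡ A n j m - mul3 A E n j m
  mul3-oneMinus A E n j m = trans
    (trans (sumTo-cong n (λ a _ → trans (sumTo-cong j (λ b _ → trans (sumTo-cong m (λ c _ →
        trans (cong (A a b c *_) (oneMinus-one3 E (n ∸ a) (j ∸ b) (m ∸ c))) (*-distribˡ-sub (A a b c) (one3 (n ∸ a) (j ∸ b) (m ∸ c)) (E (n ∸ a) (j ∸ b) (m ∸ c)))))
        (sumTo-sub m (f a b) (g a b)))) (sumTo-sub j (λ b → sumTo m (f a b)) (λ b → sumTo m (g a b)))))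
      (sumTo-sub n (λ a → sumTo j (λ b → sumTo m (f a b))) (λ a → sumTo j (λ b → sumTo m (g a b)))))
    (cong (_- mul3 A E n j m) (mul3-one A n j m))
    where
    f g : ℕ → ℕ → ℕ → ℚ
    f a b c = A a b c * one3 (n ∸ a) (j ∸ b) (m ∸ c)
    g a b c = A a b c * E (n ∸ a) (j ∸ b) (m ∸ c)

  -- The equation A (1 - E) = 1 in the form A = 1 + A E, which serves as a recursion for A as soon
  -- as E has no constant term in y.
  unfold : ∀ A E n j m → mul3 A (oneMinus E) n j m ≡ one3 n j m → A n j m ≡ one3 n j m + mul3 A E n j m
  unfold A E n j m e = trans (sym (trans (ℚₚ.+-assoc (A n j m) (- mul3 A E n j m) (mul3 A E n j m))
      (trans (cong (A n j m +_) (ℚₚ.+-inverseˡ (mul3 A E n j m))) (ℚₚ.+-identityʳ _))))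
    (cong (_+ mul3 A E n j m) (trans (sym (mul3-oneMinus A E n j m)) e))

  fold : ∀ A E n j m → A n j m ≡ one3 n j m + mul3 A E n j m → mul3 A (oneMinus E) n j m ≡ one3 n j m
  fold A E n j m e = trans (mul3-oneMinus A E n j m) (trans (cong (_- mul3 A E n j m) e)
    (trans (ℚₚ.+-assoc (one3 n j m) _ _) (trans (cong (one3 n j m +_) (ℚₚ.+-inverseʳ (mul3 A E n j m))) (ℚₚ.+-identityʳ _))))

  sumPoly-0 : ∀ xs g → (∀ i → coeffL xs i ≡ 0ℚ) → sumPoly xs g ≡ 0ℚ
  sumPoly-0 []       g h = refl
  sumPoly-0 (x ∷ xs) g h = trans (cong₂ _+_ (trans (cong (_* g 0) (h 0)) (ℚₚ.*-zeroˡ (g 0))) (sumPoly-0 xs _ (λ i → h (suc i)))) (ℚₚ.+-identityˡ 0ℚ)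

  -- The lists representing C may differ by trailing zeros, which substitution does not see.
  sumPoly-ext : ∀ xs ys g → (∀ i → coeffL xs i ≡ coeffL ys i) → sumPoly xs g ≡ sumPoly ys g
  sumPoly-ext []       ys       g h = sym (sumPoly-0 ys g (λ i → sym (h i)))
  sumPoly-ext (x ∷ xs) []       g h = sumPoly-0 (x ∷ xs) g h
  sumPoly-ext (x ∷ xs) (y ∷ ys) g h = cong₂ _+_ (cong (_* g 0) (h 0)) (sumPoly-ext xs ys _ (λ i → h (suc i)))

  *-congℚ : ∀ x x′ y y′ → x ≡ x′ → y ≡ y′ → x * y ≡ x′ * y′
  *-congℚ _ _ _ _ refl refl = refl

  *-0ℚ : ∀ x y → y ≡ 0ℚ → x * y ≡ 0ℚ
  *-0ℚ x y refl = ℚₚ.*-zeroʳ x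

  module Unique {P C D P′ C′ D′} (S : System P C D) (S′ : System P′ C′ D′) where
    private
      module S  = System S
      module S′ = System S′

    SameC SameD : ℕ → ℕ → Set
    SameC n j = ∀ i → coeffL (C n j) i ≡ coeffL (C′ n j) i
    SameD n j = ∀ m → D n j m ≡ D′ n j m

    Same : ℕ → Set
    Same n = (∀ k → P n k ≡ P′ n k) × (∀ j → SameC n j) × (∀ j → SameD n j)

    E-zero : ∀ n m → substC C n 0 m ≡ 0ℚ
    E-zero n m = sumPoly-0 (C n 0) (λ i → invPow i m) (S.eqC n 0)
    E-zero′ : ∀ n m → substC C′ n 0 m ≡ 0ℚ
    E-zero′ n m = sumPoly-0 (C′ n 0) (λ i → invPow i m) (S′.eqC n 0)

    module Level (n : ℕ) (below : ∀ k → k < n → Same k) where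

      -- In P(t, tx) the coefficient `P a k` comes with total t-degree a + k. At level n the case a
      -- = n therefore leaves only k = 0, where the initial condition gives the value; everything
      -- else lies on lower levels.
      sameP : ∀ a k → a ≤ n → k ≤ n ∸ a → P a k ≡ P′ a k
      sameP a k a≤n k≤ with ℕₚ.m≤n⇒m<n∨m≡n a≤n
      ... | inj₁ a<n  = proj₁ (below a a<n) k
      ... | inj₂ refl with subst (k ≤_) (ℕₚ.n∸n≡0 n) k≤
      ...   | z≤n = trans (S.init n) (sym (S′.init n))

      at : (T : ℕ → Set) → (∀ k → k < n → T k) → T n → ∀ k → k ≤ n → T k
      at T lt eq k k≤n with ℕₚ.m≤n⇒m<n∨m≡n k≤n
      ... | inj₁ k<n  = lt k k<n
      ... | inj₂ refl = eq

      stepC : ∀ j → SameD n j → SameC n (suc j)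
      stepC j sd zero    = trans (S.eqC n (suc j) 0) (sym (S′.eqC n (suc j) 0))
      stepC j sd (suc i) = trans (S.eqC n (suc j) (suc i)) (trans
        (sumTo-cong n (λ a a≤n → sumTo-cong (n ∸ a) (λ k k≤ → cong (λ z → if i ≤ᵇ k then z else 0ℚ) (*-congℚ (P a k) (P′ a k) (D ((n ∸ a) ∸ k) j (k ∸ i)) (D′ ((n ∸ a) ∸ k) j (k ∸ i)) (sameP a k a≤n k≤)
          (at (λ b → SameD b j) (λ b b<n → proj₂ (proj₂ (below b b<n)) j) sd ((n ∸ a) ∸ k) (ℕₚ.≤-trans (ℕₚ.m∸n≤m (n ∸ a) k) (ℕₚ.m∸n≤m n a)) (k ∸ i))))))
        (sym (S′.eqC n (suc j) (suc i))))

      stepD : ∀ j → (∀ b → b < j → SameD n b) → (∀ b → b ≤ j → SameC n b) → SameD n j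
      stepD j sd sc m = trans (unfold D (substC C) n j m (S.eqD n j m)) (trans (cong (one3 n j m +_)
          (sumTo-cong n λ a a≤n → sumTo-cong j λ b b≤j → sumTo-cong m λ c _ → term a b c a≤n b≤j))
        (sym (unfold D′ (substC C′) n j m (S′.eqD n j m))))
        where
        term : ∀ a b c → a ≤ n → b ≤ j → D a b c * substC C (n ∸ a) (j ∸ b) (m ∸ c) ≡ D′ a b c * substC C′ (n ∸ a) (j ∸ b) (m ∸ c)
        term a b c a≤n b≤j with ℕₚ.m≤n⇒m<n∨m≡n b≤j
        ... | inj₁ b<j = *-congℚ (D a b c) (D′ a b c) (substC C (n ∸ a) (j ∸ b) (m ∸ c)) (substC C′ (n ∸ a) (j ∸ b) (m ∸ c)) (at (λ a → SameD a b) (λ a a<n → proj₂ (proj₂ (below a a<n)) b) (sd b b<j) a a≤n c)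
          (sumPoly-ext (C (n ∸ a) (j ∸ b)) (C′ (n ∸ a) (j ∸ b)) (λ i → invPow i (m ∸ c))
            (at (λ k → SameC k (j ∸ b)) (λ k k<n → proj₁ (proj₂ (below k k<n)) (j ∸ b)) (sc (j ∸ b) (ℕₚ.m∸n≤m j b)) (n ∸ a) (ℕₚ.m∸n≤m n a)))
        -- The unknown coefficient of D at the current power of y is multiplied by the coefficient
        -- of y⁰ in C, which vanishes.
        ... | inj₂ refl = trans (*-0ℚ (D a b c) (substC C (n ∸ a) (b ∸ b) (m ∸ c)) (trans (cong (λ z → substC C (n ∸ a) z (m ∸ c)) (ℕₚ.n∸n≡0 b)) (E-zero (n ∸ a) (m ∸ c))))
          (sym (*-0ℚ (D′ a b c) (substC C′ (n ∸ a) (b ∸ b) (m ∸ c)) (trans (cong (λ z → substC C′ (n ∸ a) z (m ∸ c)) (ℕₚ.n∸n≡0 b)) (E-zero′ (n ∸ a) (m ∸ c)))))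

      upTo : ∀ j → (∀ b → b ≤ j → SameC n b) × (∀ b → b ≤ j → SameD n b)
      upTo zero = sc , λ { zero z≤n → stepD 0 (λ _ ()) sc }
        where
        sc : ∀ b → b ≤ 0 → SameC n b
        sc zero z≤n i = trans (S.eqC n 0 i) (sym (S′.eqC n 0 i))
      upTo (suc j) = sc , sd
        where
        sc : ∀ b → b ≤ suc j → SameC n b
        sc b b≤ with ℕₚ.m≤n⇒m<n∨m≡n b≤
        ... | inj₁ (s≤s b≤j) = proj₁ (upTo j) b b≤j
        ... | inj₂ refl      = stepC j (proj₂ (upTo j) j ℕₚ.≤-refl)
        sd : ∀ b → b ≤ suc j → SameD n b
        sd b b≤ with ℕₚ.m≤n⇒m<n∨m≡n b≤
        ... | inj₁ (s≤s b≤j) = proj₂ (upTo j) b b≤j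
        ... | inj₂ refl      = stepD (suc j) (λ b b<j → proj₂ (upTo j) b (ℕₚ.≤-pred b<j)) sc

      same : Same n
      same = (λ k → trans (S.eqP n k) (trans (proj₁ (upTo (suc k)) (suc k) ℕₚ.≤-refl 1) (sym (S′.eqP n k)))) ,
        (λ j → proj₁ (upTo j) j ℕₚ.≤-refl) , (λ j → proj₂ (upTo j) j ℕₚ.≤-refl)

    below : ∀ n k → k < n → Same k
    below (suc n) k (s≤s k≤n) with ℕₚ.m≤n⇒m<n∨m≡n k≤n
    ... | inj₁ k<n  = below n k k<n
    ... | inj₂ refl = Level.same k (below k)

    sameTriple : SameTriple P C D P′ C′ D′
    sameTriple = (λ n k → proj₁ (same n) k) , (λ n j i → proj₁ (proj₂ (same n)) j i) , (λ n j m → proj₂ (proj₂ (same n)) j m)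
      where
      same : ∀ n → Same n
      same n = Level.same n (below n)

-- The patch series solve the system.

module SystemSolution where

  open import Defs
  open Counting
  open FaceClasses
  open Starred
  open OpenWords using (F-zero; F-suc)
  open KeptWords using (sum-shift)
  open Patches
  open SystemUnique
  open import Data.Nat as ℕ using (ℕ; zero; suc; _+_; _*_; _∸_; _≤_; _<_; _≤ᵇ_; s≤s)
  import Data.Nat.Properties as ℕₚ
  open import Data.Nat.Combinatorics using (_C_)
  open import Data.Integer as ℤ using ()
  import Data.Integer.Properties as ℤₚ
  open import Data.Rational as ℚ using (ℚ; 0ℚ)
  import Data.Rational.Properties as ℚₚ
  open import Data.Rational.Unnormalised as ℚᵘ using (mkℚᵘ; *≡*)
  import Data.Rational.Unnormalised.Properties as ℚᵘₚ
  open import Data.Bool using (Bool; true; false; not; if_then_else_)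
  open import Data.List using ([]; _∷_; _++_; length; map; downFrom; applyUpTo)
  open import Data.List.Properties using (length-++; map-++)
  open import Data.List.Membership.Propositional using (_∈_)
  open import Data.Product using (_×_; _,_; proj₁; proj₂)
  open import Data.Sum using (inj₁; inj₂)
  open import Relation.Nullary using (yes; no)
  open import Relation.Binary.PropositionalEquality

  neg : Word → Word
  neg = map not

  neg-splits : ∀ x v (f : Word × Word → ℕ) → sumOver (F.splits (not x) (neg v)) f ≡ sumOver (F.splits x v) (λ (a , b) → f (neg a , neg b))
  neg-splits x []      f = refl
  neg-splits x (y ∷ v) f = go x y
    where
    tailed : sumOver (map (F.consˡ (not y)) (F.splits (not x) (neg v))) f ≡ sumOver (map (F.consˡ y) (F.splits x v)) (λ (a , b) → f (neg a , neg b))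
    tailed = trans (sumOver-map (F.consˡ (not y)) (F.splits (not x) (neg v)) f) (trans (neg-splits x v _) (sym (sumOver-map (F.consˡ y) (F.splits x v) _)))
    go : ∀ x′ y′ → sumOver (F.splits-here (not x′) (not y′) (neg v) ++ map (F.consˡ (not y)) (F.splits (not x) (neg v))) f
       ≡ sumOver (F.splits-here x′ y′ v ++ map (F.consˡ y) (F.splits x v)) (λ (a , b) → f (neg a , neg b))
    go true  true  = cong (f ([] , neg v) +_) tailed
    go false false = cong (f ([] , neg v) +_) tailed
    go true  false = tailed
    go false true  = tailed

  -- Exchanging up and down permutes the four quadrangle words, so it preserves every term of
  -- Tutte's equation.
  cnt-neg : ∀ n w → F.cnt n (neg w) ≡ F.cnt n w
  cnt-neg-fuel : ∀ n f w → length w < f → F.cnt n (neg w) ≡ F.cnt n w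
  cnt-neg-< : ∀ n k → k < n → ∀ w → F.cnt k (neg w) ≡ F.cnt k w

  splits-neg : ∀ n f s v → (∀ w → length w < f → F.cnt n (neg w) ≡ F.cnt n w) → (∀ k → k < n → ∀ w → F.cnt k (neg w) ≡ F.cnt k w) → length v < f →
    sumOver (F.splits (not s) (neg v)) (F.bridgeSum n) ≡ sumOver (F.splits s v) (F.bridgeSum n)
  splits-neg n f s v here′ lower lt = trans (neg-splits s v (F.bridgeSum n)) (sumOver-cong (F.splits s v) λ {(a , b)} i →
      conv-cong n (λ k k≤n → pick k k≤n a (proj₁ (len a b i))) (λ k k≤n → pick k k≤n b (proj₂ (len a b i))))
    where
    pick : ∀ k → k ≤ n → ∀ w → length w < suc (length v) → F.cnt k (neg w) ≡ F.cnt k w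
    pick k k≤n w lw with ℕₚ.m≤n⇒m<n∨m≡n k≤n
    ... | inj₁ k<n  = lower k k<n w
    ... | inj₂ refl = here′ w (ℕₚ.≤-trans lw lt)
    len : ∀ a b → (a , b) ∈ F.splits s v → length a < suc (length v) × length b < suc (length v)
    len a b i with F.splits-sound s v i
    ... | refl = s≤s (subst (length a ≤_) (sym (length-++ a)) (ℕₚ.m≤m+n (length a) _)) ,
                 s≤s (subst (length b ≤_) (sym (length-++ a)) (ℕₚ.≤-trans (ℕₚ.n≤1+n _) (ℕₚ.m≤n+m (suc (length b)) (length a))))

  quadCand-neg : ∀ s → quadCand (not s) 0 ≡ map neg (quadCand s 0)
  quadCand-neg true  = refl
  quadCand-neg false = refl

  cnt-neg-fuel n       (suc f) []      lt = refl
  cnt-neg-fuel zero    (suc f) (s ∷ v) (s≤s lt) = trans (F-zero (not s) (neg v)) (trans (splits-neg 0 f (not s) v (cnt-neg-fuel 0 f) (cnt-neg-< 0) lt) (sym (F-zero s v)))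
  cnt-neg-fuel (suc n) (suc f) (s ∷ v) (s≤s lt) = trans (F-suc n (not s) (neg v)) (trans (cong₂ _+_
      (splits-neg (suc n) f (not s) v (cnt-neg-fuel (suc n) f) (cnt-neg-< (suc n)) lt)
      (trans (cong (λ l → sumOver l (λ p → F.cnt n (p ++ neg v))) (quadCand-neg s)) (trans (sumOver-map neg (quadCand s 0) _)
        (sumOver-ext (quadCand s 0) (λ p → trans (cong (F.cnt n) (sym (map-++ not p v))) (cnt-neg-< (suc n) n ℕₚ.≤-refl (p ++ v)))))))
    (sym (F-suc n s v)))
  cnt-neg n w = cnt-neg-fuel n (suc (length w)) w ℕₚ.≤-refl
  cnt-neg-< (suc n) k (s≤s k≤n) w with ℕₚ.m≤n⇒m<n∨m≡n k≤n
  ... | inj₁ k<n  = cnt-neg-< n k k<n w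
  ... | inj₂ refl = cnt-neg-fuel k (suc (length w)) w ℕₚ.≤-refl

  neg-du : ∀ k → neg (du k) ≡ ud k
  neg-du zero    = refl
  neg-du (suc k) = cong (λ z → U ∷ D ∷ z) (neg-du k)

  neg-ud : ∀ k → neg (ud k) ≡ du k
  neg-ud zero    = refl
  neg-ud (suc k) = cong (λ z → D ∷ U ∷ z) (neg-ud k)

  -- Rotation swaps the two blocks and exchanging up with down restores their types. The symmetry is
  -- needed because the equation for C produces tⁱ with the second index i, while `e` sums over the
  -- first index.
  patch-sym : ∀ k s n → patch k s n ≡ patch s k n
  patch-sym k s n = trans (F.cnt-swap n (du k) (ud s)) (trans (sym (cnt-neg n (ud s ++ du k)))
    (cong (F.cnt n) (trans (map-++ not (ud s) (du k)) (cong₂ _++_ (neg-ud s) (neg-du k)))))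

  patch-0 : ∀ k n → patch k 0 n ≡ P k n
  patch-0 k n = patch-sym k 0 n

  -- Sums and products are compared on the unnormalised fractions n/1, where no common divisor has
  -- to be cancelled.
  ℕtoℚᵘ : ∀ n → ℚ.toℚᵘ (ℕtoℚ n) ℚᵘ.≃ mkℚᵘ (ℤ.+ n) 0
  ℕtoℚᵘ n = ℚₚ.toℚᵘ-fromℚᵘ (mkℚᵘ (ℤ.+ n) 0)

  ℕtoℚ-+ : ∀ a b → ℕtoℚ (a + b) ≡ ℕtoℚ a ℚ.+ ℕtoℚ b
  ℕtoℚ-+ a b = ℚₚ.toℚᵘ-injective (ℚᵘₚ.≃-trans (ℕtoℚᵘ (a + b)) (ℚᵘₚ.≃-sym (ℚᵘₚ.≃-trans (ℚₚ.toℚᵘ-homo-+ (ℕtoℚ a) (ℕtoℚ b))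
    (ℚᵘₚ.≃-trans (ℚᵘₚ.+-cong (ℕtoℚᵘ a) (ℕtoℚᵘ b)) (*≡* (cong (ℤ._* ℤ.+ 1) (cong₂ ℤ._+_ (ℤₚ.*-identityʳ (ℤ.+ a)) (ℤₚ.*-identityʳ (ℤ.+ b)))))))))

  ℕtoℚ-* : ∀ a b → ℕtoℚ (a * b) ≡ ℕtoℚ a ℚ.* ℕtoℚ b
  ℕtoℚ-* a b = ℚₚ.toℚᵘ-injective (ℚᵘₚ.≃-trans (ℕtoℚᵘ (a * b)) (ℚᵘₚ.≃-sym (ℚᵘₚ.≃-trans (ℚₚ.toℚᵘ-homo-* (ℕtoℚ a) (ℕtoℚ b))
    (ℚᵘₚ.≃-trans (ℚᵘₚ.*-cong (ℕtoℚᵘ a) (ℕtoℚᵘ b)) (*≡* (cong (ℤ._* ℤ.+ 1) (sym (ℤₚ.pos-* a b))))))))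

  ℕtoℚ-Σ : ∀ n (f : ℕ → ℕ) → ℕtoℚ (Σ≤ n f) ≡ sumTo n (λ k → ℕtoℚ (f k))
  ℕtoℚ-Σ zero    f = cong ℕtoℚ (ℕₚ.+-identityʳ (f 0))
  ℕtoℚ-Σ (suc n) f = trans (ℕtoℚ-+ (f (suc n)) (Σ≤ n f)) (trans (ℚₚ.+-comm (ℕtoℚ (f (suc n))) _) (cong (ℚ._+ ℕtoℚ (f (suc n))) (ℕtoℚ-Σ n f)))

  Pₛ : PSer
  Pₛ n k = ℕtoℚ (P k n)

  -- The factor tⁱ shifts the patch series by i. It also bounds the degree in x: `Cₛ` uses i up to n
  -- only, which makes its coefficients polynomials and keeps the subtraction honest.
  coefficient : ℕ → ℕ → ℕ → ℕ
  coefficient n j i = patch j i (n ∸ i)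

  Cₛ : CSer
  Cₛ n zero    = []
  Cₛ n (suc j) = 0ℚ ∷ applyUpTo (λ i → ℕtoℚ (coefficient n j i)) (suc n)

  Dℚ : DSer
  Dℚ n j m = ℕtoℚ (Dₛ j n m)

  coeff-< : ∀ len (g : ℕ → ℚ) i → i < len → coeffL (applyUpTo g len) i ≡ g i
  coeff-< (suc len) g zero    (s≤s h) = refl
  coeff-< (suc len) g (suc i) (s≤s h) = coeff-< len (λ k → g (suc k)) i h

  coeff-≥ : ∀ len (g : ℕ → ℚ) i → len ≤ i → coeffL (applyUpTo g len) i ≡ 0ℚ
  coeff-≥ zero    g i       h       = refl
  coeff-≥ (suc len) g (suc i) (s≤s h) = coeff-≥ len (λ k → g (suc k)) i h

  Hℕ : ℕ → ℕ → ℕ → ℕ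
  Hℕ n j i = Σ≤ n (λ a → Σ≤ (n ∸ a) (λ k → if i ≤ᵇ k then P k a * Dₛ j ((n ∸ a) ∸ k) (k ∸ i) else 0))

  Hℕ-correct : ∀ n j i → Hcoeff Pₛ Dℚ n j i ≡ ℕtoℚ (Hℕ n j i)
  Hℕ-correct n j i = sym (trans (ℕtoℚ-Σ n (λ a → Σ≤ (n ∸ a) (term a))) (sumTo-cong n λ a _ → trans (ℕtoℚ-Σ (n ∸ a) (term a)) (sumTo-cong (n ∸ a) λ k _ → go a k (i ≤ᵇ k))))
    where
    term : ℕ → ℕ → ℕ
    term a k = if i ≤ᵇ k then P k a * Dₛ j ((n ∸ a) ∸ k) (k ∸ i) else 0
    go : ∀ a k b → ℕtoℚ (if b then P k a * Dₛ j ((n ∸ a) ∸ k) (k ∸ i) else 0) ≡ (if b then Pₛ a k ℚ.* Dℚ ((n ∸ a) ∸ k) j (k ∸ i) else 0ℚ)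
    go a k true  = ℕtoℚ-* (P k a) (Dₛ j ((n ∸ a) ∸ k) (k ∸ i))
    go a k false = refl

  Σ≤-if : ∀ i n (h : ℕ → ℕ) → Σ≤ (i + n) (λ k → if i ≤ᵇ k then h k else 0) ≡ Σ≤ n (λ m → h (i + m))
  Σ≤-if zero    n h = refl
  Σ≤-if (suc i) n h = trans (sum-shift (suc (i + n)) (λ k → if suc i ≤ᵇ k then h k else 0))
    (trans (Σ≤-ext (i + n) (λ k → cong (λ b → if b then h (suc k) else 0) (lem i k))) (Σ≤-if i n (λ k → h (suc k))))
    where
    lem : ∀ i k → (suc i ≤ᵇ suc k) ≡ (i ≤ᵇ k)
    lem zero    k = refl
    lem (suc i) k = refl

  ≤ᵇ-false : ∀ i k → k < i → (i ≤ᵇ k) ≡ false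
  ≤ᵇ-false (suc i) zero    h       = refl
  ≤ᵇ-false (suc (suc i)) (suc k) (s≤s h) = ≤ᵇ-false (suc i) k h

  if-Σ : ∀ (b : Bool) n (f : ℕ → ℕ) → Σ≤ n (λ a → if b then f a else 0) ≡ (if b then Σ≤ n f else 0)
  if-Σ true  n f = refl
  if-Σ false n f = sumOver-0 (downFrom (suc n))

  Hℕ-flip : ∀ n j i → Hℕ n j i ≡ Σ≤ n (λ k → if i ≤ᵇ k then Σ≤ (n ∸ k) (λ a → P k a * Dₛ j ((n ∸ a) ∸ k) (k ∸ i)) else 0)
  Hℕ-flip n j i = trans (triangle n (λ a k → if i ≤ᵇ k then P k a * Dₛ j ((n ∸ a) ∸ k) (k ∸ i) else 0))
    (Σ≤-ext n (λ k → if-Σ (i ≤ᵇ k) (n ∸ k) (λ a → P k a * Dₛ j ((n ∸ a) ∸ k) (k ∸ i))))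

  Hℕ-> : ∀ n j i → n < i → Hℕ n j i ≡ 0
  Hℕ-> n j i n<i = trans (Hℕ-flip n j i) (trans (Σ≤-cong n (λ k k≤n → cong (λ b → if b then Σ≤ (n ∸ k) (λ a → P k a * Dₛ j ((n ∸ a) ∸ k) (k ∸ i)) else 0)
    (≤ᵇ-false i k (ℕₚ.≤-<-trans k≤n n<i)))) (sumOver-0 (downFrom (suc n))))

  -- Every contribution to xⁱ carries tⁱ because P is taken at tx. Removing this power leaves the
  -- extraction `G i`, which is the patch series.
  Hℕ-≤ : ∀ n j i → Hℕ (i + n) j i ≡ patch j i n
  Hℕ-≤ n j i = trans (Hℕ-flip (i + n) j i) (trans (Σ≤-if i n _) (trans (Σ≤-ext n inner) (sym (patch≡G j n i))))
    where
    inner : ∀ m → Σ≤ (i + n ∸ (i + m)) (λ a → P (i + m) a * Dₛ j ((i + n ∸ a) ∸ (i + m)) (i + m ∸ i)) ≡ conv (P (i + m)) (λ b → Dₛ j b m) (n ∸ m)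
    inner m = trans (cong (λ z → Σ≤ z (λ a → P (i + m) a * Dₛ j ((i + n ∸ a) ∸ (i + m)) (i + m ∸ i))) (ℕₚ.[m+n]∸[m+o]≡n∸o i n m))
      (Σ≤-ext (n ∸ m) (λ a → cong (P (i + m) a *_) (cong₂ (Dₛ j)
        (trans (ℕₚ.∸-+-assoc (i + n) a (i + m)) (trans (cong (i + n ∸_) (ℕₚ.+-comm a (i + m))) (trans (sym (ℕₚ.∸-+-assoc (i + n) (i + m) a)) (cong (_∸ a) (ℕₚ.[m+n]∸[m+o]≡n∸o i n m)))))
        (ℕₚ.m+n∸m≡n i m))))

  solves-C : ∀ n j i → coeffL (Cₛ n j) i ≡ Crhs Pₛ Dℚ n j i
  solves-C n zero    i       = refl
  solves-C n (suc j) zero    = refl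
  solves-C n (suc j) (suc i) with i ℕ.≤? n
  ... | yes i≤n = trans (coeff-< (suc n) (λ k → ℕtoℚ (coefficient n j k)) i (s≤s i≤n)) (sym (trans (Hℕ-correct n j i) (cong ℕtoℚ
      (trans (cong (λ z → Hℕ z j i) (sym (ℕₚ.m+[n∸m]≡n i≤n))) (Hℕ-≤ (n ∸ i) j i)))))
  ... | no i≰n = trans (coeff-≥ (suc n) (λ k → ℕtoℚ (coefficient n j k)) i (ℕₚ.≰⇒> i≰n)) (sym (trans (Hℕ-correct n j i) (cong ℕtoℚ (Hℕ-> n j i (ℕₚ.≰⇒> i≰n)))))

  sumPoly-applyUpTo : ∀ n (g h : ℕ → ℕ) → sumPoly (applyUpTo (λ i → ℕtoℚ (g i)) (suc n)) (λ i → ℕtoℚ (h i)) ≡ ℕtoℚ (Σ≤ n (λ i → g i * h i))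
  sumPoly-applyUpTo zero    g h = trans (ℚₚ.+-identityʳ _) (trans (sym (ℕtoℚ-* (g 0) (h 0))) (cong ℕtoℚ (sym (ℕₚ.+-identityʳ (g 0 * h 0)))))
  sumPoly-applyUpTo (suc n) g h = trans (cong₂ ℚ._+_ (sym (ℕtoℚ-* (g 0) (h 0))) (sumPoly-applyUpTo n (λ i → g (suc i)) (λ i → h (suc i))))
    (trans (sym (ℕtoℚ-+ (g 0 * h 0) (Σ≤ n (λ i → g (suc i) * h (suc i))))) (cong ℕtoℚ (sym (sum-shift (suc n) (λ i → g i * h i)))))

  E : ℕ → Series
  E zero    n m = 0
  E (suc j) n m = e 0 j n m

  -- C is divisible by x, so the powers of 1 / (1 - x) start with the first, and `invPow (suc i) m`
  -- computes to the binomial in `e-closed`.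
  substC≡E : ∀ n j m → substC Cₛ n j m ≡ ℕtoℚ (E j n m)
  substC≡E n zero    m = refl
  substC≡E n (suc j) m = trans (cong₂ ℚ._+_ (ℚₚ.*-zeroˡ (invPow 0 m)) (sumPoly-applyUpTo n (coefficient n j) (λ i → (i + m) C m)))
    (trans (ℚₚ.+-identityˡ _) (cong ℕtoℚ (trans (Σ≤-ext n (λ i → trans (ℕₚ.*-comm (coefficient n j i) _) (cong (((i + m) C m) *_) (patch-sym j i (n ∸ i))))) (sym (e-closed n m 0 j)))))

  reverse : ∀ n (h : ℕ → ℕ) → Σ≤ n h ≡ Σ≤ n (λ k → h (n ∸ k))
  reverse zero    h = refl
  reverse (suc n) h = sym (trans (sum-shift (suc n) (λ k → h (suc n ∸ k))) (cong (h (suc n) +_) (sym (reverse n h))))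

  reverse-Σ : ∀ n (f : ℕ → ℕ → ℕ) → Σ≤ n (λ k → f k (n ∸ k)) ≡ Σ≤ n (λ k → f (n ∸ k) k)
  reverse-Σ n f = trans (reverse n (λ k → f k (n ∸ k))) (Σ≤-cong n (λ k k≤n → cong (f (n ∸ k)) (ℕₚ.m∸[m∸n]≡n k≤n)))

  δ-one3 : ∀ n m → ℕtoℚ (δ n m) ≡ one3 n 0 m
  δ-one3 zero    zero    = refl
  δ-one3 zero    (suc m) = refl
  δ-one3 (suc n) m       = refl

  one3-suc : ∀ n j m → one3 n (suc j) m ≡ 0ℚ
  one3-suc zero    j m = refl
  one3-suc (suc n) j m = refl

  DE : ℕ → ℕ → ℕ → ℕ
  DE n j m = Σ≤ n (λ a → Σ≤ j (λ b → Σ≤ m (λ c → Dₛ b a c * E (j ∸ b) (n ∸ a) (m ∸ c))))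

  DE-correct : ∀ n j m → mul3 Dℚ (substC Cₛ) n j m ≡ ℕtoℚ (DE n j m)
  DE-correct n j m = sym (trans (ℕtoℚ-Σ n (λ a → Σ≤ j (λ b → Σ≤ m (term a b)))) (sumTo-cong n λ a _ → trans (ℕtoℚ-Σ j (λ b → Σ≤ m (term a b))) (sumTo-cong j λ b _ →
    trans (ℕtoℚ-Σ m (term a b)) (sumTo-cong m λ c _ → trans (ℕtoℚ-* (Dₛ b a c) (E (j ∸ b) (n ∸ a) (m ∸ c)))
      (cong (Dℚ a b c ℚ.*_) (sym (substC≡E (n ∸ a) (j ∸ b) (m ∸ c))))))))
    where
    term : ℕ → ℕ → ℕ → ℕ
    term a b c = Dₛ b a c * E (j ∸ b) (n ∸ a) (m ∸ c)

  DE-zero : ∀ n m → DE n 0 m ≡ 0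
  DE-zero n m = trans (Σ≤-ext n (λ a → trans (ℕₚ.+-identityʳ _) (trans (Σ≤-ext m (λ c → ℕₚ.*-zeroʳ (Dₛ 0 a c))) (sumOver-0 (downFrom (suc m)))))) (sumOver-0 (downFrom (suc n)))

  -- In `mul3` the factor D comes first and in the recursion for `Dₛ` second, so all three sums are
  -- reversed. The summand with y⁰ of C drops out.
  DE-suc : ∀ n j m → DE n (suc j) m ≡ Dₛ (suc j) n m
  DE-suc n j m = trans (sumOver-swap (downFrom (suc n)) (downFrom (suc (suc j))) (λ a b → Σ≤ m (λ c → Dₛ b a c * E (suc j ∸ b) (n ∸ a) (m ∸ c))))
    (trans (reverse-Σ (suc j) T) (trans (sum-shift (suc j) (λ b → T (suc j ∸ b) b)) (trans (cong₂ _+_ no-0 (Σ≤-ext j at)) (sym (Dₛ-suc j n m)))))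
    where
    T : ℕ → ℕ → ℕ
    T b b′ = Σ≤ n (λ a → Σ≤ m (λ c → Dₛ b a c * E b′ (n ∸ a) (m ∸ c)))
    no-0 : T (suc j) 0 ≡ 0
    no-0 = trans (Σ≤-ext n (λ a → trans (Σ≤-ext m (λ c → ℕₚ.*-zeroʳ (Dₛ (suc j) a c))) (sumOver-0 (downFrom (suc m))))) (sumOver-0 (downFrom (suc n)))
    at : ∀ s → T (j ∸ s) (suc s) ≡ conv₂ (e 0 s) (Dₛ (j ∸ s)) n m
    at s = trans (reverse-Σ n (λ a a′ → Σ≤ m (λ c → Dₛ (j ∸ s) a c * e 0 s a′ (m ∸ c))))
      (Σ≤-ext n (λ a → trans (reverse-Σ m (λ c c′ → Dₛ (j ∸ s) (n ∸ a) c * e 0 s a c′)) (Σ≤-ext m (λ c → ℕₚ.*-comm (Dₛ (j ∸ s) (n ∸ a) (m ∸ c)) (e 0 s a c)))))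

  solves-D : ∀ n j m → Dℚ n j m ≡ one3 n j m ℚ.+ mul3 Dℚ (substC Cₛ) n j m
  solves-D n zero    m = trans (δ-one3 n m) (sym (trans (cong (one3 n 0 m ℚ.+_) (trans (DE-correct n 0 m) (cong ℕtoℚ (DE-zero n m)))) (ℚₚ.+-identityʳ _)))
  solves-D n (suc j) m = sym (trans (cong₂ ℚ._+_ (one3-suc n j m) (trans (DE-correct n (suc j) m) (cong ℕtoℚ (DE-suc n j m)))) (ℚₚ.+-identityˡ _))

  P-0 : ∀ n → Pₛ n 0 ≡ δ₀ n
  P-0 zero    = cong ℕtoℚ F.cnt-[]
  P-0 (suc n) = cong ℕtoℚ (F.cnt-suc-[] n)

  solution : System Pₛ Cₛ Dℚ
  solution = record
    { eqP₀ = λ n → refl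
    ; eqP  = λ n k → cong ℕtoℚ (sym (patch-0 k n))
    ; eqD  = λ n j m → fold Dℚ (substC Cₛ) n j m (solves-D n j m)
    ; eqC  = solves-C
    ; init = P-0 }

-- Comparison of the counts and conclusion.

open import Defs
open Counting
open Rooted
open FaceClasses
open MapTransfer
open EulerianTransfer
open Starred
open OpenWords
open KeptWords
open Patches
open SystemUnique
open SystemSolution
open import Data.Bool using (false)
open import Data.Nat using (ℕ; zero; suc; _∸_; _*_)
import Data.Nat as ℕ
import Data.Nat.Properties as ℕₚ
open import Data.List using ([]; _∷_; length; downFrom)
open import Data.Product using (Σ; _×_; _,_; proj₁)
open import Data.Rational using (_+_; 1ℚ)
import Data.Rational.Properties as ℚₚ
open import Relation.Binary.PropositionalEquality

module RQ = Root quadClass false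
module RB = Root balancedClass false

uddu-count : ℕ → ℕ
uddu-count n = F.cnt n (U ∷ D ∷ D ∷ U ∷ [])

quads-count : ∀ n → length (RQ.rootCodes (suc n)) ≡ 2 * uddu-count n
quads-count n = trans (RQ.rootCodes-length (suc n)) (trans (weight-one n (quadCand D) (λ g p → F.cnt (n ∸ g) (U ∷ p)) (λ g → refl))
  (cong (ℕ._+ (uddu-count n ℕ.+ 0)) (F.cnt-swap n (U ∷ []) (U ∷ D ∷ D ∷ []))))

orientations-count : ∀ n → length (RB.rootCodes (suc n)) ≡ uddu-count n
orientations-count n = trans (RB.rootCodes-length (suc n)) (eulerian-count n)

-- Splitting U D would leave two empty words with total weight n + 1, which do not exist. The two
-- quadrangles behind U give D U U D and U U D D, both rotations of U D D U.
digon-count : ∀ n → F.cnt (suc n) (U ∷ D ∷ []) ≡ 2 * uddu-count n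
digon-count n = trans (F-suc n U (D ∷ [])) (trans (cong₂ ℕ._+_ nothing-there (cong₂ ℕ._+_ (F.cnt-swap n (D ∷ U ∷ []) (U ∷ D ∷ []))
    (cong (ℕ._+ 0) (F.cnt-swap n (U ∷ []) (U ∷ D ∷ D ∷ []))))) refl)
  where
  nothing-there : sumOver (F.splits D (D ∷ [])) (F.bridgeSum (suc n)) ≡ 0
  nothing-there = trans (ℕₚ.+-identityʳ _) (trans (sumOver-cong (downFrom (suc (suc n))) λ {k} _ → zero-either k) (sumOver-0 (downFrom (suc (suc n)))))
    where
    zero-either : ∀ k → F.cnt k [] * F.cnt (suc n ∸ k) [] ≡ 0
    zero-either zero    = trans (cong (F.cnt 0 [] *_) (F.cnt-suc-[] n)) (ℕₚ.*-zeroʳ (F.cnt 0 []))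
    zero-either (suc k) = cong (_* F.cnt (suc n ∸ suc k) []) (F.cnt-suc-[] k)

quads≡2orientations : ∀ n → length (RQ.rootCodes n) ≡ 2 * length (RB.rootCodes n)
quads≡2orientations zero    = refl
quads≡2orientations (suc n) = trans (quads-count n) (cong (2 *_) (sym (orientations-count n)))

-- For n = 0 the digon U D can only be closed into a single edge; this is the 1 to be subtracted
-- from the coefficient of y, as there is no quadrangulation without faces.
P-quads : ∀ n → Pₛ n 1 ≡ δ₀ n + ℕtoℚ (length (RQ.rootCodes n))
P-quads zero    = trans (cong ℕtoℚ digon-0) (sym (ℚₚ.+-identityʳ 1ℚ))
  where
  digon-0 : F.cnt 0 (U ∷ D ∷ []) ≡ 1
  digon-0 = trans (F-zero U (D ∷ [])) (trans (ℕₚ.+-identityʳ _) (trans (ℕₚ.+-identityʳ _) (cong₂ _*_ F.cnt-[] F.cnt-[])))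
P-quads (suc n) = trans (cong ℕtoℚ (trans (digon-count n) (sym (quads-count n)))) (sym (ℚₚ.+-identityˡ (ℕtoℚ (length (RQ.rootCodes (suc n))))))

theorem21 : Σ PSer (λ P → Σ CSer (λ C → Σ DSer (λ D → System P C D)))
    × (∀ P C D P' C' D' → System P C D → System P' C' D' → SameTriple P C D P' C' D')
    × (∀ P C D → System P C D → ∀ n →
    Σ ℕ (λ q → Σ ℕ (λ g →
    NumClasses (ColourfulQuad n) CQIso q
    × NumClasses (EulerianOrientation n) EOIso g
    × (P n 1 ≡ δ₀ n + ℕtoℚ q)
    × (q ≡ 2 * g))))
theorem21 = (Pₛ , Cₛ , Dℚ , solution)
  , (λ _ _ _ _ _ _ s s′ → Unique.sameTriple s s′)
  , λ _ _ _ s n → length (RQ.rootCodes n) , length (RB.rootCodes n)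
    , QuadTransfer.classes n , OrientationTransfer.classes n
    -- By uniqueness the given solution has the coefficients of the patch series.
    , trans (proj₁ (Unique.sameTriple s solution) n 1) (P-quads n)
    , quads≡2orientations n
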